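{- For $n\ge1$ let $P_{n}^{(\mathrm{udr},\mathrm{ipk})}(s,t)=\sum_{\pi\in\mathfrak{S}_{n}}s^{\mathrm{udr}(\pi)}t^{\mathrm{ipk}(\pi)+1}$. Then: (a) As formal power series, \begin{multline*} \frac{1}{(1-s)(1-t)}+\frac{1}{4(1-s)^{2}}\sum_{n=1}^{\infty}\frac{(1+s^{2})^{n}}{(1-s^{2})^{n-1}}\left(\frac{1+t}{1-t}\right)^{n+1}P_{n}^{(\mathrm{udr},\mathrm{ipk})}\left(\frac{2s}{1+s^{2}},\frac{4t}{(1+t)^{2}}\right)x^{n}\\ =\sum_{i,j=0}^{\infty}\left(\frac{1+x}{1-x}\right)^{2ij}\left(1+s\left(\frac{1+x}{1-x}\right)^{j}\right)s^{2i}t^{j}. \end{multline*} (b) For all $n\geq1$, \begin{multline*} \frac{1}{4(1-s)^{2}}\frac{(1+s^{2})^{n}}{(1-s^{2})^{n-1}}\left(\frac{1+t}{1-t}\right)^{n+1}P_{n}^{(\mathrm{udr},\mathrm{ipk})}\left(\frac{2s}{1+s^{2}},\frac{4t}{(1+t)^{2}}\right)\\ =\frac{1}{n!}\sum_{k=0}^n 2^{k}d(n,k)\frac{(2^{k}A_{k}(s^{2})+sB_{k}(s^{2}))A_{k}(t)}{(1-s^{2})^{k+1}(1-t)^{k+1}}. \end{multline*} (c) For all $n\ge1$, \[ P_{n}^{(\mathrm{udr},\mathrm{ipk})}(s,t) =\frac{1}{n!}\sum_{k=0}^n d(n,k)\left((1-s^{2})(1-t)\right)^{\frac{n-k}{2}}P_{k}^{\mathrm{udr}}(s)P_{k}^{\mathrm{pk}}(t).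 \]
   Context: $\mathfrak{S}_n$ is the symmetric group on $[n]$. For $\pi\in\mathfrak{S}_n$: $i\in[n-1]$ is a descent if $\pi(i)>\pi(i+1)$, $\mathrm{des}(\pi)$ the number of descents; $i$ with $2\le i\le n-1$ is a peak if $\pi(i-1)<\pi(i)>\pi(i+1)$, $\mathrm{pk}(\pi)$ the number of peaks, $\mathrm{ipk}(\pi)=\mathrm{pk}(\pi^{ -1})$. A birun of $\pi$ (in one-line notation) is a maximal monotone consecutive subsequence; an up-down run is a birun or the one-element subsequence $\pi(1)$ when $\pi(1)>\pi(2)$; $\mathrm{udr}(\pi)$ is the number of up-down runs. $A_n(t)=\sum_{\pi\in\mathfrak{S}_n}t^{\mathrm{des}(\pi)+1}$, $P_n^{\mathrm{pk}}(t)=\sum_{\pi\in\mathfrak{S}_n}t^{\mathrm{pk}(\pi)+1}$, $P_n^{\mathrm{udr}}(t)=\sum_{\pi\in\mathfrak{S}_n}t^{\mathrm{udr}(\pi)}$ for $n\ge1$, all equal to $1$ for $n=0$. $B_n(t)$ is defined by $\frac{B_n(t)}{(1-t)^{n+1}}=\sum_{k\ge0}(2k+1)^nt^k$. $d(n,k)$ is the number of permutations in $\mathfrak{S}_n$ with exactly $k$ cycles, all of odd length (with $d(0,0)=1$); $d(n,k)=0$ if $n-k$ is odd. -}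

module Defs where

open import Data.Nat as ℕ using (ℕ; zero; suc; _∸_; _≡ᵇ_; _<ᵇ_; _≤ᵇ_; _!; _%_; _/_)
open import Data.Nat.Properties using (_!≢0)
open import Data.Integer using (+_)
open import Data.Bool using (Bool; true; false; _∧_; _∨_; not; if_then_else_)
open import Data.List using (List; []; _∷_; map; length; filterᵇ; take; drop; upTo; foldr; concatMap)
open import Data.Bool.ListAction using (and)
open import Data.Product using (_×_; _,_; proj₁; proj₂)
open import Data.Rational as ℚ using (ℚ; 0ℚ; 1ℚ; -_)
open import Relation.Binary.PropositionalEquality using (_≡_)

rng : ℕ → ℕ → List ℕ
rng a b = map (a ℕ.+_) (upTo (suc b ∸ a))

count : {A : Set} → (A → Bool) → List A → ℕ
count p xs = length (filterᵇ p xs)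

sumℚ : ℕ → (ℕ → ℚ) → ℚ
sumℚ N f = foldr (λ i acc → f i ℚ.+ acc) 0ℚ (rng 0 N)

ℕtoℚ : ℕ → ℚ
ℕtoℚ n = + n ℚ./ 1

recipFact : ℕ → ℚ
recipFact n = (+ 1 ℚ./ (n !)) {{n !≢0}}

-- Formal power series in three variables s, t, x over ℚ.
-- F a b c is the coefficient of s^a t^b x^c.

PS : Set
PS = ℕ → ℕ → ℕ → ℚ

infix 4 _≈ₚ_
_≈ₚ_ : PS → PS → Set
F ≈ₚ G = ∀ a b c → F a b c ≡ G a b c

cst : ℚ → PS
cst q zero zero zero = q
cst q _    _    _    = 0ℚ

𝟘 𝟙 S T X : PS
𝟘 _ _ _ = 0ℚ
𝟙 = cst 1ℚ
S (suc zero) zero zero = 1ℚ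
S _ _ _ = 0ℚ
T zero (suc zero) zero = 1ℚ
T _ _ _ = 0ℚ
X zero zero (suc zero) = 1ℚ
X _ _ _ = 0ℚ

infixl 6 _⊕_ _⊖_
infixl 7 _⊗_ _·_

_⊕_ : PS → PS → PS
(F ⊕ G) a b c = F a b c ℚ.+ G a b c

⊝_ : PS → PS
(⊝ F) a b c = - F a b c

_⊖_ : PS → PS → PS
F ⊖ G = F ⊕ (⊝ G)

_·_ : ℚ → PS → PS
(q · F) a b c = q ℚ.* F a b c

_⊗_ : PS → PS → PS
(F ⊗ G) a b c =
  sumℚ a λ i → sumℚ b λ j → sumℚ c λ k →
    F i j k ℚ.* G (a ∸ i) (b ∸ j) (c ∸ k)

pow : PS → ℕ → PS
pow F zero    = 𝟙
pow F (suc m) = F ⊗ pow F m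

sumPS : ℕ → (ℕ → PS) → PS
sumPS N F a b c = sumℚ N λ k → F k a b c

-- Infinite sum Σ_{k≥0} F k of a summable family.  It is used ONLY for
-- families in which F k has total order ≥ k (all monomials s^a t^b x^c
-- occurring in F k satisfy a+b+c ≥ k); then terms with k > a+b+c do not
-- contribute to the coefficient of s^a t^b x^c, so this is the genuine
-- formal sum.
Σ∞ : (ℕ → PS) → PS
Σ∞ F a b c = sumℚ (a ℕ.+ b ℕ.+ c) λ k → F k a b c

-- Substitution of a series V (with zero constant term) into the power
-- series Σ_k q_k y^k:  Σ_k q_k V^k.
subst : (ℕ → ℚ) → PS → PS
subst q V = Σ∞ λ k → q k · pow V k

-- Multiplicative inverse of a series G with constant term 1:
-- 1/G = 1/(1 - (1 - G)) = Σ_k (1 - G)^k.  Used only for G with G(0)=1.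
inv : PS → PS
inv G = subst (λ _ → 1ℚ) (𝟙 ⊖ G)

-- Permutations of [n] in one-line notation: lists (π(1),…,π(n)).

words : ℕ → ℕ → List (List ℕ)
words n zero    = [] ∷ []
words n (suc m) = concatMap (λ w → map (λ v → v ∷ w) (rng 1 n)) (words n m)

elem : ℕ → List ℕ → Bool
elem v [] = false
elem v (u ∷ us) = (v ≡ᵇ u) ∨ elem v us

distinct : List ℕ → Bool
distinct [] = true
distinct (u ∷ us) = not (elem u us) ∧ distinct us

Sym : ℕ → List (List ℕ)
Sym n = filterᵇ distinct (words n n)

-- π(i), 1-indexed (0 outside the range)
at : List ℕ → ℕ → ℕ
at []       _             = 0
at (u ∷ us) zero          = 0
at (u ∷ us) (suc zero)    = u
at (u ∷ us) (suc (suc i)) = at us (suc i)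

indexOf : ℕ → List ℕ → ℕ
indexOf v [] = 0
indexOf v (u ∷ us) = if v ≡ᵇ u then 1 else suc (indexOf v us)

inverse : List ℕ → List ℕ
inverse w = map (λ v → indexOf v w) (rng 1 (length w))

des : List ℕ → ℕ
des w = count (λ i → at w (suc i) <ᵇ at w i) (rng 1 (length w ∸ 1))

pk : List ℕ → ℕ
pk w = count (λ i → (at w (i ∸ 1) <ᵇ at w i) ∧ (at w (suc i) <ᵇ at w i))
             (rng 2 (length w ∸ 1))

ipk : List ℕ → ℕ
ipk w = pk (inverse w)

incr decr : List ℕ → Bool
incr [] = true
incr (u ∷ []) = true
incr (u ∷ v ∷ us) = (u <ᵇ v) ∧ incr (v ∷ us)
decr [] = true
decr (u ∷ []) = true
decr (u ∷ v ∷ us) = (v <ᵇ u) ∧ decr (v ∷ us)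

mono : List ℕ → Bool
mono w = incr w ∨ decr w

seg : List ℕ → ℕ → ℕ → List ℕ
seg w i j = take (suc j ∸ i) (drop (i ∸ 1) w)

biruns : List ℕ → ℕ
biruns w = count (λ ij → isBirun (proj₁ ij) (proj₂ ij)) pairs
  where
  n = length w
  pairs : List (ℕ × ℕ)
  pairs = concatMap (λ i → map (λ j → (i , j)) (rng i n)) (rng 1 n)
  isBirun : ℕ → ℕ → Bool
  isBirun i j = mono (seg w i j)
              ∧ ((i ≡ᵇ 1) ∨ not (mono (seg w (i ∸ 1) j)))
              ∧ ((j ≡ᵇ n) ∨ not (mono (seg w i (suc j))))

-- up-down runs: biruns, plus the run π(1) when π(1) > π(2)
udr : List ℕ → ℕ
udr w = biruns w ℕ.+ (if (2 ≤ᵇ length w) ∧ (at w 2 <ᵇ at w 1) then 1 else 0)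

sumSym : ℕ → (List ℕ → PS) → PS
sumSym n F = foldr (λ w acc → F w ⊕ acc) 𝟘 (Sym n)

A : ℕ → PS → PS
A zero    y = 𝟙
A (suc n) y = sumSym (suc n) λ w → pow y (des w ℕ.+ 1)

Ppk : ℕ → PS → PS
Ppk zero    y = 𝟙
Ppk (suc n) y = sumSym (suc n) λ w → pow y (pk w ℕ.+ 1)

Pudr : ℕ → PS → PS
Pudr zero    y = 𝟙
Pudr (suc n) y = sumSym (suc n) λ w → pow y (udr w)

Pudripk : ℕ → PS → PS → PS
Pudripk n y z = sumSym n λ w → pow y (udr w) ⊗ pow z (ipk w ℕ.+ 1)

B : ℕ → PS → PS
B n y = pow (𝟙 ⊖ y) (suc n) ⊗ subst (λ k → ℕtoℚ ((2 ℕ.* k ℕ.+ 1) ℕ.^ n)) y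

iter : List ℕ → ℕ → ℕ → ℕ
iter w zero    i = i
iter w (suc m) i = at w (iter w m i)

cycleLen : List ℕ → ℕ → ℕ
cycleLen w i = go (rng 1 (length w))
  where
  go : List ℕ → ℕ
  go [] = 0
  go (m ∷ ms) = if iter w m i ≡ᵇ i then m else go ms

cycleMin : List ℕ → ℕ → Bool
cycleMin w i = and (map (λ m → i ≤ᵇ iter w m i) (rng 1 (length w)))

numCycles : List ℕ → ℕ
numCycles w = count (cycleMin w) (rng 1 (length w))

allCyclesOdd : List ℕ → Bool
allCyclesOdd w = and (map (λ i → cycleLen w i % 2 ≡ᵇ 1) (rng 1 (length w)))

d : ℕ → ℕ → ℕ
d n k = count (λ w → allCyclesOdd w ∧ (numCycles w ≡ᵇ k)) (Sym n)

{-# OPTIONS --safe #-}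
module Submission where

open import Defs
open import Data.Nat using (ℕ; suc; _*_; _^_; _∸_; _/_; _≤_)
open import Data.Integer using (+_)
open import Data.Rational using () renaming (_/_ to _/ℚ_)
open import Data.Product using (_×_)
open import Algebra.Bundles using (CommutativeRing)
import Algebra.Solver.Ring
import Algebra.Solver.Ring.AlmostCommutativeRing as ACR
open import Algebra.Structures using (IsCommutativeSemiring)
open import Data.Bool as Bool using (Bool; true; false; _∧_; _∨_; not; if_then_else_) renaming (T to True)
open import Data.Bool.ListAction using (and)
import Data.Bool.Properties as Boolₚ
import Data.Integer as ℤ
import Data.Integer.Properties as ℤₚ
open import Data.List using (List; []; _∷_; _++_; map; length; foldr; concatMap; upTo; downFrom; applyUpTo; cartesianProductWith; reverse; _ʳ++_; take; drop)
open import Data.List.Membership.Propositional using (_∈_; _∉_)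
open import Data.List.Membership.Propositional.Properties as ∈ₚ using (∈-∃++)
import Data.List.Properties as Listₚ
open import Data.List.Relation.Binary.Permutation.Propositional as ↭ using (_↭_; ↭-sym; ↭-trans; ↭-refl; prep; swap)
import Data.List.Relation.Binary.Permutation.Propositional.Properties as ↭ₚ
open import Data.List.Relation.Unary.All as All using (All; []; _∷_)
import Data.List.Relation.Unary.All.Properties as Allₚ
open import Data.List.Relation.Unary.AllPairs as AllPairs using (AllPairs; []; _∷_)
import Data.List.Relation.Unary.AllPairs.Properties as AllPairsₚ
open import Data.List.Relation.Unary.Any using (here; there)
open import Data.List.Relation.Unary.Unique.Propositional using (Unique)
import Data.List.Relation.Unary.Unique.Propositional.Properties as Uniqueₚ
open import Data.Maybe using (Maybe; nothing; just)
open import Data.Nat as ℕ using (zero; z≤n; s≤s; _<_; _<ᵇ_; _≡ᵇ_; _!; _%_; NonZero)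
open import Data.Nat.DivMod using (m*n/n≡m)
import Data.Nat.Properties as ℕₚ
import Data.Nat.Solver as ℕSolver
open import Data.Product using (_,_; proj₁; proj₂; ∃; ∃₂)
open import Data.Rational as ℚ using (ℚ; 0ℚ; 1ℚ)
import Data.Rational.Properties as ℚₚ
import Data.Rational.Solver as ℚSolver
import Data.Rational.Unnormalised as ℚᵘ
import Data.Rational.Unnormalised.Properties as ℚᵘₚ
open import Data.Sum using (_⊎_; inj₁; inj₂)
open import Data.Unit using (tt)
open import Function using (_∘_; id)
open import Level using (0ℓ)
open import Relation.Binary.Definitions using (tri<; tri≈; tri>)
open import Relation.Binary.PropositionalEquality as ≡ using (_≡_; _≢_; refl; sym; trans; cong; cong₂; module ≡-Reasoning)
import Relation.Binary.Reasoning.Setoid as SetoidR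
open import Relation.Nullary using (¬_; yes; no; contradiction)

-- Fix alphabets of a letters, respectively 2b letters, with alternating signs.  Call a weakly increasing word
-- compatible with a permutation if it repeats positive letters only at ascents and negative ones only at
-- descents.  Transfer matrices show that the number of compatible words is the coefficient of s^a (respectively
-- t^b) in a rational function depending only on udr (respectively pk).  Standardisation identifies a permutation π
-- with words compatible with π and with π⁻¹ with a chain of pairs of letters in which exactly the pairs of positive
-- sign may be repeated; half of the pairs are positive, so these are counted by ((1+x)/(1-x))^(ab), which is (a).
-- Since ((1+x)/(1-x))^m = exp (2m artanh x) is the exponential generating function of permutations with odd cycles
-- weighted by (2m)^(number of cycles), (b) reduces to the generating functions of the powers a^k and b^k.  Every
-- word has exactly one standardisation, so the powers a^k and (2b)^k also have expansions in
-- terms of P_k^udr and P_k^pk; inverting the substitutions s ↦ 2s/(1+s²) and t ↦ 4t/(1+t)² then gives (c).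

-- All three parts are read off one numerical identity, `∑-udr-ipk`: weighted by `α n` and `β n`,
-- the coefficients at s^a and t^b add up to a coefficient of `𝕌 ^ˢ (a * b)`. The sign of the least
-- letter matters. In the first alphabet it is positive, which acts like an ascent in front of π(1),
-- so that an initial descent counts as a change of direction: this is the extra run of `udr`. In
-- the second alphabet it is negative, which acts like a descent in front and creates no peak. The
-- second alphabet has an even number of letters so that every letter of the first lies in as many
-- positive as negative pairs. The first alphabet has any number a of letters, and the parity of a
-- separates s^(2i) from s^(2i+1) in (a). The constant 1/4 is a product of two halves, one from x =
-- ½ (1+x²) `𝕊` and one from 2x/(1-x)² = ½ `𝕌`² `𝕋`. In (c) the substitutions are undone by
-- injectivity, not by inverse series: the difference of the two sides is a finite sum of products
-- f(s) g(t), and it vanishes because its image under both substitutions does.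

-- Finite sums over lists and initial segments

bigop : {R I : Set} → (R → R → R) → R → List I → (I → R) → R
bigop _⊹_ e []      f = e
bigop _⊹_ e (x ∷ L) f = f x ⊹ bigop _⊹_ e L f

∑ℕ : {I : Set} → List I → (I → ℕ) → ℕ
∑ℕ = bigop ℕ._+_ 0

∑ℚ : {I : Set} → List I → (I → ℚ) → ℚ
∑ℚ = bigop ℚ._+_ 0ℚ

module Sums {R : Set} {_⊹_ _⋆_ : R → R → R} {0# 1# : R}
            (isCS : IsCommutativeSemiring _≡_ _⊹_ _⋆_ 0# 1#) where

  open IsCommutativeSemiring isCS using (+-assoc; +-comm; +-identityˡ; zeroʳ; distribˡ; *-comm)

  private
    interchange : ∀ a b c e → (a ⊹ b) ⊹ (c ⊹ e) ≡ (a ⊹ c) ⊹ (b ⊹ e)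
    interchange a b c e = begin
      (a ⊹ b) ⊹ (c ⊹ e) ≡⟨ +-assoc a b (c ⊹ e) ⟩
      a ⊹ (b ⊹ (c ⊹ e)) ≡⟨ cong (a ⊹_) (+-assoc b c e) ⟨
      a ⊹ ((b ⊹ c) ⊹ e) ≡⟨ cong (λ z → a ⊹ (z ⊹ e)) (+-comm b c) ⟩
      a ⊹ ((c ⊹ b) ⊹ e) ≡⟨ cong (a ⊹_) (+-assoc c b e) ⟩
      a ⊹ (c ⊹ (b ⊹ e)) ≡⟨ +-assoc a c (b ⊹ e) ⟨
      (a ⊹ c) ⊹ (b ⊹ e) ∎
      where open ≡-Reasoning

  private
    ∑ : {I : Set} → List I → (I → R) → R
    ∑ = bigop _⊹_ 0#

  foldr-∑ : {I : Set} (L : List I) (f : I → R) → foldr (λ i acc → f i ⊹ acc) 0# L ≡ ∑ L f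
  foldr-∑ []      f = refl
  foldr-∑ (x ∷ L) f = cong (f x ⊹_) (foldr-∑ L f)

  module _ {I : Set} where

    ∑-cong∈ : ∀ (L : List I) {f g : I → R} → (∀ {x} → x ∈ L → f x ≡ g x) → ∑ L f ≡ ∑ L g
    ∑-cong∈ []      e = refl
    ∑-cong∈ (x ∷ L) e = cong₂ _⊹_ (e (here refl)) (∑-cong∈ L (e ∘ there))

    ∑-cong : ∀ (L : List I) {f g : I → R} → (∀ x → f x ≡ g x) → ∑ L f ≡ ∑ L g
    ∑-cong L e = ∑-cong∈ L (λ {x} _ → e x)

    ∑-zero : ∀ (L : List I) → ∑ L (λ _ → 0#) ≡ 0#
    ∑-zero []      = refl
    ∑-zero (x ∷ L) = trans (+-identityˡ _) (∑-zero L)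

    ∑-zero∈ : ∀ (L : List I) {f : I → R} → (∀ {x} → x ∈ L → f x ≡ 0#) → ∑ L f ≡ 0#
    ∑-zero∈ L e = trans (∑-cong∈ L e) (∑-zero L)

    ∑-++ : ∀ (L M : List I) f → ∑ (L ++ M) f ≡ ∑ L f ⊹ ∑ M f
    ∑-++ []      M f = sym (+-identityˡ _)
    ∑-++ (x ∷ L) M f = trans (cong (f x ⊹_) (∑-++ L M f)) (sym (+-assoc _ _ _))

    ∑-+ : ∀ (L : List I) f g → ∑ L (λ x → f x ⊹ g x) ≡ ∑ L f ⊹ ∑ L g
    ∑-+ []      f g = sym (+-identityˡ _)
    ∑-+ (x ∷ L) f g = trans (cong (_ ⊹_) (∑-+ L f g)) (interchange _ _ _ _)

    ∑-*ˡ : ∀ (L : List I) c f → ∑ L (λ x → c ⋆ f x) ≡ c ⋆ ∑ L f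
    ∑-*ˡ []      c f = sym (zeroʳ c)
    ∑-*ˡ (x ∷ L) c f = trans (cong (_ ⊹_) (∑-*ˡ L c f)) (sym (distribˡ c _ _))

    ∑-*ʳ : ∀ (L : List I) c f → ∑ L (λ x → f x ⋆ c) ≡ ∑ L f ⋆ c
    ∑-*ʳ L c f = trans (∑-cong L (λ x → *-comm _ c)) (trans (∑-*ˡ L c f) (*-comm c _))

    ∑-↭ : ∀ {L M : List I} f → L ↭ M → ∑ L f ≡ ∑ M f
    ∑-↭ f ↭.refl         = refl
    ∑-↭ f (prep x p)     = cong (f x ⊹_) (∑-↭ f p)
    ∑-↭ f (swap x y p)   = trans (sym (+-assoc _ _ _))
      (trans (cong₂ _⊹_ (+-comm _ _) (∑-↭ f p)) (+-assoc _ _ _))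
    ∑-↭ f (↭.trans p q)  = trans (∑-↭ f p) (∑-↭ f q)

  module _ {I J : Set} where

    ∑-map : ∀ (φ : I → J) (L : List I) f → ∑ (map φ L) f ≡ ∑ L (f ∘ φ)
    ∑-map φ []      f = refl
    ∑-map φ (x ∷ L) f = cong (f (φ x) ⊹_) (∑-map φ L f)

    ∑-concatMap : ∀ (φ : I → List J) (L : List I) f → ∑ (concatMap φ L) f ≡ ∑ L (λ i → ∑ (φ i) f)
    ∑-concatMap φ []      f = refl
    ∑-concatMap φ (x ∷ L) f = trans (∑-++ (φ x) _ f) (cong (_ ⊹_) (∑-concatMap φ L f))

    ∑-swap : ∀ (L : List I) (M : List J) (f : I → J → R) → ∑ L (λ i → ∑ M (f i)) ≡ ∑ M (λ j → ∑ L (λ i → f i j))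
    ∑-swap []      M f = sym (∑-zero M)
    ∑-swap (x ∷ L) M f = trans (cong (_ ⊹_) (∑-swap L M f)) (sym (∑-+ M _ _))

module ℕ∑ = Sums ℕₚ.+-*-isCommutativeSemiring
module ℚ∑ = Sums (CommutativeRing.isCommutativeSemiring ℚₚ.+-*-commutativeRing)

upTo-suc : ∀ n → upTo (suc n) ≡ 0 ∷ map suc (upTo n)
upTo-suc n = cong (0 ∷_) (sym (Listₚ.map-upTo suc n))

rng0≡upTo : ∀ n → rng 0 n ≡ upTo (suc n)
rng0≡upTo n = Listₚ.map-id (upTo (suc n))

-- Recursion on the bound with a shifted summand: the coefficient n+1 of a product f g then unfolds
-- by computation to f(0) g(n+1) plus the coefficient n of the product of the tail of f with g. The
-- ring laws of series are inductions along this.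
∑≤ : ℕ → (ℕ → ℚ) → ℚ
∑≤ zero    f = f 0
∑≤ (suc n) f = f 0 ℚ.+ ∑≤ n (f ∘ suc)

∑≤-applyUpTo : ∀ {I : Set} n (f : I → ℚ) (g : ℕ → I) → ∑ℚ (applyUpTo g (suc n)) f ≡ ∑≤ n (f ∘ g)
∑≤-applyUpTo zero    f g = ℚₚ.+-identityʳ _
∑≤-applyUpTo (suc n) f g = cong (f (g 0) ℚ.+_) (∑≤-applyUpTo n f (g ∘ suc))

∑≤-upTo : ∀ n f → ∑ℚ (upTo (suc n)) f ≡ ∑≤ n f
∑≤-upTo n f = ∑≤-applyUpTo n f id

sumℚ≡∑≤ : ∀ n f → sumℚ n f ≡ ∑≤ n f
sumℚ≡∑≤ n f = trans (ℚ∑.foldr-∑ (rng 0 n) f) (trans (cong (λ L → ∑ℚ L f) (rng0≡upTo n)) (∑≤-upTo n f))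

∑≤-cong≤ : ∀ n {f g} → (∀ i → i ≤ n → f i ≡ g i) → ∑≤ n f ≡ ∑≤ n g
∑≤-cong≤ zero    e = e 0 z≤n
∑≤-cong≤ (suc n) e = cong₂ ℚ._+_ (e 0 z≤n) (∑≤-cong≤ n (λ i le → e (suc i) (s≤s le)))

∑≤-cong : ∀ n {f g} → (∀ i → f i ≡ g i) → ∑≤ n f ≡ ∑≤ n g
∑≤-cong n e = ∑≤-cong≤ n (λ i _ → e i)

∑≤-zero : ∀ n → ∑≤ n (λ _ → 0ℚ) ≡ 0ℚ
∑≤-zero n = trans (sym (∑≤-upTo n _)) (ℚ∑.∑-zero (upTo (suc n)))

∑≤-zero≤ : ∀ n {f} → (∀ i → i ≤ n → f i ≡ 0ℚ) → ∑≤ n f ≡ 0ℚ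
∑≤-zero≤ n e = trans (∑≤-cong≤ n e) (∑≤-zero n)

∑≤-+ : ∀ n f g → ∑≤ n (λ i → f i ℚ.+ g i) ≡ ∑≤ n f ℚ.+ ∑≤ n g
∑≤-+ n f g = trans (sym (∑≤-upTo n _)) (trans (ℚ∑.∑-+ (upTo (suc n)) f g) (cong₂ ℚ._+_ (∑≤-upTo n f) (∑≤-upTo n g)))

∑≤-*ˡ : ∀ n c f → ∑≤ n (λ i → c ℚ.* f i) ≡ c ℚ.* ∑≤ n f
∑≤-*ˡ n c f = trans (sym (∑≤-upTo n _)) (trans (ℚ∑.∑-*ˡ (upTo (suc n)) c f) (cong (c ℚ.*_) (∑≤-upTo n f)))

∑≤-*ʳ : ∀ n c f → ∑≤ n (λ i → f i ℚ.* c) ≡ ∑≤ n f ℚ.* c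
∑≤-*ʳ n c f = trans (sym (∑≤-upTo n _)) (trans (ℚ∑.∑-*ʳ (upTo (suc n)) c f) (cong (ℚ._* c) (∑≤-upTo n f)))

∑≤-∑ : ∀ {I : Set} n (L : List I) (f : ℕ → I → ℚ) → ∑≤ n (λ i → ∑ℚ L (f i)) ≡ ∑ℚ L (λ x → ∑≤ n (λ i → f i x))
∑≤-∑ n L f = trans (sym (∑≤-upTo n _)) (trans (ℚ∑.∑-swap (upTo (suc n)) L f) (ℚ∑.∑-cong L (λ x → ∑≤-upTo n _)))

∑≤-swap : ∀ m n (f : ℕ → ℕ → ℚ) → ∑≤ m (λ i → ∑≤ n (f i)) ≡ ∑≤ n (λ j → ∑≤ m (λ i → f i j))
∑≤-swap m n f = trans (∑≤-cong m (λ i → sym (∑≤-upTo n (f i)))) (trans (∑≤-∑ m (upTo (suc n)) f) (∑≤-upTo n _))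

∑≤-last : ∀ n f → ∑≤ (suc n) f ≡ ∑≤ n f ℚ.+ f (suc n)
∑≤-last zero    f = refl
∑≤-last (suc n) f = trans (cong (f 0 ℚ.+_) (∑≤-last n (f ∘ suc))) (sym (ℚₚ.+-assoc (f 0) _ _))

∑≤-trunc : ∀ n k {f} → (∀ i → n < i → f i ≡ 0ℚ) → ∑≤ (k ℕ.+ n) f ≡ ∑≤ n f
∑≤-trunc n zero    v = refl
∑≤-trunc n (suc k) {f} v = trans (∑≤-last (k ℕ.+ n) f)
  (trans (cong₂ ℚ._+_ (∑≤-trunc n k v) (v _ (s≤s (ℕₚ.m≤n+m n k)))) (ℚₚ.+-identityʳ _))

∑≤-trunc≤ : ∀ {n N} {f} → n ≤ N → (∀ i → n < i → f i ≡ 0ℚ) → ∑≤ N f ≡ ∑≤ n f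
∑≤-trunc≤ {n} {N} {f} le v = trans (cong (λ z → ∑≤ z f) (sym (ℕₚ.m∸n+n≡m le))) (∑≤-trunc n (N ∸ n) v)

∑≤-single : ∀ N {f} m → m ≤ N → (∀ i → i ≢ m → f i ≡ 0ℚ) → ∑≤ N f ≡ f m
∑≤-single N {f} zero le v = ∑≤-trunc≤ {0} {N} z≤n (λ { (suc i) _ → v (suc i) (λ ()) })
∑≤-single (suc N) {f} (suc m) (s≤s le) v = trans
  (cong₂ ℚ._+_ (v 0 (λ ())) (∑≤-single N m le (λ i ne → v (suc i) (ne ∘ ℕₚ.suc-injective))))
  (ℚₚ.+-identityˡ _)

-- Univariate formal power series

record Ser : Set where
  no-eta-equality
  constructor ser
  infixl 9 _⟪_⟫
  field _⟪_⟫ : ℕ → ℚ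
open Ser public

infix 4 _≗_
infixl 6 _⊞_ _⊟_
infixl 7 _✶_ _·ˢ_
infixr 8 _^ˢ_

record _≗_ (f g : Ser) : Set where
  no-eta-equality
  constructor ptw
  field coeff : ∀ n → f ⟪ n ⟫ ≡ g ⟪ n ⟫
open _≗_ public

_⊞_ _✶_ : Ser → Ser → Ser
(f ⊞ g) ⟪ n ⟫ = f ⟪ n ⟫ ℚ.+ g ⟪ n ⟫
(f ✶ g) ⟪ n ⟫ = ∑≤ n (λ i → f ⟪ i ⟫ ℚ.* g ⟪ n ∸ i ⟫)

⊟_ : Ser → Ser
(⊟ f) ⟪ n ⟫ = ℚ.- f ⟪ n ⟫

_⊟_ : Ser → Ser → Ser
f ⊟ g = f ⊞ (⊟ g)

cˢ : ℚ → Ser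
cˢ q ⟪ zero ⟫  = q
cˢ q ⟪ suc _ ⟫ = 0ℚ

0ˢ 1ˢ 𝕩 : Ser
0ˢ ⟪ _ ⟫ = 0ℚ
1ˢ = cˢ 1ℚ
𝕩 ⟪ zero ⟫        = 0ℚ
𝕩 ⟪ suc zero ⟫    = 1ℚ
𝕩 ⟪ suc (suc _) ⟫ = 0ℚ

_^ˢ_ : Ser → ℕ → Ser
f ^ˢ zero  = 1ˢ
f ^ˢ suc n = f ✶ f ^ˢ n

tl : Ser → Ser
tl f ⟪ n ⟫ = f ⟪ suc n ⟫

_·ˢ_ : ℚ → Ser → Ser
(q ·ˢ f) ⟪ n ⟫ = q ℚ.* f ⟪ n ⟫

✶-cong : ∀ {f f' g g'} → f ≗ f' → g ≗ g' → f ✶ g ≗ f' ✶ g'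
✶-cong e e' .coeff n = ∑≤-cong n (λ i → cong₂ ℚ._*_ (coeff e i) (coeff e' (n ∸ i)))

-- The defining recursion splits off the constant term of the left factor, this one that of the
-- right factor; comparing the two gives commutativity.
✶-suc : ∀ f g n → (f ✶ g) ⟪ suc n ⟫ ≡ (f ✶ tl g) ⟪ n ⟫ ℚ.+ f ⟪ suc n ⟫ ℚ.* g ⟪ 0 ⟫
✶-suc f g zero = refl
✶-suc f g (suc n) = trans (cong (f ⟪ 0 ⟫ ℚ.* g ⟪ suc (suc n) ⟫ ℚ.+_) (✶-suc (tl f) g n))
  (sym (ℚₚ.+-assoc (f ⟪ 0 ⟫ ℚ.* g ⟪ suc (suc n) ⟫) ((tl f ✶ tl g) ⟪ n ⟫) _))

✶-comm : ∀ f g → f ✶ g ≗ g ✶ f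
✶-comm f g .coeff zero    = ℚₚ.*-comm (f ⟪ 0 ⟫) (g ⟪ 0 ⟫)
✶-comm f g .coeff (suc n) = begin
  f ⟪ 0 ⟫ ℚ.* g ⟪ suc n ⟫ ℚ.+ (tl f ✶ g) ⟪ n ⟫       ≡⟨ cong₂ ℚ._+_ (ℚₚ.*-comm (f ⟪ 0 ⟫) _) (coeff (✶-comm (tl f) g) n) ⟩
  g ⟪ suc n ⟫ ℚ.* f ⟪ 0 ⟫ ℚ.+ (g ✶ tl f) ⟪ n ⟫       ≡⟨ ℚₚ.+-comm (g ⟪ suc n ⟫ ℚ.* f ⟪ 0 ⟫) _ ⟩
  (g ✶ tl f) ⟪ n ⟫ ℚ.+ g ⟪ suc n ⟫ ℚ.* f ⟪ 0 ⟫       ≡⟨ ✶-suc g f n ⟨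
  (g ✶ f) ⟪ suc n ⟫                          ∎
  where open ≡-Reasoning

✶-distribʳ : ∀ h f g → (f ⊞ g) ✶ h ≗ f ✶ h ⊞ g ✶ h
✶-distribʳ h f g .coeff n = trans (∑≤-cong n (λ i → ℚₚ.*-distribʳ-+ (h ⟪ n ∸ i ⟫) (f ⟪ i ⟫) (g ⟪ i ⟫)))
  (∑≤-+ n (λ i → f ⟪ i ⟫ ℚ.* h ⟪ n ∸ i ⟫) (λ i → g ⟪ i ⟫ ℚ.* h ⟪ n ∸ i ⟫))

·ˢ-✶ : ∀ q f g → (q ·ˢ f) ✶ g ≗ q ·ˢ (f ✶ g)
·ˢ-✶ q f g .coeff n = trans (∑≤-cong n (λ i → ℚₚ.*-assoc q (f ⟪ i ⟫) (g ⟪ n ∸ i ⟫))) (∑≤-*ˡ n q (λ i → f ⟪ i ⟫ ℚ.* g ⟪ n ∸ i ⟫))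

✶-assoc : ∀ f g h → (f ✶ g) ✶ h ≗ f ✶ (g ✶ h)
✶-assoc f g h .coeff zero = ℚₚ.*-assoc (f ⟪ 0 ⟫) (g ⟪ 0 ⟫) (h ⟪ 0 ⟫)
✶-assoc f g h .coeff (suc n) = begin
  -- By computation, the tail of f g is f(0) times the tail of g, plus the tail of f times g.
  f ⟪ 0 ⟫ ℚ.* g ⟪ 0 ⟫ ℚ.* h ⟪ suc n ⟫ ℚ.+ ((f ⟪ 0 ⟫ ·ˢ tl g ⊞ tl f ✶ g) ✶ h) ⟪ n ⟫
    ≡⟨ cong (f ⟪ 0 ⟫ ℚ.* g ⟪ 0 ⟫ ℚ.* h ⟪ suc n ⟫ ℚ.+_)
        (trans (coeff (✶-distribʳ h (f ⟪ 0 ⟫ ·ˢ tl g) (tl f ✶ g)) n)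
          (cong₂ ℚ._+_ (coeff (·ˢ-✶ (f ⟪ 0 ⟫) (tl g) h) n) (coeff (✶-assoc (tl f) g h) n))) ⟩
  f ⟪ 0 ⟫ ℚ.* g ⟪ 0 ⟫ ℚ.* h ⟪ suc n ⟫ ℚ.+ (f ⟪ 0 ⟫ ℚ.* (tl g ✶ h) ⟪ n ⟫ ℚ.+ (tl f ✶ (g ✶ h)) ⟪ n ⟫)
    ≡⟨ solve 5 (λ a b c e k → a :* b :* c :+ (a :* e :+ k) := a :* (b :* c :+ e) :+ k) refl
         (f ⟪ 0 ⟫) (g ⟪ 0 ⟫) (h ⟪ suc n ⟫) ((tl g ✶ h) ⟪ n ⟫) ((tl f ✶ (g ✶ h)) ⟪ n ⟫) ⟩
  f ⟪ 0 ⟫ ℚ.* (g ✶ h) ⟪ suc n ⟫ ℚ.+ (tl f ✶ (g ✶ h)) ⟪ n ⟫ ∎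
  where open ≡-Reasoning
        open ℚSolver.+-*-Solver

cˢ-✶ : ∀ q f → cˢ q ✶ f ≗ q ·ˢ f
cˢ-✶ q f .coeff zero    = refl
cˢ-✶ q f .coeff (suc n) = trans (cong (q ℚ.* f ⟪ suc n ⟫ ℚ.+_)
  (∑≤-zero≤ n (λ i _ → ℚₚ.*-zeroˡ (f ⟪ n ∸ i ⟫)))) (ℚₚ.+-identityʳ _)

≗-refl : ∀ {f} → f ≗ f
≗-refl .coeff n = refl

≗-sym : ∀ {f g} → f ≗ g → g ≗ f
≗-sym e .coeff n = sym (coeff e n)

≗-trans : ∀ {f g h} → f ≗ g → g ≗ h → f ≗ h
≗-trans e e' .coeff n = trans (coeff e n) (coeff e' n)

✶-identityˡ : ∀ f → 1ˢ ✶ f ≗ f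
✶-identityˡ f = ≗-trans (cˢ-✶ 1ℚ f) (ptw λ n → ℚₚ.*-identityˡ _)

serRing : CommutativeRing 0ℓ 0ℓ
serRing = record
  { Carrier = Ser ; _≈_ = _≗_ ; _+_ = _⊞_ ; _*_ = _✶_ ; -_ = ⊟_ ; 0# = 0ˢ ; 1# = 1ˢ
  ; isCommutativeRing = record
    { isRing = record
      { +-isAbelianGroup = record
        { isGroup = record
          { isMonoid = record
            { isSemigroup = record
              { isMagma = record
                { isEquivalence = record { refl = ≗-refl ; sym = ≗-sym ; trans = ≗-trans }
                ; ∙-cong = λ e e' → ptw λ n → cong₂ ℚ._+_ (coeff e n) (coeff e' n) }
              ; assoc = λ f g h → ptw λ n → ℚₚ.+-assoc (f ⟪ n ⟫) (g ⟪ n ⟫) (h ⟪ n ⟫) }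
            ; identity = (λ f → ptw λ n → ℚₚ.+-identityˡ (f ⟪ n ⟫)) , (λ f → ptw λ n → ℚₚ.+-identityʳ (f ⟪ n ⟫)) }
          ; inverse = (λ f → ptw λ n → ℚₚ.+-inverseˡ (f ⟪ n ⟫)) , (λ f → ptw λ n → ℚₚ.+-inverseʳ (f ⟪ n ⟫))
          ; ⁻¹-cong = λ e → ptw λ n → cong ℚ.-_ (coeff e n) }
        ; comm = λ f g → ptw λ n → ℚₚ.+-comm (f ⟪ n ⟫) (g ⟪ n ⟫) }
      ; *-cong = ✶-cong
      ; *-assoc = ✶-assoc
      ; *-identity = ✶-identityˡ , (λ f → ≗-trans (✶-comm f 1ˢ) (✶-identityˡ f))
      ; distrib = (λ h f g → ≗-trans (✶-comm h (f ⊞ g)) (≗-trans (✶-distribʳ h f g)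
                    (ptw λ n → cong₂ ℚ._+_ (coeff (✶-comm f h) n) (coeff (✶-comm g h) n))))
                , ✶-distribʳ }
    ; *-comm = ✶-comm } }

module ℛ = CommutativeRing serRing

-- The constants of the ring solver are rationals, so that it decides identities with coefficients
-- such as 1/2 and 1/4.
cˢ-hom : CommutativeRing.rawRing ℚₚ.+-*-commutativeRing ACR.-Raw-AlmostCommutative⟶ ACR.fromCommutativeRing serRing
cˢ-hom = record
  { ⟦_⟧ = cˢ
  ; +-homo = λ p q → ptw λ { zero → refl ; (suc n) → refl }
  ; *-homo = λ p q → ptw λ { zero → sym (coeff (cˢ-✶ p (cˢ q)) 0) ; (suc n) → sym (trans (coeff (cˢ-✶ p (cˢ q)) (suc n)) (ℚₚ.*-zeroʳ p)) }
  ; -‿homo = λ p → ptw λ { zero → refl ; (suc n) → refl }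
  ; 0-homo = ptw λ { zero → refl ; (suc n) → refl }
  ; 1-homo = ≗-refl
  }

cˢ-≟ : ∀ p q → Maybe (cˢ p ≗ cˢ q)
cˢ-≟ p q with p ℚₚ.≟ q
... | yes e = just (ptw λ n → cong (λ z → cˢ z ⟪ n ⟫) e)
... | no _  = nothing

module 𝒮 = Algebra.Solver.Ring (CommutativeRing.rawRing ℚₚ.+-*-commutativeRing) (ACR.fromCommutativeRing serRing) cˢ-hom cˢ-≟

ones : Ser
ones ⟪ _ ⟫ = 1ℚ

𝕩✶-zero : ∀ f → (𝕩 ✶ f) ⟪ 0 ⟫ ≡ 0ℚ
𝕩✶-zero f = ℚₚ.*-zeroˡ (f ⟪ 0 ⟫)

𝕩✶-suc : ∀ f n → (𝕩 ✶ f) ⟪ suc n ⟫ ≡ f ⟪ n ⟫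
𝕩✶-suc f n = trans (cong₂ ℚ._+_ (ℚₚ.*-zeroˡ (f ⟪ suc n ⟫))
  (coeff (≗-trans (✶-cong {tl 𝕩} {1ˢ} {f} {f} (ptw λ { zero → refl ; (suc _) → refl }) ≗-refl) (✶-identityˡ f)) n)) (ℚₚ.+-identityˡ (f ⟪ n ⟫))

^ˢ-cong : ∀ {f g} → f ≗ g → ∀ k → f ^ˢ k ≗ g ^ˢ k
^ˢ-cong e zero    = ≗-refl
^ˢ-cong e (suc k) = ✶-cong e (^ˢ-cong e k)

^ˢ-+ : ∀ f m n → f ^ˢ (m ℕ.+ n) ≗ f ^ˢ m ✶ f ^ˢ n
^ˢ-+ f zero    n = ≗-sym (✶-identityˡ (f ^ˢ n))
^ˢ-+ f (suc m) n = ≗-trans (ℛ.*-congˡ (^ˢ-+ f m n)) (≗-sym (✶-assoc f (f ^ˢ m) (f ^ˢ n)))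

^ˢ-✶ : ∀ f g n → (f ✶ g) ^ˢ n ≗ f ^ˢ n ✶ g ^ˢ n
^ˢ-✶ f g zero    = ≗-sym (✶-identityˡ 1ˢ)
^ˢ-✶ f g (suc n) = ≗-trans (ℛ.*-congˡ (^ˢ-✶ f g n))
  (solve 4 (λ a b c e → (a :* b) :* (c :* e) := (a :* c) :* (b :* e)) ≗-refl f g (f ^ˢ n) (g ^ˢ n))
  where open 𝒮

1ˢ-^ˢ : ∀ n → 1ˢ ^ˢ n ≗ 1ˢ
1ˢ-^ˢ zero    = ≗-refl
1ˢ-^ˢ (suc n) = ≗-trans (✶-identityˡ _) (1ˢ-^ˢ n)

-- Makes the cut-offs of compositions harmless: at index n, all exponents beyond n contribute 0.
^ˢ-order : ∀ {f} → f ⟪ 0 ⟫ ≡ 0ℚ → ∀ {k n} → n < k → (f ^ˢ k) ⟪ n ⟫ ≡ 0ℚ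
^ˢ-order {f} f0 {suc k} {zero}  _       = trans (cong (ℚ._* (f ^ˢ k) ⟪ 0 ⟫) f0) (ℚₚ.*-zeroˡ ((f ^ˢ k) ⟪ 0 ⟫))
^ˢ-order {f} f0 {suc k} {suc n} (s≤s l) = trans (cong₂ ℚ._+_
  (trans (cong (ℚ._* (f ^ˢ k) ⟪ suc n ⟫) f0) (ℚₚ.*-zeroˡ ((f ^ˢ k) ⟪ suc n ⟫)))
  (∑≤-zero≤ n (λ i _ → trans (cong (f ⟪ suc i ⟫ ℚ.*_) (^ˢ-order f0 (ℕₚ.≤-<-trans (ℕₚ.m∸n≤m n i) l))) (ℚₚ.*-zeroʳ (f ⟪ suc i ⟫)))))
  (ℚₚ.+-identityˡ 0ℚ)

∑ˢ : {I : Set} → List I → (I → Ser) → Ser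
∑ˢ L f ⟪ n ⟫ = ∑ℚ L (λ x → f x ⟪ n ⟫)

∑ˢ-cong : {I : Set} (L : List I) {f g : I → Ser} → (∀ x → f x ≗ g x) → ∑ˢ L f ≗ ∑ˢ L g
∑ˢ-cong L e .coeff n = ℚ∑.∑-cong L (λ x → coeff (e x) n)

∑ˢ-✶ʳ : {I : Set} (L : List I) (f : I → Ser) (g : Ser) → ∑ˢ L f ✶ g ≗ ∑ˢ L (λ x → f x ✶ g)
∑ˢ-✶ʳ L f g .coeff n = trans (∑≤-cong n (λ i → sym (ℚ∑.∑-*ʳ L (g ⟪ n ∸ i ⟫) (λ x → f x ⟪ i ⟫))))
  (∑≤-∑ n L (λ i x → f x ⟪ i ⟫ ℚ.* g ⟪ n ∸ i ⟫))

∑ˢ-✶ˡ : {I : Set} (L : List I) (g : Ser) (f : I → Ser) → g ✶ ∑ˢ L f ≗ ∑ˢ L (λ x → g ✶ f x)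
∑ˢ-✶ˡ L g f = ≗-trans (✶-comm g _) (≗-trans (∑ˢ-✶ʳ L f g) (∑ˢ-cong L (λ x → ✶-comm (f x) g)))

-- The composition f ∘ v, meaningful only when v has no constant term.
Sub : Ser → Ser → Ser
Sub v f ⟪ n ⟫ = ∑≤ n (λ k → f ⟪ k ⟫ ℚ.* (v ^ˢ k) ⟪ n ⟫)

Sub-cong : ∀ v {f g} → f ≗ g → Sub v f ≗ Sub v g
Sub-cong v e .coeff n = ∑≤-cong n (λ k → cong (ℚ._* (v ^ˢ k) ⟪ n ⟫) (coeff e k))

Sub-⊞ : ∀ v f g → Sub v (f ⊞ g) ≗ Sub v f ⊞ Sub v g
Sub-⊞ v f g .coeff n = trans (∑≤-cong n (λ k → ℚₚ.*-distribʳ-+ ((v ^ˢ k) ⟪ n ⟫) (f ⟪ k ⟫) (g ⟪ k ⟫)))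
  (∑≤-+ n (λ k → f ⟪ k ⟫ ℚ.* (v ^ˢ k) ⟪ n ⟫) (λ k → g ⟪ k ⟫ ℚ.* (v ^ˢ k) ⟪ n ⟫))

Sub-·ˢ : ∀ v q f → Sub v (q ·ˢ f) ≗ q ·ˢ Sub v f
Sub-·ˢ v q f .coeff n = trans (∑≤-cong n (λ k → ℚₚ.*-assoc q (f ⟪ k ⟫) ((v ^ˢ k) ⟪ n ⟫))) (∑≤-*ˡ n q (λ k → f ⟪ k ⟫ ℚ.* (v ^ˢ k) ⟪ n ⟫))

Sub-con : ∀ v q → Sub v (cˢ q) ≗ cˢ q
Sub-con v q .coeff zero    = ℚₚ.*-identityʳ q
Sub-con v q .coeff (suc n) = trans (cong₂ ℚ._+_ (ℚₚ.*-zeroʳ q) (∑≤-zero≤ n (λ i _ → ℚₚ.*-zeroˡ ((v ^ˢ suc i) ⟪ suc n ⟫)))) (ℚₚ.+-identityˡ 0ℚ)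

Sub-∑ˢ : ∀ {I : Set} v (L : List I) (f : I → Ser) → Sub v (∑ˢ L f) ≗ ∑ˢ L (λ x → Sub v (f x))
Sub-∑ˢ v L f .coeff n = trans (∑≤-cong n (λ k → sym (ℚ∑.∑-*ʳ L ((v ^ˢ k) ⟪ n ⟫) (λ x → f x ⟪ k ⟫))))
  (∑≤-∑ n L (λ k x → f x ⟪ k ⟫ ℚ.* (v ^ˢ k) ⟪ n ⟫))

hd-tl : ∀ f → f ≗ cˢ (f ⟪ 0 ⟫) ⊞ 𝕩 ✶ tl f
hd-tl f .coeff zero    = sym (trans (cong (f ⟪ 0 ⟫ ℚ.+_) (𝕩✶-zero (tl f))) (ℚₚ.+-identityʳ (f ⟪ 0 ⟫)))
hd-tl f .coeff (suc n) = sym (trans (ℚₚ.+-identityˡ _) (𝕩✶-suc (tl f) n))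

module _ {v : Ser} (v0 : v ⟪ 0 ⟫ ≡ 0ℚ) where

  -- Composition is multiplicative for the factor x. The other multiplicative rules, for powers of
  -- x, 1/(1-x), 1-x and 1-x², are derived from this one.
  Sub-𝕩 : ∀ f → Sub v (𝕩 ✶ f) ≗ v ✶ Sub v f
  Sub-𝕩 f .coeff n = trans (lhs n) (sym (begin
    (v ✶ Sub v f) ⟪ n ⟫
      -- Each inner sum is extended to the common bound n, so that the summations can be exchanged.
      ≡⟨ ∑≤-cong n (λ i → cong (v ⟪ i ⟫ ℚ.*_) (sym (∑≤-trunc≤ (ℕₚ.m∸n≤m n i) (λ k lt →
           trans (cong (f ⟪ k ⟫ ℚ.*_) (^ˢ-order {v} v0 lt)) (ℚₚ.*-zeroʳ (f ⟪ k ⟫)))))) ⟩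
    ∑≤ n (λ i → v ⟪ i ⟫ ℚ.* ∑≤ n (λ k → f ⟪ k ⟫ ℚ.* (v ^ˢ k) ⟪ n ∸ i ⟫))
      ≡⟨ ∑≤-cong n (λ i → trans (sym (∑≤-*ˡ n (v ⟪ i ⟫) (λ k → f ⟪ k ⟫ ℚ.* (v ^ˢ k) ⟪ n ∸ i ⟫)))
            (∑≤-cong n (λ k → swap3 (v ⟪ i ⟫) (f ⟪ k ⟫) ((v ^ˢ k) ⟪ n ∸ i ⟫)))) ⟩
    ∑≤ n (λ i → ∑≤ n (λ k → f ⟪ k ⟫ ℚ.* (v ⟪ i ⟫ ℚ.* (v ^ˢ k) ⟪ n ∸ i ⟫)))
      ≡⟨ ∑≤-swap n n (λ i k → f ⟪ k ⟫ ℚ.* (v ⟪ i ⟫ ℚ.* (v ^ˢ k) ⟪ n ∸ i ⟫)) ⟩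
    ∑≤ n (λ k → ∑≤ n (λ i → f ⟪ k ⟫ ℚ.* (v ⟪ i ⟫ ℚ.* (v ^ˢ k) ⟪ n ∸ i ⟫)))
      ≡⟨ ∑≤-cong n (λ k → ∑≤-*ˡ n (f ⟪ k ⟫) (λ i → v ⟪ i ⟫ ℚ.* (v ^ˢ k) ⟪ n ∸ i ⟫)) ⟩
    ∑≤ n (λ k → f ⟪ k ⟫ ℚ.* (v ^ˢ suc k) ⟪ n ⟫) ∎))
    where
    open ≡-Reasoning
    swap3 : ∀ a b c → a ℚ.* (b ℚ.* c) ≡ b ℚ.* (a ℚ.* c)
    swap3 = let open ℚSolver.+-*-Solver in solve 3 (λ a b c → a :* (b :* c) := b :* (a :* c)) refl
    -- The sum over the powers v^(k+1) runs one exponent further than the composition of x f; the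
    -- additional term has order above n.
    vanish : ∀ n → f ⟪ n ⟫ ℚ.* (v ^ˢ suc n) ⟪ n ⟫ ≡ 0ℚ
    vanish n = trans (cong (f ⟪ n ⟫ ℚ.*_) (^ˢ-order {v} v0 (ℕₚ.n<1+n n))) (ℚₚ.*-zeroʳ (f ⟪ n ⟫))
    lhs : ∀ n → Sub v (𝕩 ✶ f) ⟪ n ⟫ ≡ ∑≤ n (λ k → f ⟪ k ⟫ ℚ.* (v ^ˢ suc k) ⟪ n ⟫)
    lhs zero    = trans (cong (ℚ._* 1ℚ) (𝕩✶-zero f)) (trans (ℚₚ.*-zeroˡ 1ℚ) (sym (vanish 0)))
    lhs (suc m) = trans (cong₂ ℚ._+_ (trans (cong (ℚ._* 0ℚ) (𝕩✶-zero f)) (ℚₚ.*-zeroˡ 0ℚ))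
        (∑≤-cong m (λ k → cong (ℚ._* (v ^ˢ suc k) ⟪ suc m ⟫) (𝕩✶-suc f k))))
      (trans (ℚₚ.+-comm 0ℚ s) (trans (cong (s ℚ.+_) (sym (vanish (suc m)))) (sym (∑≤-last m (λ k → f ⟪ k ⟫ ℚ.* (v ^ˢ suc k) ⟪ suc m ⟫)))))
      where s = ∑≤ m (λ k → f ⟪ k ⟫ ℚ.* (v ^ˢ suc k) ⟪ suc m ⟫)

  -- Horner's scheme: f is its constant term plus x times its tail.
  Sub-step : ∀ f → Sub v f ≗ cˢ (f ⟪ 0 ⟫) ⊞ v ✶ Sub v (tl f)
  Sub-step f = ≗-trans (Sub-cong v (hd-tl f)) (≗-trans (Sub-⊞ v (cˢ (f ⟪ 0 ⟫)) (𝕩 ✶ tl f))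
    (ℛ.+-cong (Sub-con v (f ⟪ 0 ⟫)) (Sub-𝕩 (tl f))))

  Sub-𝕩^ : ∀ k f → Sub v (𝕩 ^ˢ k ✶ f) ≗ v ^ˢ k ✶ Sub v f
  Sub-𝕩^ zero    f = ≗-trans (Sub-cong v (✶-identityˡ f)) (≗-sym (✶-identityˡ (Sub v f)))
  Sub-𝕩^ (suc k) f = ≗-trans (Sub-cong v (✶-assoc 𝕩 (𝕩 ^ˢ k) f)) (≗-trans (Sub-𝕩 (𝕩 ^ˢ k ✶ f))
    (≗-trans (ℛ.*-congˡ (Sub-𝕩^ k f)) (≗-sym (✶-assoc v (v ^ˢ k) (Sub v f)))))

  -- The hypothesis m v = q x says that v has order exactly one, so f ↦ f ∘ v is triangular.
  Sub-injective : ∀ {m q r} → m ✶ v ≗ cˢ q ✶ 𝕩 → r ℚ.* q ≡ 1ℚ → ∀ n f → Sub v f ≗ 0ˢ → f ⟪ n ⟫ ≡ 0ℚ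
  Sub-injective {m} {q} {r} mv rq zero    f z = trans (sym (ℚₚ.*-identityʳ (f ⟪ 0 ⟫))) (coeff z 0)
  Sub-injective {m} {q} {r} mv rq (suc n) f z = Sub-injective {m} {q} {r} mv rq n (tl f) g≗0
    where
    g = Sub v (tl f)
    f0 : cˢ (f ⟪ 0 ⟫) ≗ 0ˢ
    f0 .coeff zero    = trans (sym (ℚₚ.*-identityʳ (f ⟪ 0 ⟫))) (coeff z 0)
    f0 .coeff (suc _) = refl
    vg : v ✶ g ≗ 0ˢ
    vg = ≗-trans (≗-sym (≗-trans (ℛ.+-congʳ f0) (ℛ.+-identityˡ (v ✶ g)))) (≗-trans (≗-sym (Sub-step f)) z)
    -- Multiplication by m turns v into q x, and q is invertible, so v g = 0 forces g = 0. The
    -- induction then continues with the tail of f.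
    xg : cˢ q ✶ (𝕩 ✶ g) ≗ 0ˢ
    xg = ≗-trans (≗-sym (✶-assoc (cˢ q) 𝕩 g)) (≗-trans (ℛ.*-congʳ (≗-sym mv)) (≗-trans (✶-assoc m v g) (≗-trans (ℛ.*-congˡ vg) (ℛ.zeroʳ m))))
    g≗0 : g ≗ 0ˢ
    g≗0 .coeff k = begin
      g ⟪ k ⟫                             ≡⟨ ℚₚ.*-identityˡ (g ⟪ k ⟫) ⟨
      1ℚ ℚ.* g ⟪ k ⟫                      ≡⟨ cong (ℚ._* g ⟪ k ⟫) rq ⟨
      r ℚ.* q ℚ.* g ⟪ k ⟫                 ≡⟨ ℚₚ.*-assoc r q (g ⟪ k ⟫) ⟩
      r ℚ.* (q ℚ.* g ⟪ k ⟫)               ≡⟨ cong (λ z → r ℚ.* (q ℚ.* z)) (𝕩✶-suc g k) ⟨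
      r ℚ.* (q ℚ.* (𝕩 ✶ g) ⟪ suc k ⟫)     ≡⟨ cong (r ℚ.*_) (coeff (cˢ-✶ q (𝕩 ✶ g)) (suc k)) ⟨
      r ℚ.* (cˢ q ✶ (𝕩 ✶ g)) ⟪ suc k ⟫   ≡⟨ cong (r ℚ.*_) (coeff xg (suc k)) ⟩
      r ℚ.* 0ℚ                            ≡⟨ ℚₚ.*-zeroʳ r ⟩
      0ℚ ∎
      where open ≡-Reasoning

invˢ : Ser → Ser
invˢ g = Sub (1ˢ ⊟ g) ones

-- `ones` is its own tail, so `Sub-step` says that the candidate i satisfies i = 1 + (1 - g) i.
invˢ-law : ∀ {g} → g ⟪ 0 ⟫ ≡ 1ℚ → g ✶ invˢ g ≗ 1ˢ
invˢ-law {g} g0 = begin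
  g ✶ i                     ≈⟨ solve 2 (λ g i → g :* i := i :- (con 1ℚ :- g) :* i) ≗-refl g i ⟩
  i ⊟ h ✶ i                 ≈⟨ ℛ.+-congʳ (Sub-step {h} h0 ones) ⟩
  (1ˢ ⊞ h ✶ Sub h (tl ones)) ⊟ h ✶ i ≈⟨ ℛ.+-congʳ (ℛ.+-congˡ (ℛ.*-congˡ (Sub-cong h {tl ones} {ones} (ptw λ _ → refl)))) ⟩
  (1ˢ ⊞ h ✶ i) ⊟ h ✶ i      ≈⟨ solve 1 (λ p → (con 1ℚ :+ p) :- p := con 1ℚ) ≗-refl (h ✶ i) ⟩
  1ˢ ∎
  where
  open 𝒮
  open SetoidR ℛ.setoid
  i = invˢ g
  h = 1ˢ ⊟ g
  h0 : h ⟪ 0 ⟫ ≡ 0ℚ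
  h0 = cong (λ z → 1ℚ ℚ.+ (ℚ.- z)) g0

cancel : ∀ {m i f g} → m ✶ i ≗ 1ˢ → m ✶ f ≗ m ✶ g → f ≗ g
cancel {m} {i} {f} {g} mi e = begin
  f               ≈⟨ ✶-identityˡ f ⟨
  1ˢ ✶ f          ≈⟨ ℛ.*-congʳ mi ⟨
  m ✶ i ✶ f       ≈⟨ perm m i f ⟩
  i ✶ (m ✶ f)     ≈⟨ ℛ.*-congˡ e ⟩
  i ✶ (m ✶ g)     ≈⟨ perm m i g ⟨
  m ✶ i ✶ g       ≈⟨ ℛ.*-congʳ mi ⟩
  1ˢ ✶ g          ≈⟨ ✶-identityˡ g ⟩
  g ∎
  where
  open SetoidR ℛ.setoid
  perm : ∀ m i f → m ✶ i ✶ f ≗ i ✶ (m ✶ f)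
  perm = let open 𝒮 in solve 3 (λ m i f → m :* i :* f := i :* (m :* f)) ≗-refl

inv-unique : ∀ {m i j} → m ✶ i ≗ 1ˢ → m ✶ j ≗ 1ˢ → i ≗ j
inv-unique {m} {i} {j} mi mj = cancel {m} {i} mi (≗-trans mi (≗-sym mj))

-- Booleans, indicators and lists without repetition

T⇒≡ : ∀ {b} → True b → b ≡ true
T⇒≡ {true} _ = refl

≡⇒T : ∀ {b} → b ≡ true → True b
≡⇒T refl = tt

¬T⇒≡ : ∀ {b} → ¬ True b → b ≡ false
¬T⇒≡ {true}  n = contradiction tt n
¬T⇒≡ {false} _ = refl

True-∧ : ∀ {a b} → True (a ∧ b) → True a × True b
True-∧ {true} t = tt , t

<ᵇ-true : ∀ {m n} → m < n → (m <ᵇ n) ≡ true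
<ᵇ-true lt = T⇒≡ (ℕₚ.<⇒<ᵇ lt)

<ᵇ-false : ∀ {m n} → n ≤ m → (m <ᵇ n) ≡ false
<ᵇ-false {m} {n} le = ¬T⇒≡ (λ t → ℕₚ.<⇒≱ (ℕₚ.<ᵇ⇒< m n t) le)

≡ᵇ-true : ∀ n → (n ≡ᵇ n) ≡ true
≡ᵇ-true n = T⇒≡ (ℕₚ.≡⇒≡ᵇ n n refl)

≡ᵇ-false : ∀ {m n} → m ≢ n → (m ≡ᵇ n) ≡ false
≡ᵇ-false {m} {n} ne = ¬T⇒≡ (λ t → ne (ℕₚ.≡ᵇ⇒≡ m n t))

⟦_⟧ : Bool → ℕ
⟦ true ⟧  = 1
⟦ false ⟧ = 0

⟦⟧-∧ : ∀ a b → ⟦ a ∧ b ⟧ ≡ ⟦ a ⟧ ℕ.* ⟦ b ⟧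
⟦⟧-∧ true  b = sym (ℕₚ.+-identityʳ ⟦ b ⟧)
⟦⟧-∧ false b = refl

count-∑ : {I : Set} (p : I → Bool) (L : List I) → count p L ≡ ∑ℕ L (λ x → ⟦ p x ⟧)
count-∑ p []      = refl
count-∑ p (x ∷ L) with p x
... | true  = cong suc (count-∑ p L)
... | false = count-∑ p L

module _ {I : Set} where

  -- The pigeonhole principle: each head of `xs` is removed from `ys`, and the lengths leave nothing
  -- over. Through it, an injective self-map of a duplicate-free list permutes the list, so only
  -- injectivity is ever checked.
  unique-⊆-↭ : ∀ {xs ys : List I} → Unique xs → (∀ {x} → x ∈ xs → x ∈ ys) → length ys ≤ length xs → xs ↭ ys
  unique-⊆-↭ {[]}     {[]}     u s l = ↭-refl
  unique-⊆-↭ {x ∷ xs} {ys}     (x∉ ∷ u) s l with ∈-∃++ (s (here refl))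
  ... | as , bs , refl = ↭-trans (prep x (unique-⊆-↭ u s' l')) (↭-sym (↭ₚ.shift x as bs))
    where
    s' : ∀ {y} → y ∈ xs → y ∈ as ++ bs
    s' {y} m with ↭ₚ.∈-resp-↭ (↭ₚ.shift x as bs) (s (there m))
    ... | here refl = contradiction refl (All.lookup x∉ m)
    ... | there m'  = m'
    l' : length (as ++ bs) ≤ length xs
    l' = ℕ.s≤s⁻¹ (ℕₚ.≤-trans (ℕₚ.≤-reflexive (sym (↭ₚ.↭-length (↭ₚ.shift x as bs)))) l)

  ∑-single : ∀ {L : List I} {f : I → ℕ} {s} → Unique L → s ∈ L → (∀ {x} → x ∈ L → x ≢ s → f x ≡ 0) → ∑ℕ L f ≡ f s
  ∑-single {x ∷ L} {f} (x∉ ∷ u) (here refl) v = trans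
    (cong (f x ℕ.+_) (ℕ∑.∑-zero∈ L (λ m → v (there m) (All.lookup x∉ m ∘ sym)))) (ℕₚ.+-identityʳ (f x))
  ∑-single {x ∷ L} {f} (x∉ ∷ u) (there m) v = cong₂ ℕ._+_ (v (here refl) (All.lookup x∉ m))
    (∑-single u m (λ m' → v (there m')))

  Unique-↭ : ∀ {xs ys : List I} → xs ↭ ys → Unique xs → Unique ys
  Unique-↭ ↭.refl u = u
  Unique-↭ (prep x p) (x∉ ∷ u) = ↭ₚ.All-resp-↭ p x∉ ∷ Unique-↭ p u
  Unique-↭ (swap x y p) ((x≢y ∷ x∉) ∷ y∉ ∷ u) =
    ((x≢y ∘ sym) ∷ ↭ₚ.All-resp-↭ p y∉) ∷ ↭ₚ.All-resp-↭ p x∉ ∷ Unique-↭ p u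
  Unique-↭ (↭.trans p q) u = Unique-↭ q (Unique-↭ p u)

Unique-map : {I J : Set} {f : I → J} {xs : List I} → (∀ {x y} → x ∈ xs → y ∈ xs → f x ≡ f y → x ≡ y) → Unique xs → Unique (map f xs)
Unique-map {xs = []}     inj u = []
Unique-map {xs = x ∷ xs} inj (x∉ ∷ u) =
  Allₚ.map⁺ (All.tabulate (λ m e → All.lookup x∉ m (inj (here refl) (there m) e))) ∷
  Unique-map (λ m m' → inj (there m) (there m')) u

module _ {I : Set} {L : List I} {φ : I → I} (u : Unique L) (closed : ∀ {x} → x ∈ L → φ x ∈ L)
         (inj : ∀ {x y} → x ∈ L → y ∈ L → φ x ≡ φ y → x ≡ y) where

  map-↭ : map φ L ↭ L
  map-↭ = unique-⊆-↭ (Unique-map inj u) sub (ℕₚ.≤-reflexive (sym (Listₚ.length-map φ L)))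
    where
    sub : ∀ {x} → x ∈ map φ L → x ∈ L
    sub m with ∈ₚ.∈-map⁻ φ m
    ... | _ , m' , refl = closed m'

  ∑-reindex : (f : I → ℕ) → ∑ℕ L (f ∘ φ) ≡ ∑ℕ L f
  ∑-reindex f = trans (sym (ℕ∑.∑-map φ L f)) (ℕ∑.∑-↭ f map-↭)

-- Words of fixed length over an alphabet

module _ {I : Set} where

  -- Enumerated with the tail in the outer loop, in order to agree with `words` as a list.
  tuples : List I → ℕ → List (List I)
  tuples L zero    = [] ∷ []
  tuples L (suc n) = cartesianProductWith (λ w v → v ∷ w) (tuples L n) L

  ∑-tuples : ∀ (L : List I) n f → ∑ℕ (tuples L (suc n)) f ≡ ∑ℕ (tuples L n) (λ w → ∑ℕ L (λ v → f (v ∷ w)))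
  ∑-tuples L n f = go (tuples L n)
    where
    go : ∀ W → ∑ℕ (cartesianProductWith (λ w v → v ∷ w) W L) f ≡ ∑ℕ W (λ w → ∑ℕ L (λ v → f (v ∷ w)))
    go []      = refl
    go (w ∷ W) = trans (ℕ∑.∑-++ (map (_∷ w) L) _ f) (cong₂ ℕ._+_ (ℕ∑.∑-map (_∷ w) L f) (go W))

  ∑-tuples′ : ∀ (L : List I) n f → ∑ℕ (tuples L (suc n)) f ≡ ∑ℕ L (λ v → ∑ℕ (tuples L n) (λ w → f (v ∷ w)))
  ∑-tuples′ L n f = trans (∑-tuples L n f) (ℕ∑.∑-swap (tuples L n) L (λ w v → f (v ∷ w)))

  ∈-tuples⁺ : ∀ {L : List I} {w} → All (_∈ L) w → w ∈ tuples L (length w)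
  ∈-tuples⁺ []      = here refl
  ∈-tuples⁺ (m ∷ a) = ∈ₚ.∈-cartesianProductWith⁺ _ (∈-tuples⁺ a) m

  ∈-tuples⁻ : ∀ {L : List I} n {w} → w ∈ tuples L n → length w ≡ n × All (_∈ L) w
  ∈-tuples⁻ zero    (here refl) = refl , []
  ∈-tuples⁻ {L} (suc n) m with ∈ₚ.∈-cartesianProductWith⁻ _ (tuples L n) L m
  ... | w , v , mw , mv , refl = cong suc (proj₁ (∈-tuples⁻ n mw)) , mv ∷ proj₂ (∈-tuples⁻ n mw)

  Unique-tuples : ∀ {L : List I} n → Unique L → Unique (tuples L n)
  Unique-tuples zero    u = [] ∷ []
  Unique-tuples (suc n) u = Uniqueₚ.cartesianProductWith⁺ _ (λ { refl → refl , refl }) (Unique-tuples n u) u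

words≡tuples : ∀ n m → words n m ≡ tuples (rng 1 n) m
words≡tuples n zero    = refl
words≡tuples n (suc m) = trans (cong (concatMap (λ w → map (λ v → v ∷ w) (rng 1 n))) (words≡tuples n m)) (go (tuples (rng 1 n) m))
  where
  go : ∀ W → concatMap (λ w → map (λ v → v ∷ w) (rng 1 n)) W ≡ cartesianProductWith (λ w v → v ∷ w) W (rng 1 n)
  go []      = refl
  go (w ∷ W) = cong (map (_∷ w) (rng 1 n) ++_) (go W)

-- Positions and values in one-line notation

∈-rng⁺ : ∀ {n v} → 1 ≤ v → v ≤ n → v ∈ rng 1 n
∈-rng⁺ (s≤s _) le = ∈ₚ.∈-map⁺ suc (∈ₚ.∈-upTo⁺ le)

∈-rng⁻ : ∀ {n v} → v ∈ rng 1 n → 1 ≤ v × v ≤ n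
∈-rng⁻ m with ∈ₚ.∈-map⁻ suc m
... | _ , m' , refl = s≤s z≤n , ∈ₚ.∈-upTo⁻ m'

length-rng : ∀ n → length (rng 1 n) ≡ n
length-rng n = trans (Listₚ.length-map suc (upTo n)) (Listₚ.length-upTo n)

Unique-rng : ∀ n → Unique (rng 1 n)
Unique-rng n = Uniqueₚ.map⁺ ℕₚ.suc-injective (Uniqueₚ.upTo⁺ n)

rng-suc : ∀ n → rng 1 (suc n) ≡ 1 ∷ map suc (rng 1 n)
rng-suc n = cong (λ z → map suc z) (upTo-suc n)

at∈ : ∀ w {i} → 1 ≤ i → i ≤ length w → at w i ∈ w
at∈ (u ∷ us) {suc zero}    _ _       = here refl
at∈ (u ∷ us) {suc (suc i)} _ (s≤s l) = there (at∈ us (s≤s z≤n) l)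

at-map : ∀ (f : ℕ → ℕ) w {i} → 1 ≤ i → i ≤ length w → at (map f w) i ≡ f (at w i)
at-map f (u ∷ us) {suc zero}    _ _       = refl
at-map f (u ∷ us) {suc (suc i)} _ (s≤s l) = at-map f us (s≤s z≤n) l

at-rng : ∀ n {i} → 1 ≤ i → i ≤ n → at (rng 1 n) i ≡ i
at-rng (suc n) {suc zero}    _ _       = refl
at-rng (suc n) {suc (suc i)} _ (s≤s l) = trans (cong (λ z → at z (suc (suc i))) (rng-suc n))
  (trans (at-map suc (rng 1 n) (s≤s z≤n) (ℕₚ.≤-trans l (ℕₚ.≤-reflexive (sym (length-rng n))))) (cong suc (at-rng n (s≤s z≤n) l)))

at-map-rng : ∀ f n {i} → 1 ≤ i → i ≤ n → at (map f (rng 1 n)) i ≡ f i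
at-map-rng f n p l = trans (at-map f (rng 1 n) p (ℕₚ.≤-trans l (ℕₚ.≤-reflexive (sym (length-rng n))))) (cong f (at-rng n p l))

map-at-rng : ∀ w → map (at w) (rng 1 (length w)) ≡ w
map-at-rng []       = refl
map-at-rng (u ∷ us) = trans (cong (map (at (u ∷ us))) (rng-suc (length us))) (cong (u ∷_)
  (trans (sym (Listₚ.map-∘ (rng 1 (length us)))) (trans
    (Listₚ.map-cong-local (All.tabulate (λ m → shift (proj₁ (∈-rng⁻ m))))) (map-at-rng us))))
  where
  shift : ∀ {i} → 1 ≤ i → at (u ∷ us) (suc i) ≡ at us i
  shift (s≤s _) = refl

indexOf-here : ∀ v us → indexOf v (v ∷ us) ≡ 1
indexOf-here v us = cong (λ b → if b then 1 else suc (indexOf v us)) (≡ᵇ-true v)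

indexOf-there : ∀ {v u} us → v ≢ u → indexOf v (u ∷ us) ≡ suc (indexOf v us)
indexOf-there {v} us ne = cong (λ b → if b then 1 else suc (indexOf v us)) (≡ᵇ-false ne)

indexOf≥1 : ∀ {v} w → v ∈ w → 1 ≤ indexOf v w
indexOf≥1 {v} (u ∷ us) m with v ≡ᵇ u
... | true  = s≤s z≤n
... | false = s≤s z≤n

indexOf≤ : ∀ {v} w → v ∈ w → indexOf v w ≤ length w
indexOf≤ {v} (u ∷ us) m with v ℕₚ.≟ u
... | yes refl rewrite indexOf-here v us = s≤s z≤n
... | no ne rewrite indexOf-there us ne with m
...   | here e  = contradiction e ne
...   | there m' = s≤s (indexOf≤ us m')

at-indexOf : ∀ {v} w → v ∈ w → at w (indexOf v w) ≡ v
at-indexOf {v} (u ∷ us) m with v ℕₚ.≟ u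
... | yes refl rewrite indexOf-here v us = refl
... | no ne rewrite indexOf-there us ne with m
...   | here e  = contradiction e ne
...   | there m' with indexOf v us | indexOf≥1 us m' | at-indexOf us m'
...     | suc _ | _ | e = e

indexOf-at : ∀ {w} → Unique w → ∀ {i} → 1 ≤ i → i ≤ length w → indexOf (at w i) w ≡ i
indexOf-at {u ∷ us} _        {suc zero}    _ _       = indexOf-here u us
indexOf-at {u ∷ us} (u∉ ∷ q) {suc (suc i)} _ (s≤s l) =
  trans (indexOf-there us (All.lookup u∉ (at∈ us (s≤s z≤n) l) ∘ sym)) (cong suc (indexOf-at q (s≤s z≤n) l))

-- The symmetric group

elem⇒∈ : ∀ v us → True (elem v us) → v ∈ us
elem⇒∈ v (u ∷ us) t with v ℕₚ.≟ u
... | yes refl = here refl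
... | no ne rewrite ≡ᵇ-false ne = there (elem⇒∈ v us t)

∈⇒elem : ∀ {v us} → v ∈ us → True (elem v us)
∈⇒elem {v} {u ∷ us} (here refl) rewrite ≡ᵇ-true v = tt
∈⇒elem {v} {u ∷ us} (there m) with v ≡ᵇ u
... | true  = tt
... | false = ∈⇒elem m

distinct⇒Unique : ∀ w → True (distinct w) → Unique w
distinct⇒Unique []       t = []
distinct⇒Unique (u ∷ us) t with elem u us in eq
... | false = All.tabulate (λ { m refl → ≡.subst True eq (∈⇒elem m) }) ∷ distinct⇒Unique us t

Unique⇒distinct : ∀ {w} → Unique w → True (distinct w)
Unique⇒distinct [] = tt
Unique⇒distinct {u ∷ us} (u∉ ∷ q) with elem u us in eq
... | true  = contradiction refl (All.lookup u∉ (elem⇒∈ u us (≡⇒T eq)))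
... | false = Unique⇒distinct q

-- Trades the Boolean filter for `w ↭ rng 1 n`, the form in which permutations are handled from here
-- on: n different letters out of n are all of them.
Sym⁻ : ∀ n {w} → w ∈ Sym n → w ↭ rng 1 n
Sym⁻ n {w} m with ∈ₚ.∈-filter⁻ (Bool.T? ∘ distinct) {xs = words n n} m
... | mw , t with ∈-tuples⁻ n (≡.subst (w ∈_) (words≡tuples n n) mw)
...   | lw , a = unique-⊆-↭ (distinct⇒Unique w t) (All.lookup a) (ℕₚ.≤-reflexive (trans (length-rng n) (sym lw)))

Sym⁺ : ∀ n {w} → w ↭ rng 1 n → w ∈ Sym n
Sym⁺ n {w} p = ∈ₚ.∈-filter⁺ (Bool.T? ∘ distinct) {xs = words n n}
  (≡.subst (w ∈_) (sym (words≡tuples n n)) (≡.subst (λ k → w ∈ tuples (rng 1 n) k) (trans (↭ₚ.↭-length p) (length-rng n))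
    (∈-tuples⁺ (All.tabulate (↭ₚ.∈-resp-↭ p)))))
  (Unique⇒distinct (Unique-↭ (↭-sym p) (Unique-rng n)))

Unique-Sym : ∀ n → Unique (Sym n)
Unique-Sym n = Uniqueₚ.filter⁺ (Bool.T? ∘ distinct)
  (≡.subst Unique (sym (words≡tuples n n)) (Unique-tuples n (Unique-rng n)))

module Perm n {w} (p : w ↭ rng 1 n) where

  len : length w ≡ n
  len = trans (↭ₚ.↭-length p) (length-rng n)

  uniq : Unique w
  uniq = Unique-↭ (↭-sym p) (Unique-rng n)

  ∈w : ∀ {v} → 1 ≤ v → v ≤ n → v ∈ w
  ∈w l u = ↭ₚ.∈-resp-↭ (↭-sym p) (∈-rng⁺ l u)

  w∈ : ∀ {v} → v ∈ w → 1 ≤ v × v ≤ n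
  w∈ m = ∈-rng⁻ (↭ₚ.∈-resp-↭ p m)

  private
    idx : ℕ → ℕ
    idx v = indexOf v w

  inverse≡ : inverse w ≡ map (λ v → indexOf v w) (rng 1 n)
  inverse≡ = cong (λ k → map idx (rng 1 k)) len

  idx-range : ∀ {v} → v ∈ rng 1 n → 1 ≤ indexOf v w × indexOf v w ≤ n
  idx-range m = indexOf≥1 w m' , ℕₚ.≤-trans (indexOf≤ w m') (ℕₚ.≤-reflexive len)
    where m' = ↭ₚ.∈-resp-↭ (↭-sym p) m

  idx-inj : ∀ {u v} → u ∈ rng 1 n → v ∈ rng 1 n → indexOf u w ≡ indexOf v w → u ≡ v
  idx-inj mu mv e = trans (sym (at-indexOf w (↭ₚ.∈-resp-↭ (↭-sym p) mu))) (trans (cong (at w) e) (at-indexOf w (↭ₚ.∈-resp-↭ (↭-sym p) mv)))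

  inverse-↭ : inverse w ↭ rng 1 n
  inverse-↭ = ≡.subst (_↭ rng 1 n) (sym inverse≡)
    (map-↭ (Unique-rng n) (λ m → ∈-rng⁺ (proj₁ (idx-range m)) (proj₂ (idx-range m))) idx-inj)

-- The inverse has the entry v at position w(v). As its entries are distinct, searching v in it
-- returns w(v).
inverse-involutive : ∀ n {w} → w ↭ rng 1 n → inverse (inverse w) ≡ w
inverse-involutive n {w} p = begin
  inverse (inverse w)                               ≡⟨ P′.inverse≡ ⟩
  map (λ v → indexOf v (inverse w)) (rng 1 n)       ≡⟨ Listₚ.map-cong-local (All.tabulate (λ m → back (∈-rng⁻ m))) ⟩
  map (at w) (rng 1 n)                              ≡⟨ cong (λ k → map (at w) (rng 1 k)) P.len ⟨
  map (at w) (rng 1 (length w))                     ≡⟨ map-at-rng w ⟩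
  w ∎
  where
  open ≡-Reasoning
  module P = Perm n p
  module P′ = Perm n P.inverse-↭
  back : ∀ {v} → 1 ≤ v × v ≤ n → indexOf v (inverse w) ≡ at w v
  back {v} (l , u) = trans (cong (λ z → indexOf z (inverse w)) (sym e)) (indexOf-at P′.uniq (proj₁ r) (ℕₚ.≤-trans (proj₂ r) (ℕₚ.≤-reflexive (sym P′.len))))
    where
    u' = ℕₚ.≤-trans u (ℕₚ.≤-reflexive (sym P.len))
    r = P.w∈ (at∈ w l u')
    e : at (inverse w) (at w v) ≡ v
    e = trans (cong (λ z → at z (at w v)) P.inverse≡) (trans (at-map-rng _ n (proj₁ r) (proj₂ r)) (indexOf-at P.uniq l u'))

∑-Sym-inverse : ∀ n f → ∑ℕ (Sym n) (f ∘ inverse) ≡ ∑ℕ (Sym n) f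
∑-Sym-inverse n = ∑-reindex (Unique-Sym n) (λ m → Sym⁺ n (Perm.inverse-↭ n (Sym⁻ n m)))
  (λ m m' e → trans (sym (inverse-involutive n (Sym⁻ n m))) (trans (cong inverse e) (inverse-involutive n (Sym⁻ n m'))))

-- Words over signed alphabets.  The letter x is positive when ε x is true; it may be repeated at an
-- ascent (b = true) if it is positive and at a descent (b = false) if it is negative.

step : (ℕ → Bool) → Bool → ℕ → ℕ → Bool
step ε b x y = if x <ᵇ y then true else if x ≡ᵇ y then (if ε x then b else not b) else false

module _ (ε : ℕ → Bool) (b : Bool) where

  step-< : ∀ {x y} → x < y → step ε b x y ≡ true
  step-< lt rewrite <ᵇ-true lt = refl

  step-> : ∀ {x y} → y < x → step ε b x y ≡ false
  step-> {x} {y} lt rewrite <ᵇ-false (ℕₚ.<⇒≤ lt) | ≡ᵇ-false {x} {y} (ℕₚ.>⇒≢ lt) = refl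

  step-≡ : ∀ x → step ε b x x ≡ (if ε x then b else not b)
  step-≡ x rewrite <ᵇ-false (ℕₚ.≤-refl {x}) | ≡ᵇ-true x = refl

patR : (ℕ → ℕ → Bool) → List ℕ → List Bool
patR R []          = []
patR R (x ∷ [])    = []
patR R (x ∷ y ∷ w) = R x y ∷ patR R (y ∷ w)

pat : List ℕ → List Bool
pat = patR _<ᵇ_

length-patR : ∀ R x w → length (patR R (x ∷ w)) ≡ length w
length-patR R x []      = refl
length-patR R x (y ∷ w) = cong suc (length-patR R y w)

patR-rng : ∀ {R R′ : ℕ → ℕ → Bool} {f g : ℕ → ℕ} n →
  (∀ {i} → 1 ≤ i → suc i ≤ n → R (f i) (f (suc i)) ≡ R′ (g i) (g (suc i))) →
  patR R (map f (rng 1 n)) ≡ patR R′ (map g (rng 1 n))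
patR-rng {R} {R′} {f} {g} n e = begin
  patR R (map f (rng 1 n))       ≡⟨ cong (patR R) (unmap f) ⟩
  patR R (applyUpTo (f ∘ suc) n) ≡⟨ go n (f ∘ suc) (g ∘ suc) (λ l → e (s≤s z≤n) l) ⟩
  patR R′ (applyUpTo (g ∘ suc) n) ≡⟨ cong (patR R′) (unmap g) ⟨
  patR R′ (map g (rng 1 n)) ∎
  where
  open ≡-Reasoning
  unmap : ∀ f → map f (rng 1 n) ≡ applyUpTo (f ∘ suc) n
  unmap f = trans (sym (Listₚ.map-∘ (upTo n))) (Listₚ.map-upTo (f ∘ suc) n)
  go : ∀ n f g → (∀ {i} → suc (suc i) ≤ n → R (f i) (f (suc i)) ≡ R′ (g i) (g (suc i))) →
       patR R (applyUpTo f n) ≡ patR R′ (applyUpTo g n)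
  go zero          f g e = refl
  go (suc zero)    f g e = refl
  go (suc (suc n)) f g e = cong₂ _∷_ (e (s≤s (s≤s z≤n))) (go (suc n) (f ∘ suc) (g ∘ suc) (λ l → e (s≤s l)))

-- The entry at v of a product of transfer matrices, one for each element of the pattern, applied to
-- the all-ones vector. It sees a permutation only through its ascents and descents.
cntFrom : (ℕ → Bool) → List ℕ → ℕ → List Bool → ℕ
cntFrom ε Y v []      = 1
cntFrom ε Y v (b ∷ p) = ∑ℕ Y (λ v′ → ⟦ step ε b v v′ ⟧ ℕ.* cntFrom ε Y v′ p)

cnt : (ℕ → Bool) → List ℕ → List Bool → ℕ
cnt ε Y p = ∑ℕ Y (λ v → cntFrom ε Y v p)

compat : (ℕ → Bool) → List ℕ → List ℕ → Bool
compat δ (p ∷ q ∷ σ) (x ∷ y ∷ g) = step δ (p <ᵇ q) x y ∧ compat δ (q ∷ σ) (y ∷ g)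
compat δ _           _           = true

cntFrom-compat : ∀ δ Y x p σ → cntFrom δ Y x (pat (p ∷ σ)) ≡ ∑ℕ (tuples Y (length σ)) (λ g → ⟦ compat δ (p ∷ σ) (x ∷ g) ⟧)
cntFrom-compat δ Y x p []      = refl
cntFrom-compat δ Y x p (q ∷ σ) = sym (begin
  ∑ℕ (tuples Y (suc (length σ))) (λ g → ⟦ compat δ (p ∷ q ∷ σ) (x ∷ g) ⟧)
    ≡⟨ ∑-tuples′ Y (length σ) _ ⟩
  ∑ℕ Y (λ y → ∑ℕ (tuples Y (length σ)) (λ g → ⟦ step δ (p <ᵇ q) x y ∧ compat δ (q ∷ σ) (y ∷ g) ⟧))
    ≡⟨ ℕ∑.∑-cong Y (λ y → trans (ℕ∑.∑-cong (tuples Y (length σ)) (λ g → ⟦⟧-∧ (step δ (p <ᵇ q) x y) _))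
         (trans (ℕ∑.∑-*ˡ (tuples Y (length σ)) ⟦ step δ (p <ᵇ q) x y ⟧ _) (cong (⟦ step δ (p <ᵇ q) x y ⟧ ℕ.*_) (sym (cntFrom-compat δ Y y q σ))))) ⟩
  ∑ℕ Y (λ y → ⟦ step δ (p <ᵇ q) x y ⟧ ℕ.* cntFrom δ Y y (pat (q ∷ σ))) ∎)
  where open ≡-Reasoning

cnt-compat : ∀ δ Y n σ → length σ ≡ suc n → cnt δ Y (pat σ) ≡ ∑ℕ (tuples Y (suc n)) (λ g → ⟦ compat δ σ g ⟧)
cnt-compat δ Y n (p ∷ σ) refl = trans (ℕ∑.∑-cong Y (λ x → cntFrom-compat δ Y x p σ)) (sym (∑-tuples′ Y n _))

-- Sorting by a key, and standardisation

module Sorting (κ : ℕ → ℕ) where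

  infix 4 _⊰_
  _⊰_ : ℕ → ℕ → Set
  x ⊰ y = κ x < κ y

  sortedᵇ : List ℕ → Bool
  sortedᵇ (p ∷ q ∷ σ) = (κ p <ᵇ κ q) ∧ sortedᵇ (q ∷ σ)
  sortedᵇ _           = true

  sortedᵇ⇒AllPairs : ∀ σ → True (sortedᵇ σ) → AllPairs _⊰_ σ
  sortedᵇ⇒AllPairs []          t = []
  sortedᵇ⇒AllPairs (p ∷ [])    t = [] ∷ []
  sortedᵇ⇒AllPairs (p ∷ q ∷ σ) t = link (sortedᵇ⇒AllPairs (q ∷ σ) (proj₂ (True-∧ t)))
    where
    lt = ℕₚ.<ᵇ⇒< (κ p) (κ q) (proj₁ (True-∧ t))
    link : AllPairs _⊰_ (q ∷ σ) → AllPairs _⊰_ (p ∷ q ∷ σ)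
    link (a ∷ s) = (lt ∷ All.map (ℕₚ.<-trans lt) a) ∷ a ∷ s

  AllPairs⇒sortedᵇ : ∀ {σ} → AllPairs _⊰_ σ → sortedᵇ σ ≡ true
  AllPairs⇒sortedᵇ {[]}        s = refl
  AllPairs⇒sortedᵇ {p ∷ []}    s = refl
  AllPairs⇒sortedᵇ {p ∷ q ∷ σ} ((lt ∷ _) ∷ s) rewrite <ᵇ-true lt = AllPairs⇒sortedᵇ s

  sorted-unique : ∀ {σ τ} → AllPairs _⊰_ σ → AllPairs _⊰_ τ → σ ↭ τ → σ ≡ τ
  sorted-unique {[]} {τ} s t p = sym (↭ₚ.↭-empty-inv (↭-sym p))
  sorted-unique {x ∷ σ} {[]} s t p = contradiction p ↭ₚ.¬x∷xs↭[]
  sorted-unique {x ∷ σ} {y ∷ τ} (a ∷ s) (b ∷ t) p with ↭ₚ.∈-resp-↭ p (here refl)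
  ... | here refl = cong (x ∷_) (sorted-unique s t (↭ₚ.drop-∷ p))
  ... | there mx with ↭ₚ.∈-resp-↭ (↭-sym p) (here refl)
  ...   | here refl = cong (x ∷_) (sorted-unique s t (↭ₚ.drop-∷ p))
  ...   | there my = contradiction (ℕₚ.<-trans (All.lookup a my) (All.lookup b mx)) (ℕₚ.<-irrefl refl)

  insert : ∀ x σ → AllPairs _⊰_ σ → (∀ {y} → y ∈ σ → κ x ≢ κ y) → ∃ λ τ → AllPairs _⊰_ τ × τ ↭ x ∷ σ
  insert x []      s ne = x ∷ [] , [] ∷ [] , ↭-refl
  insert x (y ∷ σ) (a ∷ s) ne with ℕₚ.<-cmp (κ x) (κ y)
  ... | tri< lt _ _ = x ∷ y ∷ σ , (lt ∷ All.map (ℕₚ.<-trans lt) a) ∷ a ∷ s , ↭-refl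
  ... | tri≈ _ e _  = contradiction e (ne (here refl))
  ... | tri> _ _ gt with insert x σ s (ne ∘ there)
  ...   | τ , t , p = y ∷ τ , ↭ₚ.All-resp-↭ (↭-sym p) (gt ∷ a) ∷ t , ↭-trans (prep y p) (swap y x ↭-refl)

  sort : ∀ L → Unique L → (∀ {x y} → x ∈ L → y ∈ L → κ x ≡ κ y → x ≡ y) → ∃ λ τ → AllPairs _⊰_ τ × τ ↭ L
  sort []      u inj = [] , [] , ↭-refl
  sort (x ∷ L) (x∉ ∷ u) inj with sort L u (λ m m′ → inj (there m) (there m′))
  ... | σ , s , p with insert x σ s (λ m e → let m′ = ↭ₚ.∈-resp-↭ p m in All.lookup x∉ m′ (inj (here refl) (there m′) e))
  ...   | τ , t , q = τ , t , ↭-trans q (prep x p)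

  indexOf-mono : ∀ {σ x y} → AllPairs _⊰_ σ → x ∈ σ → y ∈ σ → x ⊰ y → indexOf x σ < indexOf y σ
  indexOf-mono {z ∷ σ} {x} {y} (a ∷ s) mx my lt with x ℕₚ.≟ z | y ℕₚ.≟ z
  ... | yes refl | yes refl = contradiction lt (ℕₚ.<-irrefl refl)
  ... | yes refl | no ne with my
  ...   | here e   = contradiction e ne
  ...   | there my′ rewrite indexOf-here x σ | indexOf-there σ ne = s≤s (indexOf≥1 σ my′)
  indexOf-mono {z ∷ σ} {x} {y} (a ∷ s) mx my lt | no ne | yes refl with mx
  ...   | here e   = contradiction e ne
  ...   | there mx′ = contradiction (ℕₚ.<-trans lt (All.lookup a mx′)) (ℕₚ.<-irrefl refl)
  indexOf-mono {z ∷ σ} {x} {y} (a ∷ s) mx my lt | no ne | no ne′ with mx | my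
  ...   | here e | _ = contradiction e ne
  ...   | there _ | here e = contradiction e ne′
  ...   | there mx′ | there my′ rewrite indexOf-there σ ne | indexOf-there σ ne′ = s≤s (indexOf-mono s mx′ my′ lt)

  indexOf-<ᵇ : ∀ {σ x y} → AllPairs _⊰_ σ → x ∈ σ → y ∈ σ → κ x ≢ κ y → (indexOf x σ <ᵇ indexOf y σ) ≡ (κ x <ᵇ κ y)
  indexOf-<ᵇ {σ} {x} {y} s mx my ne with ℕₚ.<-cmp (κ x) (κ y)
  ... | tri< lt _ _ = trans (<ᵇ-true (indexOf-mono s mx my lt)) (sym (<ᵇ-true lt))
  ... | tri≈ _ e _  = contradiction e ne
  ... | tri> _ _ gt = trans (<ᵇ-false (ℕₚ.<⇒≤ (indexOf-mono s my mx gt))) (sym (<ᵇ-false (ℕₚ.<⇒≤ gt)))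

-- The key orders positions by the letter they carry; ties are broken by position, increasingly
-- for a positive and decreasingly for a negative letter.
module Standardise (n : ℕ) (δ : ℕ → Bool) (h : ℕ → ℕ) where

  offset : ℕ → ℕ
  offset p = if δ (h p) then p else n ∸ p

  key : ℕ → ℕ
  key p = h p ℕ.* suc n ℕ.+ offset p

  offset≤ : ∀ {p} → p ≤ n → offset p ≤ n
  offset≤ {p} l with δ (h p)
  ... | true  = l
  ... | false = ℕₚ.m∸n≤m n p

  -- The offset is at most n and cannot outweigh the multiple of n + 1 contributed by the letter.
  key-< : ∀ {p q} → p ≤ n → h p < h q → key p < key q
  key-< {p} {q} l lt = begin-strict
    h p ℕ.* suc n ℕ.+ offset p <⟨ ℕₚ.+-monoʳ-< (h p ℕ.* suc n) (s≤s (offset≤ l)) ⟩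
    h p ℕ.* suc n ℕ.+ suc n    ≡⟨ ℕₚ.+-comm (h p ℕ.* suc n) (suc n) ⟩
    suc (h p) ℕ.* suc n        ≤⟨ ℕₚ.*-monoˡ-≤ (suc n) lt ⟩
    h q ℕ.* suc n              ≤⟨ ℕₚ.m≤m+n _ _ ⟩
    h q ℕ.* suc n ℕ.+ offset q ∎
    where open ℕₚ.≤-Reasoning

  key-≡ : ∀ {p q} → p ≤ n → q ≤ n → p < q → h p ≡ h q → if δ (h p) then key p < key q else key q < key p
  key-≡ {p} {q} lp lq lt e rewrite e with δ (h q)
  ... | true  = ℕₚ.+-monoʳ-< (h q ℕ.* suc n) lt
  ... | false = ℕₚ.+-monoʳ-< (h q ℕ.* suc n) (ℕₚ.∸-monoʳ-< lt lq)

  -- Different letters are compared alike on both sides. Equal positive letters require p < q and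
  -- equal negative ones q < p, which is how the offset breaks the tie. Hence a word is compatible
  -- with σ exactly when σ lists the positions by increasing key.
  step-key : ∀ {p q} → p ≤ n → q ≤ n → p ≢ q → step δ (p <ᵇ q) (h p) (h q) ≡ (key p <ᵇ key q)
  step-key {p} {q} lp lq ne with ℕₚ.<-cmp (h p) (h q)
  ... | tri< lt _ _ = trans (step-< δ _ lt) (sym (<ᵇ-true (key-< lp lt)))
  ... | tri> _ _ gt = trans (step-> δ _ gt) (sym (<ᵇ-false (ℕₚ.<⇒≤ (key-< lq gt))))
  ... | tri≈ _ e _  = trans (≡.subst (λ z → step δ (p <ᵇ q) (h p) z ≡ (if δ (h p) then p <ᵇ q else not (p <ᵇ q))) e (step-≡ δ (p <ᵇ q) (h p))) tie
    where
    tie : (if δ (h p) then p <ᵇ q else not (p <ᵇ q)) ≡ (key p <ᵇ key q)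
    tie with ℕₚ.<-cmp p q
    ... | tri≈ _ e′ _ = contradiction e′ ne
    ... | tri< lt _ _ with δ (h p) | key-≡ lp lq lt e
    ...   | true  | k = trans (<ᵇ-true lt) (sym (<ᵇ-true k))
    ...   | false | k = trans (cong not (<ᵇ-true lt)) (sym (<ᵇ-false (ℕₚ.<⇒≤ k)))
    tie | tri> _ _ gt with δ (h p) | δ (h q) | cong δ e | key-≡ lq lp gt (sym e)
    ...   | true  | true  | _ | k = trans (<ᵇ-false (ℕₚ.<⇒≤ gt)) (sym (<ᵇ-false (ℕₚ.<⇒≤ k)))
    ...   | false | false | _ | k = trans (cong not (<ᵇ-false (ℕₚ.<⇒≤ gt))) (sym (<ᵇ-true k))

  key-inj : ∀ {p q} → p ≤ n → q ≤ n → key p ≡ key q → p ≡ q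
  key-inj {p} {q} lp lq e with ℕₚ.<-cmp (h p) (h q)
  ... | tri< lt _ _ = contradiction e (ℕₚ.<⇒≢ (key-< lp lt))
  ... | tri> _ _ gt = contradiction (sym e) (ℕₚ.<⇒≢ (key-< lq gt))
  ... | tri≈ _ e′ _ with ℕₚ.<-cmp p q
  ...   | tri≈ _ r _ = r
  ...   | tri< lt _ _ with δ (h p) | key-≡ lp lq lt e′
  ...     | true  | k = contradiction e (ℕₚ.<⇒≢ k)
  ...     | false | k = contradiction (sym e) (ℕₚ.<⇒≢ k)
  key-inj {p} {q} lp lq e | tri≈ _ e′ _ | tri> _ _ gt with δ (h q) | key-≡ lq lp gt (sym e′)
  ...     | true  | k = contradiction (sym e) (ℕₚ.<⇒≢ k)
  ...     | false | k = contradiction e (ℕₚ.<⇒≢ k)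

  open Sorting key public

  compat-sorted : ∀ {σ} → Unique σ → All (_≤ n) σ → compat δ σ (map h σ) ≡ sortedᵇ σ
  compat-sorted {[]}        u a = refl
  compat-sorted {p ∷ []}    u a = refl
  compat-sorted {p ∷ q ∷ σ} ((p≢q ∷ _) ∷ u) (lp ∷ lq ∷ a) = cong₂ _∧_ (step-key lp lq p≢q) (compat-sorted u (lq ∷ a))

-- Each word compatible with σ is written as h ∘ σ and the summations are exchanged. For given h the
-- compatible σ is the one that sorts the positions by key, so a single term is left, and the
-- pattern of the inverse of this σ can be read off h. `Φ` carries an arbitrary statistic of that
-- pattern.
standardise : ∀ n δ Y → Unique Y → (Φ : List Bool → ℕ) →
  ∑ℕ (Sym (suc n)) (λ σ → Φ (pat (inverse σ)) ℕ.* cnt δ Y (pat σ)) ≡ ∑ℕ (tuples Y (suc n)) (λ h → Φ (patR (step δ true) h))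
standardise n δ Y uY Φ = begin
  ∑ℕ (Sym N) (λ σ → Φ (pat (inverse σ)) ℕ.* cnt δ Y (pat σ))
    ≡⟨ ℕ∑.∑-cong∈ (Sym N) (λ {σ} m → cong (Φ (pat (inverse σ)) ℕ.*_) (pull σ m)) ⟩
  ∑ℕ (Sym N) (λ σ → Φ (pat (inverse σ)) ℕ.* ∑ℕ Ys (λ h → ⟦ compat δ σ (map (at h) σ) ⟧))
    ≡⟨ ℕ∑.∑-cong (Sym N) (λ σ → sym (ℕ∑.∑-*ˡ Ys (Φ (pat (inverse σ))) _)) ⟩
  ∑ℕ (Sym N) (λ σ → ∑ℕ Ys (λ h → Φ (pat (inverse σ)) ℕ.* ⟦ compat δ σ (map (at h) σ) ⟧))
    ≡⟨ ℕ∑.∑-swap (Sym N) Ys _ ⟩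
  ∑ℕ Ys (λ h → ∑ℕ (Sym N) (λ σ → Φ (pat (inverse σ)) ℕ.* ⟦ compat δ σ (map (at h) σ) ⟧))
    ≡⟨ ℕ∑.∑-cong∈ Ys (λ {h} m → only h (proj₁ (∈-tuples⁻ N m))) ⟩
  ∑ℕ Ys (λ h → Φ (patR (step δ true) h)) ∎
  where
  open ≡-Reasoning
  N = suc n
  Ys = tuples Y N
  -- The map h ↦ h ∘ σ permutes the words of length N, so a sum over h replaces the sum over the
  -- compatible words themselves.
  pull : ∀ σ → σ ∈ Sym N → cnt δ Y (pat σ) ≡ ∑ℕ Ys (λ h → ⟦ compat δ σ (map (at h) σ) ⟧)
  pull σ m = trans (cnt-compat δ Y n σ P.len) (sym (∑-reindex (Unique-tuples N uY) closed inj (λ g → ⟦ compat δ σ g ⟧)))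
    where
    module P = Perm N (Sym⁻ N m)
    closed : ∀ {h} → h ∈ Ys → map (at h) σ ∈ Ys
    closed {h} mh with ∈-tuples⁻ N mh
    ... | lh , a = ≡.subst (λ k → map (at h) σ ∈ tuples Y k) (trans (Listₚ.length-map (at h) σ) P.len)
      (∈-tuples⁺ (Allₚ.map⁺ (All.tabulate (λ mp → let l , u = P.w∈ mp in
        All.lookup a (at∈ h l (ℕₚ.≤-trans u (ℕₚ.≤-reflexive (sym lh))))))))
    map-inj : ∀ {h h′ : ℕ → ℕ} L {p} → map h L ≡ map h′ L → p ∈ L → h p ≡ h′ p
    map-inj (x ∷ L) e (here refl) = Listₚ.∷-injectiveˡ e
    map-inj (x ∷ L) e (there mp)  = map-inj L (Listₚ.∷-injectiveʳ e) mp
    inj : ∀ {h h′} → h ∈ Ys → h′ ∈ Ys → map (at h) σ ≡ map (at h′) σ → h ≡ h′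
    inj {h} {h′} mh mh′ e = trans (sym (ext h (proj₁ (∈-tuples⁻ N mh)))) (trans
      (Listₚ.map-cong-local (All.tabulate (λ mp → let l , u = ∈-rng⁻ mp in map-inj σ e (P.∈w l u))))
      (ext h′ (proj₁ (∈-tuples⁻ N mh′))))
      where
      ext : ∀ h → length h ≡ N → map (at h) (rng 1 N) ≡ h
      ext h e = trans (cong (λ k → map (at h) (rng 1 k)) (sym e)) (map-at-rng h)
  only : ∀ h → length h ≡ N → ∑ℕ (Sym N) (λ σ → Φ (pat (inverse σ)) ℕ.* ⟦ compat δ σ (map (at h) σ) ⟧) ≡ Φ (patR (step δ true) h)
  only h lh = begin
    ∑ℕ (Sym N) (λ σ → Φ (pat (inverse σ)) ℕ.* ⟦ compat δ σ (map (at h) σ) ⟧)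
      ≡⟨ ℕ∑.∑-cong∈ (Sym N) (λ {σ} m → cong (λ b → Φ (pat (inverse σ)) ℕ.* ⟦ b ⟧)
           (let module P = Perm N (Sym⁻ N m) in St.compat-sorted P.uniq (All.tabulate (λ mp → proj₂ (P.w∈ mp))))) ⟩
    ∑ℕ (Sym N) (λ σ → Φ (pat (inverse σ)) ℕ.* ⟦ St.sortedᵇ σ ⟧)
      ≡⟨ ∑-single (Unique-Sym N) (Sym⁺ N τ↭) other ⟩
    Φ (pat (inverse τ)) ℕ.* ⟦ St.sortedᵇ τ ⟧
      ≡⟨ cong (λ b → Φ (pat (inverse τ)) ℕ.* ⟦ b ⟧) (St.AllPairs⇒sortedᵇ τ-sorted) ⟩
    Φ (pat (inverse τ)) ℕ.* 1
      ≡⟨ ℕₚ.*-identityʳ _ ⟩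
    Φ (pat (inverse τ))
      ≡⟨ cong Φ patterns ⟩
    Φ (patR (step δ true) h) ∎
    where
    module St = Standardise N δ (at h)
    srt = St.sort (rng 1 N) (Unique-rng N) (λ m m′ → St.key-inj (proj₂ (∈-rng⁻ m)) (proj₂ (∈-rng⁻ m′)))
    τ = proj₁ srt
    τ-sorted = proj₁ (proj₂ srt)
    τ↭ = proj₂ (proj₂ srt)
    module Pτ = Perm N τ↭
    other : ∀ {σ} → σ ∈ Sym N → σ ≢ τ → Φ (pat (inverse σ)) ℕ.* ⟦ St.sortedᵇ σ ⟧ ≡ 0
    other {σ} m ne with St.sortedᵇ σ in eq
    ... | true  = contradiction (St.sorted-unique (St.sortedᵇ⇒AllPairs σ (≡⇒T eq)) τ-sorted (↭-trans (Sym⁻ N m) (↭-sym τ↭))) ne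
    ... | false = ℕₚ.*-zeroʳ (Φ (pat (inverse σ)))
    -- Entry i of the inverse is the place of i in the sorted list, and i comes before i+1 there
    -- exactly when its key is smaller. Since i < i+1, this is a `step` with the bit `true`.
    patterns : pat (inverse τ) ≡ patR (step δ true) h
    patterns = begin
      pat (inverse τ)                                  ≡⟨ cong pat Pτ.inverse≡ ⟩
      pat (map (λ v → indexOf v τ) (rng 1 N))          ≡⟨ patR-rng {R′ = step δ true} {g = at h} N (λ {i} l u → consecutive l u) ⟩
      patR (step δ true) (map (at h) (rng 1 N))        ≡⟨ cong (λ k → patR (step δ true) (map (at h) (rng 1 k))) lh ⟨
      patR (step δ true) (map (at h) (rng 1 (length h))) ≡⟨ cong (patR (step δ true)) (map-at-rng h) ⟩
      patR (step δ true) h ∎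
      where
      consecutive : ∀ {i} → 1 ≤ i → suc i ≤ N → (indexOf i τ <ᵇ indexOf (suc i) τ) ≡ step δ true (at h i) (at h (suc i))
      consecutive {i} l u = trans (St.indexOf-<ᵇ τ-sorted (Pτ.∈w l i≤) (Pτ.∈w (s≤s z≤n) u) (λ e → ℕₚ.1+n≢n (sym (St.key-inj i≤ u e))))
        (sym (≡.subst (λ b → step δ b (at h i) (at h (suc i)) ≡ (St.key i <ᵇ St.key (suc i))) (<ᵇ-true (ℕₚ.n<1+n i)) (St.step-key i≤ u (λ e → ℕₚ.1+n≢n (sym e)))))
        where i≤ = ℕₚ.≤-trans (ℕₚ.n≤1+n i) u

length-tuples : ∀ {I : Set} (Y : List I) n → ∑ℕ (tuples Y n) (λ _ → 1) ≡ length Y ℕ.^ n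
length-tuples Y zero    = refl
length-tuples Y (suc n) = trans (∑-tuples′ Y n _) (trans (ℕ∑.∑-cong Y (λ _ → length-tuples Y n)) (const Y))
  where
  const : ∀ Z → ∑ℕ Z (λ _ → length Y ℕ.^ n) ≡ length Z ℕ.* length Y ℕ.^ n
  const []      = refl
  const (_ ∷ Z) = cong (length Y ℕ.^ n ℕ.+_) (const Z)

∑-Sym-cnt : ∀ n δ Y → Unique Y → ∑ℕ (Sym (suc n)) (λ σ → cnt δ Y (pat σ)) ≡ length Y ℕ.^ suc n
∑-Sym-cnt n δ Y uY = trans (ℕ∑.∑-cong (Sym (suc n)) (λ σ → sym (ℕₚ.+-identityʳ _)))
  (trans (standardise n δ Y uY (λ _ → 1)) (length-tuples Y (suc n)))

-- Standardisation with `Φ` counting the words over the first alphabet. As `standardise` evaluates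
-- `Φ` at the inverse, the sum is first reindexed by π ↦ π⁻¹.
∑-Sym-cnt-cnt : ∀ n ε K δ Y → Unique Y → ∑ℕ (Sym (suc n)) (λ π → cnt ε K (pat π) ℕ.* cnt δ Y (pat (inverse π)))
  ≡ ∑ℕ (tuples Y (suc n)) (λ h → cnt ε K (patR (step δ true) h))
∑-Sym-cnt-cnt n ε K δ Y uY = trans
  (ℕ∑.∑-cong∈ (Sym (suc n)) (λ {π} m → cong (λ z → cnt ε K (pat z) ℕ.* cnt δ Y (pat (inverse π))) (sym (inverse-involutive (suc n) (Sym⁻ (suc n) m)))))
  (trans (∑-Sym-inverse (suc n) (λ σ → cnt ε K (pat (inverse σ)) ℕ.* cnt δ Y (pat σ))) (standardise n δ Y uY (cnt ε K)))

-- The embedding of ℕ into ℚ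

ℕtoℚ-+ : ∀ m n → ℕtoℚ (m ℕ.+ n) ≡ ℕtoℚ m ℚ.+ ℕtoℚ n
ℕtoℚ-+ m n = ℚₚ.toℚᵘ-injective (begin
  ℚ.toℚᵘ (ℕtoℚ (m ℕ.+ n))                    ≈⟨ ℚₚ.toℚᵘ-fromℚᵘ (ℚᵘ.mkℚᵘ (+ (m ℕ.+ n)) 0) ⟩
  ℚᵘ.mkℚᵘ (+ (m ℕ.+ n)) 0                    ≈⟨ ℚᵘ.*≡* (cong (ℤ._* + 1) (cong₂ ℤ._+_ (sym (ℤₚ.*-identityʳ (+ m))) (sym (ℤₚ.*-identityʳ (+ n))))) ⟩
  ℚᵘ.mkℚᵘ (+ m) 0 ℚᵘ.+ ℚᵘ.mkℚᵘ (+ n) 0       ≈⟨ ℚᵘₚ.+-cong (ℚₚ.toℚᵘ-fromℚᵘ (ℚᵘ.mkℚᵘ (+ m) 0)) (ℚₚ.toℚᵘ-fromℚᵘ (ℚᵘ.mkℚᵘ (+ n) 0)) ⟨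
  ℚ.toℚᵘ (ℕtoℚ m) ℚᵘ.+ ℚ.toℚᵘ (ℕtoℚ n)       ≈⟨ ℚₚ.toℚᵘ-homo-+ (ℕtoℚ m) (ℕtoℚ n) ⟨
  ℚ.toℚᵘ (ℕtoℚ m ℚ.+ ℕtoℚ n) ∎)
  where
  open SetoidR ℚᵘₚ.≃-setoid

ℕtoℚ-* : ∀ m n → ℕtoℚ (m ℕ.* n) ≡ ℕtoℚ m ℚ.* ℕtoℚ n
ℕtoℚ-* zero    n = sym (ℚₚ.*-zeroˡ (ℕtoℚ n))
ℕtoℚ-* (suc m) n = begin
  ℕtoℚ (n ℕ.+ m ℕ.* n)                   ≡⟨ ℕtoℚ-+ n (m ℕ.* n) ⟩
  ℕtoℚ n ℚ.+ ℕtoℚ (m ℕ.* n)              ≡⟨ cong₂ ℚ._+_ (sym (ℚₚ.*-identityˡ (ℕtoℚ n))) (ℕtoℚ-* m n) ⟩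
  1ℚ ℚ.* ℕtoℚ n ℚ.+ ℕtoℚ m ℚ.* ℕtoℚ n    ≡⟨ ℚₚ.*-distribʳ-+ (ℕtoℚ n) 1ℚ (ℕtoℚ m) ⟨
  (1ℚ ℚ.+ ℕtoℚ m) ℚ.* ℕtoℚ n             ≡⟨ cong (ℚ._* ℕtoℚ n) (ℕtoℚ-+ 1 m) ⟨
  ℕtoℚ (suc m) ℚ.* ℕtoℚ n ∎
  where open ≡-Reasoning

ℕtoℚ-∑ : ∀ {I : Set} (L : List I) f → ℕtoℚ (∑ℕ L f) ≡ ∑ℚ L (ℕtoℚ ∘ f)
ℕtoℚ-∑ []      f = refl
ℕtoℚ-∑ (x ∷ L) f = trans (ℕtoℚ-+ (f x) (∑ℕ L f)) (cong (ℕtoℚ (f x) ℚ.+_) (ℕtoℚ-∑ L f))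

-- Chains in a finite total order

module Chains {I : Set} (R : I → I → Bool) where

  chainsFrom : List I → I → ℕ → ℕ
  chainsFrom L x zero    = 1
  chainsFrom L x (suc n) = ∑ℕ L (λ y → ⟦ R x y ⟧ ℕ.* chainsFrom L y n)

  chains : List I → ℕ → ℕ
  chains L zero    = 1
  chains L (suc n) = ∑ℕ L (λ x → chainsFrom L x n)

  -- The diagonal of `R` is left open: whether an element may be repeated is its sign.
  Before : I → I → Set
  Before x y = R x y ≡ true × R y x ≡ false

  module _ {x xs} (b : All (Before x) xs) where

    chainsFrom-tail : ∀ n {y} → y ∈ xs → chainsFrom (x ∷ xs) y n ≡ chainsFrom xs y n
    chainsFrom-tail zero    m = refl
    chainsFrom-tail (suc n) {y} m = cong₂ ℕ._+_
      (cong (λ z → ⟦ z ⟧ ℕ.* chainsFrom (x ∷ xs) x n) (proj₂ (All.lookup b m)))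
      (ℕ∑.∑-cong∈ xs (λ {y′} m′ → cong (⟦ R y y′ ⟧ ℕ.*_) (chainsFrom-tail n m′)))

    chainsFrom-head : ∀ n → chainsFrom (x ∷ xs) x n ≡ (if R x x then chains (x ∷ xs) n else chains xs n)
    chainsFrom-head zero with R x x
    ... | true  = refl
    ... | false = refl
    chainsFrom-head (suc n) = trans (cong (⟦ R x x ⟧ ℕ.* chainsFrom (x ∷ xs) x n ℕ.+_)
      (ℕ∑.∑-cong∈ xs (λ {y} m → trans (cong (λ z → ⟦ z ⟧ ℕ.* chainsFrom (x ∷ xs) y n) (proj₁ (All.lookup b m))) (ℕₚ.+-identityʳ _)))) rest
      where
      rest : ⟦ R x x ⟧ ℕ.* chainsFrom (x ∷ xs) x n ℕ.+ ∑ℕ xs (λ y → chainsFrom (x ∷ xs) y n) ≡ (if R x x then chains (x ∷ xs) (suc n) else chains xs (suc n))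
      rest with R x x
      ... | true  = cong (ℕ._+ ∑ℕ xs (λ y → chainsFrom (x ∷ xs) y n)) (ℕₚ.+-identityʳ _)
      ... | false = ℕ∑.∑-cong∈ xs (chainsFrom-tail n)

    -- No chain returns to x. After a first entry x it continues in the whole list if x may be
    -- repeated and in `xs` if not; all other chains lie in `xs`.
    chains-∷ : ∀ n → chains (x ∷ xs) (suc n) ≡ (if R x x then chains (x ∷ xs) n else chains xs n) ℕ.+ chains xs (suc n)
    chains-∷ n = cong₂ ℕ._+_ (chainsFrom-head n) (ℕ∑.∑-cong∈ xs (chainsFrom-tail n))

-- Generating series of chains

𝕁 𝕌 : Ser
𝕁 = invˢ (1ˢ ⊟ 𝕩)
𝕌 = (1ˢ ⊞ 𝕩) ✶ 𝕁

𝕁-law : (1ˢ ⊟ 𝕩) ✶ 𝕁 ≗ 1ˢ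
𝕁-law = invˢ-law {1ˢ ⊟ 𝕩} refl

∏ : {I : Set} → List I → (I → Ser) → Ser
∏ = bigop _✶_ 1ˢ

∏-++ : ∀ {I : Set} (L M : List I) f → ∏ (L ++ M) f ≗ ∏ L f ✶ ∏ M f
∏-++ []      M f = ≗-sym (✶-identityˡ _)
∏-++ (x ∷ L) M f = ≗-trans (ℛ.*-congˡ (∏-++ L M f)) (≗-sym (✶-assoc (f x) _ _))

∏-map : ∀ {I J : Set} (φ : I → J) L f → ∏ (map φ L) f ≗ ∏ L (f ∘ φ)
∏-map φ []      f = ≗-refl
∏-map φ (x ∷ L) f = ℛ.*-congˡ (∏-map φ L f)

module _ {I : Set} (R : I → I → Bool) where
  open Chains R

  chainSer : List I → Ser
  chainSer L ⟪ n ⟫ = ℕtoℚ (chains L n)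

  -- By `chains-∷`, a new least element gives F = x F + G when it is repeatable, hence the factor
  -- 1/(1-x), and F = x G + G when it is not, hence the factor 1+x.
  chainSer-∏ : ∀ {L} → AllPairs Before L → chainSer L ≗ ∏ L (λ x → if R x x then 𝕁 else 1ˢ ⊞ 𝕩)
  chainSer-∏ {[]} [] .coeff zero    = refl
  chainSer-∏ {[]} [] .coeff (suc n) = refl
  chainSer-∏ {x ∷ xs} (b ∷ s) with R x x | chains-∷ b
  ... | true | rec = cancel {1ˢ ⊟ 𝕩} {𝕁} 𝕁-law (begin
      (1ˢ ⊟ 𝕩) ✶ F                   ≈⟨ solve 2 (λ x F → (con 1ℚ :- x) :* F := F :- x :* F) ≗-refl 𝕩 F ⟩
      F ⊟ 𝕩 ✶ F                      ≈⟨ ℛ.+-congʳ F-rec ⟩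
      (𝕩 ✶ F ⊞ G) ⊟ 𝕩 ✶ F            ≈⟨ solve 2 (λ p G → (p :+ G) :- p := G) ≗-refl (𝕩 ✶ F) G ⟩
      G                              ≈⟨ chainSer-∏ s ⟩
      Q                              ≈⟨ ✶-identityˡ Q ⟨
      1ˢ ✶ Q                         ≈⟨ ℛ.*-congʳ 𝕁-law ⟨
      (1ˢ ⊟ 𝕩) ✶ 𝕁 ✶ Q               ≈⟨ ✶-assoc (1ˢ ⊟ 𝕩) 𝕁 Q ⟩
      (1ˢ ⊟ 𝕩) ✶ (𝕁 ✶ Q)             ∎)
    where
    open 𝒮 using (solve; con; _:=_; _:*_; _:-_; _:+_)
    open SetoidR ℛ.setoid
    F = chainSer (x ∷ xs)
    G = chainSer xs
    Q = ∏ xs (λ x → if R x x then 𝕁 else 1ˢ ⊞ 𝕩)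
    F-rec : F ≗ 𝕩 ✶ F ⊞ G
    F-rec .coeff zero    = sym (trans (cong (ℚ._+ 1ℚ) (𝕩✶-zero F)) (ℚₚ.+-identityˡ 1ℚ))
    F-rec .coeff (suc n) = trans (cong ℕtoℚ (rec n)) (trans (ℕtoℚ-+ (chains (x ∷ xs) n) (chains xs (suc n))) (cong (ℚ._+ G ⟪ suc n ⟫) (sym (𝕩✶-suc F n))))
  ... | false | rec = begin
      F                              ≈⟨ F-rec ⟩
      𝕩 ✶ G ⊞ G                      ≈⟨ solve 2 (λ x G → x :* G :+ G := (con 1ℚ :+ x) :* G) ≗-refl 𝕩 G ⟩
      (1ˢ ⊞ 𝕩) ✶ G                   ≈⟨ ℛ.*-congˡ (chainSer-∏ s) ⟩
      (1ˢ ⊞ 𝕩) ✶ Q                   ∎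
    where
    open 𝒮 using (solve; con; _:=_; _:*_; _:-_; _:+_)
    open SetoidR ℛ.setoid
    F = chainSer (x ∷ xs)
    G = chainSer xs
    Q = ∏ xs (λ x → if R x x then 𝕁 else 1ˢ ⊞ 𝕩)
    F-rec : F ≗ 𝕩 ✶ G ⊞ G
    F-rec .coeff zero    = sym (trans (cong (ℚ._+ 1ℚ) (𝕩✶-zero G)) (ℚₚ.+-identityˡ 1ℚ))
    F-rec .coeff (suc n) = trans (cong ℕtoℚ (rec n)) (trans (ℕtoℚ-+ (chains xs n) (chains xs (suc n))) (cong (ℚ._+ G ⟪ suc n ⟫) (sym (𝕩✶-suc G n))))

-- The pairs (v , y) of letters form a signed alphabet, ordered lexicographically with the order of
-- the second letters reversed when v is negative; the sign of a pair is the product of the signs.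

module Pairs (ε δ : ℕ → Bool) (N : ℕ) where

  -- The inner `step` tells whether the standardised second word ascends at this place, and its
  -- value is the bit with which the first word has to be compatible. Chains of pairs are therefore
  -- the pairs of words on the right-hand side of `∑-Sym-cnt-cnt`.
  pairStep : ℕ × ℕ → ℕ × ℕ → Bool
  pairStep (v , y) (v′ , y′) = step ε (step δ true y y′) v v′

  row : ℕ → List (ℕ × ℕ)
  row v = map (v ,_) (if ε v then upTo N else downFrom N)

  grid : ℕ → List (ℕ × ℕ)
  grid M = concatMap row (upTo M)

  ∑-grid : ∀ M f → ∑ℕ (grid M) f ≡ ∑ℕ (upTo M) (λ v → ∑ℕ (upTo N) (λ y → f (v , y)))
  ∑-grid M f = trans (ℕ∑.∑-concatMap row (upTo M) f) (ℕ∑.∑-cong (upTo M) (λ v → trans (ℕ∑.∑-map (v ,_) (if ε v then upTo N else downFrom N) f) (order v)))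
    where
    order : ∀ v → ∑ℕ (if ε v then upTo N else downFrom N) (λ y → f (v , y)) ≡ ∑ℕ (upTo N) (λ y → f (v , y))
    order v with ε v
    ... | true  = refl
    ... | false = ℕ∑.∑-↭ _ (≡.subst (_↭ upTo N) (Listₚ.reverse-upTo N) (↭ₚ.↭-reverse (upTo N)))

  open Chains pairStep

  cntFrom-chains : ∀ M v y n → ∑ℕ (tuples (upTo N) n) (λ h → cntFrom ε (upTo M) v (patR (step δ true) (y ∷ h))) ≡ chainsFrom (grid M) (v , y) n
  cntFrom-chains M v y zero    = refl
  cntFrom-chains M v y (suc n) = begin
    ∑ℕ (tuples Y (suc n)) (λ h → cntFrom ε K v (patR (step δ true) (y ∷ h)))
      ≡⟨ ∑-tuples′ Y n _ ⟩
    ∑ℕ Y (λ y′ → ∑ℕ Yn (λ h → ∑ℕ K (λ v′ → s v′ y′ ℕ.* cntFrom ε K v′ (patR (step δ true) (y′ ∷ h)))))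
      ≡⟨ ℕ∑.∑-cong Y (λ y′ → trans (ℕ∑.∑-swap Yn K _) (ℕ∑.∑-cong K (λ v′ →
           trans (ℕ∑.∑-*ˡ Yn (s v′ y′) _) (cong (s v′ y′ ℕ.*_) (cntFrom-chains M v′ y′ n))))) ⟩
    ∑ℕ Y (λ y′ → ∑ℕ K (λ v′ → s v′ y′ ℕ.* chainsFrom (grid M) (v′ , y′) n))
      ≡⟨ ℕ∑.∑-swap Y K _ ⟩
    ∑ℕ K (λ v′ → ∑ℕ Y (λ y′ → s v′ y′ ℕ.* chainsFrom (grid M) (v′ , y′) n))
      ≡⟨ ∑-grid M _ ⟨
    chainsFrom (grid M) (v , y) (suc n) ∎
    where
    open ≡-Reasoning
    Y = upTo N
    Yn = tuples Y n
    K = upTo M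
    s : ℕ → ℕ → ℕ
    s v′ y′ = ⟦ pairStep (v , y) (v′ , y′) ⟧

  cnt-chains : ∀ M n → ∑ℕ (tuples (upTo N) (suc n)) (λ h → cnt ε (upTo M) (patR (step δ true) h)) ≡ chains (grid M) (suc n)
  cnt-chains M n = begin
    ∑ℕ (tuples Y (suc n)) (λ h → ∑ℕ K (λ v → cntFrom ε K v (patR (step δ true) h)))
      ≡⟨ ∑-tuples′ Y n _ ⟩
    ∑ℕ Y (λ y → ∑ℕ (tuples Y n) (λ h → ∑ℕ K (λ v → cntFrom ε K v (patR (step δ true) (y ∷ h)))))
      ≡⟨ ℕ∑.∑-cong Y (λ y → trans (ℕ∑.∑-swap (tuples Y n) K _) (ℕ∑.∑-cong K (λ v → cntFrom-chains M v y n))) ⟩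
    ∑ℕ Y (λ y → ∑ℕ K (λ v → chainsFrom (grid M) (v , y) n))
      ≡⟨ ℕ∑.∑-swap Y K _ ⟩
    ∑ℕ K (λ v → ∑ℕ Y (λ y → chainsFrom (grid M) (v , y) n))
      ≡⟨ ∑-grid M _ ⟨
    chains (grid M) (suc n) ∎
    where
    open ≡-Reasoning
    Y = upTo N
    K = upTo M

  row-sorted : ∀ v → AllPairs Before (row v)
  row-sorted v with ε v in eq
  ... | true  = AllPairsₚ.map⁺ (AllPairsₚ.applyUpTo⁺₁ id N (λ lt _ →
      trans (cong (λ b → step ε b v v) (step-< δ true lt)) (trans (step-≡ ε true v) (cong (λ b → if b then true else false) eq)) ,
      trans (cong (λ b → step ε b v v) (step-> δ true lt)) (trans (step-≡ ε false v) (cong (λ b → if b then false else true) eq))))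
  ... | false = AllPairsₚ.map⁺ (AllPairsₚ.applyDownFrom⁺₁ id N (λ lt _ →
      trans (cong (λ b → step ε b v v) (step-> δ true lt)) (trans (step-≡ ε false v) (cong (λ b → if b then false else true) eq)) ,
      trans (cong (λ b → step ε b v v) (step-< δ true lt)) (trans (step-≡ ε true v) (cong (λ b → if b then true else false) eq))))

  grid-sorted : ∀ M → AllPairs Before (grid M)
  grid-sorted M = AllPairsₚ.concat⁺ (Allₚ.map⁺ (All.tabulate (λ {v} _ → row-sorted v)))
    (AllPairsₚ.map⁺ (AllPairsₚ.applyUpTo⁺₁ id M (λ lt _ → Allₚ.map⁺ (All.tabulate (λ _ → Allₚ.map⁺ (All.tabulate (λ _ →
      step-< ε _ lt , step-> ε _ lt)))))))

-- Alphabets with alternating signs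

even odd : ℕ → Bool
even zero          = true
even (suc zero)    = false
even (suc (suc n)) = even n
odd n = not (even n)

∏-cong : ∀ {I : Set} (L : List I) {f g : I → Ser} → (∀ x → f x ≗ g x) → ∏ L f ≗ ∏ L g
∏-cong []      e = ≗-refl
∏-cong (x ∷ L) e = ℛ.*-cong (e x) (∏-cong L e)

module _ {f : ℕ → Ser} {u : Ser} (period : ∀ y → f (suc (suc y)) ≡ f y) (f01 : f 0 ✶ f 1 ≗ u) where

  ∏-upTo : ∀ b → ∏ (upTo (b ℕ.* 2)) f ≗ u ^ˢ b
  ∏-upTo zero    = ≗-refl
  ∏-upTo (suc b) = ≗-trans (≗-sym (✶-assoc (f 0) (f 1) _)) (ℛ.*-cong f01 (begin
    ∏ (applyUpTo (suc ∘ suc) (b ℕ.* 2)) f     ≡⟨ cong (λ L → ∏ L f) (Listₚ.map-upTo (suc ∘ suc) (b ℕ.* 2)) ⟨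
    ∏ (map (suc ∘ suc) (upTo (b ℕ.* 2))) f    ≈⟨ ∏-map (suc ∘ suc) (upTo (b ℕ.* 2)) f ⟩
    ∏ (upTo (b ℕ.* 2)) (f ∘ suc ∘ suc)        ≈⟨ ∏-cong (upTo (b ℕ.* 2)) (λ y → ℛ.reflexive (period y)) ⟩
    ∏ (upTo (b ℕ.* 2)) f                      ≈⟨ ∏-upTo b ⟩
    u ^ˢ b ∎))
    where open SetoidR ℛ.setoid

  ∏-downFrom : ∀ b → ∏ (downFrom (b ℕ.* 2)) f ≗ u ^ˢ b
  ∏-downFrom zero    = ≗-refl
  ∏-downFrom (suc b) = ≗-trans (≗-sym (✶-assoc (f (suc (b ℕ.* 2))) (f (b ℕ.* 2)) _))
    (ℛ.*-cong (≗-trans (✶-comm (f (suc (b ℕ.* 2))) (f (b ℕ.* 2))) (≗-trans (ℛ.*-cong (ℛ.reflexive (even0 b)) (ℛ.reflexive (odd1 b))) f01)) (∏-downFrom b))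
    where
    even0 : ∀ b → f (b ℕ.* 2) ≡ f 0
    even0 zero    = refl
    even0 (suc b) = trans (period (b ℕ.* 2)) (even0 b)
    odd1 : ∀ b → f (suc (b ℕ.* 2)) ≡ f 1
    odd1 zero    = refl
    odd1 (suc b) = trans (period (suc (b ℕ.* 2))) (odd1 b)

module _ (b : ℕ) where
  open Pairs even odd (b ℕ.* 2)

  private
    sign : Bool → Ser
    sign z = if z then 𝕁 else 1ˢ ⊞ 𝕩

    pair-sign : ∀ v y → pairStep (v , y) (v , y) ≡ (if even v then odd y else not (odd y))
    pair-sign v y = trans (cong (λ z → step even z v v) (trans (step-≡ odd true y) (if-id (odd y)))) (step-≡ even (odd y) v)
      where
      if-id : ∀ z → (if z then true else false) ≡ z
      if-id true  = refl
      if-id false = refl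

    -- The second alphabet has b letters of each sign, so for either sign of v half of the 2b pairs
    -- in the row are positive, and each couple of opposite signs gives (1+x)/(1-x). This is why the
    -- second alphabet has an even number of letters.
    row-∏ : ∀ v → ∏ (row v) (λ x → sign (pairStep x x)) ≗ 𝕌 ^ˢ b
    row-∏ v = ≗-trans (∏-map (v ,_) (if even v then upTo (b ℕ.* 2) else downFrom (b ℕ.* 2)) _)
      (≗-trans (∏-cong (if even v then upTo (b ℕ.* 2) else downFrom (b ℕ.* 2)) (λ y → ℛ.reflexive (cong sign (pair-sign v y)))) signs)
      where
      signs : ∏ (if even v then upTo (b ℕ.* 2) else downFrom (b ℕ.* 2)) (λ y → sign (if even v then odd y else not (odd y))) ≗ 𝕌 ^ˢ b
      signs with even v
      ... | true  = ∏-upTo {λ y → sign (odd y)} (λ _ → refl) ≗-refl b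
      ... | false = ∏-downFrom {λ y → sign (not (odd y))} (λ _ → refl) (✶-comm 𝕁 (1ˢ ⊞ 𝕩)) b

    grid-∏ : ∀ V → ∏ (concatMap row V) (λ x → sign (pairStep x x)) ≗ 𝕌 ^ˢ (length V ℕ.* b)
    grid-∏ []      = ≗-refl
    grid-∏ (v ∷ V) = ≗-trans (∏-++ (row v) (concatMap row V) _) (≗-trans (ℛ.*-cong (row-∏ v) (grid-∏ V)) (≗-sym (^ˢ-+ 𝕌 b (length V ℕ.* b))))

  ∑-Sym-cnt-𝕌 : ∀ a n → ℕtoℚ (∑ℕ (Sym (suc n)) (λ π → cnt even (upTo a) (pat π) ℕ.* cnt odd (upTo (b ℕ.* 2)) (pat (inverse π)))) ≡ (𝕌 ^ˢ (a ℕ.* b)) ⟪ suc n ⟫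
  ∑-Sym-cnt-𝕌 a n = trans (cong ℕtoℚ (trans (∑-Sym-cnt-cnt n even (upTo a) odd (upTo (b ℕ.* 2)) (Uniqueₚ.upTo⁺ (b ℕ.* 2))) (cnt-chains a n)))
    (coeff (≗-trans (chainSer-∏ pairStep (grid-sorted a)) (≗-trans (grid-∏ (upTo a)) (ℛ.reflexive (cong (λ k → 𝕌 ^ˢ (k ℕ.* b)) (Listₚ.length-upTo a))))) (suc n))

-- Transfer matrices

kern : Bool → Ser
kern q ⟪ zero ⟫  = ℕtoℚ ⟦ q ⟧
kern q ⟪ suc _ ⟫ = 1ℚ

1-𝕩-kern : (1ˢ ⊟ 𝕩) ✶ kern true ≗ 1ˢ
1-𝕩-kern = ≗-trans (solve 2 (λ x k → (con 1ℚ :- x) :* k := k :- x :* k) ≗-refl 𝕩 (kern true)) telescope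
  where
  open 𝒮 using (solve; con; _:=_; _:*_; _:-_)
  telescope : kern true ⊟ 𝕩 ✶ kern true ≗ 1ˢ
  telescope .coeff zero    = cong (λ z → 1ℚ ℚ.+ (ℚ.- z)) (𝕩✶-zero (kern true))
  telescope .coeff (suc n) = trans (cong (λ z → 1ℚ ℚ.+ (ℚ.- z)) (trans (𝕩✶-suc (kern true) n) (k1 n))) refl
    where
    k1 : ∀ n → kern true ⟪ n ⟫ ≡ 1ℚ
    k1 zero    = refl
    k1 (suc n) = refl

kern-true : kern true ≗ 𝕁
kern-true = inv-unique {1ˢ ⊟ 𝕩} 1-𝕩-kern 𝕁-law

kern-false : kern false ≗ 𝕩 ✶ 𝕁
kern-false = ≗-trans shift (ℛ.*-congˡ kern-true)
  where
  shift : kern false ≗ 𝕩 ✶ kern true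
  shift .coeff zero          = sym (𝕩✶-zero (kern true))
  shift .coeff (suc zero)    = sym (𝕩✶-suc (kern true) 0)
  shift .coeff (suc (suc n)) = sym (𝕩✶-suc (kern true) (suc n))

∑-upTo-shift : ∀ v m (f : ℕ → ℕ) → (∀ {i} → i < v → f i ≡ 0) → ℕtoℚ (∑ℕ (upTo (v ℕ.+ suc m)) f) ≡ ∑≤ m (λ i → ℕtoℚ (f (v ℕ.+ i)))
∑-upTo-shift zero    m f z = trans (ℕtoℚ-∑ (upTo (suc m)) f) (∑≤-upTo m (ℕtoℚ ∘ f))
∑-upTo-shift (suc v) m f z = trans (cong ℕtoℚ (trans (cong (λ L → ∑ℕ L f) (upTo-suc (v ℕ.+ suc m)))
  (cong₂ ℕ._+_ (z (s≤s z≤n)) (ℕ∑.∑-map suc (upTo (v ℕ.+ suc m)) f)))) (∑-upTo-shift v m (f ∘ suc) (λ l → z (s≤s l)))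

step-kern : ∀ ε b v i → ℕtoℚ ⟦ step ε b v (v ℕ.+ i) ⟧ ≡ kern (if ε v then b else not b) ⟪ i ⟫
step-kern ε b v zero    = cong (ℕtoℚ ∘ ⟦_⟧) (trans (cong (step ε b v) (ℕₚ.+-identityʳ v)) (step-≡ ε b v))
step-kern ε b v (suc i) = cong (ℕtoℚ ∘ ⟦_⟧) (step-< ε b (ℕₚ.m<m+n v (s≤s z≤n)))

-- A move from v to v+i depends on v only through its sign, and it leaves m-i of the m letters above
-- v. So the transfer matrix acts as a convolution in the number of letters above the current one.
cntFrom-kern : ∀ ε b v m p → ℕtoℚ (cntFrom ε (upTo (v ℕ.+ suc m)) v (b ∷ p)) ≡
  ∑≤ m (λ i → kern (if ε v then b else not b) ⟪ i ⟫ ℚ.* ℕtoℚ (cntFrom ε (upTo (v ℕ.+ suc m)) (v ℕ.+ i) p))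
cntFrom-kern ε b v m p = trans
  (∑-upTo-shift v m _ (λ {i} l → cong (λ z → ⟦ z ⟧ ℕ.* cntFrom ε (upTo (v ℕ.+ suc m)) i p) (step-> ε b l)))
  (∑≤-cong m (λ i → trans (ℕtoℚ-* ⟦ step ε b v (v ℕ.+ i) ⟧ _) (cong (ℚ._* ℕtoℚ (cntFrom ε (upTo (v ℕ.+ suc m)) (v ℕ.+ i) p)) (step-kern ε b v i))))

+suc-shift : ∀ v {m i} → i ≤ m → v ℕ.+ suc m ≡ (v ℕ.+ i) ℕ.+ suc (m ∸ i)
+suc-shift v {m} {i} le = trans (cong (λ z → v ℕ.+ suc z) (sym (ℕₚ.m+[n∸m]≡n le)))
  (trans (cong (v ℕ.+_) (sym (ℕₚ.+-suc i (m ∸ i)))) (sym (ℕₚ.+-assoc v i (suc (m ∸ i)))))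

-- With positive letters only, the words compatible with a permutation are counted by its descents.

descents : List Bool → ℕ
descents []          = 0
descents (true ∷ p)  = descents p
descents (false ∷ p) = suc (descents p)

desSer : List Bool → Ser
desSer []      = kern true
desSer (b ∷ p) = kern b ✶ desSer p

all⁺ : ℕ → Bool
all⁺ _ = true

cntFrom-desSer : ∀ p v m → ℕtoℚ (cntFrom all⁺ (upTo (v ℕ.+ suc m)) v p) ≡ desSer p ⟪ m ⟫
cntFrom-desSer []      v zero    = refl
cntFrom-desSer []      v (suc m) = refl
cntFrom-desSer (b ∷ p) v m = trans (cntFrom-kern all⁺ b v m p) (∑≤-cong≤ m (λ i le → cong (kern b ⟪ i ⟫ ℚ.*_)
  (trans (cong (λ N → ℕtoℚ (cntFrom all⁺ (upTo N) (v ℕ.+ i) p)) (+suc-shift v le)) (cntFrom-desSer p (v ℕ.+ i) (m ∸ i)))))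

-- The free choice of the first letter gives each letter the weight 1, a coefficient of `kern true`,
-- and is thus encoded as an ascent in front of the pattern. The factor `𝕩` passes from the m
-- letters above the least one to the size m+1 of the alphabet.
cnt-desSer : ∀ p N → ℕtoℚ (cnt all⁺ (upTo N) p) ≡ (𝕩 ✶ desSer (true ∷ p)) ⟪ N ⟫
cnt-desSer p zero    = sym (𝕩✶-zero (desSer (true ∷ p)))
cnt-desSer p (suc m) = trans (trans (∑-upTo-shift 0 m (λ v → cntFrom all⁺ (upTo (suc m)) v p) (λ ()))
  (∑≤-cong≤ m (λ i le → trans (trans (cong (λ N → ℕtoℚ (cntFrom all⁺ (upTo N) i p)) (+suc-shift 0 le)) (cntFrom-desSer p i (m ∸ i)))
    (trans (sym (ℚₚ.*-identityˡ _)) (cong (ℚ._* desSer p ⟪ m ∸ i ⟫) (k1 i))))))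
  (sym (𝕩✶-suc (desSer (true ∷ p)) m))
  where
  k1 : ∀ i → 1ℚ ≡ kern true ⟪ i ⟫
  k1 zero    = refl
  k1 (suc i) = refl

desSer-closed : ∀ p → desSer p ≗ 𝕩 ^ˢ descents p ✶ 𝕁 ^ˢ suc (length p)
desSer-closed []          = ≗-trans kern-true (solve 1 (λ j → j := con 1ℚ :* (j :* con 1ℚ)) ≗-refl 𝕁)
  where open 𝒮 using (solve; con; _:=_; _:*_)
desSer-closed (true ∷ p)  = ≗-trans (ℛ.*-cong kern-true (desSer-closed p))
  (solve 3 (λ j x k → j :* (x :* k) := x :* (j :* k)) ≗-refl 𝕁 (𝕩 ^ˢ descents p) (𝕁 ^ˢ suc (length p)))
  where open 𝒮 using (solve; con; _:=_; _:*_)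
desSer-closed (false ∷ p) = ≗-trans (ℛ.*-cong kern-false (desSer-closed p))
  (solve 4 (λ y j x k → (y :* j) :* (x :* k) := (y :* x) :* (j :* k)) ≗-refl 𝕩 𝕁 (𝕩 ^ˢ descents p) (𝕁 ^ˢ suc (length p)))
  where open 𝒮 using (solve; con; _:=_; _:*_)

cnt-des : ∀ p N → ℕtoℚ (cnt all⁺ (upTo N) p) ≡ (𝕩 ^ˢ suc (descents p) ✶ 𝕁 ^ˢ suc (suc (length p))) ⟪ N ⟫
cnt-des p N = trans (cnt-desSer p N) (coeff (≗-trans (ℛ.*-congˡ (desSer-closed (true ∷ p))) (≗-sym (✶-assoc 𝕩 (𝕩 ^ˢ descents p) (𝕁 ^ˢ suc (suc (length p)))))) N)

-- With alternating signs, the smallest letter positive, they are counted by the up-down runs.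

𝕂 𝕊 ℂ : Ser
𝕂 = invˢ (1ˢ ⊟ 𝕩 ✶ 𝕩)
𝕊 = ((+ 2 ℚ./ 1) ·ˢ 𝕩) ✶ invˢ (1ˢ ⊞ 𝕩 ✶ 𝕩)
ℂ = (1ˢ ⊞ 𝕩 ✶ 𝕩) ✶ 𝕂

𝕂-law : (1ˢ ⊟ 𝕩 ✶ 𝕩) ✶ 𝕂 ≗ 1ˢ
𝕂-law = invˢ-law {1ˢ ⊟ 𝕩 ✶ 𝕩} refl

·ˢ-con : ∀ q f → q ·ˢ f ≗ cˢ q ✶ f
·ˢ-con q f = ≗-sym (cˢ-✶ q f)

1+𝕩²-𝕊 : (1ˢ ⊞ 𝕩 ✶ 𝕩) ✶ 𝕊 ≗ cˢ (+ 2 ℚ./ 1) ✶ 𝕩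
1+𝕩²-𝕊 = ≗-trans (solve 3 (λ a b c → a :* (b :* c) := b :* (a :* c)) ≗-refl (1ˢ ⊞ 𝕩 ✶ 𝕩) ((+ 2 ℚ./ 1) ·ˢ 𝕩) (invˢ (1ˢ ⊞ 𝕩 ✶ 𝕩)))
  (≗-trans (ℛ.*-cong (·ˢ-con (+ 2 ℚ./ 1) 𝕩) (invˢ-law {1ˢ ⊞ 𝕩 ✶ 𝕩} refl)) (ℛ.*-identityʳ _))
  where open 𝒮 using (solve; con; _:=_; _:*_)

-- Signs alternate along the alphabet, so a move over an even distance keeps the sign of the letter
-- and a move over an odd distance reverses it. The two parts of `kern` are the entries of a 2 by 2
-- transfer matrix of series.
evenPart oddPart : Ser → Ser
evenPart f ⟪ n ⟫ = if even n then f ⟪ n ⟫ else 0ℚ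
oddPart  f ⟪ n ⟫ = if even n then 0ℚ else f ⟪ n ⟫

kernE-true : evenPart (kern true) ≗ 𝕂
kernE-true = inv-unique {1ˢ ⊟ 𝕩 ✶ 𝕩} (≗-trans (solve 2 (λ x k → (con 1ℚ :- x :* x) :* k := k :- x :* (x :* k)) ≗-refl 𝕩 k) telescope) 𝕂-law
  where
  open 𝒮 using (solve; con; _:=_; _:*_; _:-_)
  k = evenPart (kern true)
  c : ∀ n → k ⟪ suc (suc n) ⟫ ≡ k ⟪ n ⟫
  c zero          = refl
  c (suc zero)    = refl
  c (suc (suc n)) = refl
  telescope : k ⊟ 𝕩 ✶ (𝕩 ✶ k) ≗ 1ˢ
  telescope .coeff zero          = cong (λ z → 1ℚ ℚ.+ (ℚ.- z)) (𝕩✶-zero (𝕩 ✶ k))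
  telescope .coeff (suc zero)    = cong (λ z → 0ℚ ℚ.+ (ℚ.- z)) (trans (𝕩✶-suc (𝕩 ✶ k) 0) (𝕩✶-zero k))
  telescope .coeff (suc (suc n)) = trans (cong₂ (λ y z → y ℚ.+ (ℚ.- z)) (c n) (trans (𝕩✶-suc (𝕩 ✶ k) (suc n)) (𝕩✶-suc k n))) (ℚₚ.+-inverseʳ (k ⟪ n ⟫))

kernO : ∀ q → oddPart (kern q) ≗ 𝕩 ✶ 𝕂
kernO q = ≗-trans shift (ℛ.*-congˡ kernE-true)
  where
  c : ∀ n → oddPart (kern q) ⟪ suc n ⟫ ≡ evenPart (kern true) ⟪ n ⟫
  c zero          = refl
  c (suc zero)    = refl
  c (suc (suc n)) = flip (even n) (even (suc n)) (even-suc n)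
    where
    even-suc : ∀ n → even (suc n) ≡ not (even n)
    even-suc zero          = refl
    even-suc (suc zero)    = refl
    even-suc (suc (suc n)) = even-suc n
    flip : ∀ a b → b ≡ not a → (if b then 0ℚ else 1ℚ) ≡ (if a then 1ℚ else 0ℚ)
    flip true  false _ = refl
    flip false true  _ = refl
  shift : oddPart (kern q) ≗ 𝕩 ✶ evenPart (kern true)
  shift .coeff zero    = sym (𝕩✶-zero (evenPart (kern true)))
  shift .coeff (suc n) = trans (c n) (sym (𝕩✶-suc (evenPart (kern true)) n))

kernE-false : evenPart (kern false) ≗ 𝕩 ✶ (𝕩 ✶ 𝕂)
kernE-false = ≗-trans shift (ℛ.*-congˡ (ℛ.*-congˡ kernE-true))
  where
  k = evenPart (kern true)
  c : ∀ n → evenPart (kern false) ⟪ suc (suc n) ⟫ ≡ k ⟪ n ⟫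
  c zero          = refl
  c (suc zero)    = refl
  c (suc (suc n)) = refl
  shift : evenPart (kern false) ≗ 𝕩 ✶ (𝕩 ✶ k)
  shift .coeff zero          = sym (𝕩✶-zero (𝕩 ✶ k))
  shift .coeff (suc zero)    = sym (trans (𝕩✶-suc (𝕩 ✶ k) 0) (𝕩✶-zero k))
  shift .coeff (suc (suc n)) = trans (c n) (sym (trans (𝕩✶-suc (𝕩 ✶ k) (suc n)) (𝕩✶-suc k n)))

-- The exponent is the number of letters of the alphabet above the first letter of the word; s is its sign.
altSer : Bool → List Bool → Ser
altSer s []      = kern true
altSer s (b ∷ p) = evenPart (kern (if s then b else not b)) ✶ altSer s p ⊞ oddPart (kern (if s then b else not b)) ✶ altSer (not s) p

even-+ : ∀ v i → even (v ℕ.+ i) ≡ (if even i then even v else not (even v))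
even-+ v zero          = cong even (ℕₚ.+-identityʳ v)
even-+ v (suc zero)    = trans (cong even (ℕₚ.+-comm v 1)) (flip v)
  where
  flip : ∀ v → even (suc v) ≡ not (even v)
  flip zero          = refl
  flip (suc zero)    = refl
  flip (suc (suc v)) = flip v
even-+ v (suc (suc i)) = trans (cong even (trans (ℕₚ.+-suc v (suc i)) (cong suc (ℕₚ.+-suc v i)))) (even-+ v i)

altSer-split : ∀ k s p m → ∑≤ m (λ i → k ⟪ i ⟫ ℚ.* altSer (if even i then s else not s) p ⟪ m ∸ i ⟫)
  ≡ (evenPart k ✶ altSer s p ⊞ oddPart k ✶ altSer (not s) p) ⟪ m ⟫
altSer-split k s p m = trans (∑≤-cong m split) (∑≤-+ m (λ i → evenPart k ⟪ i ⟫ ℚ.* altSer s p ⟪ m ∸ i ⟫) (λ i → oddPart k ⟪ i ⟫ ℚ.* altSer (not s) p ⟪ m ∸ i ⟫))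
  where
  split : ∀ i → k ⟪ i ⟫ ℚ.* altSer (if even i then s else not s) p ⟪ m ∸ i ⟫
        ≡ evenPart k ⟪ i ⟫ ℚ.* altSer s p ⟪ m ∸ i ⟫ ℚ.+ oddPart k ⟪ i ⟫ ℚ.* altSer (not s) p ⟪ m ∸ i ⟫
  split i with even i
  ... | true  = sym (trans (cong (k ⟪ i ⟫ ℚ.* altSer s p ⟪ m ∸ i ⟫ ℚ.+_) (ℚₚ.*-zeroˡ (altSer (not s) p ⟪ m ∸ i ⟫))) (ℚₚ.+-identityʳ _))
  ... | false = sym (trans (cong (ℚ._+ k ⟪ i ⟫ ℚ.* altSer (not s) p ⟪ m ∸ i ⟫) (ℚₚ.*-zeroˡ (altSer s p ⟪ m ∸ i ⟫))) (ℚₚ.+-identityˡ _))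

cntFrom-altSer : ∀ p v m → ℕtoℚ (cntFrom even (upTo (v ℕ.+ suc m)) v p) ≡ altSer (even v) p ⟪ m ⟫
cntFrom-altSer []      v zero    = refl
cntFrom-altSer []      v (suc m) = refl
cntFrom-altSer (b ∷ p) v m = trans (cntFrom-kern even b v m p) (trans
  (∑≤-cong≤ m (λ i le → cong (k ⟪ i ⟫ ℚ.*_) (trans (cong (λ N → ℕtoℚ (cntFrom even (upTo N) (v ℕ.+ i) p)) (+suc-shift v le))
     (trans (cntFrom-altSer p (v ℕ.+ i) (m ∸ i)) (cong (λ s → altSer s p ⟪ m ∸ i ⟫) (even-+ v i))))))
  (altSer-split k (even v) p m))
  where k = kern (if even v then b else not b)

-- The first letter i is reached, with weight 1 and with its correct sign, by an ascending move over
-- the distance i from the positive letter 0. This is the origin of the leading `true`, both as sign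
-- and as ascent.
cnt-altSer : ∀ p N → ℕtoℚ (cnt even (upTo N) p) ≡ (𝕩 ✶ altSer true (true ∷ p)) ⟪ N ⟫
cnt-altSer p zero    = sym (𝕩✶-zero (altSer true (true ∷ p)))
cnt-altSer p (suc m) = trans (trans (trans (∑-upTo-shift 0 m (λ v → cntFrom even (upTo (suc m)) v p) (λ ()))
  (∑≤-cong≤ m (λ i le → trans (trans (cong (λ N → ℕtoℚ (cntFrom even (upTo N) i p)) (+suc-shift 0 le)) (trans (cntFrom-altSer p i (m ∸ i)) (cong (λ s → altSer s p ⟪ m ∸ i ⟫) (even-+ 0 i))))
    (trans (sym (ℚₚ.*-identityˡ _)) (cong (ℚ._* altSer (if even i then true else false) p ⟪ m ∸ i ⟫) (k1 i))))))
  (altSer-split (kern true) true p m))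
  (sym (𝕩✶-suc (altSer true (true ∷ p)) m))
  where
  k1 : ∀ i → 1ℚ ≡ kern true ⟪ i ⟫
  k1 zero    = refl
  k1 (suc i) = refl

differ : Bool → Bool → ℕ
differ true  true  = 0
differ false false = 0
differ _     _     = 1

changes : List Bool → ℕ
changes []           = 0
changes (b ∷ [])     = 0
changes (b ∷ b′ ∷ p) = differ b b′ ℕ.+ changes (b′ ∷ p)

ℂ𝕊 : ℂ ✶ 𝕊 ≗ cˢ (+ 2 ℚ./ 1) ✶ 𝕩 ✶ 𝕂
ℂ𝕊 = ≗-trans (solve 3 (λ a k s → (a :* k) :* s := (a :* s) :* k) ≗-refl (1ˢ ⊞ 𝕩 ✶ 𝕩) 𝕂 𝕊) (ℛ.*-congʳ 1+𝕩²-𝕊)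
  where open 𝒮 using (solve; con; _:=_; _:*_)

𝕁𝕂 : (1ˢ ⊞ 𝕩) ✶ 𝕂 ≗ 𝕁
𝕁𝕂 = inv-unique {1ˢ ⊟ 𝕩} (≗-trans (solve 2 (λ x k → (con 1ℚ :- x) :* ((con 1ℚ :+ x) :* k) := (con 1ℚ :- x :* x) :* k) ≗-refl 𝕩 𝕂) 𝕂-law) 𝕁-law
  where open 𝒮 using (solve; con; _:=_; _:*_; _:-_; _:+_)

altClosed : Bool → List Bool → Ser
altClosed b p = 𝕁 ✶ 𝕁 ✶ ℂ ^ˢ length p ✶ 𝕊 ^ˢ changes (b ∷ p)

private
  same diff : Ser → Ser → Ser
  same f g = 𝕂 ✶ f ⊞ (𝕩 ✶ 𝕂) ✶ g
  diff f g = (𝕩 ✶ (𝕩 ✶ 𝕂)) ✶ f ⊞ (𝕩 ✶ 𝕂) ✶ g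

  alt-unfold : ∀ s b p → altSer s (b ∷ p) ≗ (if s then (if b then same else diff) else (if b then diff else same)) (altSer s p) (altSer (not s) p)
  alt-unfold true  true  p = ℛ.+-cong (ℛ.*-congʳ kernE-true) (ℛ.*-congʳ (kernO true))
  alt-unfold true  false p = ℛ.+-cong (ℛ.*-congʳ kernE-false) (ℛ.*-congʳ (kernO false))
  alt-unfold false true  p = ℛ.+-cong (ℛ.*-congʳ kernE-false) (ℛ.*-congʳ (kernO false))
  alt-unfold false false p = ℛ.+-cong (ℛ.*-congʳ kernE-true) (ℛ.*-congʳ (kernO true))

module _ where
  open 𝒮 using (solve; con; _:=_; _:*_; _:-_; _:+_)
  open SetoidR ℛ.setoid

  private
    base-same : same (kern true) (kern true) ≗ 𝕁 ✶ 𝕁 ✶ 1ˢ ✶ 1ˢ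
    base-same = begin
      same (kern true) (kern true)          ≈⟨ solve 3 (λ k x j → k :* j :+ (x :* k) :* j := ((con 1ℚ :+ x) :* k) :* j) ≗-refl 𝕂 𝕩 (kern true) ⟩
      (1ˢ ⊞ 𝕩) ✶ 𝕂 ✶ kern true              ≈⟨ ℛ.*-cong 𝕁𝕂 kern-true ⟩
      𝕁 ✶ 𝕁                                 ≈⟨ solve 1 (λ a → a := a :* con 1ℚ :* con 1ℚ) ≗-refl (𝕁 ✶ 𝕁) ⟩
      𝕁 ✶ 𝕁 ✶ 1ˢ ✶ 1ˢ ∎
    diff≗ : ∀ f g → diff f g ≗ 𝕩 ✶ (𝕂 ✶ g ⊞ (𝕩 ✶ 𝕂) ✶ f)
    diff≗ f g = solve 4 (λ x k f g → (x :* (x :* k)) :* f :+ (x :* k) :* g := x :* (k :* g :+ (x :* k) :* f)) ≗-refl 𝕩 𝕂 f g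
    keep : ∀ n c → same (𝕁 ✶ 𝕁 ✶ ℂ ^ˢ n ✶ 𝕊 ^ˢ c) (𝕩 ✶ (𝕁 ✶ 𝕁 ✶ ℂ ^ˢ n ✶ 𝕊 ^ˢ c)) ≗ 𝕁 ✶ 𝕁 ✶ ℂ ^ˢ suc n ✶ 𝕊 ^ˢ c
    keep n c = solve 5 (λ x k jj cn sc → k :* (jj :* cn :* sc) :+ (x :* k) :* (x :* (jj :* cn :* sc)) := jj :* (((con 1ℚ :+ x :* x) :* k) :* cn) :* sc) ≗-refl 𝕩 𝕂 (𝕁 ✶ 𝕁) (ℂ ^ˢ n) (𝕊 ^ˢ c)
    turn : ∀ n c → same (𝕩 ✶ (𝕁 ✶ 𝕁 ✶ ℂ ^ˢ n ✶ 𝕊 ^ˢ c)) (𝕁 ✶ 𝕁 ✶ ℂ ^ˢ n ✶ 𝕊 ^ˢ c) ≗ 𝕁 ✶ 𝕁 ✶ ℂ ^ˢ suc n ✶ 𝕊 ^ˢ suc c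
    turn n c = begin
      same (𝕩 ✶ r) r                        ≈⟨ solve 3 (λ x k r → k :* (x :* r) :+ (x :* k) :* r := (con (+ 2 ℚ./ 1) :* x :* k) :* r) ≗-refl 𝕩 𝕂 r ⟩
      cˢ (+ 2 ℚ./ 1) ✶ 𝕩 ✶ 𝕂 ✶ r            ≈⟨ ℛ.*-congʳ ℂ𝕊 ⟨
      ℂ ✶ 𝕊 ✶ r                             ≈⟨ solve 5 (λ c s jj cn sc → (c :* s) :* (jj :* cn :* sc) := jj :* (c :* cn) :* (s :* sc)) ≗-refl ℂ 𝕊 (𝕁 ✶ 𝕁) (ℂ ^ˢ n) (𝕊 ^ˢ c) ⟩
      𝕁 ✶ 𝕁 ✶ ℂ ^ˢ suc n ✶ 𝕊 ^ˢ suc c ∎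
      where r = 𝕁 ✶ 𝕁 ✶ ℂ ^ˢ n ✶ 𝕊 ^ˢ c

    same-cong : ∀ {f f′ g g′} → f ≗ f′ → g ≗ g′ → same f g ≗ same f′ g′
    same-cong e e′ = ℛ.+-cong (ℛ.*-congˡ e) (ℛ.*-congˡ e′)

    opposite : ∀ b p {f g} → altSer (not b) (b ∷ p) ≗ diff f g → same g f ≗ altClosed b p → altSer (not b) (b ∷ p) ≗ 𝕩 ✶ altClosed b p
    opposite b p {f} {g} e e′ = ≗-trans e (≗-trans (diff≗ f g) (ℛ.*-congˡ e′))

  -- A letter v whose sign forbids the repetition has the same successors as v+1, whose sign allows
  -- it; this is the factor `𝕩`, and only one unknown series r remains. Prepending a step in the
  -- same direction gives (1+x²) `𝕂` r = `ℂ` r, a step in the other direction 2 x `𝕂` r = `ℂ` `𝕊` r.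
  alt-closed : ∀ b p → altSer b (b ∷ p) ≗ altClosed b p × altSer (not b) (b ∷ p) ≗ 𝕩 ✶ altClosed b p
  alt-closed true  [] = ≗-trans (alt-unfold true true []) base-same , opposite true [] (alt-unfold false true []) base-same
  alt-closed false [] = ≗-trans (alt-unfold false false []) base-same , opposite false [] (alt-unfold true false []) base-same
  alt-closed true (true ∷ p) with alt-closed true p
  ... | e , e′ = ≗-trans (alt-unfold true true (true ∷ p)) E , opposite true (true ∷ p) (alt-unfold false true (true ∷ p)) E
    where E = ≗-trans (same-cong e e′) (keep (length p) (changes (true ∷ p)))
  alt-closed false (false ∷ p) with alt-closed false p
  ... | e , e′ = ≗-trans (alt-unfold false false (false ∷ p)) E , opposite false (false ∷ p) (alt-unfold true false (false ∷ p)) E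
    where E = ≗-trans (same-cong e e′) (keep (length p) (changes (false ∷ p)))
  alt-closed true (false ∷ p) with alt-closed false p
  ... | e , e′ = ≗-trans (alt-unfold true true (false ∷ p)) E , opposite true (false ∷ p) (alt-unfold false true (false ∷ p)) E
    where E = ≗-trans (same-cong e′ e) (turn (length p) (changes (false ∷ p)))
  alt-closed false (true ∷ p) with alt-closed true p
  ... | e , e′ = ≗-trans (alt-unfold false false (true ∷ p)) E , opposite false (true ∷ p) (alt-unfold true false (true ∷ p)) E
    where E = ≗-trans (same-cong e′ e) (turn (length p) (changes (true ∷ p)))

cnt-udr : ∀ p N → ℕtoℚ (cnt even (upTo N) p) ≡ (𝕩 ✶ (𝕁 ✶ 𝕁 ✶ ℂ ^ˢ length p ✶ 𝕊 ^ˢ changes (true ∷ p))) ⟪ N ⟫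
cnt-udr p N = trans (cnt-altSer p N) (coeff (✶-cong {𝕩} ≗-refl (proj₁ (alt-closed true p))) N)

-- With alternating signs, the smallest letter negative and 2b letters, they are counted by the peaks.

𝕋 : Ser
𝕋 = ((+ 4 ℚ./ 1) ·ˢ 𝕩) ✶ invˢ (1ˢ ⊞ 𝕩) ^ˢ 2

𝕌𝕋 : 𝕌 ✶ 𝕌 ✶ 𝕋 ≗ cˢ (+ 4 ℚ./ 1) ✶ 𝕩 ✶ (𝕁 ✶ 𝕁)
𝕌𝕋 = begin
  𝕌 ✶ 𝕌 ✶ 𝕋
    ≈⟨ solve 4 (λ p j f i → (p :* j) :* (p :* j) :* (f :* (i :* (i :* con 1ℚ))) := (p :* i) :* (p :* i) :* f :* (j :* j)) ≗-refl (1ˢ ⊞ 𝕩) 𝕁 ((+ 4 ℚ./ 1) ·ˢ 𝕩) I ⟩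
  (1ˢ ⊞ 𝕩) ✶ I ✶ ((1ˢ ⊞ 𝕩) ✶ I) ✶ ((+ 4 ℚ./ 1) ·ˢ 𝕩) ✶ (𝕁 ✶ 𝕁)
    ≈⟨ ℛ.*-congʳ (ℛ.*-cong (ℛ.*-cong law law) (·ˢ-con (+ 4 ℚ./ 1) 𝕩)) ⟩
  1ˢ ✶ 1ˢ ✶ (cˢ (+ 4 ℚ./ 1) ✶ 𝕩) ✶ (𝕁 ✶ 𝕁)
    ≈⟨ solve 2 (λ f j → con 1ℚ :* con 1ℚ :* f :* j := f :* j) ≗-refl (cˢ (+ 4 ℚ./ 1) ✶ 𝕩) (𝕁 ✶ 𝕁) ⟩
  cˢ (+ 4 ℚ./ 1) ✶ 𝕩 ✶ (𝕁 ✶ 𝕁) ∎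
  where
  open 𝒮 using (solve; con; _:=_; _:*_)
  open SetoidR ℛ.setoid
  I = invˢ (1ˢ ⊞ 𝕩)
  law : (1ˢ ⊞ 𝕩) ✶ I ≗ 1ˢ
  law = invˢ-law {1ˢ ⊞ 𝕩} refl

∑-upTo-pairs : ∀ b f → ∑ℕ (upTo (b ℕ.* 2)) f ≡ ∑ℕ (upTo b) (λ j → f (j ℕ.* 2) ℕ.+ f (suc (j ℕ.* 2)))
∑-upTo-pairs zero    f = refl
∑-upTo-pairs (suc b) f = begin
  f 0 ℕ.+ (f 1 ℕ.+ ∑ℕ (applyUpTo (suc ∘ suc) (b ℕ.* 2)) f)
    ≡⟨ ℕₚ.+-assoc (f 0) (f 1) _ ⟨
  f 0 ℕ.+ f 1 ℕ.+ ∑ℕ (applyUpTo (suc ∘ suc) (b ℕ.* 2)) f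
    ≡⟨ cong (f 0 ℕ.+ f 1 ℕ.+_) (trans (cong (λ L → ∑ℕ L f) (sym (Listₚ.map-upTo (suc ∘ suc) (b ℕ.* 2)))) (ℕ∑.∑-map (suc ∘ suc) (upTo (b ℕ.* 2)) f)) ⟩
  f 0 ℕ.+ f 1 ℕ.+ ∑ℕ (upTo (b ℕ.* 2)) (f ∘ suc ∘ suc)
    ≡⟨ cong (f 0 ℕ.+ f 1 ℕ.+_) (∑-upTo-pairs b (f ∘ suc ∘ suc)) ⟩
  f 0 ℕ.+ f 1 ℕ.+ ∑ℕ (upTo b) (λ j → f (suc (suc (j ℕ.* 2))) ℕ.+ f (suc (suc (suc (j ℕ.* 2)))))
    ≡⟨ cong (f 0 ℕ.+ f 1 ℕ.+_) (ℕ∑.∑-map suc (upTo b) (λ j → f (j ℕ.* 2) ℕ.+ f (suc (j ℕ.* 2)))) ⟨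
  f 0 ℕ.+ f 1 ℕ.+ ∑ℕ (map suc (upTo b)) (λ j → f (j ℕ.* 2) ℕ.+ f (suc (j ℕ.* 2)))
    ≡⟨ cong (λ L → ∑ℕ L (λ j → f (j ℕ.* 2) ℕ.+ f (suc (j ℕ.* 2)))) (upTo-suc b) ⟨
  ∑ℕ (upTo (suc b)) (λ j → f (j ℕ.* 2) ℕ.+ f (suc (j ℕ.* 2))) ∎
  where open ≡-Reasoning

even-2* : ∀ j → even (j ℕ.* 2) ≡ true
even-2* zero    = refl
even-2* (suc j) = even-2* j

even-1+2* : ∀ j → even (suc (j ℕ.* 2)) ≡ false
even-1+2* zero    = refl
even-1+2* (suc j) = even-1+2* j

-- The letters 2j (negative) and 2j+1 (positive) form a pair; the exponent is the number of pairs above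
-- that of the first letter of the word.
minusSer plusSer : List Bool → Ser
minusSer []      = kern true
minusSer (b ∷ p) = kern (not b) ✶ minusSer p ⊞ kern true ✶ plusSer p
plusSer []      = kern true
plusSer (b ∷ p) = kern false ✶ minusSer p ⊞ kern b ✶ plusSer p

*2-mono-< : ∀ {i j} → i < j → suc (i ℕ.* 2) < j ℕ.* 2
*2-mono-< {i} {suc j} (s≤s l) = s≤s (s≤s (ℕₚ.*-monoˡ-≤ 2 l))

-- The transfer matrix in 2 by 2 blocks, indexed by the distance i between the pairs. Inside a pair
-- the negative letter is the smaller one, so the move from - to + is always allowed there and the
-- move from + to - never.
module _ (b : Bool) (j : ℕ) where
  private
    j<j+1+i : ∀ i → j < j ℕ.+ suc i
    j<j+1+i i = ℕₚ.m<m+n j (s≤s z≤n)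

  step-−− : ∀ i → ℕtoℚ ⟦ step odd b (j ℕ.* 2) ((j ℕ.+ i) ℕ.* 2) ⟧ ≡ kern (not b) ⟪ i ⟫
  step-−− zero    = cong (ℕtoℚ ∘ ⟦_⟧) (trans (cong (λ z → step odd b (j ℕ.* 2) (z ℕ.* 2)) (ℕₚ.+-identityʳ j))
    (trans (step-≡ odd b (j ℕ.* 2)) (cong (λ z → if not z then b else not b) (even-2* j))))
  step-−− (suc i) = cong (ℕtoℚ ∘ ⟦_⟧) (step-< odd b (ℕₚ.<-trans (ℕₚ.n<1+n _) (*2-mono-< (j<j+1+i i))))

  step-−+ : ∀ i → ℕtoℚ ⟦ step odd b (j ℕ.* 2) (suc ((j ℕ.+ i) ℕ.* 2)) ⟧ ≡ kern true ⟪ i ⟫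
  step-−+ i = trans (cong (ℕtoℚ ∘ ⟦_⟧) (step-< odd b (s≤s (ℕₚ.*-monoˡ-≤ 2 (ℕₚ.m≤m+n j i))))) (k1 i)
    where
    k1 : ∀ i → 1ℚ ≡ kern true ⟪ i ⟫
    k1 zero    = refl
    k1 (suc i) = refl

  step-+− : ∀ i → ℕtoℚ ⟦ step odd b (suc (j ℕ.* 2)) ((j ℕ.+ i) ℕ.* 2) ⟧ ≡ kern false ⟪ i ⟫
  step-+− zero    = cong (ℕtoℚ ∘ ⟦_⟧) (trans (cong (λ z → step odd b (suc (j ℕ.* 2)) (z ℕ.* 2)) (ℕₚ.+-identityʳ j)) (step-> odd b {suc (j ℕ.* 2)} {j ℕ.* 2} (ℕₚ.n<1+n _)))
  step-+− (suc i) = cong (ℕtoℚ ∘ ⟦_⟧) (step-< odd b (*2-mono-< (j<j+1+i i)))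

  step-++ : ∀ i → ℕtoℚ ⟦ step odd b (suc (j ℕ.* 2)) (suc ((j ℕ.+ i) ℕ.* 2)) ⟧ ≡ kern b ⟪ i ⟫
  step-++ zero    = cong (ℕtoℚ ∘ ⟦_⟧) (trans (cong (λ z → step odd b (suc (j ℕ.* 2)) (suc (z ℕ.* 2))) (ℕₚ.+-identityʳ j))
    (trans (step-≡ odd b (suc (j ℕ.* 2))) (cong (λ z → if not z then b else not b) (even-1+2* j))))
  step-++ (suc i) = cong (ℕtoℚ ∘ ⟦_⟧) (step-< odd b (ℕₚ.<-trans (*2-mono-< (j<j+1+i i)) (ℕₚ.n<1+n _)))

private
  letters : ℕ → List ℕ
  letters b = upTo (b ℕ.* 2)

cntFrom-pairs : ∀ p j m → ℕtoℚ (cntFrom odd (upTo ((j ℕ.+ suc m) ℕ.* 2)) (j ℕ.* 2) p) ≡ minusSer p ⟪ m ⟫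
                        × ℕtoℚ (cntFrom odd (upTo ((j ℕ.+ suc m) ℕ.* 2)) (suc (j ℕ.* 2)) p) ≡ plusSer p ⟪ m ⟫
cntFrom-pairs []      j zero    = refl , refl
cntFrom-pairs []      j (suc m) = refl , refl
cntFrom-pairs (b ∷ p) j m =
    expand (j ℕ.* 2) (kern (not b)) (kern true) (λ l → step-> odd b (ℕₚ.<-trans (ℕₚ.n<1+n _) (*2-mono-< l))) (λ l → step-> odd b (*2-mono-< l)) (step-−− b j) (step-−+ b j)
  , expand (suc (j ℕ.* 2)) (kern false) (kern b) (λ l → step-> odd b (ℕₚ.<-trans (ℕₚ.<-trans (ℕₚ.n<1+n _) (*2-mono-< l)) (ℕₚ.n<1+n _))) (λ l → step-> odd b (ℕₚ.<-trans (*2-mono-< l) (ℕₚ.n<1+n _))) (step-+− b j) (step-++ b j)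
  where
  Y = letters (j ℕ.+ suc m)
  expand : ∀ x k k′ →
    (∀ {i} → i < j → step odd b x (i ℕ.* 2) ≡ false) → (∀ {i} → i < j → step odd b x (suc (i ℕ.* 2)) ≡ false) →
    (∀ i → ℕtoℚ ⟦ step odd b x ((j ℕ.+ i) ℕ.* 2) ⟧ ≡ k ⟪ i ⟫) → (∀ i → ℕtoℚ ⟦ step odd b x (suc ((j ℕ.+ i) ℕ.* 2)) ⟧ ≡ k′ ⟪ i ⟫) →
    ℕtoℚ (cntFrom odd Y x (b ∷ p)) ≡ (k ✶ minusSer p ⊞ k′ ✶ plusSer p) ⟪ m ⟫
  expand x k k′ z z′ e e′ = begin
    ℕtoℚ (∑ℕ Y F)
      ≡⟨ cong ℕtoℚ (∑-upTo-pairs (j ℕ.+ suc m) F) ⟩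
    ℕtoℚ (∑ℕ (upTo (j ℕ.+ suc m)) (λ i → F (i ℕ.* 2) ℕ.+ F (suc (i ℕ.* 2))))
      ≡⟨ ∑-upTo-shift j m _ (λ {i} l → cong₂ ℕ._+_ (cong (λ q → ⟦ q ⟧ ℕ.* cntFrom odd Y (i ℕ.* 2) p) (z l)) (cong (λ q → ⟦ q ⟧ ℕ.* cntFrom odd Y (suc (i ℕ.* 2)) p) (z′ l))) ⟩
    ∑≤ m (λ i → ℕtoℚ (F ((j ℕ.+ i) ℕ.* 2) ℕ.+ F (suc ((j ℕ.+ i) ℕ.* 2))))
      ≡⟨ ∑≤-cong≤ m (λ i le → trans (ℕtoℚ-+ (F ((j ℕ.+ i) ℕ.* 2)) (F (suc ((j ℕ.+ i) ℕ.* 2)))) (cong₂ ℚ._+_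
           (trans (ℕtoℚ-* ⟦ step odd b x ((j ℕ.+ i) ℕ.* 2) ⟧ _) (cong₂ ℚ._*_ (e i) (trans (cong (λ N → ℕtoℚ (cntFrom odd (letters N) ((j ℕ.+ i) ℕ.* 2) p)) (+suc-shift j le)) (proj₁ (cntFrom-pairs p (j ℕ.+ i) (m ∸ i))))))
           (trans (ℕtoℚ-* ⟦ step odd b x (suc ((j ℕ.+ i) ℕ.* 2)) ⟧ _) (cong₂ ℚ._*_ (e′ i) (trans (cong (λ N → ℕtoℚ (cntFrom odd (letters N) (suc ((j ℕ.+ i) ℕ.* 2)) p)) (+suc-shift j le)) (proj₂ (cntFrom-pairs p (j ℕ.+ i) (m ∸ i)))))))) ⟩
    ∑≤ m (λ i → k ⟪ i ⟫ ℚ.* minusSer p ⟪ m ∸ i ⟫ ℚ.+ k′ ⟪ i ⟫ ℚ.* plusSer p ⟪ m ∸ i ⟫)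
      ≡⟨ ∑≤-+ m (λ i → k ⟪ i ⟫ ℚ.* minusSer p ⟪ m ∸ i ⟫) (λ i → k′ ⟪ i ⟫ ℚ.* plusSer p ⟪ m ∸ i ⟫) ⟩
    (k ✶ minusSer p ⊞ k′ ✶ plusSer p) ⟪ m ⟫ ∎
    where
    open ≡-Reasoning
    F : ℕ → ℕ
    F y = ⟦ step odd b x y ⟧ ℕ.* cntFrom odd Y y p

-- The first letter is free, as it would be after a descent from the least letter, which is negative
-- and hence repeatable there: both kernels of `minusSer` at a descent are `kern true`. This is the
-- leading `false`. The factor `𝕩` passes from the m pairs above the first pair to m+1 pairs.
cnt-minusSer : ∀ p b → ℕtoℚ (cnt odd (upTo (b ℕ.* 2)) p) ≡ (𝕩 ✶ minusSer (false ∷ p)) ⟪ b ⟫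
cnt-minusSer p zero    = sym (𝕩✶-zero (minusSer (false ∷ p)))
cnt-minusSer p (suc m) = begin
  ℕtoℚ (∑ℕ Y F)
    ≡⟨ cong ℕtoℚ (∑-upTo-pairs (suc m) F) ⟩
  ℕtoℚ (∑ℕ (upTo (suc m)) (λ i → F (i ℕ.* 2) ℕ.+ F (suc (i ℕ.* 2))))
    ≡⟨ ∑-upTo-shift 0 m (λ i → F (i ℕ.* 2) ℕ.+ F (suc (i ℕ.* 2))) (λ ()) ⟩
  ∑≤ m (λ i → ℕtoℚ (F (i ℕ.* 2) ℕ.+ F (suc (i ℕ.* 2))))
    ≡⟨ ∑≤-cong≤ m (λ i le → trans (ℕtoℚ-+ (F (i ℕ.* 2)) (F (suc (i ℕ.* 2)))) (cong₂ ℚ._+_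
         (trans (trans (cong (λ N → ℕtoℚ (cntFrom odd (letters N) (i ℕ.* 2) p)) (+suc-shift 0 le)) (proj₁ (cntFrom-pairs p i (m ∸ i)))) (unit i (minusSer p ⟪ m ∸ i ⟫)))
         (trans (trans (cong (λ N → ℕtoℚ (cntFrom odd (letters N) (suc (i ℕ.* 2)) p)) (+suc-shift 0 le)) (proj₂ (cntFrom-pairs p i (m ∸ i)))) (unit i (plusSer p ⟪ m ∸ i ⟫))))) ⟩
  ∑≤ m (λ i → kern true ⟪ i ⟫ ℚ.* minusSer p ⟪ m ∸ i ⟫ ℚ.+ kern true ⟪ i ⟫ ℚ.* plusSer p ⟪ m ∸ i ⟫)
    ≡⟨ ∑≤-+ m (λ i → kern true ⟪ i ⟫ ℚ.* minusSer p ⟪ m ∸ i ⟫) (λ i → kern true ⟪ i ⟫ ℚ.* plusSer p ⟪ m ∸ i ⟫) ⟩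
  minusSer (false ∷ p) ⟪ m ⟫
    ≡⟨ 𝕩✶-suc (minusSer (false ∷ p)) m ⟨
  (𝕩 ✶ minusSer (false ∷ p)) ⟪ suc m ⟫ ∎
  where
  open ≡-Reasoning
  Y = letters (suc m)
  F : ℕ → ℕ
  F y = cntFrom odd Y y p
  unit : ∀ i q → q ≡ kern true ⟪ i ⟫ ℚ.* q
  unit zero    q = sym (ℚₚ.*-identityˡ q)
  unit (suc i) q = sym (ℚₚ.*-identityˡ q)

peaks : List Bool → ℕ
peaks []                 = 0
peaks (false ∷ p)        = peaks p
peaks (true ∷ [])        = 0
peaks (true ∷ true ∷ p)  = peaks (true ∷ p)
peaks (true ∷ false ∷ p) = suc (peaks p)

pkClosed : Bool → List Bool → Ser
pkClosed true  p = (1ˢ ⊞ 𝕩) ✶ (𝕁 ✶ 𝕁) ✶ 𝕌 ^ˢ length p ✶ 𝕋 ^ˢ peaks (true ∷ p)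
pkClosed false p = cˢ (+ 2 ℚ./ 1) ✶ (𝕁 ✶ 𝕁) ✶ 𝕌 ^ˢ length p ✶ 𝕋 ^ˢ peaks p

module _ where
  open 𝒮 using (solve; con; _:=_; _:*_; _:-_; _:+_)
  open SetoidR ℛ.setoid

  private
    ascUnfold : ∀ p → minusSer (true ∷ p) ≗ 𝕁 ✶ (𝕩 ✶ minusSer p ⊞ plusSer p) × plusSer (true ∷ p) ≗ 𝕁 ✶ (𝕩 ✶ minusSer p ⊞ plusSer p)
    ascUnfold p = e , e
      where
      e : kern false ✶ minusSer p ⊞ kern true ✶ plusSer p ≗ 𝕁 ✶ (𝕩 ✶ minusSer p ⊞ plusSer p)
      e = ≗-trans (ℛ.+-cong (ℛ.*-congʳ kern-false) (ℛ.*-congʳ kern-true))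
        (solve 4 (λ x j m q → (x :* j) :* m :+ j :* q := j :* (x :* m :+ q)) ≗-refl 𝕩 𝕁 (minusSer p) (plusSer p))
    descUnfold : ∀ p → minusSer (false ∷ p) ≗ 𝕁 ✶ (minusSer p ⊞ plusSer p) × plusSer (false ∷ p) ≗ 𝕩 ✶ (𝕁 ✶ (minusSer p ⊞ plusSer p))
    descUnfold p =
        ≗-trans (ℛ.+-cong (ℛ.*-congʳ kern-true) (ℛ.*-congʳ kern-true)) (solve 3 (λ j m q → j :* m :+ j :* q := j :* (m :+ q)) ≗-refl 𝕁 (minusSer p) (plusSer p))
      , ≗-trans (ℛ.+-cong (ℛ.*-congʳ kern-false) (ℛ.*-congʳ kern-false)) (solve 4 (λ x j m q → (x :* j) :* m :+ (x :* j) :* q := x :* (j :* (m :+ q))) ≗-refl 𝕩 𝕁 (minusSer p) (plusSer p))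

  -- Before an ascent the negative letter of a pair has the same successors as the positive one, so
  -- the two series agree. Before a descent the positive letter has the successors of the next
  -- negative letter, which gives the factor `𝕩`. In the normalisation of `pkClosed` every further
  -- step then costs `𝕌`, and an ascent followed by a descent also `𝕋`, by `𝕌𝕋`.
  pk-closed : ∀ b p → minusSer (b ∷ p) ≗ pkClosed b p × plusSer (b ∷ p) ≗ (if b then 1ˢ else 𝕩) ✶ pkClosed b p
  pk-closed true p = ≗-trans (proj₁ (ascUnfold p)) (asc p) , ≗-trans (proj₂ (ascUnfold p)) (≗-trans (asc p) (≗-sym (✶-identityˡ _)))
    where
    asc : ∀ p → 𝕁 ✶ (𝕩 ✶ minusSer p ⊞ plusSer p) ≗ pkClosed true p
    asc [] = ≗-trans (ℛ.*-congˡ (ℛ.+-cong (ℛ.*-congˡ kern-true) kern-true))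
      (solve 2 (λ x j → j :* (x :* j :+ j) := (con 1ℚ :+ x) :* (j :* j) :* con 1ℚ :* con 1ℚ) ≗-refl 𝕩 𝕁)
    asc (true ∷ p) = ≗-trans (ℛ.*-congˡ (ℛ.+-cong (ℛ.*-congˡ (proj₁ (pk-closed true p))) (proj₂ (pk-closed true p))))
      (solve 4 (λ x j u t → j :* (x :* ((con 1ℚ :+ x) :* (j :* j) :* u :* t) :+ con 1ℚ :* ((con 1ℚ :+ x) :* (j :* j) :* u :* t))
         := (con 1ℚ :+ x) :* (j :* j) :* (((con 1ℚ :+ x) :* j) :* u) :* t) ≗-refl 𝕩 𝕁 (𝕌 ^ˢ length p) (𝕋 ^ˢ peaks (true ∷ p)))
    asc (false ∷ p) = begin
      𝕁 ✶ (𝕩 ✶ minusSer (false ∷ p) ⊞ plusSer (false ∷ p))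
        ≈⟨ ℛ.*-congˡ (ℛ.+-cong (ℛ.*-congˡ (proj₁ (pk-closed false p))) (proj₂ (pk-closed false p))) ⟩
      𝕁 ✶ (𝕩 ✶ pkClosed false p ⊞ 𝕩 ✶ pkClosed false p)
        ≈⟨ solve 4 (λ x j u t → j :* (x :* (con (+ 2 ℚ./ 1) :* (j :* j) :* u :* t) :+ x :* (con (+ 2 ℚ./ 1) :* (j :* j) :* u :* t))
             := (con (+ 4 ℚ./ 1) :* x :* (j :* j)) :* j :* u :* t) ≗-refl 𝕩 𝕁 (𝕌 ^ˢ length p) (𝕋 ^ˢ peaks p) ⟩
      cˢ (+ 4 ℚ./ 1) ✶ 𝕩 ✶ (𝕁 ✶ 𝕁) ✶ 𝕁 ✶ 𝕌 ^ˢ length p ✶ 𝕋 ^ˢ peaks p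
        ≈⟨ ℛ.*-congʳ (ℛ.*-congʳ (ℛ.*-congʳ 𝕌𝕋)) ⟨
      𝕌 ✶ 𝕌 ✶ 𝕋 ✶ 𝕁 ✶ 𝕌 ^ˢ length p ✶ 𝕋 ^ˢ peaks p
        ≈⟨ solve 5 (λ x j T u t → ((con 1ℚ :+ x) :* j) :* ((con 1ℚ :+ x) :* j) :* T :* j :* u :* t
             := (con 1ℚ :+ x) :* (j :* j) :* (((con 1ℚ :+ x) :* j) :* u) :* (T :* t)) ≗-refl 𝕩 𝕁 𝕋 (𝕌 ^ˢ length p) (𝕋 ^ˢ peaks p) ⟩
      pkClosed true (false ∷ p) ∎
  pk-closed false p = ≗-trans (proj₁ (descUnfold p)) (desc p) , ≗-trans (proj₂ (descUnfold p)) (ℛ.*-congˡ (desc p))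
    where
    desc : ∀ p → 𝕁 ✶ (minusSer p ⊞ plusSer p) ≗ pkClosed false p
    desc [] = ≗-trans (ℛ.*-congˡ (ℛ.+-cong kern-true kern-true))
      (solve 1 (λ j → j :* (j :+ j) := con (+ 2 ℚ./ 1) :* (j :* j) :* con 1ℚ :* con 1ℚ) ≗-refl 𝕁)
    desc (true ∷ p) = ≗-trans (ℛ.*-congˡ (ℛ.+-cong (proj₁ (pk-closed true p)) (proj₂ (pk-closed true p))))
      (solve 4 (λ x j u t → j :* ((con 1ℚ :+ x) :* (j :* j) :* u :* t :+ con 1ℚ :* ((con 1ℚ :+ x) :* (j :* j) :* u :* t))
         := con (+ 2 ℚ./ 1) :* (j :* j) :* (((con 1ℚ :+ x) :* j) :* u) :* t) ≗-refl 𝕩 𝕁 (𝕌 ^ˢ length p) (𝕋 ^ˢ peaks (true ∷ p)))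
    desc (false ∷ p) = ≗-trans (ℛ.*-congˡ (ℛ.+-cong (proj₁ (pk-closed false p)) (proj₂ (pk-closed false p))))
      (solve 4 (λ x j u t → j :* (con (+ 2 ℚ./ 1) :* (j :* j) :* u :* t :+ x :* (con (+ 2 ℚ./ 1) :* (j :* j) :* u :* t))
         := con (+ 2 ℚ./ 1) :* (j :* j) :* (((con 1ℚ :+ x) :* j) :* u) :* t) ≗-refl 𝕩 𝕁 (𝕌 ^ˢ length p) (𝕋 ^ˢ peaks p))

cnt-pk : ∀ p b → ℕtoℚ (cnt odd (upTo (b ℕ.* 2)) p) ≡ (𝕩 ✶ (cˢ (+ 2 ℚ./ 1) ✶ (𝕁 ✶ 𝕁) ✶ 𝕌 ^ˢ length p ✶ 𝕋 ^ˢ peaks p)) ⟪ b ⟫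
cnt-pk p b = trans (cnt-minusSer p b) (coeff (✶-cong {𝕩} ≗-refl (proj₁ (pk-closed false p))) b)

-- Statistics as functions of the pattern of ascents and descents

>ᵇ-not : ∀ {u v} → u ≢ v → (v <ᵇ u) ≡ not (u <ᵇ v)
>ᵇ-not {u} {v} ne with ℕₚ.<-cmp u v
... | tri< lt _ _ = trans (<ᵇ-false (ℕₚ.<⇒≤ lt)) (cong not (sym (<ᵇ-true lt)))
... | tri≈ _ e _  = contradiction e ne
... | tri> _ _ gt = trans (<ᵇ-true gt) (cong not (sym (<ᵇ-false (ℕₚ.<⇒≤ gt))))

des-pat : ∀ u us → Unique (u ∷ us) → des (u ∷ us) ≡ descents (pat (u ∷ us))
des-pat u []       q = refl
des-pat u (v ∷ us) ((u≢v ∷ _) ∷ q) = begin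
  count P (rng 1 (suc (length us)))
    ≡⟨ count-∑ P (rng 1 (suc (length us))) ⟩
  ∑ℕ (rng 1 (suc (length us))) (⟦_⟧ ∘ P)
    ≡⟨ cong (λ L → ∑ℕ L (⟦_⟧ ∘ P)) (rng-suc (length us)) ⟩
  ⟦ v <ᵇ u ⟧ ℕ.+ ∑ℕ (map suc (rng 1 (length us))) (⟦_⟧ ∘ P)
    ≡⟨ cong₂ ℕ._+_ (cong ⟦_⟧ (>ᵇ-not u≢v)) (trans (ℕ∑.∑-map suc (rng 1 (length us)) (⟦_⟧ ∘ P))
         (trans (ℕ∑.∑-cong∈ (rng 1 (length us)) (λ m → cong ⟦_⟧ (shift (proj₁ (∈-rng⁻ m))))) (sym (count-∑ P′ (rng 1 (length us)))))) ⟩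
  ⟦ not (u <ᵇ v) ⟧ ℕ.+ des (v ∷ us)
    ≡⟨ cong (⟦ not (u <ᵇ v) ⟧ ℕ.+_) (des-pat v us q) ⟩
  ⟦ not (u <ᵇ v) ⟧ ℕ.+ descents (pat (v ∷ us))
    ≡⟨ head (u <ᵇ v) ⟩
  descents (pat (u ∷ v ∷ us)) ∎
  where
  open ≡-Reasoning
  P P′ : ℕ → Bool
  P i = at (u ∷ v ∷ us) (suc i) <ᵇ at (u ∷ v ∷ us) i
  P′ i = at (v ∷ us) (suc i) <ᵇ at (v ∷ us) i
  shift : ∀ {i} → 1 ≤ i → P (suc i) ≡ P′ i
  shift (s≤s _) = refl
  head : ∀ b → ⟦ not b ⟧ ℕ.+ descents (pat (v ∷ us)) ≡ descents (b ∷ pat (v ∷ us))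
  head true  = refl
  head false = refl

peaks-∷ : ∀ a b p → peaks (a ∷ b ∷ p) ≡ ⟦ a ∧ not b ⟧ ℕ.+ peaks (b ∷ p)
peaks-∷ true  true  p = refl
peaks-∷ true  false p = refl
peaks-∷ false b     p = refl

pk-pat : ∀ u us → Unique (u ∷ us) → pk (u ∷ us) ≡ peaks (pat (u ∷ us))
pk-pat u []           q = refl
pk-pat u (v ∷ [])     q with u <ᵇ v
... | true  = refl
... | false = refl
pk-pat u (v ∷ x ∷ us) (_ ∷ (v≢x ∷ n) ∷ q) = begin
  count P (rng 2 (suc (suc (length us))))
    ≡⟨ count-∑ P (rng 2 (suc (suc (length us)))) ⟩
  ∑ℕ (map (2 ℕ.+_) (upTo (suc (length us)))) (⟦_⟧ ∘ P)
    ≡⟨ ∑-map (2 ℕ.+_) (upTo (suc (length us))) (⟦_⟧ ∘ P) ⟩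
  ∑ℕ (upTo (suc (length us))) (λ i → ⟦ P (2 ℕ.+ i) ⟧)
    ≡⟨ cong (λ L → ∑ℕ L (λ i → ⟦ P (2 ℕ.+ i) ⟧)) (upTo-suc (length us)) ⟩
  ⟦ (u <ᵇ v) ∧ (x <ᵇ v) ⟧ ℕ.+ ∑ℕ (map suc (upTo (length us))) (λ i → ⟦ P (2 ℕ.+ i) ⟧)
    ≡⟨ cong₂ ℕ._+_ (cong (λ z → ⟦ (u <ᵇ v) ∧ z ⟧) (>ᵇ-not v≢x)) (trans (∑-map suc (upTo (length us)) _) (sym rest)) ⟩
  ⟦ (u <ᵇ v) ∧ not (v <ᵇ x) ⟧ ℕ.+ pk (v ∷ x ∷ us)
    ≡⟨ cong (⟦ (u <ᵇ v) ∧ not (v <ᵇ x) ⟧ ℕ.+_) (pk-pat v (x ∷ us) ((v≢x ∷ n) ∷ q)) ⟩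
  ⟦ (u <ᵇ v) ∧ not (v <ᵇ x) ⟧ ℕ.+ peaks (pat (v ∷ x ∷ us))
    ≡⟨ peaks-∷ (u <ᵇ v) (v <ᵇ x) (pat (x ∷ us)) ⟨
  peaks (pat (u ∷ v ∷ x ∷ us)) ∎
  where
  open ≡-Reasoning
  open ℕ∑ using (∑-map)
  P P′ : ℕ → Bool
  P i = (at (u ∷ v ∷ x ∷ us) (i ∸ 1) <ᵇ at (u ∷ v ∷ x ∷ us) i) ∧ (at (u ∷ v ∷ x ∷ us) (suc i) <ᵇ at (u ∷ v ∷ x ∷ us) i)
  P′ i = (at (v ∷ x ∷ us) (i ∸ 1) <ᵇ at (v ∷ x ∷ us) i) ∧ (at (v ∷ x ∷ us) (suc i) <ᵇ at (v ∷ x ∷ us) i)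
  rest : pk (v ∷ x ∷ us) ≡ ∑ℕ (upTo (length us)) (λ i → ⟦ P (3 ℕ.+ i) ⟧)
  rest = trans (count-∑ P′ (rng 2 (suc (length us)))) (∑-map (2 ℕ.+_) (upTo (length us)) (⟦_⟧ ∘ P′))

linear : (ℕ → ℕ → Bool) → List ℕ → Bool
linear R (u ∷ v ∷ us) = R u v ∧ linear R (v ∷ us)
linear R _            = true

_>ᵇ_ : ℕ → ℕ → Bool
u >ᵇ v = v <ᵇ u

mono-linear : ∀ w → mono w ≡ linear _<ᵇ_ w ∨ linear _>ᵇ_ w
mono-linear w = cong₂ _∨_ (inc w) (dec w)
  where
  inc : ∀ w → incr w ≡ linear _<ᵇ_ w
  inc []           = refl
  inc (u ∷ [])     = refl
  inc (u ∷ v ∷ us) = cong ((u <ᵇ v) ∧_) (inc (v ∷ us))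
  dec : ∀ w → decr w ≡ linear _>ᵇ_ w
  dec []           = refl
  dec (u ∷ [])     = refl
  dec (u ∷ v ∷ us) = cong ((v <ᵇ u) ∧_) (dec (v ∷ us))

-- ℓ stands for the initial segment of length ℓ+1.
stops : (List ℕ → Bool) → List ℕ → ℕ → Bool
stops M v ℓ = (suc ℓ ≡ᵇ length v) ∨ not (M (take (suc (suc ℓ)) v))

-- Initial segments of linear words are linear, so the linear ones form a chain and only the longest
-- of them cannot be extended.
linear-stops : ∀ R x L → ∑ℕ (upTo (suc (length L))) (λ ℓ → ⟦ linear R (take (suc ℓ) (x ∷ L)) ∧ stops (linear R) (x ∷ L) ℓ ⟧) ≡ 1
linear-stops R x []      = refl
linear-stops R x (y ∷ L) = trans (cong (λ Z → ∑ℕ Z F) (upTo-suc (suc (length L)))) (trans (cong (F 0 ℕ.+_) (ℕ∑.∑-map suc (upTo (suc (length L))) F)) (cases (R x y) refl))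
  where
  F : ℕ → ℕ
  F ℓ = ⟦ linear R (take (suc ℓ) (x ∷ y ∷ L)) ∧ stops (linear R) (x ∷ y ∷ L) ℓ ⟧
  cases : ∀ b → R x y ≡ b → F 0 ℕ.+ ∑ℕ (upTo (suc (length L))) (F ∘ suc) ≡ 1
  cases true  e rewrite e = linear-stops R y L
  cases false e rewrite e = cong suc (ℕ∑.∑-zero (upTo (suc (length L))))

firstRun runAfter : List ℕ → ℕ
firstRun v = ∑ℕ (upTo (length v)) (λ ℓ → ⟦ mono (take (suc ℓ) v) ∧ stops mono v ℓ ⟧)
runAfter []      = 0
runAfter (p ∷ v) = ∑ℕ (upTo (length v)) (λ ℓ → ⟦ mono (take (suc ℓ) v) ∧ not (mono (p ∷ take (suc ℓ) v)) ∧ stops mono v ℓ ⟧)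

private
  ∑-proportional : ∀ N (f g : ℕ → ℕ) c → (∀ ℓ → f ℓ ≡ c ℕ.* g ℓ) → ∑ℕ (upTo N) g ≡ 1 → ∑ℕ (upTo N) f ≡ c
  ∑-proportional N f g c e s = trans (ℕ∑.∑-cong (upTo N) e) (trans (ℕ∑.∑-*ˡ (upTo N) c g) (trans (cong (c ℕ.*_) s) (ℕₚ.*-identityʳ c)))

-- `R` is the direction of the first step of the word and `R′` the opposite one, so that increasing
-- and decreasing runs share one argument: the first step excludes `R′`, and being monotone reduces
-- to being `R`-linear.
module Direction (R R′ : ℕ → ℕ → Bool) (mono≡ : ∀ w → mono w ≡ linear R w ∨ linear R′ w)
                 {u u′ : ℕ} (Ruu′ : R u u′ ≡ true) (R′uu′ : R′ u u′ ≡ false) (us : List ℕ) where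

  private
    v : List ℕ
    v = u ∷ u′ ∷ us

    mono-take : ∀ ℓ → mono (take (suc ℓ) v) ≡ linear R (take (suc ℓ) v)
    mono-take zero    = refl
    mono-take (suc ℓ) = trans (mono≡ (take (suc (suc ℓ)) v)) (trans (cong (λ z → linear R (take (suc (suc ℓ)) v) ∨ (z ∧ linear R′ (u′ ∷ take ℓ us))) R′uu′) (Boolₚ.∨-identityʳ _))

    stops≡ : ∀ ℓ → stops mono v ℓ ≡ stops (linear R) v ℓ
    stops≡ ℓ = cong (λ z → (suc ℓ ≡ᵇ length v) ∨ not z) (mono-take (suc ℓ))

    run : ℕ → ℕ
    run ℓ = ⟦ linear R (take (suc ℓ) v) ∧ stops (linear R) v ℓ ⟧

  firstRun≡1 : firstRun v ≡ 1
  firstRun≡1 = ∑-proportional (length v) (λ ℓ → ⟦ mono (take (suc ℓ) v) ∧ stops mono v ℓ ⟧) run 1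
    (λ ℓ → trans (cong ⟦_⟧ (cong₂ _∧_ (mono-take ℓ) (stops≡ ℓ))) (sym (ℕₚ.*-identityˡ (run ℓ)))) (linear-stops R u (u′ ∷ us))

  runAfter≡ : ∀ p → R p u ∨ R′ p u ≡ true → runAfter (p ∷ v) ≡ ⟦ not (R p u) ⟧
  runAfter≡ p one = ∑-proportional (length v) (λ ℓ → ⟦ mono (take (suc ℓ) v) ∧ not (mono (p ∷ take (suc ℓ) v)) ∧ stops mono v ℓ ⟧) run ⟦ not (R p u) ⟧
    term (linear-stops R u (u′ ∷ us))
    where
    bool : ∀ a b c → a ∧ (not (b ∧ a) ∧ c) ≡ not b ∧ (a ∧ c)
    bool true  true  c = refl
    bool true  false c = refl
    bool false true  c = refl
    bool false false c = refl
    mono-p : ∀ ℓ → mono (p ∷ take (suc (suc ℓ)) v) ≡ R p u ∧ linear R (take (suc (suc ℓ)) v)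
    mono-p ℓ = trans (mono≡ (p ∷ take (suc (suc ℓ)) v)) (trans (cong (λ z → (R p u ∧ linear R (take (suc (suc ℓ)) v)) ∨ (R′ p u ∧ (z ∧ linear R′ (u′ ∷ take ℓ us)))) R′uu′)
      (trans (cong ((R p u ∧ linear R (take (suc (suc ℓ)) v)) ∨_) (Boolₚ.∧-zeroʳ (R′ p u))) (Boolₚ.∨-identityʳ _)))
    term : ∀ ℓ → ⟦ mono (take (suc ℓ) v) ∧ not (mono (p ∷ take (suc ℓ) v)) ∧ stops mono v ℓ ⟧
               ≡ ⟦ not (R p u) ⟧ ℕ.* ⟦ linear R (take (suc ℓ) v) ∧ stops (linear R) v ℓ ⟧
    -- The one-letter segment counts on neither side: p and u together are monotone, and the step
    -- from u to u′ extends the segment in direction `R`.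
    term zero = trans (cong (λ z → ⟦ not z ∧ stops mono v 0 ⟧) (trans (mono≡ (p ∷ u ∷ [])) (trans (cong₂ _∨_ (Boolₚ.∧-identityʳ (R p u)) (Boolₚ.∧-identityʳ (R′ p u))) one)))
      (sym (trans (cong (λ z → ⟦ not (R p u) ⟧ ℕ.* ⟦ not (z ∧ true) ⟧) Ruu′) (ℕₚ.*-zeroʳ ⟦ not (R p u) ⟧)))
    term (suc ℓ) = trans (cong ⟦_⟧ (trans (cong₂ _∧_ (mono-take (suc ℓ)) (cong₂ _∧_ (cong not (mono-p ℓ)) (stops≡ (suc ℓ)))) (bool (linear R (take (suc (suc ℓ)) v)) (R p u) (stops (linear R) v (suc ℓ)))))
      (⟦⟧-∧ (not (R p u)) _)

private
  mono-linear′ : ∀ w → mono w ≡ linear _>ᵇ_ w ∨ linear _<ᵇ_ w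
  mono-linear′ w = trans (mono-linear w) (Boolₚ.∨-comm (linear _<ᵇ_ w) _)

firstRun-1 : ∀ u us → Unique (u ∷ us) → firstRun (u ∷ us) ≡ 1
firstRun-1 u []        q = refl
firstRun-1 u (u′ ∷ us) ((u≢u′ ∷ _) ∷ _) = cases (u <ᵇ u′) refl
  where
  cases : ∀ b → (u <ᵇ u′) ≡ b → firstRun (u ∷ u′ ∷ us) ≡ 1
  cases true  e = Direction.firstRun≡1 _<ᵇ_ _>ᵇ_ mono-linear {u} {u′} e (trans (>ᵇ-not u≢u′) (cong not e)) us
  cases false e = Direction.firstRun≡1 _>ᵇ_ _<ᵇ_ mono-linear′ {u} {u′} (trans (>ᵇ-not u≢u′) (cong not e)) e us

runAfter-differ : ∀ p u u′ us → Unique (p ∷ u ∷ u′ ∷ us) → runAfter (p ∷ u ∷ u′ ∷ us) ≡ differ (p <ᵇ u) (u <ᵇ u′)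
runAfter-differ p u u′ us ((p≢u ∷ _) ∷ (u≢u′ ∷ _) ∷ _) = cases (u <ᵇ u′) refl
  where
  total : ∀ a b → b ≡ not a → a ∨ b ≡ true
  total true  _    _    = refl
  total false true refl = refl
  dif : ∀ a → ⟦ not a ⟧ ≡ differ a true
  dif true  = refl
  dif false = refl
  dif′ : ∀ a → ⟦ not (not a) ⟧ ≡ differ a false
  dif′ true  = refl
  dif′ false = refl
  cases : ∀ b → (u <ᵇ u′) ≡ b → runAfter (p ∷ u ∷ u′ ∷ us) ≡ differ (p <ᵇ u) (u <ᵇ u′)
  cases true  e = trans (Direction.runAfter≡ _<ᵇ_ _>ᵇ_ mono-linear {u} {u′} e (trans (>ᵇ-not u≢u′) (cong not e)) us p (total (p <ᵇ u) (u <ᵇ p) (>ᵇ-not p≢u)))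
    (trans (dif (p <ᵇ u)) (cong (differ (p <ᵇ u)) (sym e)))
  cases false e = trans (Direction.runAfter≡ _>ᵇ_ _<ᵇ_ mono-linear′ {u} {u′} (trans (>ᵇ-not u≢u′) (cong not e)) e us p (trans (Boolₚ.∨-comm (u <ᵇ p) (p <ᵇ u)) (total (p <ᵇ u) (u <ᵇ p) (>ᵇ-not p≢u))))
    (trans (cong (λ z → ⟦ not z ⟧) (>ᵇ-not p≢u)) (trans (dif′ (p <ᵇ u)) (cong (differ (p <ᵇ u)) (sym e))))

isBirun : List ℕ → ℕ → ℕ → Bool
isBirun w i j = mono (seg w i j) ∧ ((i ≡ᵇ 1) ∨ not (mono (seg w (i ∸ 1) j))) ∧ ((j ≡ᵇ length w) ∨ not (mono (seg w i (suc j))))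

biruns-∑ : ∀ w → biruns w ≡ ∑ℕ (rng 1 (length w)) (λ i → ∑ℕ (rng i (length w)) (λ j → ⟦ isBirun w i j ⟧))
biruns-∑ w = trans (count-∑ (λ ij → isBirun w (proj₁ ij) (proj₂ ij)) pairs) (trans
  (ℕ∑.∑-concatMap (λ i → map (λ j → (i , j)) (rng i (length w))) (rng 1 (length w)) F)
  (ℕ∑.∑-cong (rng 1 (length w)) (λ i → ℕ∑.∑-map (λ j → (i , j)) (rng i (length w)) F)))
  where
  pairs = concatMap (λ i → map (λ j → (i , j)) (rng i (length w))) (rng 1 (length w))
  F : ℕ × ℕ → ℕ
  F ij = ⟦ isBirun w (proj₁ ij) (proj₂ ij) ⟧

private
  len-seg : ∀ i ℓ → suc (i ℕ.+ ℓ) ∸ i ≡ suc ℓ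
  len-seg zero    ℓ = refl
  len-seg (suc i) ℓ = len-seg i ℓ

  end-seg : ∀ i ℓ n → i ≤ n → (suc (i ℕ.+ ℓ) ≡ᵇ n) ≡ (suc ℓ ≡ᵇ n ∸ i)
  end-seg zero    ℓ n       l       = refl
  end-seg (suc i) ℓ (suc n) (s≤s l) = end-seg i ℓ n l

  drop-∷ : ∀ i (w : List ℕ) → suc i ≤ length w → ∃ λ p → drop i w ≡ p ∷ drop (suc i) w
  drop-∷ zero    (x ∷ w) l       = x , refl
  drop-∷ (suc i) (x ∷ w) (s≤s l) = drop-∷ i w l

  ∑-row : ∀ i n f → ∑ℕ (rng (suc i) n) f ≡ ∑ℕ (upTo (n ∸ i)) (λ ℓ → f (suc (i ℕ.+ ℓ)))
  ∑-row i n f = ℕ∑.∑-map (suc i ℕ.+_) (upTo (n ∸ i)) f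

  seg-suc : ∀ w i ℓ → seg w (suc i) (suc (i ℕ.+ ℓ)) ≡ take (suc ℓ) (drop i w)
  seg-suc w i ℓ = cong (λ k → take k (drop i w)) (len-seg i ℓ)

  stops-suc : ∀ w i ℓ → i ≤ length w → ((suc (i ℕ.+ ℓ) ≡ᵇ length w) ∨ not (mono (seg w (suc i) (suc (suc (i ℕ.+ ℓ)))))) ≡ stops mono (drop i w) ℓ
  stops-suc w i ℓ l = cong₂ (λ a b → a ∨ not (mono b)) (trans (end-seg i ℓ (length w) l) (cong (suc ℓ ≡ᵇ_) (sym (Listₚ.length-drop i w))))
    (cong (λ k → take k (drop i w)) (trans (cong (λ z → suc z ∸ i) (sym (ℕₚ.+-suc i ℓ))) (len-seg i (suc ℓ))))

birunsAt : List ℕ → ℕ → ℕ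
birunsAt w i = ∑ℕ (rng (suc i) (length w)) (λ j → ⟦ isBirun w (suc i) j ⟧)

birunsAt-zero : ∀ w → birunsAt w 0 ≡ firstRun w
birunsAt-zero w = trans (∑-row 0 (length w) _) (ℕ∑.∑-cong (upTo (length w)) (λ ℓ → cong ⟦_⟧ (cong₂ (λ a b → mono a ∧ b) (seg-suc w 0 ℓ) (stops-suc w 0 ℓ z≤n))))

birunsAt-suc : ∀ w i → suc i ≤ length w → birunsAt w (suc i) ≡ runAfter (drop i w)
birunsAt-suc w i l with drop-∷ i w l
... | p , e = trans (trans (∑-row (suc i) (length w) _) (trans
  (cong (λ k → ∑ℕ (upTo k) (λ ℓ → ⟦ isBirun w (suc (suc i)) (suc (suc i ℕ.+ ℓ)) ⟧)) (sym (Listₚ.length-drop (suc i) w)))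
  (ℕ∑.∑-cong (upTo (length (drop (suc i) w))) (λ ℓ → cong ⟦_⟧ (cong₂ _∧_ (cong mono (seg-suc w (suc i) ℓ))
    (cong₂ (λ a b → not (mono a) ∧ b) (trans (cong (λ k → take k (drop i w)) (trans (cong (λ z → suc z ∸ i) (sym (ℕₚ.+-suc i ℓ))) (len-seg i (suc ℓ)))) (cong (take (suc (suc ℓ))) e)) (stops-suc w (suc i) ℓ l))))))) (cong runAfter (sym e))

private
  runs-changes : ∀ u us → Unique (u ∷ us) → ∑ℕ (upTo (length us)) (λ i → runAfter (drop i (u ∷ us))) ≡ changes (pat (u ∷ us))
  runs-changes u []       q = refl
  runs-changes u (v ∷ us) (u∉ ∷ q) = trans (cong (λ L → ∑ℕ L (λ i → runAfter (drop i (u ∷ v ∷ us)))) (upTo-suc (length us)))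
    (trans (cong (runAfter (u ∷ v ∷ us) ℕ.+_) (trans (ℕ∑.∑-map suc (upTo (length us)) _) (runs-changes v us q))) (head us (u∉ ∷ q)))
    where
    head : ∀ us → Unique (u ∷ v ∷ us) → runAfter (u ∷ v ∷ us) ℕ.+ changes (pat (v ∷ us)) ≡ changes (pat (u ∷ v ∷ us))
    head []       ((u≢v ∷ _) ∷ _) = cong (λ z → ⟦ not z ∧ true ⟧ ℕ.+ 0 ℕ.+ 0) (trans (mono-linear (u ∷ v ∷ [])) (trans (cong₂ _∨_ (Boolₚ.∧-identityʳ (u <ᵇ v)) (trans (Boolₚ.∧-identityʳ (v <ᵇ u)) (>ᵇ-not u≢v))) (Boolₚ.∨-inverseʳ (u <ᵇ v))))
    head (x ∷ us) q = cong (ℕ._+ changes (pat (v ∷ x ∷ us))) (runAfter-differ u v x us q)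

-- Biruns are sorted by their starting point, which determines the end. The first letter starts one;
-- a later letter starts one exactly when the direction changes there, and the last of several
-- letters starts none, since it forms a monotone segment with its predecessor.
biruns-changes : ∀ u us → Unique (u ∷ us) → biruns (u ∷ us) ≡ suc (changes (pat (u ∷ us)))
biruns-changes u us q = begin
  biruns w
    ≡⟨ biruns-∑ w ⟩
  ∑ℕ (rng 1 (length w)) (λ i → ∑ℕ (rng i (length w)) (λ j → ⟦ isBirun w i j ⟧))
    ≡⟨ ℕ∑.∑-map suc (upTo (length w)) _ ⟩
  ∑ℕ (upTo (suc (length us))) (birunsAt w)
    ≡⟨ cong (λ L → ∑ℕ L (birunsAt w)) (upTo-suc (length us)) ⟩
  birunsAt w 0 ℕ.+ ∑ℕ (map suc (upTo (length us))) (birunsAt w)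
    ≡⟨ cong₂ ℕ._+_ (trans (birunsAt-zero w) (firstRun-1 u us q)) (ℕ∑.∑-map suc (upTo (length us)) (birunsAt w)) ⟩
  suc (∑ℕ (upTo (length us)) (λ i → birunsAt w (suc i)))
    ≡⟨ cong suc (ℕ∑.∑-cong∈ (upTo (length us)) (λ {i} m → birunsAt-suc w i (ℕₚ.≤-trans (∈ₚ.∈-upTo⁻ m) (ℕₚ.n≤1+n _)))) ⟩
  suc (∑ℕ (upTo (length us)) (λ i → runAfter (drop i w)))
    ≡⟨ cong suc (runs-changes u us q) ⟩
  suc (changes (pat w)) ∎
  where
  open ≡-Reasoning
  w = u ∷ us

-- The extra one-letter run is the change of direction against a fictitious ascent in front of the
-- word.
udr-pat : ∀ u us → Unique (u ∷ us) → udr (u ∷ us) ≡ suc (changes (true ∷ pat (u ∷ us)))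
udr-pat u []       q = refl
udr-pat u (v ∷ us) ((u≢v ∷ r) ∷ q) = trans (cong₂ (λ a b → a ℕ.+ (if b then 1 else 0)) (biruns-changes u (v ∷ us) ((u≢v ∷ r) ∷ q)) (>ᵇ-not u≢v))
  (cong suc (trans (ℕₚ.+-comm _ (if not (u <ᵇ v) then 1 else 0)) (cong (ℕ._+ changes (pat (u ∷ v ∷ us))) (dif (u <ᵇ v)))))
  where
  dif : ∀ b → (if not b then 1 else 0) ≡ differ true b
  dif true  = refl
  dif false = refl

-- Cycles

and-true : ∀ {I : Set} {p : I → Bool} (L : List I) → (∀ {x} → x ∈ L → p x ≡ true) → and (map p L) ≡ true
and-true []      h = refl
and-true (x ∷ L) h rewrite h (here refl) = and-true L (h ∘ there)

and-false : ∀ {I : Set} {p : I → Bool} {L : List I} {x} → x ∈ L → p x ≡ false → and (map p L) ≡ false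
and-false (here refl) e rewrite e = refl
and-false {p = p} {y ∷ L} (there m) e with p y
... | true  = and-false m e
... | false = refl

firstHit : (ℕ → Bool) → List ℕ → ℕ
firstHit p []       = 0
firstHit p (m ∷ ms) = if p m then m else firstHit p ms

-- The local search function of cycleLen has no name; the type of search is inferred from its use.
mutual
  cycleLen-firstHit : ∀ w i → cycleLen w i ≡ firstHit (λ m → iter w m i ≡ᵇ i) (rng 1 (length w))
  cycleLen-firstHit w i with rng 1 (length w)
  ... | L = search w i L

  private
    search : ∀ w i L → _ ≡ firstHit (λ m → iter w m i ≡ᵇ i) L
    search w i []       = refl
    search w i (m ∷ ms) = cong (if iter w m i ≡ᵇ i then m else_) (search w i ms)

firstHit-applyUpTo : ∀ p f n k → k < n → p (f k) ≡ true → (∀ {i} → i < k → p (f i) ≡ false) → firstHit p (applyUpTo f n) ≡ f k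
firstHit-applyUpTo p f (suc n) zero    _       t h rewrite t = refl
firstHit-applyUpTo p f (suc n) (suc k) (s≤s l) t h rewrite h (s≤s z≤n) = firstHit-applyUpTo p (f ∘ suc) n k l t (h ∘ s≤s)

iter-shift : ∀ w m i → iter w (suc m) i ≡ iter w m (at w i)
iter-shift w zero    i = refl
iter-shift w (suc m) i = cong (at w) (iter-shift w m i)

Walk : List ℕ → ℕ → List ℕ → ℕ → Set
Walk w a []      b = at w a ≡ b
Walk w a (x ∷ l) b = at w a ≡ x × Walk w x l b

Walk-∷ʳ : ∀ {w} y l {a b} → Walk w y l a → at w a ≡ b → Walk w y (l ++ a ∷ []) b
Walk-∷ʳ y []      e e′ = e , e′
Walk-∷ʳ y (x ∷ l) (e , k) e′ = e , Walk-∷ʳ x l k e′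

-- Each step along the closed walk moves its old starting point to the end of the list; m collects
-- the points already passed, and l shrinks until x is the start.
Walk-rotate : ∀ {w} a l m {x} → Walk w a (l ++ m) a → x ∈ a ∷ l → ∃ λ l′ → Walk w x l′ x × x ∷ l′ ↭ a ∷ l ++ m
Walk-rotate a l       m k       (here refl) = l ++ m , k , ↭-refl
Walk-rotate {w} a (y ∷ l) m {x} (e , k) (there mx)
  with Walk-rotate y l (m ++ a ∷ []) (≡.subst (λ z → Walk w y z y) (Listₚ.++-assoc l m (a ∷ [])) (Walk-∷ʳ y (l ++ m) k e)) mx
... | l′ , k′ , p = l′ , k′ , ↭-trans p (↭-trans (≡.subst (λ z → y ∷ z ↭ (y ∷ l ++ m) ++ a ∷ []) (Listₚ.++-assoc l m (a ∷ [])) ↭-refl)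
    (↭-sym (↭ₚ.∷↭∷ʳ a (y ∷ l ++ m))))

Walk-closed : ∀ {w} a l {b y} → Walk w a l b → y ∈ a ∷ l → at w y ∈ l ++ b ∷ []
Walk-closed a []      e (here refl) = here e
Walk-closed a (x ∷ l) (e , k) (here refl) = here e
Walk-closed a (x ∷ l) (e , k) (there m)   = there (Walk-closed x l k m)

Walk-iter : ∀ {w} a l₁ {x l₂ b} → Walk w a (l₁ ++ x ∷ l₂) b → iter w (suc (length l₁)) a ≡ x
Walk-iter a []       (e , _) = e
Walk-iter {w} a (y ∷ l₁) (e , k) = trans (iter-shift w (suc (length l₁)) a) (trans (cong (iter w (suc (length l₁))) e) (Walk-iter y l₁ k))

Walk-return : ∀ {w} a l {b} → Walk w a l b → iter w (suc (length l)) a ≡ b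
Walk-return a []      e = e
Walk-return {w} a (y ∷ l) (e , k) = trans (iter-shift w (suc (length l)) a) (trans (cong (iter w (suc (length l))) e) (Walk-return y l k))

-- The searches in `cycleLen` and `cycleMin` stop at `length w`; `small` ensures that they go once
-- around the cycle.
module Orbit {w x l} (k : Walk w x l x) (u : Unique (x ∷ l)) (small : suc (length l) ≤ length w) where

  iter∈ : ∀ m → iter w m x ∈ x ∷ l
  iter∈ zero    = here refl
  iter∈ (suc m) = ↭ₚ.∈-resp-↭ (↭-sym (↭ₚ.∷↭∷ʳ x l)) (Walk-closed x l k (iter∈ m))

  private
    split : ∀ i (l : List ℕ) → i < length l → ∃₂ λ l₁ y → ∃ λ l₂ → l ≡ l₁ ++ y ∷ l₂ × length l₁ ≡ i
    split zero    (y ∷ l) _       = [] , y , l , refl , refl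
    split (suc i) (z ∷ l) (s≤s p) with split i l p
    ... | l₁ , y , l₂ , e , e′ = z ∷ l₁ , y , l₂ , cong (z ∷_) e , cong suc e′

    x∉l : ∀ {y} → y ∈ l → x ≢ y
    x∉l = All.lookup (AllPairs.head u)

  cycleLen≡ : cycleLen w x ≡ suc (length l)
  cycleLen≡ = trans (cycleLen-firstHit w x) (trans (cong (firstHit p) (Listₚ.map-upTo suc (length w)))
    (firstHit-applyUpTo p suc (length w) (length l) small (trans (cong (_≡ᵇ x) (Walk-return x l k)) (≡ᵇ-true x)) early))
    where
    p : ℕ → Bool
    p m = iter w m x ≡ᵇ x
    -- Before the return the iterates are entries of l, and these differ from x.
    early : ∀ {i} → i < length l → p (suc i) ≡ false
    early {i} lt with split i l lt
    ... | l₁ , y , l₂ , e , refl = ≡ᵇ-false (λ q → x∉l (≡.subst (y ∈_) (sym e) (∈ₚ.∈-++⁺ʳ l₁ (here refl)))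
      (trans (sym q) (Walk-iter x l₁ (≡.subst (λ z → Walk w x z x) e k))))

  cycleMin-true : All (x <_) l → cycleMin w x ≡ true
  cycleMin-true a = and-true (rng 1 (length w)) (λ {m} _ → T⇒≡ (ℕₚ.≤⇒≤ᵇ (least (iter∈ m))))
    where
    least : ∀ {y} → y ∈ x ∷ l → x ≤ y
    least (here refl) = ℕₚ.≤-refl
    least (there m)   = ℕₚ.<⇒≤ (All.lookup a m)

  cycleMin-false : ∀ {y} → y ∈ l → y < x → cycleMin w x ≡ false
  cycleMin-false {y} m lt with ∈-∃++ m
  ... | l₁ , l₂ , refl = and-false (∈-rng⁺ (s≤s z≤n) bound)
      (¬T⇒≡ (λ t → ℕₚ.<⇒≱ lt (≡.subst (x ≤_) (Walk-iter x l₁ k) (ℕₚ.≤ᵇ⇒≤ x _ t))))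
    where
    bound : suc (length l₁) ≤ length w
    bound = ℕₚ.≤-trans (s≤s (ℕₚ.≤-trans (ℕₚ.m≤m+n (length l₁) (suc (length l₂))) (ℕₚ.≤-reflexive (sym (Listₚ.length-++ l₁))))) small

-- A cycle is stored as its least element r and the list xs of its other elements in the
-- reverse of the order in which they are visited from r.

Edge : Set
Edge = ℕ × ℕ

hd : List ℕ → ℕ → ℕ
hd []      r = r
hd (x ∷ _) r = x

-- An edge (c , v) stands for the condition w(c) = v. The reversed order makes the extension of a
-- path a cons: the new edge leaves the current end `hd xs r`.
pathE : List ℕ → ℕ → List Edge
pathE []       r = []
pathE (x ∷ xs) r = (hd xs r , x) ∷ pathE xs r

cycEs : List (ℕ × List ℕ) → List Edge
cycEs []              = []
cycEs ((r , xs) ∷ cs) = (hd xs r , r) ∷ pathE xs r ++ cycEs cs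

sources targets : List Edge → List ℕ
sources = map proj₁
targets = map proj₂

sat : List ℕ → List Edge → Bool
sat w []            = true
sat w ((c , v) ∷ E) = (at w c ≡ᵇ v) ∧ sat w E

sat⇒ : ∀ {w E} → True (sat w E) → ∀ {c v} → (c , v) ∈ E → at w c ≡ v
sat⇒ {w} {(c , v) ∷ E} t (here refl) = ℕₚ.≡ᵇ⇒≡ (at w c) v (proj₁ (True-∧ t))
sat⇒ {w} {(c , v) ∷ E} t (there m)   = sat⇒ {w} {E} (proj₂ (True-∧ {at w c ≡ᵇ v} t)) m

sat⇐ : ∀ {w} E → (∀ {c v} → (c , v) ∈ E → at w c ≡ v) → sat w E ≡ true
sat⇐ []                h = refl
sat⇐ {w} ((c , v) ∷ E) h rewrite h (here refl) | ≡ᵇ-true v = sat⇐ E (h ∘ there)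

sources-cyc : ∀ xs r → hd xs r ∷ sources (pathE xs r) ≡ xs ++ r ∷ []
sources-cyc []       r = refl
sources-cyc (x ∷ xs) r = cong (x ∷_) (sources-cyc xs r)

members : List (ℕ × List ℕ) → List ℕ
members = concatMap (λ c → proj₂ c ++ proj₁ c ∷ [])

sources-cycEs : ∀ cs → sources (cycEs cs) ≡ members cs
sources-cycEs []              = refl
sources-cycEs ((r , xs) ∷ cs) = trans (cong (hd xs r ∷_) (Listₚ.map-++ proj₁ (pathE xs r) (cycEs cs)))
  (cong₂ _++_ (sources-cyc xs r) (sources-cycEs cs))

path-Walk : ∀ {w} xs r {l b} → (∀ {c v} → (c , v) ∈ pathE xs r → at w c ≡ v) → Walk w (hd xs r) l b → Walk w r (xs ʳ++ l) b
path-Walk []       r h k = k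
path-Walk (x ∷ xs) r h k = path-Walk xs r (h ∘ there) (h (here refl) , k)

-- The parity is `even` because the least element of the cycle is stored apart from the list.
oddCycles : List (ℕ × List ℕ) → Bool
oddCycles = and ∘ map (λ c → even (length (proj₂ c)))

-- Translates the statistics defined by iterating w into data of `cs`. Every element lies in a
-- listed cycle; rotating the closed walk so that it begins there gives the cycle length, and
-- comparison with the least element decides `cycleMin`.
module Decomposition {n w} (p : w ↭ rng 1 n) (cs : List (ℕ × List ℕ))
  (s : True (sat w (cycEs cs))) (cover : members cs ↭ rng 1 n) (least : All (λ c → All (proj₁ c <_) (proj₂ c)) cs) where

  private
    module P = Perm n p

    ⊆edges : ∀ {r xs} cs → (r , xs) ∈ cs → ∀ {e} → e ∈ (hd xs r , r) ∷ pathE xs r → e ∈ cycEs cs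
    ⊆edges ((r , xs) ∷ cs) (here refl) (here refl) = here refl
    ⊆edges ((r , xs) ∷ cs) (here refl) (there m)   = there (∈ₚ.∈-++⁺ˡ m)
    ⊆edges ((r , xs) ∷ cs) (there mc)  m           = there (∈ₚ.∈-++⁺ʳ (pathE xs r) (⊆edges cs mc m))

    walk : ∀ {r xs} → (r , xs) ∈ cs → Walk w r (reverse xs) r
    walk {r} {xs} mc = path-Walk xs r (λ m → sat⇒ s (⊆edges cs mc (there m))) (sat⇒ s (⊆edges cs mc (here refl)))

    cyc↭ : ∀ (r : ℕ) xs → r ∷ reverse xs ↭ xs ++ r ∷ []
    cyc↭ r xs = ↭-trans (prep r (↭ₚ.↭-reverse xs)) (↭ₚ.∷↭∷ʳ r xs)

    cyc-rest : ∀ {c} cs → c ∈ cs → ∃ λ L → members cs ↭ (proj₂ c ++ proj₁ c ∷ []) ++ L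
    cyc-rest (c ∷ cs) (here refl) = members cs , ↭-refl
    cyc-rest {c} (c′ ∷ cs) (there m) with cyc-rest cs m
    ... | L , q = (proj₂ c′ ++ proj₁ c′ ∷ []) ++ L , ↭-trans (↭ₚ.++⁺ˡ (proj₂ c′ ++ proj₁ c′ ∷ []) q) (↭ₚ.shifts (proj₂ c′ ++ proj₁ c′ ∷ []) (proj₂ c ++ proj₁ c ∷ []))

    module Elem {r xs} (mc : (r , xs) ∈ cs) {x} (mx : x ∈ xs ++ r ∷ []) where
      private
        rot = Walk-rotate r (reverse xs) [] (≡.subst (λ z → Walk w r z r) (sym (Listₚ.++-identityʳ (reverse xs))) (walk mc)) (↭ₚ.∈-resp-↭ (↭-sym (cyc↭ r xs)) mx)
      l = proj₁ rot
      l↭ : x ∷ l ↭ xs ++ r ∷ []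
      l↭ = ↭-trans (proj₂ (proj₂ rot)) (≡.subst (λ z → r ∷ z ↭ xs ++ r ∷ []) (sym (Listₚ.++-identityʳ (reverse xs))) (cyc↭ r xs))
      private
        rest = cyc-rest cs mc
        whole : (xs ++ r ∷ []) ++ proj₁ rest ↭ w
        whole = ↭-trans (↭-sym (proj₂ rest)) (↭-trans cover (↭-sym p))
      uniq : Unique (x ∷ l)
      uniq = Unique-↭ (↭-sym l↭) (Uniqueˡ (xs ++ r ∷ []) (Unique-↭ (↭-sym whole) P.uniq))
        where
        Uniqueˡ : ∀ (as : List ℕ) {bs} → Unique (as ++ bs) → Unique as
        Uniqueˡ []       _       = []
        Uniqueˡ (a ∷ as) (q ∷ u) = Allₚ.++⁻ˡ as q ∷ Uniqueˡ as u
      small : suc (length l) ≤ length w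
      small = ℕₚ.≤-trans (ℕₚ.≤-reflexive (↭ₚ.↭-length l↭)) (ℕₚ.≤-trans (ℕₚ.m≤m+n _ (length (proj₁ rest)))
        (ℕₚ.≤-reflexive (trans (sym (Listₚ.length-++ (xs ++ r ∷ []))) (↭ₚ.↭-length whole))))
      open Orbit {w} {x} {l} (proj₁ (proj₂ rot)) uniq small public
      len : cycleLen w x ≡ suc (length xs)
      len = trans cycleLen≡ (trans (↭ₚ.↭-length l↭) (trans (Listₚ.length-++ xs) (ℕₚ.+-comm (length xs) 1)))

    locate : ∀ {x} cs → x ∈ members cs → ∃ λ c → c ∈ cs × x ∈ proj₂ c ++ proj₁ c ∷ []
    locate (c ∷ cs) m with ∈ₚ.∈-++⁻ (proj₂ c ++ proj₁ c ∷ []) m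
    ... | inj₁ m′ = c , here refl , m′
    ... | inj₂ m′ with locate cs m′
    ...   | c′ , mc , mx = c′ , there mc , mx

    min-of : ∀ {r xs} → (r , xs) ∈ cs → ∑ℕ (xs ++ r ∷ []) (λ x → ⟦ cycleMin w x ⟧) ≡ 1
    min-of {r} {xs} mc = trans (ℕ∑.∑-++ xs (r ∷ []) _) (cong₂ ℕ._+_
        (ℕ∑.∑-zero∈ xs (λ m → cong ⟦_⟧ (other m)))
        (cong (λ b → ⟦ b ⟧ ℕ.+ 0) (E.cycleMin-true (↭ₚ.All-resp-↭ (↭ₚ.drop-∷ (↭-trans (↭ₚ.∷↭∷ʳ r xs) (↭-sym E.l↭))) (All.lookup least mc)))))
      where
      module E = Elem mc (∈ₚ.∈-++⁺ʳ xs (here refl))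
      other : ∀ {x} → x ∈ xs → cycleMin w x ≡ false
      other {x} m = F.cycleMin-false r∈ lt
        where
        module F = Elem mc (∈ₚ.∈-++⁺ˡ {ys = r ∷ []} m)
        lt : r < x
        lt = All.lookup (All.lookup least mc) m
        r∈ : r ∈ F.l
        r∈ with ↭ₚ.∈-resp-↭ (↭-sym F.l↭) (∈ₚ.∈-++⁺ʳ xs (here refl))
        ... | here refl = contradiction lt (ℕₚ.<-irrefl refl)
        ... | there q   = q

    ∑-mins : ∀ ds → (∀ {c} → c ∈ ds → c ∈ cs) → ∑ℕ (members ds) (λ x → ⟦ cycleMin w x ⟧) ≡ length ds
    ∑-mins []              h = refl
    ∑-mins ((r , xs) ∷ ds) h = trans (ℕ∑.∑-++ (xs ++ r ∷ []) (members ds) _) (cong₂ ℕ._+_ (min-of (h (here refl))) (∑-mins ds (h ∘ there)))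

    parity : ∀ k → (suc k % 2 ≡ᵇ 1) ≡ even k
    parity zero          = refl
    parity (suc zero)    = refl
    parity (suc (suc k)) = parity k

  numCycles≡ : numCycles w ≡ length cs
  numCycles≡ = trans (count-∑ (cycleMin w) (rng 1 (length w))) (trans (cong (λ k → ∑ℕ (rng 1 k) (λ x → ⟦ cycleMin w x ⟧)) P.len)
    (trans (ℕ∑.∑-↭ _ (↭-sym cover)) (∑-mins cs id)))

  private
    oddᵇ : ℕ → Bool
    oddᵇ i = cycleLen w i % 2 ≡ᵇ 1

    odd-at : ∀ {r xs} → (r , xs) ∈ cs → ∀ {x} → x ∈ xs ++ r ∷ [] → oddᵇ x ≡ even (length xs)
    odd-at {r} {xs} mc mx = trans (cong (λ z → z % 2 ≡ᵇ 1) (Elem.len mc mx)) (parity (length xs))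

    ∈rng-len : ∀ {x} → x ∈ members cs → x ∈ rng 1 (length w)
    ∈rng-len {x} m = ≡.subst (λ k → x ∈ rng 1 k) (sym P.len) (↭ₚ.∈-resp-↭ cover m)

    evenCycle : ∀ ds → (∀ {c} → c ∈ ds → c ∈ cs) → oddCycles ds ≡ false → ∃ λ c → c ∈ cs × even (length (proj₂ c)) ≡ false
    evenCycle (c ∷ ds) h e with even (length (proj₂ c)) in eq
    ... | false = c , h (here refl) , eq
    ... | true  = evenCycle ds (h ∘ there) e

    all-odd : ∀ ds → oddCycles ds ≡ true → ∀ {c} → c ∈ ds → even (length (proj₂ c)) ≡ true
    all-odd (c ∷ ds) e (here refl) = T⇒≡ (proj₁ (True-∧ (≡⇒T e)))
    all-odd (c ∷ ds) e (there m)   = all-odd ds (T⇒≡ (proj₂ (True-∧ {even (length (proj₂ c))} (≡⇒T e)))) m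

    mem : ∀ {c} ds → c ∈ ds → proj₁ c ∈ members ds
    mem (c ∷ ds) (here refl) = ∈ₚ.∈-++⁺ˡ (∈ₚ.∈-++⁺ʳ (proj₂ c) (here refl))
    mem (c ∷ ds) (there m)   = ∈ₚ.∈-++⁺ʳ (proj₂ c ++ proj₁ c ∷ []) (mem ds m)

  allCyclesOdd≡ : allCyclesOdd w ≡ oddCycles cs
  allCyclesOdd≡ = cases (oddCycles cs) refl
    where
    cases : ∀ b → oddCycles cs ≡ b → allCyclesOdd w ≡ oddCycles cs
    cases true e = trans (and-true (rng 1 (length w)) one) (sym e)
      where
      one : ∀ {x} → x ∈ rng 1 (length w) → oddᵇ x ≡ true
      one {x} m with locate cs (↭ₚ.∈-resp-↭ (↭-sym cover) (≡.subst (λ k → x ∈ rng 1 k) P.len m))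
      ... | c , mc , mx = trans (odd-at mc mx) (all-odd cs e mc)
    cases false e with evenCycle cs id e
    ... | c , mc , ev = trans (and-false (∈rng-len (mem cs mc)) (trans (odd-at mc (∈ₚ.∈-++⁺ʳ (proj₂ c) (here refl))) ev)) (sym e)

-- Permutations are built by following cycles: closedCount m g and openCount m b g sum g (number of further
-- cycles) over the completions by m elements such that all cycles are odd, when no cycle is open,
-- resp. when a cycle of odd (b = true) or even (b = false) current length is open.
closedCount : ℕ → (ℕ → ℕ) → ℕ
openCount : ℕ → Bool → (ℕ → ℕ) → ℕ
closedCount zero    g = g 0
closedCount (suc m) g = openCount m true g
openCount zero    b g = if b then g 1 else 0
openCount (suc m) b g = (if b then closedCount (suc m) (g ∘ suc) else 0) ℕ.+ suc m ℕ.* openCount m (not b) g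

-- Brings the two cases of the recursion into one formula; for m = 0 the truncated `m ∸ 1` is
-- multiplied by 0.
openCount-close : ∀ m b g → (if b then closedCount m (g ∘ suc) else 0) ℕ.+ m ℕ.* openCount (m ∸ 1) (not b) g ≡ openCount m b g
openCount-close zero    b g = ℕₚ.+-identityʳ _
openCount-close (suc m) b g = refl

closedCount-cong : ∀ m {g h : ℕ → ℕ} → (∀ c → g c ≡ h c) → closedCount m g ≡ closedCount m h
openCount-cong : ∀ m b {g h : ℕ → ℕ} → (∀ c → g c ≡ h c) → openCount m b g ≡ openCount m b h
closedCount-cong zero    e = e 0
closedCount-cong (suc m) e = openCount-cong m true e
openCount-cong zero    b     e = cong (λ z → if b then z else 0) (e 1)
openCount-cong (suc m) b {g} {h} e = cong₂ (λ y z → (if b then y else 0) ℕ.+ suc m ℕ.* z) (closedCount-cong (suc m) {g ∘ suc} {h ∘ suc} (e ∘ suc)) (openCount-cong m (not b) e)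

even-suc : ∀ n → even (suc n) ≡ not (even n)
even-suc zero          = refl
even-suc (suc zero)    = refl
even-suc (suc (suc n)) = even-suc n

-- Summation over permutations along their cycles

assoc : List Edge → ℕ → ℕ
assoc []            i = 0
assoc ((c , v) ∷ E) i = if i ≡ᵇ c then v else assoc E i

assoc-∈ : ∀ {E} → Unique (sources E) → ∀ {c v} → (c , v) ∈ E → assoc E c ≡ v
assoc-∈ {(c , v) ∷ E} u (here refl) = cong (λ b → if b then v else assoc E c) (≡ᵇ-true c)
assoc-∈ {(c , v) ∷ E} (a ∷ u) {c′} (there m) = trans (cong (λ b → if b then v else assoc E c′) (≡ᵇ-false {c′} {c} (λ e → All.lookup a (∈ₚ.∈-map⁺ proj₁ m) (sym e)))) (assoc-∈ u m)

map-assoc : ∀ E → Unique (sources E) → map (assoc E) (sources E) ≡ targets E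
map-assoc E u = go E id
  where
  go : ∀ F → (∀ {e} → e ∈ F → e ∈ E) → map (assoc E) (sources F) ≡ targets F
  go []            h = refl
  go ((c , v) ∷ F) h = cong₂ _∷_ (assoc-∈ u (h (here refl))) (go F (h ∘ there))

AllPairs-remove : ∀ {I : Set} {Q : I → I → Set} as {v bs} → AllPairs Q (as ++ v ∷ bs) → AllPairs Q (as ++ bs)
AllPairs-remove []       (_ ∷ q) = q
AllPairs-remove (a ∷ as) (p ∷ q) = Allₚ.++⁺ (Allₚ.++⁻ˡ as p) (All.tail (Allₚ.++⁻ʳ as p)) ∷ AllPairs-remove as q

module _ (n : ℕ) (g : ℕ → ℕ) where

  private
    f : List ℕ → ℕ
    f w = ⟦ allCyclesOdd w ⟧ ℕ.* g (numCycles w)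

    Z : List Edge → ℕ
    Z E = ∑ℕ (Sym n) (λ w → ⟦ sat w E ⟧ ℕ.* f w)

    at-range : ∀ {w c} → w ∈ Sym n → c ∈ rng 1 n → at w c ∈ rng 1 n
    at-range {w} {c} m mc = let module P = Perm n (Sym⁻ n m); l , u = ∈-rng⁻ mc in
      ↭ₚ.∈-resp-↭ (Sym⁻ n m) (at∈ w l (ℕₚ.≤-trans u (ℕₚ.≤-reflexive (sym P.len))))

    at-inj : ∀ {w c c′} → w ∈ Sym n → c ∈ rng 1 n → c′ ∈ rng 1 n → at w c ≡ at w c′ → c ≡ c′
    at-inj {w} {c} {c′} m mc mc′ e = let module P = Perm n (Sym⁻ n m); l , u = ∈-rng⁻ mc; l′ , u′ = ∈-rng⁻ mc′ in
      trans (sym (indexOf-at P.uniq l (ℕₚ.≤-trans u (ℕₚ.≤-reflexive (sym P.len))))) (trans (cong (λ z → indexOf z w) e)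
        (indexOf-at P.uniq l′ (ℕₚ.≤-trans u′ (ℕₚ.≤-reflexive (sym P.len)))))

    Z-split : ∀ c E → c ∈ rng 1 n → Z E ≡ ∑ℕ (rng 1 n) (λ v → Z ((c , v) ∷ E))
    Z-split c E mc = trans (ℕ∑.∑-cong∈ (Sym n) (λ {w} m → one w m)) (ℕ∑.∑-swap (Sym n) (rng 1 n) (λ w v → ⟦ sat w ((c , v) ∷ E) ⟧ ℕ.* f w))
      where
      one : ∀ w → w ∈ Sym n → ⟦ sat w E ⟧ ℕ.* f w ≡ ∑ℕ (rng 1 n) (λ v → ⟦ (at w c ≡ᵇ v) ∧ sat w E ⟧ ℕ.* f w)
      one w m = sym (trans (∑-single (Unique-rng n) (at-range m mc) (λ {v} _ ne → cong (λ b → ⟦ b ∧ sat w E ⟧ ℕ.* f w) (≡ᵇ-false (ne ∘ sym))))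
        (cong (λ b → ⟦ b ∧ sat w E ⟧ ℕ.* f w) (≡ᵇ-true (at w c))))

    Z-used : ∀ c v E → c ∈ rng 1 n → c ∉ sources E → (∀ {c′} → c′ ∈ sources E → c′ ∈ rng 1 n) → v ∈ targets E → Z ((c , v) ∷ E) ≡ 0
    Z-used c v E mc c∉ src mv with ∈ₚ.∈-map⁻ proj₂ mv
    ... | (c′ , _) , me , refl = ℕ∑.∑-zero∈ (Sym n) zero-at
      where
      zero-at : ∀ {w} → w ∈ Sym n → ⟦ sat w ((c , v) ∷ E) ⟧ ℕ.* f w ≡ 0
      zero-at {w} m with sat w ((c , v) ∷ E) in eq
      ... | false = refl
      ... | true  = contradiction (≡.subst (_∈ sources E) (sym c≡c′) (∈ₚ.∈-map⁺ proj₁ me)) c∉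
        where
        t : True (sat w ((c , v) ∷ E))
        t = ≡⇒T eq
        c≡c′ : c ≡ c′
        c≡c′ = at-inj m mc (src (∈ₚ.∈-map⁺ proj₁ me)) (trans (sat⇒ {w} {(c , v) ∷ E} t (here refl)) (sym (sat⇒ {w} {(c , v) ∷ E} t (there me))))

    -- With every value prescribed exactly one permutation is left, `w0`, and `Decomposition` reads
    -- its cycles off `cs`.
    Z-complete : ∀ cs → targets (cycEs cs) ↭ rng 1 n → sources (cycEs cs) ↭ rng 1 n → All (λ c → All (proj₁ c <_) (proj₂ c)) cs →
      Z (cycEs cs) ≡ ⟦ oddCycles cs ⟧ ℕ.* g (length cs)
    Z-complete cs tg sc ls = begin
      Z E                                          ≡⟨ ∑-single (Unique-Sym n) (Sym⁺ n w0↭) other ⟩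
      ⟦ sat w0 E ⟧ ℕ.* f w0                        ≡⟨ cong (λ b → ⟦ b ⟧ ℕ.* f w0) sat0 ⟩
      1 ℕ.* f w0                                   ≡⟨ ℕₚ.*-identityˡ (f w0) ⟩
      f w0                                         ≡⟨ cong₂ (λ b k → ⟦ b ⟧ ℕ.* g k) D.allCyclesOdd≡ D.numCycles≡ ⟩
      ⟦ oddCycles cs ⟧ ℕ.* g (length cs) ∎
      where
      open ≡-Reasoning
      E = cycEs cs
      uS = Unique-↭ (↭-sym sc) (Unique-rng n)
      w0 = map (assoc E) (rng 1 n)
      w0↭ : w0 ↭ rng 1 n
      w0↭ = ↭-trans (↭ₚ.map⁺ (assoc E) (↭-sym sc)) (≡.subst (_↭ rng 1 n) (sym (map-assoc E uS)) tg)
      at-w0 : ∀ {c v} → (c , v) ∈ E → at w0 c ≡ v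
      at-w0 m = let l , u = ∈-rng⁻ (↭ₚ.∈-resp-↭ sc (∈ₚ.∈-map⁺ proj₁ m)) in trans (at-map-rng (assoc E) n l u) (assoc-∈ uS m)
      sat0 : sat w0 E ≡ true
      sat0 = sat⇐ E at-w0
      module D = Decomposition {n} {w0} w0↭ cs (≡⇒T sat0) (≡.subst (_↭ rng 1 n) (sources-cycEs cs) sc) ls
      determined : ∀ {w} → w ∈ Sym n → True (sat w E) → w ≡ w0
      determined {w} m t = trans (sym (map-at-rng w)) (trans (cong (λ k → map (at w) (rng 1 k)) (Perm.len n (Sym⁻ n m)))
        (Listₚ.map-cong-local (All.tabulate agree)))
        where
        agree : ∀ {c} → c ∈ rng 1 n → at w c ≡ assoc E c
        agree mc with ∈ₚ.∈-map⁻ proj₁ (↭ₚ.∈-resp-↭ (↭-sym sc) mc)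
        ... | (c , v) , me , refl = trans (sat⇒ {w} {E} t me) (sym (assoc-∈ uS me))
      other : ∀ {w} → w ∈ Sym n → w ≢ w0 → ⟦ sat w E ⟧ ℕ.* f w ≡ 0
      other {w} m ne with sat w E in eq
      ... | false = refl
      ... | true  = contradiction (determined m (≡⇒T eq)) ne

    Least : List (ℕ × List ℕ) → Set
    Least = All (λ c → All (proj₁ c <_) (proj₂ c))

    Z-closed : ∀ m cs R → length R ≡ m → targets (cycEs cs) ++ R ↭ rng 1 n → sources (cycEs cs) ++ R ↭ rng 1 n → AllPairs _<_ R → Least cs →
      Z (cycEs cs) ≡ ⟦ oddCycles cs ⟧ ℕ.* closedCount m (λ c → g (length cs ℕ.+ c))
    Z-open : ∀ m cs r xs R → length R ≡ m → targets (pathE xs r ++ cycEs cs) ++ r ∷ R ↭ rng 1 n → sources (pathE xs r ++ cycEs cs) ++ hd xs r ∷ R ↭ rng 1 n →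
      AllPairs _<_ R → All (r <_) R → All (r <_) xs → Least cs →
      Z (pathE xs r ++ cycEs cs) ≡ ⟦ oddCycles cs ⟧ ℕ.* openCount m (even (length xs)) (λ c → g (length cs ℕ.+ c))
    Z-extend : ∀ m cs r xs R → length R ≡ m → targets (pathE xs r ++ cycEs cs) ++ r ∷ R ↭ rng 1 n → sources (pathE xs r ++ cycEs cs) ++ hd xs r ∷ R ↭ rng 1 n →
      AllPairs _<_ R → All (r <_) R → All (r <_) xs → Least cs →
      ∑ℕ R (λ v → Z ((hd xs r , v) ∷ pathE xs r ++ cycEs cs)) ≡ ⟦ oddCycles cs ⟧ ℕ.* (m ℕ.* openCount (m ∸ 1) (not (even (length xs))) (λ c → g (length cs ℕ.+ c)))
    Z-closed zero    cs []      refl tg sc so ls = trans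
      (Z-complete cs (≡.subst (_↭ rng 1 n) (Listₚ.++-identityʳ _) tg) (≡.subst (_↭ rng 1 n) (Listₚ.++-identityʳ _) sc) ls)
      (cong (λ k → ⟦ oddCycles cs ⟧ ℕ.* g k) (sym (ℕₚ.+-identityʳ (length cs))))
    Z-closed (suc m) cs (r ∷ R) e tg sc (a ∷ so) ls = Z-open m cs r [] R (ℕₚ.suc-injective e) tg sc so a [] ls
    Z-open m cs r xs R len tg sc so rR rx ls = begin
      Z E
        ≡⟨ Z-split c E c∈ ⟩
      ∑ℕ (rng 1 n) (λ v → Z ((c , v) ∷ E))
        -- The value at the end c of the open path is sorted into the values already taken, which
        -- contribute 0 by injectivity, the value r, which closes the cycle, and the elements of
        -- `R`, which extend it.
        ≡⟨ ℕ∑.∑-↭ _ (↭-sym tg) ⟩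
      ∑ℕ (targets E ++ r ∷ R) (λ v → Z ((c , v) ∷ E))
        ≡⟨ ℕ∑.∑-++ (targets E) (r ∷ R) _ ⟩
      ∑ℕ (targets E) (λ v → Z ((c , v) ∷ E)) ℕ.+ (Z ((c , r) ∷ E) ℕ.+ ∑ℕ R (λ v → Z ((c , v) ∷ E)))
        ≡⟨ cong₂ ℕ._+_ (ℕ∑.∑-zero∈ (targets E) (λ {v} mv → Z-used c v E c∈ c∉ src mv)) (cong₂ ℕ._+_ close (Z-extend m cs r xs R len tg sc so rR rx ls)) ⟩
      ω ℕ.* (if even (length xs) then closedCount m (g′ ∘ suc) else 0) ℕ.+ ω ℕ.* (m ℕ.* openCount (m ∸ 1) (not (even (length xs))) g′)
        ≡⟨ ℕₚ.*-distribˡ-+ ω _ _ ⟨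
      ω ℕ.* ((if even (length xs) then closedCount m (g′ ∘ suc) else 0) ℕ.+ m ℕ.* openCount (m ∸ 1) (not (even (length xs))) g′)
        ≡⟨ cong (ω ℕ.*_) (openCount-close m (even (length xs)) g′) ⟩
      ω ℕ.* openCount m (even (length xs)) g′ ∎
      where
      open ≡-Reasoning
      E = pathE xs r ++ cycEs cs
      c = hd xs r
      ω = ⟦ oddCycles cs ⟧
      g′ : ℕ → ℕ
      g′ i = g (length cs ℕ.+ i)
      src : ∀ {c′} → c′ ∈ sources E → c′ ∈ rng 1 n
      src mc = ↭ₚ.∈-resp-↭ sc (∈ₚ.∈-++⁺ˡ mc)
      c∈ : c ∈ rng 1 n
      c∈ = ↭ₚ.∈-resp-↭ sc (∈ₚ.∈-++⁺ʳ (sources E) (here refl))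
      c∉ : c ∉ sources E
      c∉ mc = All.lookup (AllPairs.head (Unique-↭ (↭ₚ.shift c (sources E) R) (Unique-↭ (↭-sym sc) (Unique-rng n)))) (∈ₚ.∈-++⁺ˡ mc) refl
      close : Z ((c , r) ∷ E) ≡ ω ℕ.* (if even (length xs) then closedCount m (g′ ∘ suc) else 0)
      close = trans (Z-closed m ((r , xs) ∷ cs) R len (↭-trans (↭-sym (↭ₚ.shift r (targets E) R)) tg) (↭-trans (↭-sym (↭ₚ.shift c (sources E) R)) sc) so (rx ∷ ls))
        (trans (cong (⟦ even (length xs) ∧ oddCycles cs ⟧ ℕ.*_) (closedCount-cong m (λ i → cong g (sym (ℕₚ.+-suc (length cs) i))))) (weigh (even (length xs)) (closedCount m (g′ ∘ suc))))
        where
        weigh : ∀ b k → ⟦ b ∧ oddCycles cs ⟧ ℕ.* k ≡ ω ℕ.* (if b then k else 0)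
        weigh true  k = refl
        weigh false k = sym (ℕₚ.*-zeroʳ ω)
    Z-extend zero    cs r xs []      refl tg sc so rR rx ls = sym (ℕₚ.*-zeroʳ ⟦ oddCycles cs ⟧)
    Z-extend (suc m) cs r xs R len tg sc so rR rx ls = trans (ℕ∑.∑-cong∈ R each) (trans (const R) (trans (cong (ℕ._* (ω ℕ.* K)) len)
      (let open ℕSolver.+-*-Solver in solve 3 (λ a b c → a :* (b :* c) := b :* (a :* c)) refl (suc m) ω K)))
      where
      E = pathE xs r ++ cycEs cs
      c = hd xs r
      ω = ⟦ oddCycles cs ⟧
      K = openCount m (not (even (length xs))) (λ i → g (length cs ℕ.+ i))
      const : ∀ (L : List ℕ) → ∑ℕ L (λ _ → ω ℕ.* K) ≡ length L ℕ.* (ω ℕ.* K)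
      const []      = refl
      const (_ ∷ L) = cong (ω ℕ.* K ℕ.+_) (const L)
      each : ∀ {v} → v ∈ R → Z ((c , v) ∷ E) ≡ ω ℕ.* K
      each {v} mv with ∈-∃++ mv
      ... | as , bs , refl = trans
        (Z-open m cs r (v ∷ xs) (as ++ bs) (ℕₚ.suc-injective (trans (sym (↭ₚ.↭-length (↭ₚ.shift v as bs))) len))
          (↭-trans (move (targets E) r) tg) (↭-trans (↭-trans (prep c (↭ₚ.++⁺ˡ (sources E) (↭-sym (↭ₚ.shift v as bs)))) (↭-sym (↭ₚ.shift c (sources E) (as ++ v ∷ bs)))) sc)
          (AllPairs-remove as so) (Allₚ.++⁺ (Allₚ.++⁻ˡ as rR) (All.tail (Allₚ.++⁻ʳ as rR))) (All.lookup rR mv ∷ rx) ls)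
        (cong (λ b → ω ℕ.* openCount m b (λ i → g (length cs ℕ.+ i))) (even-suc (length xs)))
        where
        move : ∀ (L : List ℕ) r → v ∷ L ++ r ∷ as ++ bs ↭ L ++ r ∷ as ++ v ∷ bs
        move L r = ↭-trans (↭-sym (↭ₚ.shift v L (r ∷ as ++ bs))) (↭ₚ.++⁺ˡ L (↭-trans (swap v r ↭-refl) (prep r (↭-sym (↭ₚ.shift v as bs)))))

  ∑-oddCycles : ∑ℕ (Sym n) (λ w → ⟦ allCyclesOdd w ⟧ ℕ.* g (numCycles w)) ≡ closedCount n g
  ∑-oddCycles = trans (ℕ∑.∑-cong (Sym n) (λ w → sym (ℕₚ.*-identityˡ (f w))))
    (trans (Z-closed n [] (rng 1 n) (length-rng n) ↭-refl ↭-refl (AllPairsₚ.map⁺ (AllPairsₚ.applyUpTo⁺₁ id n (λ lt _ → s≤s lt))) [])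
      (ℕₚ.*-identityˡ _))

-- The numbers d(n,k): generating polynomial, recurrence and parity

d-closedCount : ∀ n k → d n k ≡ closedCount n (λ c → ⟦ c ≡ᵇ k ⟧)
d-closedCount n k = trans (count-∑ _ (Sym n)) (trans (ℕ∑.∑-cong (Sym n) (λ w → ⟦⟧-∧ (allCyclesOdd w) _)) (∑-oddCycles n (λ c → ⟦ c ≡ᵇ k ⟧)))

∑-d : ∀ n y → ∑ℕ (upTo (suc n)) (λ k → d n k ℕ.* y ℕ.^ k) ≡ closedCount n (y ℕ.^_)
∑-d n y = begin
  ∑ℕ K (λ k → d n k ℕ.* y ℕ.^ k)
    ≡⟨ ℕ∑.∑-cong K (λ k → trans (cong (ℕ._* y ℕ.^ k) (count-∑ _ (Sym n))) (sym (ℕ∑.∑-*ʳ (Sym n) (y ℕ.^ k) _))) ⟩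
  ∑ℕ K (λ k → ∑ℕ (Sym n) (λ w → ⟦ allCyclesOdd w ∧ (numCycles w ≡ᵇ k) ⟧ ℕ.* y ℕ.^ k))
    ≡⟨ ℕ∑.∑-swap K (Sym n) _ ⟩
  ∑ℕ (Sym n) (λ w → ∑ℕ K (λ k → ⟦ allCyclesOdd w ∧ (numCycles w ≡ᵇ k) ⟧ ℕ.* y ℕ.^ k))
    ≡⟨ ℕ∑.∑-cong∈ (Sym n) (λ {w} m → pick w m) ⟩
  ∑ℕ (Sym n) (λ w → ⟦ allCyclesOdd w ⟧ ℕ.* y ℕ.^ numCycles w)
    ≡⟨ ∑-oddCycles n (y ℕ.^_) ⟩
  closedCount n (y ℕ.^_) ∎
  where
  open ≡-Reasoning
  K = upTo (suc n)
  pick : ∀ w → w ∈ Sym n → ∑ℕ K (λ k → ⟦ allCyclesOdd w ∧ (numCycles w ≡ᵇ k) ⟧ ℕ.* y ℕ.^ k) ≡ ⟦ allCyclesOdd w ⟧ ℕ.* y ℕ.^ numCycles w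
  pick w m = trans (∑-single (Uniqueₚ.upTo⁺ (suc n)) (∈ₚ.∈-upTo⁺ (s≤s bound))
      (λ {k} _ ne → cong (ℕ._* y ℕ.^ k) (trans (⟦⟧-∧ (allCyclesOdd w) _) (trans (cong (λ b → ⟦ allCyclesOdd w ⟧ ℕ.* ⟦ b ⟧) (≡ᵇ-false (ne ∘ sym))) (ℕₚ.*-zeroʳ ⟦ allCyclesOdd w ⟧)))))
    (cong (λ b → ⟦ b ⟧ ℕ.* y ℕ.^ numCycles w) (trans (cong (allCyclesOdd w ∧_) (≡ᵇ-true (numCycles w))) (Boolₚ.∧-identityʳ (allCyclesOdd w))))
    where
    bound : numCycles w ≤ n
    bound = ℕₚ.≤-trans (Listₚ.length-filter (Bool.T? ∘ cycleMin w) (rng 1 (length w))) (ℕₚ.≤-reflexive (trans (length-rng (length w)) (Perm.len n (Sym⁻ n m))))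

closedCount-scale : ∀ m y g → closedCount m (λ c → y ℕ.* g c) ≡ y ℕ.* closedCount m g
openCount-scale : ∀ m b y g → openCount m b (λ c → y ℕ.* g c) ≡ y ℕ.* openCount m b g
closedCount-scale zero    y g = refl
closedCount-scale (suc m) y g = openCount-scale m true y g
openCount-scale zero    true  y g = refl
openCount-scale zero    false y g = sym (ℕₚ.*-zeroʳ y)
openCount-scale (suc m) true  y g = trans (cong₂ (λ p q → p ℕ.+ suc m ℕ.* q) (closedCount-scale (suc m) y (g ∘ suc)) (openCount-scale m false y g))
  (let open ℕSolver.+-*-Solver in solve 4 (λ y p m q → y :* p :+ m :* (y :* q) := y :* (p :+ m :* q)) refl y (closedCount (suc m) (g ∘ suc)) (suc m) (openCount m false g))
openCount-scale (suc m) false y g = trans (cong (suc m ℕ.*_) (openCount-scale m true y g))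
  (let open ℕSolver.+-*-Solver in solve 3 (λ y m q → m :* (y :* q) := y :* (m :* q)) refl y (suc m) (openCount m true g))

-- An open cycle of even length must take another element, after which its length is odd as for a
-- cycle just opened. So the first cycle either closes at once or absorbs two more elements, which
-- can be chosen in (j+1) j ways.
closedCount-rec : ∀ j y → closedCount (suc (suc j)) (y ℕ.^_) ≡ y ℕ.* closedCount (suc j) (y ℕ.^_) ℕ.+ suc j ℕ.* (j ℕ.* closedCount j (y ℕ.^_))
closedCount-rec j y = cong₂ (λ p q → p ℕ.+ suc j ℕ.* q) (closedCount-scale (suc j) y (y ℕ.^_)) (two j)
  where
  two : ∀ j → openCount j false (y ℕ.^_) ≡ j ℕ.* closedCount j (y ℕ.^_)
  two zero    = refl
  two (suc j) = refl

-- A set of m elements splits into c odd cycles only if m and c have the same parity. In the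
-- companion statement the length of the open cycle enters modulo 2 as `⟦ b ⟧`.
closedCount-parity : ∀ m g → (∀ c → even (m ℕ.+ c) ≡ true → g c ≡ 0) → closedCount m g ≡ 0
openCount-parity : ∀ m b g → (∀ c → even (⟦ b ⟧ ℕ.+ (m ℕ.+ c)) ≡ true → g c ≡ 0) → openCount m b g ≡ 0
closedCount-parity zero    g h = h 0 refl
closedCount-parity (suc m) g h = openCount-parity m true g h
openCount-parity zero    true  g h = h 1 refl
openCount-parity zero    false g h = refl
openCount-parity (suc m) true  g h = cong₂ ℕ._+_ (closedCount-parity (suc m) (g ∘ suc) (λ c e → h (suc c) (trans (cong (even ∘ suc ∘ suc) (ℕₚ.+-suc m c)) e)))
  (trans (cong (suc m ℕ.*_) (openCount-parity m false g h)) (ℕₚ.*-zeroʳ (suc m)))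
openCount-parity (suc m) false g h = trans (cong (suc m ℕ.*_) (openCount-parity m true g h)) (ℕₚ.*-zeroʳ (suc m))

d-parity : ∀ n k → even (n ℕ.+ k) ≡ false → d n k ≡ 0
d-parity n k e = trans (d-closedCount n k) (closedCount-parity n _ (λ c e′ → cong ⟦_⟧ (≡ᵇ-false {c} {k} (λ { refl → contradiction (trans (sym e) e′) (λ ()) }))))

d-suc-zero : ∀ n → d (suc n) 0 ≡ 0
d-suc-zero n = trans (d-closedCount (suc n) 0) (go n true)
  where
  go : ∀ m b → openCount m b (λ c → ⟦ c ≡ᵇ 0 ⟧) ≡ 0
  go zero    true  = refl
  go zero    false = refl
  go (suc m) true  = cong₂ ℕ._+_ (closedCount-parity (suc m) (λ _ → 0) (λ _ _ → refl)) (trans (cong (suc m ℕ.*_) (go m false)) (ℕₚ.*-zeroʳ (suc m)))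
  go (suc m) false = trans (cong (suc m ℕ.*_) (go m true)) (ℕₚ.*-zeroʳ (suc m))

-- The Euler operator x d/dx

θ : Ser → Ser
θ f ⟪ n ⟫ = ℕtoℚ n ℚ.* f ⟪ n ⟫

θ-✶ : ∀ f g → θ (f ✶ g) ≗ θ f ✶ g ⊞ f ✶ θ g
θ-✶ f g .coeff n = begin
  ℕtoℚ n ℚ.* ∑≤ n (λ i → f ⟪ i ⟫ ℚ.* g ⟪ n ∸ i ⟫)
    ≡⟨ ∑≤-*ˡ n (ℕtoℚ n) (λ i → f ⟪ i ⟫ ℚ.* g ⟪ n ∸ i ⟫) ⟨
  ∑≤ n (λ i → ℕtoℚ n ℚ.* (f ⟪ i ⟫ ℚ.* g ⟪ n ∸ i ⟫))
    ≡⟨ ∑≤-cong≤ n (λ i le → trans (cong (ℚ._* (f ⟪ i ⟫ ℚ.* g ⟪ n ∸ i ⟫)) (trans (cong ℕtoℚ (sym (ℕₚ.m+[n∸m]≡n le))) (ℕtoℚ-+ i (n ∸ i))))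
         (leibniz (ℕtoℚ i) (ℕtoℚ (n ∸ i)) (f ⟪ i ⟫) (g ⟪ n ∸ i ⟫))) ⟩
  ∑≤ n (λ i → θ f ⟪ i ⟫ ℚ.* g ⟪ n ∸ i ⟫ ℚ.+ f ⟪ i ⟫ ℚ.* θ g ⟪ n ∸ i ⟫)
    ≡⟨ ∑≤-+ n (λ i → θ f ⟪ i ⟫ ℚ.* g ⟪ n ∸ i ⟫) (λ i → f ⟪ i ⟫ ℚ.* θ g ⟪ n ∸ i ⟫) ⟩
  (θ f ✶ g ⊞ f ✶ θ g) ⟪ n ⟫ ∎
  where
  open ≡-Reasoning
  leibniz : ∀ p q a b → (p ℚ.+ q) ℚ.* (a ℚ.* b) ≡ p ℚ.* a ℚ.* b ℚ.+ a ℚ.* (q ℚ.* b)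
  leibniz = let open ℚSolver.+-*-Solver in solve 4 (λ p q a b → (p :+ q) :* (a :* b) := p :* a :* b :+ a :* (q :* b)) refl

θ-cong : ∀ {f g} → f ≗ g → θ f ≗ θ g
θ-cong e .coeff n = cong (ℕtoℚ n ℚ.*_) (coeff e n)

θ-1ˢ : θ 1ˢ ≗ 0ˢ
θ-1ˢ .coeff zero    = refl
θ-1ˢ .coeff (suc n) = ℚₚ.*-zeroʳ (ℕtoℚ (suc n))

θ-1+𝕩 : θ (1ˢ ⊞ 𝕩) ≗ 𝕩
θ-1+𝕩 .coeff zero          = refl
θ-1+𝕩 .coeff (suc zero)    = refl
θ-1+𝕩 .coeff (suc (suc n)) = ℚₚ.*-zeroʳ (ℕtoℚ (suc (suc n)))

θ-1-𝕩 : θ (1ˢ ⊟ 𝕩) ≗ ⊟ 𝕩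
θ-1-𝕩 .coeff zero          = refl
θ-1-𝕩 .coeff (suc zero)    = refl
θ-1-𝕩 .coeff (suc (suc n)) = ℚₚ.*-zeroʳ (ℕtoℚ (suc (suc n)))

module _ where
  open 𝒮 using (solve; con; _:=_; _:*_; _:-_; _:+_; :-_)
  open SetoidR ℛ.setoid

  1-𝕩-θ𝕁 : (1ˢ ⊟ 𝕩) ✶ θ 𝕁 ≗ 𝕩 ✶ 𝕁
  1-𝕩-θ𝕁 = begin
    (1ˢ ⊟ 𝕩) ✶ θ 𝕁                                ≈⟨ solve 3 (λ x j t → (con 1ℚ :- x) :* t := ((:- x) :* j :+ (con 1ℚ :- x) :* t) :+ x :* j) ≗-refl 𝕩 𝕁 (θ 𝕁) ⟩
    ((⊟ 𝕩) ✶ 𝕁 ⊞ (1ˢ ⊟ 𝕩) ✶ θ 𝕁) ⊞ 𝕩 ✶ 𝕁          ≈⟨ ℛ.+-congʳ (ℛ.+-congʳ (ℛ.*-congʳ θ-1-𝕩)) ⟨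
    (θ (1ˢ ⊟ 𝕩) ✶ 𝕁 ⊞ (1ˢ ⊟ 𝕩) ✶ θ 𝕁) ⊞ 𝕩 ✶ 𝕁     ≈⟨ ℛ.+-congʳ (θ-✶ (1ˢ ⊟ 𝕩) 𝕁) ⟨
    θ ((1ˢ ⊟ 𝕩) ✶ 𝕁) ⊞ 𝕩 ✶ 𝕁                      ≈⟨ ℛ.+-congʳ (≗-trans (θ-cong 𝕁-law) θ-1ˢ) ⟩
    0ˢ ⊞ 𝕩 ✶ 𝕁                                    ≈⟨ ℛ.+-identityˡ (𝕩 ✶ 𝕁) ⟩
    𝕩 ✶ 𝕁 ∎

  θ𝕌 : (1ˢ ⊟ 𝕩 ✶ 𝕩) ✶ θ 𝕌 ≗ cˢ (ℕtoℚ 2) ✶ 𝕩 ✶ 𝕌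
  θ𝕌 = begin
    (1ˢ ⊟ 𝕩 ✶ 𝕩) ✶ θ 𝕌
      ≈⟨ ℛ.*-congˡ (≗-trans (θ-✶ (1ˢ ⊞ 𝕩) 𝕁) (ℛ.+-congʳ (ℛ.*-congʳ θ-1+𝕩))) ⟩
    (1ˢ ⊟ 𝕩 ✶ 𝕩) ✶ (𝕩 ✶ 𝕁 ⊞ (1ˢ ⊞ 𝕩) ✶ θ 𝕁)
      ≈⟨ solve 3 (λ x j t → (con 1ℚ :- x :* x) :* (x :* j :+ (con 1ℚ :+ x) :* t)
           := (con 1ℚ :+ x) :* x :* ((con 1ℚ :- x) :* j) :+ (con 1ℚ :+ x) :* (con 1ℚ :+ x) :* ((con 1ℚ :- x) :* t)) ≗-refl 𝕩 𝕁 (θ 𝕁) ⟩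
    (1ˢ ⊞ 𝕩) ✶ 𝕩 ✶ ((1ˢ ⊟ 𝕩) ✶ 𝕁) ⊞ (1ˢ ⊞ 𝕩) ✶ (1ˢ ⊞ 𝕩) ✶ ((1ˢ ⊟ 𝕩) ✶ θ 𝕁)
      ≈⟨ ℛ.+-congˡ (ℛ.*-congˡ 1-𝕩-θ𝕁) ⟩
    (1ˢ ⊞ 𝕩) ✶ 𝕩 ✶ ((1ˢ ⊟ 𝕩) ✶ 𝕁) ⊞ (1ˢ ⊞ 𝕩) ✶ (1ˢ ⊞ 𝕩) ✶ (𝕩 ✶ 𝕁)
      ≈⟨ solve 2 (λ x j → (con 1ℚ :+ x) :* x :* ((con 1ℚ :- x) :* j) :+ (con 1ℚ :+ x) :* (con 1ℚ :+ x) :* (x :* j)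
           := con (ℕtoℚ 2) :* x :* ((con 1ℚ :+ x) :* j)) ≗-refl 𝕩 𝕁 ⟩
    cˢ (ℕtoℚ 2) ✶ 𝕩 ✶ 𝕌 ∎

  -- The logarithmic derivative: x d/dx log `𝕌` = 2x/(1-x²). Cleared of the denominator it becomes a
  -- recurrence of order two for the coefficients.
  θ𝕌^ : ∀ m → (1ˢ ⊟ 𝕩 ✶ 𝕩) ✶ θ (𝕌 ^ˢ m) ≗ cˢ (ℕtoℚ (2 ℕ.* m)) ✶ 𝕩 ✶ 𝕌 ^ˢ m
  θ𝕌^ zero    = ≗-trans (ℛ.*-congˡ θ-1ˢ) (≗-trans (ℛ.zeroʳ (1ˢ ⊟ 𝕩 ✶ 𝕩)) (≗-trans 0≗c0 (solve 1 (λ x → con 0ℚ := con 0ℚ :* x :* con 1ℚ) ≗-refl 𝕩)))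
    where
    0≗c0 : 0ˢ ≗ cˢ 0ℚ
    0≗c0 .coeff zero    = refl
    0≗c0 .coeff (suc n) = refl
  θ𝕌^ (suc m) = begin
    (1ˢ ⊟ 𝕩 ✶ 𝕩) ✶ θ (𝕌 ✶ 𝕌 ^ˢ m)
      ≈⟨ ℛ.*-congˡ (θ-✶ 𝕌 (𝕌 ^ˢ m)) ⟩
    (1ˢ ⊟ 𝕩 ✶ 𝕩) ✶ (θ 𝕌 ✶ 𝕌 ^ˢ m ⊞ 𝕌 ✶ θ (𝕌 ^ˢ m))
      ≈⟨ solve 5 (λ a p q u v → a :* (p :* v :+ u :* q) := (a :* p) :* v :+ u :* (a :* q)) ≗-refl (1ˢ ⊟ 𝕩 ✶ 𝕩) (θ 𝕌) (θ (𝕌 ^ˢ m)) 𝕌 (𝕌 ^ˢ m) ⟩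
    (1ˢ ⊟ 𝕩 ✶ 𝕩) ✶ θ 𝕌 ✶ 𝕌 ^ˢ m ⊞ 𝕌 ✶ ((1ˢ ⊟ 𝕩 ✶ 𝕩) ✶ θ (𝕌 ^ˢ m))
      ≈⟨ ℛ.+-cong (ℛ.*-congʳ θ𝕌) (ℛ.*-congˡ (θ𝕌^ m)) ⟩
    cˢ (ℕtoℚ 2) ✶ 𝕩 ✶ 𝕌 ✶ 𝕌 ^ˢ m ⊞ 𝕌 ✶ (cˢ (ℕtoℚ (2 ℕ.* m)) ✶ 𝕩 ✶ 𝕌 ^ˢ m)
      ≈⟨ solve 5 (λ c k x u v → c :* x :* u :* v :+ u :* (k :* x :* v) := (c :+ k) :* x :* (u :* v)) ≗-refl (cˢ (ℕtoℚ 2)) (cˢ (ℕtoℚ (2 ℕ.* m))) 𝕩 𝕌 (𝕌 ^ˢ m) ⟩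
    (cˢ (ℕtoℚ 2) ⊞ cˢ (ℕtoℚ (2 ℕ.* m))) ✶ 𝕩 ✶ (𝕌 ✶ 𝕌 ^ˢ m)
      ≈⟨ ℛ.*-congʳ (ℛ.*-congʳ add) ⟩
    cˢ (ℕtoℚ (2 ℕ.* suc m)) ✶ 𝕩 ✶ (𝕌 ✶ 𝕌 ^ˢ m) ∎
    where
    add : cˢ (ℕtoℚ 2) ⊞ cˢ (ℕtoℚ (2 ℕ.* m)) ≗ cˢ (ℕtoℚ (2 ℕ.* suc m))
    add .coeff zero    = trans (sym (ℕtoℚ-+ 2 (2 ℕ.* m))) (cong ℕtoℚ (sym (ℕₚ.*-suc 2 m)))
    add .coeff (suc n) = refl

module _ (m : ℕ) where

  private
    U : ℕ → ℚ
    U n = (𝕌 ^ˢ m) ⟪ n ⟫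
    y = 2 ℕ.* m

    rhs : ∀ n → (cˢ (ℕtoℚ y) ✶ 𝕩 ✶ 𝕌 ^ˢ m) ⟪ suc n ⟫ ≡ ℕtoℚ y ℚ.* U n
    rhs n = trans (coeff (≗-trans (✶-assoc (cˢ (ℕtoℚ y)) 𝕩 (𝕌 ^ˢ m)) (cˢ-✶ (ℕtoℚ y) (𝕩 ✶ 𝕌 ^ˢ m))) (suc n)) (cong (ℕtoℚ y ℚ.*_) (𝕩✶-suc (𝕌 ^ˢ m) n))

    lhs : ∀ F → (1ˢ ⊟ 𝕩 ✶ 𝕩) ✶ F ≗ F ⊟ 𝕩 ✶ (𝕩 ✶ F)
    lhs F = let open 𝒮 in solve 2 (λ x F → (con 1ℚ :- x :* x) :* F := F :- x :* (x :* F)) ≗-refl 𝕩 F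

    U-zero : ∀ m → (𝕌 ^ˢ m) ⟪ 0 ⟫ ≡ 1ℚ
    U-zero zero    = refl
    U-zero (suc m) = trans (cong (𝕌 ⟪ 0 ⟫ ℚ.*_) (U-zero m)) refl

    U-one : U 1 ≡ ℕtoℚ y
    U-one = begin
      U 1                                             ≡⟨ ℚₚ.*-identityˡ (U 1) ⟨
      θ (𝕌 ^ˢ m) ⟪ 1 ⟫                                ≡⟨ ℚₚ.+-identityʳ _ ⟨
      θ (𝕌 ^ˢ m) ⟪ 1 ⟫ ℚ.+ (ℚ.- 0ℚ)                   ≡⟨ cong (λ z → θ (𝕌 ^ˢ m) ⟪ 1 ⟫ ℚ.+ (ℚ.- z)) (trans (𝕩✶-suc (𝕩 ✶ θ (𝕌 ^ˢ m)) 0) (𝕩✶-zero (θ (𝕌 ^ˢ m)))) ⟨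
      (θ (𝕌 ^ˢ m) ⊟ 𝕩 ✶ (𝕩 ✶ θ (𝕌 ^ˢ m))) ⟪ 1 ⟫       ≡⟨ coeff (≗-trans (≗-sym (lhs (θ (𝕌 ^ˢ m)))) (θ𝕌^ m)) 1 ⟩
      (cˢ (ℕtoℚ y) ✶ 𝕩 ✶ 𝕌 ^ˢ m) ⟪ 1 ⟫                ≡⟨ rhs 0 ⟩
      ℕtoℚ y ℚ.* U 0                                  ≡⟨ cong (ℕtoℚ y ℚ.*_) (U-zero m) ⟩
      ℕtoℚ y ℚ.* 1ℚ                                   ≡⟨ ℚₚ.*-identityʳ (ℕtoℚ y) ⟩
      ℕtoℚ y ∎
      where open ≡-Reasoning

    U-rec : ∀ n → ℕtoℚ (suc (suc n)) ℚ.* U (suc (suc n)) ≡ ℕtoℚ y ℚ.* U (suc n) ℚ.+ ℕtoℚ n ℚ.* U n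
    U-rec n = begin
      a                                               ≡⟨ solve 2 (λ a b → a := (a :+ (:- b)) :+ b) refl a b ⟩
      (a ℚ.+ (ℚ.- b)) ℚ.+ b                           ≡⟨ cong (λ z → (a ℚ.+ (ℚ.- z)) ℚ.+ b) (trans (𝕩✶-suc (𝕩 ✶ F) (suc n)) (𝕩✶-suc F n)) ⟨
      (F ⊟ 𝕩 ✶ (𝕩 ✶ F)) ⟪ suc (suc n) ⟫ ℚ.+ b         ≡⟨ cong (ℚ._+ b) (coeff (≗-trans (≗-sym (lhs F)) (θ𝕌^ m)) (suc (suc n))) ⟩
      (cˢ (ℕtoℚ y) ✶ 𝕩 ✶ 𝕌 ^ˢ m) ⟪ suc (suc n) ⟫ ℚ.+ b ≡⟨ cong (ℚ._+ b) (rhs (suc n)) ⟩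
      ℕtoℚ y ℚ.* U (suc n) ℚ.+ b ∎
      where
      open ≡-Reasoning
      open ℚSolver.+-*-Solver
      F = θ (𝕌 ^ˢ m)
      a = ℕtoℚ (suc (suc n)) ℚ.* U (suc (suc n))
      b = ℕtoℚ n ℚ.* U n

    C : ℕ → ℕ
    C n = closedCount n (y ℕ.^_)

    -- Multiplied by factorials, `U-rec` turns into `closedCount-rec`. Both have order two, so two
    -- consecutive values are carried through the induction.
    both : ∀ n → ℕtoℚ (n !) ℚ.* U n ≡ ℕtoℚ (C n) × ℕtoℚ (suc n !) ℚ.* U (suc n) ≡ ℕtoℚ (C (suc n))
    both zero    = trans (ℚₚ.*-identityˡ (U 0)) (U-zero m) , trans (ℚₚ.*-identityˡ (U 1)) (trans U-one (cong ℕtoℚ (sym (ℕₚ.*-identityʳ y))))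
    both (suc n) with both n
    ... | e , e′ = e′ , (begin
      ℕtoℚ (suc (suc n) !) ℚ.* U (suc (suc n))
        ≡⟨ cong (ℚ._* U (suc (suc n))) (ℕtoℚ-* (suc (suc n)) (suc n !)) ⟩
      ℕtoℚ (suc (suc n)) ℚ.* ℕtoℚ (suc n !) ℚ.* U (suc (suc n))
        ≡⟨ solve 3 (λ a b c → a :* b :* c := b :* (a :* c)) refl (ℕtoℚ (suc (suc n))) (ℕtoℚ (suc n !)) (U (suc (suc n))) ⟩
      ℕtoℚ (suc n !) ℚ.* (ℕtoℚ (suc (suc n)) ℚ.* U (suc (suc n)))
        ≡⟨ cong (ℕtoℚ (suc n !) ℚ.*_) (U-rec n) ⟩
      ℕtoℚ (suc n !) ℚ.* (ℕtoℚ y ℚ.* U (suc n) ℚ.+ ℕtoℚ n ℚ.* U n)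
        ≡⟨ solve 5 (λ f y a n b → f :* (y :* a :+ n :* b) := y :* (f :* a) :+ f :* (n :* b)) refl (ℕtoℚ (suc n !)) (ℕtoℚ y) (U (suc n)) (ℕtoℚ n) (U n) ⟩
      ℕtoℚ y ℚ.* (ℕtoℚ (suc n !) ℚ.* U (suc n)) ℚ.+ ℕtoℚ (suc n !) ℚ.* (ℕtoℚ n ℚ.* U n)
        ≡⟨ cong₂ ℚ._+_ (trans (cong (ℕtoℚ y ℚ.*_) e′) (sym (ℕtoℚ-* y (C (suc n))))) last ⟩
      ℕtoℚ (y ℕ.* C (suc n)) ℚ.+ ℕtoℚ (suc n ℕ.* (n ℕ.* C n))
        ≡⟨ ℕtoℚ-+ (y ℕ.* C (suc n)) (suc n ℕ.* (n ℕ.* C n)) ⟨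
      ℕtoℚ (y ℕ.* C (suc n) ℕ.+ suc n ℕ.* (n ℕ.* C n))
        ≡⟨ cong ℕtoℚ (closedCount-rec n y) ⟨
      ℕtoℚ (C (suc (suc n))) ∎)
      where
      open ≡-Reasoning
      open ℚSolver.+-*-Solver
      last : ℕtoℚ (suc n !) ℚ.* (ℕtoℚ n ℚ.* U n) ≡ ℕtoℚ (suc n ℕ.* (n ℕ.* C n))
      last = begin
        ℕtoℚ (suc n !) ℚ.* (ℕtoℚ n ℚ.* U n)                     ≡⟨ cong (ℚ._* (ℕtoℚ n ℚ.* U n)) (ℕtoℚ-* (suc n) (n !)) ⟩
        ℕtoℚ (suc n) ℚ.* ℕtoℚ (n !) ℚ.* (ℕtoℚ n ℚ.* U n)        ≡⟨ solve 4 (λ a f b u → a :* f :* (b :* u) := a :* (b :* (f :* u))) refl (ℕtoℚ (suc n)) (ℕtoℚ (n !)) (ℕtoℚ n) (U n) ⟩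
        ℕtoℚ (suc n) ℚ.* (ℕtoℚ n ℚ.* (ℕtoℚ (n !) ℚ.* U n))      ≡⟨ cong (λ z → ℕtoℚ (suc n) ℚ.* (ℕtoℚ n ℚ.* z)) e ⟩
        ℕtoℚ (suc n) ℚ.* (ℕtoℚ n ℚ.* ℕtoℚ (C n))                ≡⟨ cong (ℕtoℚ (suc n) ℚ.*_) (ℕtoℚ-* n (C n)) ⟨
        ℕtoℚ (suc n) ℚ.* ℕtoℚ (n ℕ.* C n)                       ≡⟨ ℕtoℚ-* (suc n) (n ℕ.* C n) ⟨
        ℕtoℚ (suc n ℕ.* (n ℕ.* C n)) ∎

  -- Both sides are n! times the coefficient of x^n in exp (2m artanh x).
  𝕌^-d : ∀ n → ℕtoℚ (n !) ℚ.* (𝕌 ^ˢ m) ⟪ n ⟫ ≡ ℕtoℚ (∑ℕ (upTo (suc n)) (λ k → d n k ℕ.* (2 ℕ.* m) ℕ.^ k))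
  𝕌^-d n = trans (proj₁ (both n)) (cong ℕtoℚ (sym (∑-d n y)))

-- Trivariate series that are finite sums of products of univariate ones

tri : Ser → Ser → Ser → PS
tri f g h a b c = f ⟪ a ⟫ ℚ.* g ⟪ b ⟫ ℚ.* h ⟪ c ⟫

record Is∑ {I : Set} (L : List I) (F : PS) (f g h : I → Ser) : Set where
  no-eta-equality
  constructor is∑
  field value : ∀ a b c → F a b c ≡ ∑ℚ L (λ x → tri (f x) (g x) (h x) a b c)
open Is∑ public

⊗-∑≤ : ∀ F G a b c → (F ⊗ G) a b c ≡ ∑≤ a (λ i → ∑≤ b (λ j → ∑≤ c (λ k → F i j k ℚ.* G (a ∸ i) (b ∸ j) (c ∸ k))))
⊗-∑≤ F G a b c = trans (sumℚ≡∑≤ a _) (∑≤-cong a (λ i → trans (sumℚ≡∑≤ b _) (∑≤-cong b (λ j → sumℚ≡∑≤ c _))))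

tri-⊗ : ∀ f g h f′ g′ h′ a b c → (tri f g h ⊗ tri f′ g′ h′) a b c ≡ tri (f ✶ f′) (g ✶ g′) (h ✶ h′) a b c
tri-⊗ f g h f′ g′ h′ a b c = begin
  (tri f g h ⊗ tri f′ g′ h′) a b c
    ≡⟨ ⊗-∑≤ (tri f g h) (tri f′ g′ h′) a b c ⟩
  ∑≤ a (λ i → ∑≤ b (λ j → ∑≤ c (λ k → tri f g h i j k ℚ.* tri f′ g′ h′ (a ∸ i) (b ∸ j) (c ∸ k))))
    ≡⟨ ∑≤-cong a (λ i → trans (∑≤-cong b (λ j → trans (∑≤-cong c (λ k →
         shuffle (f ⟪ i ⟫) (g ⟪ j ⟫) (h ⟪ k ⟫) (f′ ⟪ a ∸ i ⟫) (g′ ⟪ b ∸ j ⟫) (h′ ⟪ c ∸ k ⟫)))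
         (trans (∑≤-*ˡ c (p i ℚ.* q j) r) (ℚₚ.*-assoc (p i) (q j) (∑≤ c r)))))
         (trans (∑≤-*ˡ b (p i) (λ j → q j ℚ.* ∑≤ c r)) (cong (p i ℚ.*_) (∑≤-*ʳ b (∑≤ c r) q)))) ⟩
  ∑≤ a (λ i → p i ℚ.* (∑≤ b q ℚ.* ∑≤ c r))
    ≡⟨ ∑≤-*ʳ a (∑≤ b q ℚ.* ∑≤ c r) p ⟩
  ∑≤ a p ℚ.* (∑≤ b q ℚ.* ∑≤ c r)
    ≡⟨ ℚₚ.*-assoc (∑≤ a p) (∑≤ b q) (∑≤ c r) ⟨
  tri (f ✶ f′) (g ✶ g′) (h ✶ h′) a b c ∎
  where
  open ≡-Reasoning
  p q r : ℕ → ℚ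
  p i = f ⟪ i ⟫ ℚ.* f′ ⟪ a ∸ i ⟫
  q j = g ⟪ j ⟫ ℚ.* g′ ⟪ b ∸ j ⟫
  r k = h ⟪ k ⟫ ℚ.* h′ ⟪ c ∸ k ⟫
  shuffle : ∀ x y z x′ y′ z′ → x ℚ.* y ℚ.* z ℚ.* (x′ ℚ.* y′ ℚ.* z′) ≡ x ℚ.* x′ ℚ.* (y ℚ.* y′) ℚ.* (z ℚ.* z′)
  shuffle = let open ℚSolver.+-*-Solver in solve 6 (λ x y z x′ y′ z′ → x :* y :* z :* (x′ :* y′ :* z′) := x :* x′ :* (y :* y′) :* (z :* z′)) refl

tri-cong : ∀ {f f′ g g′ h h′} → f ≗ f′ → g ≗ g′ → h ≗ h′ → ∀ a b c → tri f g h a b c ≡ tri f′ g′ h′ a b c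
tri-cong e e′ e″ a b c = cong₂ ℚ._*_ (cong₂ ℚ._*_ (coeff e a) (coeff e′ b)) (coeff e″ c)

⊗-cong : ∀ {F F′ G G′} → (∀ a b c → F a b c ≡ F′ a b c) → (∀ a b c → G a b c ≡ G′ a b c) → ∀ a b c → (F ⊗ G) a b c ≡ (F′ ⊗ G′) a b c
⊗-cong {F} {F′} {G} {G′} e e′ a b c = trans (⊗-∑≤ F G a b c) (trans
  (∑≤-cong a (λ i → ∑≤-cong b (λ j → ∑≤-cong c (λ k → cong₂ ℚ._*_ (e i j k) (e′ (a ∸ i) (b ∸ j) (c ∸ k))))))
  (sym (⊗-∑≤ F′ G′ a b c)))

record Is (F : PS) (f g h : Ser) : Set where
  no-eta-equality
  constructor is
  field ext : ∀ a b c → F a b c ≡ tri f g h a b c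
open Is public

Is-⊗ : ∀ {F G f g h f′ g′ h′} → Is F f g h → Is G f′ g′ h′ → Is (F ⊗ G) (f ✶ f′) (g ✶ g′) (h ✶ h′)
Is-⊗ {F} {G} {f} {g} {h} {f′} {g′} {h′} e e′ .ext a b c =
  trans (⊗-cong {F} {tri f g h} {G} {tri f′ g′ h′} (ext e) (ext e′) a b c) (tri-⊗ f g h f′ g′ h′ a b c)

Is-cong : ∀ {F f g h f′ g′ h′} → f ≗ f′ → g ≗ g′ → h ≗ h′ → Is F f g h → Is F f′ g′ h′
Is-cong p q r e .ext a b c = trans (ext e a b c) (tri-cong p q r a b c)

private
  zero-s : ∀ y z → 0ℚ ≡ 0ℚ ℚ.* y ℚ.* z
  zero-s y z = sym (trans (cong (ℚ._* z) (ℚₚ.*-zeroˡ y)) (ℚₚ.*-zeroˡ z))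
  zero-t : ∀ x z → 0ℚ ≡ x ℚ.* 0ℚ ℚ.* z
  zero-t x z = sym (trans (cong (ℚ._* z) (ℚₚ.*-zeroʳ x)) (ℚₚ.*-zeroˡ z))

Is-𝟙 : Is 𝟙 1ˢ 1ˢ 1ˢ
Is-𝟙 .ext zero    zero    zero    = refl
Is-𝟙 .ext zero    zero    (suc c) = refl
Is-𝟙 .ext zero    (suc b) c       = zero-t (1ˢ ⟪ 0 ⟫) (1ˢ ⟪ c ⟫)
Is-𝟙 .ext (suc a) b       c       = zero-s (1ˢ ⟪ b ⟫) (1ˢ ⟪ c ⟫)

Is-S : Is S 𝕩 1ˢ 1ˢ
Is-S .ext zero          b       c       = zero-s (1ˢ ⟪ b ⟫) (1ˢ ⟪ c ⟫)
Is-S .ext (suc zero)    zero    zero    = refl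
Is-S .ext (suc zero)    zero    (suc c) = refl
Is-S .ext (suc zero)    (suc b) c       = zero-t (𝕩 ⟪ 1 ⟫) (1ˢ ⟪ c ⟫)
Is-S .ext (suc (suc a)) b       c       = zero-s (1ˢ ⟪ b ⟫) (1ˢ ⟪ c ⟫)

Is-T : Is T 1ˢ 𝕩 1ˢ
Is-T .ext zero    zero          c       = zero-t (1ˢ ⟪ 0 ⟫) (1ˢ ⟪ c ⟫)
Is-T .ext zero    (suc zero)    zero    = refl
Is-T .ext zero    (suc zero)    (suc c) = refl
Is-T .ext zero    (suc (suc b)) c       = zero-t (1ˢ ⟪ 0 ⟫) (1ˢ ⟪ c ⟫)
Is-T .ext (suc a) b             c       = zero-s (𝕩 ⟪ b ⟫) (1ˢ ⟪ c ⟫)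

Is-X : Is X 1ˢ 1ˢ 𝕩
Is-X .ext zero    zero    zero          = refl
Is-X .ext zero    zero    (suc zero)    = refl
Is-X .ext zero    zero    (suc (suc c)) = refl
Is-X .ext zero    (suc b) c             = zero-t (1ˢ ⟪ 0 ⟫) (𝕩 ⟪ c ⟫)
Is-X .ext (suc a) b       c             = zero-s (1ˢ ⟪ b ⟫) (𝕩 ⟪ c ⟫)

Is-pow : ∀ {F f g h} → Is F f g h → ∀ n → Is (pow F n) (f ^ˢ n) (g ^ˢ n) (h ^ˢ n)
Is-pow e zero    = Is-𝟙
Is-pow e (suc n) = Is-⊗ e (Is-pow e n)

data Axis : Set where
  sᵃ tᵃ xᵃ : Axis

emb : Axis → Ser → PS
emb sᵃ f = tri f 1ˢ 1ˢ
emb tᵃ f = tri 1ˢ f 1ˢ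
emb xᵃ f = tri 1ˢ 1ˢ f

coord : Axis → ℕ → ℕ → ℕ → ℕ
coord sᵃ a b c = a
coord tᵃ a b c = b
coord xᵃ a b c = c

others : Axis → ℕ → ℕ → ℕ → ℚ
others sᵃ a b c = 1ˢ ⟪ b ⟫ ℚ.* 1ˢ ⟪ c ⟫
others tᵃ a b c = 1ˢ ⟪ a ⟫ ℚ.* 1ˢ ⟪ c ⟫
others xᵃ a b c = 1ˢ ⟪ a ⟫ ℚ.* 1ˢ ⟪ b ⟫

emb-coord : ∀ x f a b c → emb x f a b c ≡ f ⟪ coord x a b c ⟫ ℚ.* others x a b c
emb-coord sᵃ f a b c = ℚₚ.*-assoc (f ⟪ a ⟫) _ _
emb-coord tᵃ f a b c = let open ℚSolver.+-*-Solver in solve 3 (λ p q r → p :* q :* r := q :* (p :* r)) refl (1ˢ ⟪ a ⟫) (f ⟪ b ⟫) (1ˢ ⟪ c ⟫)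
emb-coord xᵃ f a b c = ℚₚ.*-comm _ (f ⟪ c ⟫)

coord≤ : ∀ x a b c → coord x a b c ≤ a ℕ.+ b ℕ.+ c
coord≤ sᵃ a b c = ℕₚ.≤-trans (ℕₚ.m≤m+n a b) (ℕₚ.m≤m+n (a ℕ.+ b) c)
coord≤ tᵃ a b c = ℕₚ.≤-trans (ℕₚ.m≤n+m b a) (ℕₚ.m≤m+n (a ℕ.+ b) c)
coord≤ xᵃ a b c = ℕₚ.m≤n+m c (a ℕ.+ b)

On : Axis → PS → Ser → Set
On sᵃ F f = Is F f 1ˢ 1ˢ
On tᵃ F f = Is F 1ˢ f 1ˢ
On xᵃ F f = Is F 1ˢ 1ˢ f

On-emb : ∀ x {F f} → (∀ a b c → F a b c ≡ emb x f a b c) → On x F f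
On-emb sᵃ = is
On-emb tᵃ = is
On-emb xᵃ = is

emb-On : ∀ x {F f} → On x F f → ∀ a b c → F a b c ≡ emb x f a b c
emb-On sᵃ = ext
emb-On tᵃ = ext
emb-On xᵃ = ext

module _ (x : Axis) where

  private
    via : ∀ {F f} → On x F f → ∀ a b c → F a b c ≡ f ⟪ coord x a b c ⟫ ℚ.* others x a b c
    via {F} {f} e a b c = trans (emb-On x e a b c) (emb-coord x f a b c)

    back : ∀ {F f} → (∀ a b c → F a b c ≡ f ⟪ coord x a b c ⟫ ℚ.* others x a b c) → On x F f
    back {F} {f} e = On-emb x (λ a b c → trans (e a b c) (sym (emb-coord x f a b c)))

  On-cong : ∀ {F f g} → f ≗ g → On x F f → On x F g
  On-cong e o = back (λ a b c → trans (via o a b c) (cong (ℚ._* others x a b c) (coeff e (coord x a b c))))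

  On-⊕ : ∀ {F G f g} → On x F f → On x G g → On x (F ⊕ G) (f ⊞ g)
  On-⊕ {f = f} {g} o o′ = back (λ a b c → trans (cong₂ ℚ._+_ (via o a b c) (via o′ a b c)) (sym (ℚₚ.*-distribʳ-+ (others x a b c) (f ⟪ coord x a b c ⟫) (g ⟪ coord x a b c ⟫))))

  On-⊖ : ∀ {F G f g} → On x F f → On x G g → On x (F ⊖ G) (f ⊟ g)
  On-⊖ {F} {G} {f} {g} o o′ = back (λ a b c → trans (cong₂ (λ p q → p ℚ.+ (ℚ.- q)) (via o a b c) (via o′ a b c))
    (let open ℚSolver.+-*-Solver in solve 3 (λ p q r → p :* r :+ (:- (q :* r)) := (p :+ (:- q)) :* r) refl (f ⟪ coord x a b c ⟫) (g ⟪ coord x a b c ⟫) (others x a b c)))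

  On-· : ∀ {F f} q → On x F f → On x (q · F) (q ·ˢ f)
  On-· q o = back (λ a b c → trans (cong (q ℚ.*_) (via o a b c)) (sym (ℚₚ.*-assoc q _ _)))

  On-∑ : ∀ {I : Set} (L : List I) {F : I → PS} {f : I → Ser} → (∀ i → On x (F i) (f i)) → On x (λ a b c → ∑ℚ L (λ i → F i a b c)) (∑ˢ L f)
  On-∑ L o = back (λ a b c → trans (ℚ∑.∑-cong L (λ i → via (o i) a b c)) (ℚ∑.∑-*ʳ L (others x a b c) _))

  -- `Σ∞` cuts off at the total degree a+b+c, `Sub` at the degree in the single variable; the terms
  -- in between vanish because v^k has order at least k.
  On-subst′ : ∀ {V v} → (∀ k → On x (pow V k) (v ^ˢ k)) → v ⟪ 0 ⟫ ≡ 0ℚ → ∀ q → On x (subst q V) (Sub v (ser q))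
  On-subst′ {V} {v} o v0 q = back λ a b c → let p = coord x a b c; r = others x a b c in begin
    subst q V a b c
      ≡⟨ sumℚ≡∑≤ (a ℕ.+ b ℕ.+ c) _ ⟩
    ∑≤ (a ℕ.+ b ℕ.+ c) (λ k → q k ℚ.* pow V k a b c)
      ≡⟨ ∑≤-cong (a ℕ.+ b ℕ.+ c) (λ k → trans (cong (q k ℚ.*_) (via (o k) a b c)) (sym (ℚₚ.*-assoc (q k) _ r))) ⟩
    ∑≤ (a ℕ.+ b ℕ.+ c) (λ k → q k ℚ.* (v ^ˢ k) ⟪ p ⟫ ℚ.* r)
      ≡⟨ ∑≤-*ʳ (a ℕ.+ b ℕ.+ c) r (λ k → q k ℚ.* (v ^ˢ k) ⟪ p ⟫) ⟩
    ∑≤ (a ℕ.+ b ℕ.+ c) (λ k → q k ℚ.* (v ^ˢ k) ⟪ p ⟫) ℚ.* r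
      ≡⟨ cong (ℚ._* r) (∑≤-trunc≤ (coord≤ x a b c) (λ k lt → trans (cong (q k ℚ.*_) (^ˢ-order {v} v0 lt)) (ℚₚ.*-zeroʳ (q k)))) ⟩
    Sub v (ser q) ⟪ p ⟫ ℚ.* r ∎
    where open ≡-Reasoning

On-⊗ : ∀ x {F G f g} → On x F f → On x G g → On x (F ⊗ G) (f ✶ g)
On-⊗ sᵃ o o′ = Is-cong ≗-refl (✶-identityˡ 1ˢ) (✶-identityˡ 1ˢ) (Is-⊗ o o′)
On-⊗ tᵃ o o′ = Is-cong (✶-identityˡ 1ˢ) ≗-refl (✶-identityˡ 1ˢ) (Is-⊗ o o′)
On-⊗ xᵃ o o′ = Is-cong (✶-identityˡ 1ˢ) (✶-identityˡ 1ˢ) ≗-refl (Is-⊗ o o′)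

On-𝟙 : ∀ x → On x 𝟙 1ˢ
On-𝟙 sᵃ = Is-𝟙
On-𝟙 tᵃ = Is-𝟙
On-𝟙 xᵃ = Is-𝟙

module _ (x : Axis) where

  On-pow : ∀ {F f} → On x F f → ∀ n → On x (pow F n) (f ^ˢ n)
  On-pow o zero    = On-𝟙 x
  On-pow o (suc n) = On-⊗ x o (On-pow o n)

  On-subst : ∀ {V v} → On x V v → v ⟪ 0 ⟫ ≡ 0ℚ → ∀ q → On x (subst q V) (Sub v (ser q))
  On-subst {V} {v} o v0 q = On-subst′ x {V} {v} (On-pow {V} {v} o) v0 q

  On-inv : ∀ {G g} → On x G g → g ⟪ 0 ⟫ ≡ 1ℚ → On x (inv G) (invˢ g)
  On-inv {G} {g} o g0 = On-cong x {inv G} (Sub-cong (1ˢ ⊟ g) (ptw λ _ → refl))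
    (On-subst {𝟙 ⊖ G} {1ˢ ⊟ g} (On-⊖ x {𝟙} {G} (On-𝟙 x) o) (cong (λ z → 1ℚ ℚ.+ (ℚ.- z)) g0) (λ _ → 1ℚ))

module _ {I : Set} {L : List I} where

  Is∑-cong : ∀ {F} {f g h f′ g′ h′ : I → Ser} → (∀ i → f i ≗ f′ i) → (∀ i → g i ≗ g′ i) → (∀ i → h i ≗ h′ i) → Is∑ L F f g h → Is∑ L F f′ g′ h′
  Is∑-cong p q r e .value a b c = trans (value e a b c) (ℚ∑.∑-cong L (λ i → tri-cong (p i) (q i) (r i) a b c))

  Is∑-⊗ˡ : ∀ {F G f g h} {f′ g′ h′ : I → Ser} → Is F f g h → Is∑ L G f′ g′ h′ → Is∑ L (F ⊗ G) (λ i → f ✶ f′ i) (λ i → g ✶ g′ i) (λ i → h ✶ h′ i)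
  Is∑-⊗ˡ {F} {G} {f} {g} {h} {f′} {g′} {h′} e e′ .value a b c = begin
    (F ⊗ G) a b c
      ≡⟨ ⊗-cong {F} {tri f g h} {G} {λ a b c → ∑ℚ L (λ i → G′ i a b c)} (ext e) (value e′) a b c ⟩
    (tri f g h ⊗ (λ a b c → ∑ℚ L (λ i → G′ i a b c))) a b c
      ≡⟨ ⊗-∑≤ (tri f g h) (λ a b c → ∑ℚ L (λ i → G′ i a b c)) a b c ⟩
    ∑≤ a (λ i → ∑≤ b (λ j → ∑≤ c (λ k → tri f g h i j k ℚ.* ∑ℚ L (λ y → G′ y (a ∸ i) (b ∸ j) (c ∸ k)))))
      ≡⟨ ∑≤-cong a (λ i → trans (∑≤-cong b (λ j → trans (∑≤-cong c (λ k → sym (ℚ∑.∑-*ˡ L (tri f g h i j k) _))) (∑≤-∑ c L _))) (∑≤-∑ b L _)) ⟩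
    ∑≤ a (λ i → ∑ℚ L (λ y → ∑≤ b (λ j → ∑≤ c (λ k → tri f g h i j k ℚ.* G′ y (a ∸ i) (b ∸ j) (c ∸ k)))))
      ≡⟨ ∑≤-∑ a L _ ⟩
    ∑ℚ L (λ y → ∑≤ a (λ i → ∑≤ b (λ j → ∑≤ c (λ k → tri f g h i j k ℚ.* G′ y (a ∸ i) (b ∸ j) (c ∸ k)))))
      ≡⟨ ℚ∑.∑-cong L (λ y → trans (sym (⊗-∑≤ (tri f g h) (G′ y) a b c)) (tri-⊗ f g h (f′ y) (g′ y) (h′ y) a b c)) ⟩
    ∑ℚ L (λ y → tri (f ✶ f′ y) (g ✶ g′ y) (h ✶ h′ y) a b c) ∎
    where
    open ≡-Reasoning
    G′ : I → PS
    G′ i = tri (f′ i) (g′ i) (h′ i)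

  Is∑-⊗ʳ : ∀ {F G f g h} {f′ g′ h′ : I → Ser} → Is∑ L G f′ g′ h′ → Is F f g h → Is∑ L (G ⊗ F) (λ i → f′ i ✶ f) (λ i → g′ i ✶ g) (λ i → h′ i ✶ h)
  Is∑-⊗ʳ {F} {G} {f} {g} {h} {f′} {g′} {h′} e′ e .value a b c = begin
    (G ⊗ F) a b c
      ≡⟨ ⊗-cong {G} {λ a b c → ∑ℚ L (λ i → G′ i a b c)} {F} {tri f g h} (value e′) (ext e) a b c ⟩
    ((λ a b c → ∑ℚ L (λ i → G′ i a b c)) ⊗ tri f g h) a b c
      ≡⟨ ⊗-∑≤ (λ a b c → ∑ℚ L (λ i → G′ i a b c)) (tri f g h) a b c ⟩
    ∑≤ a (λ i → ∑≤ b (λ j → ∑≤ c (λ k → ∑ℚ L (λ y → G′ y i j k) ℚ.* tri f g h (a ∸ i) (b ∸ j) (c ∸ k))))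
      ≡⟨ ∑≤-cong a (λ i → trans (∑≤-cong b (λ j → trans (∑≤-cong c (λ k → sym (ℚ∑.∑-*ʳ L (tri f g h (a ∸ i) (b ∸ j) (c ∸ k)) _))) (∑≤-∑ c L _))) (∑≤-∑ b L _)) ⟩
    ∑≤ a (λ i → ∑ℚ L (λ y → ∑≤ b (λ j → ∑≤ c (λ k → G′ y i j k ℚ.* tri f g h (a ∸ i) (b ∸ j) (c ∸ k)))))
      ≡⟨ ∑≤-∑ a L _ ⟩
    ∑ℚ L (λ y → ∑≤ a (λ i → ∑≤ b (λ j → ∑≤ c (λ k → G′ y i j k ℚ.* tri f g h (a ∸ i) (b ∸ j) (c ∸ k)))))
      ≡⟨ ℚ∑.∑-cong L (λ y → trans (sym (⊗-∑≤ (G′ y) (tri f g h) a b c)) (tri-⊗ (f′ y) (g′ y) (h′ y) f g h a b c)) ⟩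
    ∑ℚ L (λ y → tri (f′ y ✶ f) (g′ y ✶ g) (h′ y ✶ h) a b c) ∎
    where
    open ≡-Reasoning
    G′ : I → PS
    G′ i = tri (f′ i) (g′ i) (h′ i)

sumSym-∑ : ∀ n F a b c → sumSym n F a b c ≡ ∑ℚ (Sym n) (λ w → F w a b c)
sumSym-∑ n F a b c = go (Sym n)
  where
  go : ∀ W → foldr (λ w acc → F w ⊕ acc) 𝟘 W a b c ≡ ∑ℚ W (λ w → F w a b c)
  go []      = refl
  go (w ∷ W) = cong (F w a b c ℚ.+_) (go W)

-- Generating series of the three statistics

½ : ℚ
½ = + 1 ℚ./ 2

-- They absorb the stray factors of the counts: x = ½ (1+x²) `𝕊` in `cnt-udr` and 2x/(1-x)² = ½ `𝕌`²
-- `𝕋` in `cnt-pk` raise the exponents by one, to `udr` and to the number of peaks plus one. Here n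
-- is the length of the pattern, for permutations of n+1 elements.
α β : ℕ → Ser
α n = cˢ ½ ✶ (1ˢ ⊞ 𝕩 ✶ 𝕩) ✶ (𝕁 ✶ 𝕁) ✶ ℂ ^ˢ n
β n = cˢ ½ ✶ 𝕌 ^ˢ suc (suc n)

private
  nonempty : ∀ n {w} → w ∈ Sym (suc n) → ∃₂ λ u us → w ≡ u ∷ us × Unique (u ∷ us) × length us ≡ n
  nonempty n {w} m = go w (Perm.len (suc n) (Sym⁻ (suc n) m)) (Perm.uniq (suc n) (Sym⁻ (suc n) m))
    where
    go : ∀ w → length w ≡ suc n → Unique w → ∃₂ λ u us → w ≡ u ∷ us × Unique (u ∷ us) × length us ≡ n
    go (u ∷ us) l q = u , us , refl , q , ℕₚ.suc-injective l

cnt-α : ∀ n {w} → w ∈ Sym (suc n) → ∀ a → ℕtoℚ (cnt even (upTo a) (pat w)) ≡ (α n ✶ 𝕊 ^ˢ udr w) ⟪ a ⟫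
cnt-α n m a with nonempty n m
... | u , us , refl , q , refl = trans (cnt-udr (pat (u ∷ us)) a) (coeff (begin
  𝕩 ✶ (𝕁 ✶ 𝕁 ✶ ℂ ^ˢ length (pat (u ∷ us)) ✶ s)
    ≡⟨ cong (λ k → 𝕩 ✶ (𝕁 ✶ 𝕁 ✶ ℂ ^ˢ k ✶ s)) (length-patR _<ᵇ_ u us) ⟩
  𝕩 ✶ (𝕁 ✶ 𝕁 ✶ ℂ ^ˢ length us ✶ s)
    ≈⟨ solve 4 (λ x j c s → x :* (j :* c :* s) := con ½ :* (con (+ 2 ℚ./ 1) :* x) :* j :* c :* s) ≗-refl 𝕩 (𝕁 ✶ 𝕁) (ℂ ^ˢ length us) s ⟩
  cˢ ½ ✶ (cˢ (+ 2 ℚ./ 1) ✶ 𝕩) ✶ (𝕁 ✶ 𝕁) ✶ ℂ ^ˢ length us ✶ s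
    ≈⟨ ℛ.*-congʳ (ℛ.*-congʳ (ℛ.*-congʳ (ℛ.*-congˡ 1+𝕩²-𝕊))) ⟨
  cˢ ½ ✶ ((1ˢ ⊞ 𝕩 ✶ 𝕩) ✶ 𝕊) ✶ (𝕁 ✶ 𝕁) ✶ ℂ ^ˢ length us ✶ s
    ≈⟨ solve 5 (λ p S j c s → con ½ :* (p :* S) :* j :* c :* s := con ½ :* p :* j :* c :* (S :* s)) ≗-refl (1ˢ ⊞ 𝕩 ✶ 𝕩) 𝕊 (𝕁 ✶ 𝕁) (ℂ ^ˢ length us) s ⟩
  α (length us) ✶ 𝕊 ^ˢ suc (changes (true ∷ pat (u ∷ us)))
    ≡⟨ cong (λ k → α (length us) ✶ 𝕊 ^ˢ k) (udr-pat u us q) ⟨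
  α (length us) ✶ 𝕊 ^ˢ udr (u ∷ us) ∎) a)
  where
  open 𝒮 using (solve; con; _:=_; _:*_)
  open SetoidR ℛ.setoid
  s = 𝕊 ^ˢ changes (true ∷ pat (u ∷ us))

cnt-β : ∀ n {w} → w ∈ Sym (suc n) → ∀ b → ℕtoℚ (cnt odd (upTo (b ℕ.* 2)) (pat w)) ≡ (β n ✶ 𝕋 ^ˢ (pk w ℕ.+ 1)) ⟪ b ⟫
cnt-β n m b with nonempty n m
... | u , us , refl , q , refl = trans (cnt-pk (pat (u ∷ us)) b) (coeff (begin
  𝕩 ✶ (cˢ (+ 2 ℚ./ 1) ✶ (𝕁 ✶ 𝕁) ✶ 𝕌 ^ˢ length (pat (u ∷ us)) ✶ t)
    ≡⟨ cong (λ k → 𝕩 ✶ (cˢ (+ 2 ℚ./ 1) ✶ (𝕁 ✶ 𝕁) ✶ 𝕌 ^ˢ k ✶ t)) (length-patR _<ᵇ_ u us) ⟩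
  𝕩 ✶ (cˢ (+ 2 ℚ./ 1) ✶ (𝕁 ✶ 𝕁) ✶ 𝕌 ^ˢ length us ✶ t)
    ≈⟨ solve 4 (λ x j c s → x :* (con (+ 2 ℚ./ 1) :* j :* c :* s) := con ½ :* (con (+ 4 ℚ./ 1) :* x :* j) :* c :* s) ≗-refl 𝕩 (𝕁 ✶ 𝕁) (𝕌 ^ˢ length us) t ⟩
  cˢ ½ ✶ (cˢ (+ 4 ℚ./ 1) ✶ 𝕩 ✶ (𝕁 ✶ 𝕁)) ✶ 𝕌 ^ˢ length us ✶ t
    ≈⟨ ℛ.*-congʳ (ℛ.*-congʳ (ℛ.*-congˡ 𝕌𝕋)) ⟨
  cˢ ½ ✶ (𝕌 ✶ 𝕌 ✶ 𝕋) ✶ 𝕌 ^ˢ length us ✶ t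
    ≈⟨ solve 4 (λ u T v t → con ½ :* (u :* u :* T) :* v :* t := con ½ :* (u :* (u :* v)) :* (T :* t)) ≗-refl 𝕌 𝕋 (𝕌 ^ˢ length us) t ⟩
  β (length us) ✶ 𝕋 ^ˢ suc (peaks (pat (u ∷ us)))
    ≡⟨ cong (λ k → β (length us) ✶ 𝕋 ^ˢ k) (trans (ℕₚ.+-comm (pk (u ∷ us)) 1) (cong suc (pk-pat u us q))) ⟨
  β (length us) ✶ 𝕋 ^ˢ (pk (u ∷ us) ℕ.+ 1) ∎) b)
  where
  open 𝒮 using (solve; con; _:=_; _:*_)
  open SetoidR ℛ.setoid
  t = 𝕋 ^ˢ peaks (pat (u ∷ us))

cnt-γ : ∀ n {w} → w ∈ Sym (suc n) → ∀ b → ℕtoℚ (cnt all⁺ (upTo b) (pat w)) ≡ (𝕩 ^ˢ (des w ℕ.+ 1) ✶ 𝕁 ^ˢ suc (suc n)) ⟪ b ⟫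
cnt-γ n m b with nonempty n m
... | u , us , refl , q , refl = trans (cnt-des (pat (u ∷ us)) b) (cong₂ (λ k l → (𝕩 ^ˢ k ✶ 𝕁 ^ˢ suc (suc l)) ⟪ b ⟫)
  (sym (trans (ℕₚ.+-comm (des (u ∷ us)) 1) (cong suc (des-pat u us q)))) (length-patR _<ᵇ_ u us))

powers : ℕ → Ser
powers k ⟪ b ⟫ = ℕtoℚ (b ℕ.^ k)

evenPowers : ℕ → Ser
evenPowers k ⟪ b ⟫ = ℕtoℚ ((b ℕ.* 2) ℕ.^ k)

module _ (n : ℕ) where

  private
    total : ∀ δ N → ∑ℚ (Sym (suc n)) (λ w → ℕtoℚ (cnt δ (upTo N) (pat w))) ≡ ℕtoℚ (N ℕ.^ suc n)
    total δ N = trans (sym (ℕtoℚ-∑ (Sym (suc n)) (λ w → cnt δ (upTo N) (pat w))))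
      (cong ℕtoℚ (trans (∑-Sym-cnt n δ (upTo N) (Uniqueₚ.upTo⁺ N)) (cong (ℕ._^ suc n) (Listₚ.length-upTo N))))

  ∑-udr : α n ✶ ∑ˢ (Sym (suc n)) (λ w → 𝕊 ^ˢ udr w) ≗ powers (suc n)
  ∑-udr = ≗-trans (∑ˢ-✶ˡ (Sym (suc n)) (α n) (λ w → 𝕊 ^ˢ udr w)) (ptw λ a →
    trans (ℚ∑.∑-cong∈ (Sym (suc n)) (λ m → sym (cnt-α n m a))) (total even a))

  ∑-pk : β n ✶ ∑ˢ (Sym (suc n)) (λ w → 𝕋 ^ˢ (pk w ℕ.+ 1)) ≗ evenPowers (suc n)
  ∑-pk = ≗-trans (∑ˢ-✶ˡ (Sym (suc n)) (β n) (λ w → 𝕋 ^ˢ (pk w ℕ.+ 1))) (ptw λ b →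
    trans (ℚ∑.∑-cong∈ (Sym (suc n)) (λ m → sym (cnt-β n m b))) (total odd (b ℕ.* 2)))

  ∑-des : ∑ˢ (Sym (suc n)) (λ w → 𝕩 ^ˢ (des w ℕ.+ 1) ✶ 𝕁 ^ˢ suc (suc n)) ≗ powers (suc n)
  ∑-des .coeff b = trans (ℚ∑.∑-cong∈ (Sym (suc n)) (λ m → sym (cnt-γ n m b))) (total all⁺ b)

  -- `cnt-α` counts the words compatible with w and `cnt-β`, applied to the inverse, those
  -- compatible with w⁻¹; the pairs are counted by `∑-Sym-cnt-𝕌`.
  ∑-udr-ipk : ∀ a b → ∑ℚ (Sym (suc n)) (λ w → (α n ✶ 𝕊 ^ˢ udr w) ⟪ a ⟫ ℚ.* (β n ✶ 𝕋 ^ˢ (ipk w ℕ.+ 1)) ⟪ b ⟫) ≡ (𝕌 ^ˢ (a ℕ.* b)) ⟪ suc n ⟫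
  ∑-udr-ipk a b = trans (ℚ∑.∑-cong∈ (Sym (suc n)) (λ {w} m → trans
      (cong₂ ℚ._*_ (sym (cnt-α n m a)) (sym (cnt-β n (Sym⁺ (suc n) (Perm.inverse-↭ (suc n) (Sym⁻ (suc n) m))) b)))
      (sym (ℕtoℚ-* (cnt even (upTo a) (pat w)) (cnt odd (upTo (b ℕ.* 2)) (pat (inverse w)))))))
    (trans (sym (ℕtoℚ-∑ (Sym (suc n)) (λ w → cnt even (upTo a) (pat w) ℕ.* cnt odd (upTo (b ℕ.* 2)) (pat (inverse w)))))
      (∑-Sym-cnt-𝕌 b a n))

recipFact-! : ∀ n → recipFact n ℚ.* ℕtoℚ (n !) ≡ 1ℚ
recipFact-! n = go (n !) {{ℕₚ._!≢0 n}}
  where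
  go : ∀ m .{{_ : NonZero m}} → (+ 1 ℚ./ m) ℚ.* ℕtoℚ m ≡ 1ℚ
  go (suc m) = ℚₚ.toℚᵘ-injective (begin
    ℚ.toℚᵘ ((+ 1 ℚ./ suc m) ℚ.* ℕtoℚ (suc m))             ≈⟨ ℚₚ.toℚᵘ-homo-* (+ 1 ℚ./ suc m) (ℕtoℚ (suc m)) ⟩
    ℚ.toℚᵘ (+ 1 ℚ./ suc m) ℚᵘ.* ℚ.toℚᵘ (ℕtoℚ (suc m))     ≈⟨ ℚᵘₚ.*-cong (ℚₚ.toℚᵘ-fromℚᵘ (ℚᵘ.mkℚᵘ (+ 1) m)) (ℚₚ.toℚᵘ-fromℚᵘ (ℚᵘ.mkℚᵘ (+ suc m) 0)) ⟩
    ℚᵘ.mkℚᵘ (+ 1) m ℚᵘ.* ℚᵘ.mkℚᵘ (+ suc m) 0                    ≈⟨ ℚᵘ.*≡* (trans (ℤₚ.*-identityʳ _) (trans (ℤₚ.*-identityˡ (+ suc m)) (sym (trans (ℤₚ.*-identityˡ _) (cong +_ (ℕₚ.*-identityʳ (suc m))))))) ⟩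
    ℚ.toℚᵘ 1ℚ ∎)
    where open SetoidR ℚᵘₚ.≃-setoid

𝕌^-recipFact : ∀ n m → (𝕌 ^ˢ m) ⟪ n ⟫ ≡ recipFact n ℚ.* ∑≤ n (λ k → ℕtoℚ (d n k ℕ.* (2 ℕ.* m) ℕ.^ k))
𝕌^-recipFact n m = begin
  u                                                 ≡⟨ ℚₚ.*-identityˡ u ⟨
  1ℚ ℚ.* u                                          ≡⟨ cong (ℚ._* u) (recipFact-! n) ⟨
  recipFact n ℚ.* ℕtoℚ (n !) ℚ.* u                  ≡⟨ ℚₚ.*-assoc (recipFact n) (ℕtoℚ (n !)) u ⟩
  recipFact n ℚ.* (ℕtoℚ (n !) ℚ.* u)                ≡⟨ cong (recipFact n ℚ.*_) (𝕌^-d m n) ⟩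
  recipFact n ℚ.* ℕtoℚ (∑ℕ (upTo (suc n)) D)        ≡⟨ cong (recipFact n ℚ.*_) (trans (ℕtoℚ-∑ (upTo (suc n)) D) (∑≤-upTo n (ℕtoℚ ∘ D))) ⟩
  recipFact n ℚ.* ∑≤ n (ℕtoℚ ∘ D) ∎
  where
  open ≡-Reasoning
  u = (𝕌 ^ˢ m) ⟪ n ⟫
  D : ℕ → ℕ
  D k = d n k ℕ.* (2 ℕ.* m) ℕ.^ k

-- Parts (a) and (b)

term : ℕ → PS
term n = pow (𝟙 ⊕ S ⊗ S) n ⊗ pow (inv (𝟙 ⊖ S ⊗ S)) (n ∸ 1)
         ⊗ pow ((𝟙 ⊕ T) ⊗ inv (𝟙 ⊖ T)) (suc n)
         ⊗ Pudripk n ((+ 2 ℚ./ 1) · S ⊗ inv (𝟙 ⊕ S ⊗ S))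
                     ((+ 4 ℚ./ 1) · T ⊗ pow (inv (𝟙 ⊕ T)) 2)

uˣ : PS
uˣ = (𝟙 ⊕ X) ⊗ inv (𝟙 ⊖ X)

prefactor : PS
prefactor = (+ 1 ℚ./ 4) · pow (inv (𝟙 ⊖ S)) 2

On-S² : On sᵃ (S ⊗ S) (𝕩 ✶ 𝕩)
On-S² = On-⊗ sᵃ Is-S Is-S

On-𝕂 : On sᵃ (inv (𝟙 ⊖ S ⊗ S)) 𝕂
On-𝕂 = On-inv sᵃ {𝟙 ⊖ S ⊗ S} (On-⊖ sᵃ {𝟙} {S ⊗ S} Is-𝟙 On-S²) refl

On-𝕁ˢ : On sᵃ (inv (𝟙 ⊖ S)) 𝕁
On-𝕁ˢ = On-inv sᵃ {𝟙 ⊖ S} (On-⊖ sᵃ {𝟙} {S} Is-𝟙 Is-S) refl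

On-𝕁ᵗ : On tᵃ (inv (𝟙 ⊖ T)) 𝕁
On-𝕁ᵗ = On-inv tᵃ {𝟙 ⊖ T} (On-⊖ tᵃ {𝟙} {T} Is-𝟙 Is-T) refl

On-𝕌ᵗ : On tᵃ ((𝟙 ⊕ T) ⊗ inv (𝟙 ⊖ T)) 𝕌
On-𝕌ᵗ = On-⊗ tᵃ (On-⊕ tᵃ {𝟙} {T} Is-𝟙 Is-T) On-𝕁ᵗ

On-𝕌ˣ : On xᵃ ((𝟙 ⊕ X) ⊗ inv (𝟙 ⊖ X)) 𝕌
On-𝕌ˣ = On-⊗ xᵃ (On-⊕ xᵃ {𝟙} {X} Is-𝟙 Is-X) (On-inv xᵃ {𝟙 ⊖ X} (On-⊖ xᵃ {𝟙} {X} Is-𝟙 Is-X) refl)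

On-𝕊 : On sᵃ ((+ 2 ℚ./ 1) · S ⊗ inv (𝟙 ⊕ S ⊗ S)) 𝕊
On-𝕊 = On-⊗ sᵃ (On-· sᵃ {S} (+ 2 ℚ./ 1) Is-S) (On-inv sᵃ {𝟙 ⊕ S ⊗ S} (On-⊕ sᵃ {𝟙} {S ⊗ S} Is-𝟙 On-S²) refl)

On-𝕋 : On tᵃ ((+ 4 ℚ./ 1) · T ⊗ pow (inv (𝟙 ⊕ T)) 2) 𝕋
On-𝕋 = On-⊗ tᵃ (On-· tᵃ {T} (+ 4 ℚ./ 1) Is-T) (On-pow tᵃ {inv (𝟙 ⊕ T)} (On-inv tᵃ {𝟙 ⊕ T} (On-⊕ tᵃ {𝟙} {T} Is-𝟙 Is-T) refl) 2)

module _ where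
  open 𝒮 using (solve; con; _:=_; _:*_)

  Is∑-Pudripk : ∀ n {y z f g} → On sᵃ y f → On tᵃ z g → Is∑ (Sym n) (Pudripk n y z) (λ w → f ^ˢ udr w) (λ w → g ^ˢ (ipk w ℕ.+ 1)) (λ _ → 1ˢ)
  Is∑-Pudripk n {y} {z} {f} {g} o o′ .value a b c = trans (sumSym-∑ n (λ w → pow y (udr w) ⊗ pow z (ipk w ℕ.+ 1)) a b c)
    (ℚ∑.∑-cong (Sym n) (λ w → ext (Is-cong (ℛ.*-identityʳ _) (✶-identityˡ _) (✶-identityˡ 1ˢ)
      (Is-⊗ (On-pow sᵃ {y} o (udr w)) (On-pow tᵃ {z} o′ (ipk w ℕ.+ 1)))) a b c))

  Is∑-term : ∀ n → Is∑ (Sym n) (term n) (λ w → (1ˢ ⊞ 𝕩 ✶ 𝕩) ^ˢ n ✶ 𝕂 ^ˢ (n ∸ 1) ✶ 𝕊 ^ˢ udr w) (λ w → 𝕌 ^ˢ suc n ✶ 𝕋 ^ˢ (ipk w ℕ.+ 1)) (λ _ → 1ˢ)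
  Is∑-term n = Is∑-cong
    (λ w → solve 3 (λ p k s → p :* k :* con 1ℚ :* s := p :* k :* s) ≗-refl ((1ˢ ⊞ 𝕩 ✶ 𝕩) ^ˢ n) (𝕂 ^ˢ (n ∸ 1)) (𝕊 ^ˢ udr w))
    (λ w → solve 2 (λ u t → con 1ℚ :* con 1ℚ :* u :* t := u :* t) ≗-refl (𝕌 ^ˢ suc n) (𝕋 ^ˢ (ipk w ℕ.+ 1)))
    (λ w → solve 0 (con 1ℚ :* con 1ℚ :* con 1ℚ :* con 1ℚ := con 1ℚ) ≗-refl)
    (Is∑-⊗ˡ (Is-⊗ (Is-⊗ (On-pow sᵃ {𝟙 ⊕ S ⊗ S} (On-⊕ sᵃ {𝟙} {S ⊗ S} Is-𝟙 On-S²) n) (On-pow sᵃ {inv (𝟙 ⊖ S ⊗ S)} On-𝕂 (n ∸ 1)))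
                    (On-pow tᵃ {(𝟙 ⊕ T) ⊗ inv (𝟙 ⊖ T)} On-𝕌ᵗ (suc n)))
            (Is∑-Pudripk n On-𝕊 On-𝕋))

  On-prefactor : On sᵃ prefactor ((+ 1 ℚ./ 4) ·ˢ 𝕁 ^ˢ 2)
  On-prefactor = On-· sᵃ {pow (inv (𝟙 ⊖ S)) 2} (+ 1 ℚ./ 4) (On-pow sᵃ {inv (𝟙 ⊖ S)} On-𝕁ˢ 2)

  -- Up to constants the factors in front of the polynomial are those of the word counts: they
  -- amount to ½ `α n` in s and to 2 `β n` in t, and the constants cancel.
  prefactor-term : ∀ n a b c → (prefactor ⊗ term (suc n)) a b c ≡ (𝕌 ^ˢ (a ℕ.* b)) ⟪ suc n ⟫ ℚ.* 1ˢ ⟪ c ⟫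
  prefactor-term n a b c = begin
    (prefactor ⊗ term (suc n)) a b c
      ≡⟨ value (Is∑-cong udr-part ipk-part (λ _ → ✶-identityˡ 1ˢ) (Is∑-⊗ˡ On-prefactor (Is∑-term (suc n)))) a b c ⟩
    ∑ℚ (Sym (suc n)) (λ w → tri (cˢ ½ ✶ (α n ✶ 𝕊 ^ˢ udr w)) (cˢ (ℕtoℚ 2) ✶ (β n ✶ 𝕋 ^ˢ (ipk w ℕ.+ 1))) 1ˢ a b c)
      ≡⟨ ℚ∑.∑-cong (Sym (suc n)) (λ w → trans (cong₂ (λ p q → p ℚ.* q ℚ.* 1ˢ ⟪ c ⟫) (coeff (cˢ-✶ ½ (α n ✶ 𝕊 ^ˢ udr w)) a) (coeff (cˢ-✶ (ℕtoℚ 2) (β n ✶ 𝕋 ^ˢ (ipk w ℕ.+ 1))) b))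
           (halves ((α n ✶ 𝕊 ^ˢ udr w) ⟪ a ⟫) ((β n ✶ 𝕋 ^ˢ (ipk w ℕ.+ 1)) ⟪ b ⟫) (1ˢ ⟪ c ⟫))) ⟩
    ∑ℚ (Sym (suc n)) (λ w → (α n ✶ 𝕊 ^ˢ udr w) ⟪ a ⟫ ℚ.* (β n ✶ 𝕋 ^ˢ (ipk w ℕ.+ 1)) ⟪ b ⟫ ℚ.* 1ˢ ⟪ c ⟫)
      ≡⟨ ℚ∑.∑-*ʳ (Sym (suc n)) (1ˢ ⟪ c ⟫) (λ w → (α n ✶ 𝕊 ^ˢ udr w) ⟪ a ⟫ ℚ.* (β n ✶ 𝕋 ^ˢ (ipk w ℕ.+ 1)) ⟪ b ⟫) ⟩
    ∑ℚ (Sym (suc n)) (λ w → (α n ✶ 𝕊 ^ˢ udr w) ⟪ a ⟫ ℚ.* (β n ✶ 𝕋 ^ˢ (ipk w ℕ.+ 1)) ⟪ b ⟫) ℚ.* 1ˢ ⟪ c ⟫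
      ≡⟨ cong (ℚ._* 1ˢ ⟪ c ⟫) (∑-udr-ipk n a b) ⟩
    (𝕌 ^ˢ (a ℕ.* b)) ⟪ suc n ⟫ ℚ.* 1ˢ ⟪ c ⟫ ∎
    where
    open ≡-Reasoning
    halves : ∀ x y z → ½ ℚ.* x ℚ.* (ℕtoℚ 2 ℚ.* y) ℚ.* z ≡ x ℚ.* y ℚ.* z
    halves = let module 𝒬 = ℚSolver.+-*-Solver in 𝒬.solve 3 (λ x y z → 𝒬.con ½ 𝒬.:* x 𝒬.:* (𝒬.con (ℕtoℚ 2) 𝒬.:* y) 𝒬.:* z 𝒬.:= x 𝒬.:* y 𝒬.:* z) refl
    udr-part : ∀ w → ((+ 1 ℚ./ 4) ·ˢ 𝕁 ^ˢ 2) ✶ ((1ˢ ⊞ 𝕩 ✶ 𝕩) ^ˢ suc n ✶ 𝕂 ^ˢ n ✶ 𝕊 ^ˢ udr w) ≗ cˢ ½ ✶ (α n ✶ 𝕊 ^ˢ udr w)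
    udr-part w = ≗-trans (ℛ.*-congʳ (·ˢ-con (+ 1 ℚ./ 4) (𝕁 ^ˢ 2))) (≗-trans
      (solve 5 (λ j p pn kn s → con (+ 1 ℚ./ 4) :* (j :* (j :* con 1ℚ)) :* (p :* pn :* kn :* s) := con ½ :* (con ½ :* p :* (j :* j) :* (pn :* kn) :* s)) ≗-refl
         𝕁 (1ˢ ⊞ 𝕩 ✶ 𝕩) ((1ˢ ⊞ 𝕩 ✶ 𝕩) ^ˢ n) (𝕂 ^ˢ n) (𝕊 ^ˢ udr w))
      (ℛ.*-congˡ (ℛ.*-congʳ (ℛ.*-congˡ (≗-sym (^ˢ-✶ (1ˢ ⊞ 𝕩 ✶ 𝕩) 𝕂 n))))))
    ipk-part : ∀ w → 1ˢ ✶ (𝕌 ^ˢ suc (suc n) ✶ 𝕋 ^ˢ (ipk w ℕ.+ 1)) ≗ cˢ (ℕtoℚ 2) ✶ (β n ✶ 𝕋 ^ˢ (ipk w ℕ.+ 1))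
    ipk-part w = solve 2 (λ u t → con 1ℚ :* (u :* t) := con (ℕtoℚ 2) :* (con ½ :* u :* t)) ≗-refl (𝕌 ^ˢ suc (suc n)) (𝕋 ^ˢ (ipk w ℕ.+ 1))

-- Comparison of coefficients in (a)

𝕩^-same : ∀ k → (𝕩 ^ˢ k) ⟪ k ⟫ ≡ 1ℚ
𝕩^-same zero    = refl
𝕩^-same (suc k) = trans (𝕩✶-suc (𝕩 ^ˢ k) k) (𝕩^-same k)

𝕩^-other : ∀ k {n} → n ≢ k → (𝕩 ^ˢ k) ⟪ n ⟫ ≡ 0ℚ
𝕩^-other zero    {zero}  ne = contradiction refl ne
𝕩^-other zero    {suc n} ne = refl
𝕩^-other (suc k) {zero}  ne = 𝕩✶-zero (𝕩 ^ˢ k)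
𝕩^-other (suc k) {suc n} ne = trans (𝕩✶-suc (𝕩 ^ˢ k) n) (𝕩^-other k (ne ∘ cong suc))

𝕁-coeff : ∀ n → 𝕁 ⟪ n ⟫ ≡ 1ℚ
𝕁-coeff n = trans (sym (coeff kern-true n)) (k1 n)
  where
  k1 : ∀ n → kern true ⟪ n ⟫ ≡ 1ℚ
  k1 zero    = refl
  k1 (suc n) = refl

-- The sum over n is infinite, beyond the reach of `Is∑`. A factor in s alone acts at fixed
-- exponents of t and x, and at a fixed exponent of x the infinite sum reduces to at most one term.
s-⊗ : ∀ {F f} → On sᵃ F f → ∀ H a b c → (F ⊗ H) a b c ≡ ∑≤ a (λ i → f ⟪ i ⟫ ℚ.* H (a ∸ i) b c)
s-⊗ {F} {f} o H a b c = trans (⊗-∑≤ F H a b c) (∑≤-cong a (λ i → trans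
  (∑≤-single b 0 z≤n (λ j ne → ∑≤-zero≤ c (λ k _ → trans (cong (ℚ._* H (a ∸ i) (b ∸ j) (c ∸ k)) (trans (ext o i j k) (trans (cong (λ z → f ⟪ i ⟫ ℚ.* z ℚ.* 1ˢ ⟪ k ⟫) (𝕩^-other 0 ne)) (trans (cong (ℚ._* 1ˢ ⟪ k ⟫) (ℚₚ.*-zeroʳ (f ⟪ i ⟫))) (ℚₚ.*-zeroˡ (1ˢ ⟪ k ⟫)))))) (ℚₚ.*-zeroˡ (H (a ∸ i) (b ∸ j) (c ∸ k))))))
  (trans (∑≤-single c 0 z≤n (λ k ne → trans (cong (ℚ._* H (a ∸ i) b (c ∸ k)) (trans (ext o i 0 k) (trans (cong (f ⟪ i ⟫ ℚ.* 1ℚ ℚ.*_) (𝕩^-other 0 ne)) (ℚₚ.*-zeroʳ (f ⟪ i ⟫ ℚ.* 1ℚ))))) (ℚₚ.*-zeroˡ (H (a ∸ i) b (c ∸ k)))))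
    (cong (ℚ._* H (a ∸ i) b c) (trans (ext o i 0 0) (trans (ℚₚ.*-identityʳ _) (ℚₚ.*-identityʳ (f ⟪ i ⟫))))))))

private
  xterms : PS
  xterms = Σ∞ (λ m → term (suc m) ⊗ pow X (suc m))

  term-x : ∀ m a b c → (term (suc m) ⊗ pow X (suc m)) a b c ≡ term (suc m) a b 0 ℚ.* (𝕩 ^ˢ suc m) ⟪ c ⟫
  term-x m a b c = trans (value (Is∑-⊗ʳ (Is∑-term (suc m)) (On-pow xᵃ {X} Is-X (suc m))) a b c) (trans
    (ℚ∑.∑-cong W (λ w → trans (tri-cong (ℛ.*-identityʳ (f w)) (ℛ.*-identityʳ (g w)) (✶-identityˡ (𝕩 ^ˢ suc m)) a b c)
      (cong (ℚ._* (𝕩 ^ˢ suc m) ⟪ c ⟫) (sym (ℚₚ.*-identityʳ (f w ⟪ a ⟫ ℚ.* g w ⟪ b ⟫))))))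
    (trans (ℚ∑.∑-*ʳ W ((𝕩 ^ˢ suc m) ⟪ c ⟫) (λ w → tri (f w) (g w) 1ˢ a b 0)) (cong (ℚ._* (𝕩 ^ˢ suc m) ⟪ c ⟫) (sym (value (Is∑-term (suc m)) a b 0)))))
    where
    W = Sym (suc m)
    f g : List ℕ → Ser
    f w = (1ˢ ⊞ 𝕩 ✶ 𝕩) ^ˢ suc m ✶ 𝕂 ^ˢ m ✶ 𝕊 ^ˢ udr w
    g w = 𝕌 ^ˢ suc (suc m) ✶ 𝕋 ^ˢ (ipk w ℕ.+ 1)

  xterms-zero : ∀ a b → xterms a b 0 ≡ 0ℚ
  xterms-zero a b = trans (sumℚ≡∑≤ (a ℕ.+ b ℕ.+ 0) _) (∑≤-zero≤ (a ℕ.+ b ℕ.+ 0) (λ m _ → trans (term-x m a b 0)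
    (trans (cong (term (suc m) a b 0 ℚ.*_) (𝕩^-other (suc m) {0} (λ ()))) (ℚₚ.*-zeroʳ (term (suc m) a b 0)))))

  xterms-suc : ∀ a b c → xterms a b (suc c) ≡ term (suc c) a b 0
  xterms-suc a b c = trans (sumℚ≡∑≤ (a ℕ.+ b ℕ.+ suc c) _) (trans
    (∑≤-single (a ℕ.+ b ℕ.+ suc c) c (ℕₚ.≤-trans (ℕₚ.n≤1+n c) (ℕₚ.m≤n+m (suc c) (a ℕ.+ b))) (λ m ne → trans (term-x m a b (suc c))
      (trans (cong (term (suc m) a b 0 ℚ.*_) (𝕩^-other (suc m) (ne ∘ sym ∘ ℕₚ.suc-injective))) (ℚₚ.*-zeroʳ (term (suc m) a b 0)))))
    (trans (term-x c a b (suc c)) (trans (cong (term (suc c) a b 0 ℚ.*_) (𝕩^-same (suc c))) (ℚₚ.*-identityʳ (term (suc c) a b 0)))))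

  𝕌^-zero : ∀ m → (𝕌 ^ˢ m) ⟪ 0 ⟫ ≡ 1ℚ
  𝕌^-zero zero    = refl
  𝕌^-zero (suc m) = trans (cong (𝕌 ⟪ 0 ⟫ ℚ.*_) (𝕌^-zero m)) refl

lhs-a : ∀ a b c → (inv (𝟙 ⊖ S) ⊗ inv (𝟙 ⊖ T) ⊕ prefactor ⊗ xterms) a b c ≡ (𝕌 ^ˢ (a ℕ.* b)) ⟪ c ⟫
lhs-a a b zero = trans (cong₂ ℚ._+_
  (trans (ext (Is-⊗ On-𝕁ˢ On-𝕁ᵗ) a b 0) (trans (tri-cong (ℛ.*-identityʳ 𝕁) (✶-identityˡ 𝕁) (✶-identityˡ 1ˢ) a b 0) (cong₂ (λ p q → p ℚ.* q ℚ.* 1ℚ) (𝕁-coeff a) (𝕁-coeff b))))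
  (trans (s-⊗ On-prefactor xterms a b 0) (∑≤-zero≤ a (λ i _ → trans (cong (((+ 1 ℚ./ 4) ·ˢ 𝕁 ^ˢ 2) ⟪ i ⟫ ℚ.*_) (xterms-zero (a ∸ i) b)) (ℚₚ.*-zeroʳ (((+ 1 ℚ./ 4) ·ˢ 𝕁 ^ˢ 2) ⟪ i ⟫))))))
  (sym (𝕌^-zero (a ℕ.* b)))
lhs-a a b (suc c) = trans (cong₂ ℚ._+_
  (trans (ext (Is-⊗ On-𝕁ˢ On-𝕁ᵗ) a b (suc c)) (trans (tri-cong (ℛ.*-identityʳ 𝕁) (✶-identityˡ 𝕁) (✶-identityˡ 1ˢ) a b (suc c)) (ℚₚ.*-zeroʳ (𝕁 ⟪ a ⟫ ℚ.* 𝕁 ⟪ b ⟫))))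
  (trans (s-⊗ On-prefactor xterms a b (suc c)) (trans (∑≤-cong a (λ i → cong (((+ 1 ℚ./ 4) ·ˢ 𝕁 ^ˢ 2) ⟪ i ⟫ ℚ.*_) (xterms-suc (a ∸ i) b c)))
    (trans (sym (s-⊗ On-prefactor (term (suc c)) a b 0)) (trans (prefactor-term c a b 0) (ℚₚ.*-identityʳ ((𝕌 ^ˢ (a ℕ.* b)) ⟪ suc c ⟫)))))))
  (ℚₚ.+-identityˡ ((𝕌 ^ˢ (a ℕ.* b)) ⟪ suc c ⟫))

halve : ∀ a → ∃ λ i → a ≡ i ℕ.* 2 ⊎ a ≡ suc (i ℕ.* 2)
halve zero          = 0 , inj₁ refl
halve (suc zero)    = 0 , inj₂ refl
halve (suc (suc a)) with halve a
... | i , inj₁ e = suc i , inj₁ (cong (suc ∘ suc) e)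
... | i , inj₂ e = suc i , inj₂ (cong (suc ∘ suc) e)

private
  -- They index the two summands of 1 + s u^j by their exponent e of s. Every a is 2i + e in exactly
  -- one way, and u then has the exponent (2i + e) j.
  bits : List ℕ
  bits = 0 ∷ 1 ∷ []

  rhs-term : ∀ i j → Is∑ bits (pow uˣ (2 ℕ.* i ℕ.* j) ⊗ (𝟙 ⊕ S ⊗ pow uˣ j) ⊗ pow S (2 ℕ.* i) ⊗ pow T j)
    (λ e → 𝕩 ^ˢ (e ℕ.+ 2 ℕ.* i)) (λ _ → 𝕩 ^ˢ j) (λ e → 𝕌 ^ˢ ((e ℕ.+ 2 ℕ.* i) ℕ.* j))
  rhs-term i j = Is∑-cong
    (λ e → ≗-trans (solve 2 (λ p q → con 1ℚ :* p :* q :* con 1ℚ := p :* q) ≗-refl (𝕩 ^ˢ e) (𝕩 ^ˢ (2 ℕ.* i))) (≗-sym (^ˢ-+ 𝕩 e (2 ℕ.* i))))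
    (λ e → solve 1 (λ t → con 1ℚ :* con 1ℚ :* con 1ℚ :* t := t) ≗-refl (𝕩 ^ˢ j))
    (λ e → ≗-trans (solve 2 (λ p q → p :* q :* con 1ℚ :* con 1ℚ := q :* p) ≗-refl (𝕌 ^ˢ (2 ℕ.* i ℕ.* j)) (𝕌 ^ˢ (e ℕ.* j)))
       (≗-trans (≗-sym (^ˢ-+ 𝕌 (e ℕ.* j) (2 ℕ.* i ℕ.* j))) (ℛ.reflexive (cong (𝕌 ^ˢ_) (sym (ℕₚ.*-distribʳ-+ j e (2 ℕ.* i)))))))
    (Is∑-⊗ʳ (Is∑-⊗ʳ (Is∑-⊗ˡ (On-pow xᵃ {uˣ} On-𝕌ˣ (2 ℕ.* i ℕ.* j)) two) (On-pow sᵃ {S} Is-S (2 ℕ.* i))) (On-pow tᵃ {T} Is-T j))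
    where
    open 𝒮 using (solve; con; _:=_; _:*_)
    two : Is∑ bits (𝟙 ⊕ S ⊗ pow uˣ j) (𝕩 ^ˢ_) (λ _ → 1ˢ) (λ e → 𝕌 ^ˢ (e ℕ.* j))
    two .value a b c = cong₂ ℚ._+_ (ext Is-𝟙 a b c) (trans
      (ext (Is-cong ≗-refl (✶-identityˡ 1ˢ) (≗-trans (✶-identityˡ (𝕌 ^ˢ j)) (ℛ.reflexive (cong (𝕌 ^ˢ_) (sym (ℕₚ.+-identityʳ j)))))
        (Is-⊗ Is-S (On-pow xᵃ {uˣ} On-𝕌ˣ j))) a b c) (sym (ℚₚ.+-identityʳ _)))

rhs-a : ∀ a b c → Σ∞ (λ i → Σ∞ (λ j → pow uˣ (2 ℕ.* i ℕ.* j) ⊗ (𝟙 ⊕ S ⊗ pow uˣ j) ⊗ pow S (2 ℕ.* i) ⊗ pow T j)) a b c ≡ (𝕌 ^ˢ (a ℕ.* b)) ⟪ c ⟫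
rhs-a a b c = begin
  _
    ≡⟨ sumℚ≡∑≤ N _ ⟩
  ∑≤ N (λ i → sumℚ N (λ j → R i j))
    ≡⟨ ∑≤-cong N inner ⟩
  ∑≤ N (λ i → ∑ℚ bits (λ e → P (e ℕ.+ 2 ℕ.* i)))
    ≡⟨ ∑≤-∑ N bits (λ i e → P (e ℕ.+ 2 ℕ.* i)) ⟩
  ∑≤ N (λ i → P (2 ℕ.* i)) ℚ.+ (∑≤ N (λ i → P (suc (2 ℕ.* i))) ℚ.+ 0ℚ)
    ≡⟨ cong (∑≤ N (λ i → P (2 ℕ.* i)) ℚ.+_) (ℚₚ.+-identityʳ _) ⟩
  ∑≤ N (λ i → P (2 ℕ.* i)) ℚ.+ ∑≤ N (λ i → P (suc (2 ℕ.* i)))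
    ≡⟨ pick (halve a) ⟩
  (𝕌 ^ˢ (a ℕ.* b)) ⟪ c ⟫ ∎
  where
  open ≡-Reasoning
  N = a ℕ.+ b ℕ.+ c
  R : ℕ → ℕ → ℚ
  R i j = (pow uˣ (2 ℕ.* i ℕ.* j) ⊗ (𝟙 ⊕ S ⊗ pow uˣ j) ⊗ pow S (2 ℕ.* i) ⊗ pow T j) a b c
  V P : ℕ → ℚ
  V k = (𝕌 ^ˢ (k ℕ.* b)) ⟪ c ⟫
  P k = (𝕩 ^ˢ k) ⟪ a ⟫ ℚ.* V k
  row : ∀ i j → R i j ≡ ∑ℚ bits (λ e → (𝕩 ^ˢ (e ℕ.+ 2 ℕ.* i)) ⟪ a ⟫ ℚ.* (𝕩 ^ˢ j) ⟪ b ⟫ ℚ.* (𝕌 ^ˢ ((e ℕ.+ 2 ℕ.* i) ℕ.* j)) ⟪ c ⟫)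
  row i j = value (rhs-term i j) a b c
  zero-row : ∀ x y z → y ≡ 0ℚ → x ℚ.* y ℚ.* z ≡ 0ℚ
  zero-row x y z e = trans (cong (λ y → x ℚ.* y ℚ.* z) e) (trans (cong (ℚ._* z) (ℚₚ.*-zeroʳ x)) (ℚₚ.*-zeroˡ z))
  unit-row : ∀ x y z → y ≡ 1ℚ → x ℚ.* y ℚ.* z ≡ x ℚ.* z
  unit-row x y z e = trans (cong (λ y → x ℚ.* y ℚ.* z) e) (cong (ℚ._* z) (ℚₚ.*-identityʳ x))
  inner : ∀ i → sumℚ N (λ j → R i j) ≡ ∑ℚ bits (λ e → P (e ℕ.+ 2 ℕ.* i))
  inner i = trans (sumℚ≡∑≤ N (R i)) (trans (∑≤-single N {R i} b (coord≤ tᵃ a b c)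
      (λ j ne → trans (row i j) (ℚ∑.∑-zero∈ bits {λ e → (𝕩 ^ˢ (e ℕ.+ 2 ℕ.* i)) ⟪ a ⟫ ℚ.* (𝕩 ^ˢ j) ⟪ b ⟫ ℚ.* (𝕌 ^ˢ ((e ℕ.+ 2 ℕ.* i) ℕ.* j)) ⟪ c ⟫}
        (λ {e} _ → zero-row ((𝕩 ^ˢ (e ℕ.+ 2 ℕ.* i)) ⟪ a ⟫) ((𝕩 ^ˢ j) ⟪ b ⟫) ((𝕌 ^ˢ ((e ℕ.+ 2 ℕ.* i) ℕ.* j)) ⟪ c ⟫) (𝕩^-other j (ne ∘ sym))))))
    (trans (row i b) (ℚ∑.∑-cong bits (λ e → unit-row ((𝕩 ^ˢ (e ℕ.+ 2 ℕ.* i)) ⟪ a ⟫) ((𝕩 ^ˢ b) ⟪ b ⟫) (V (e ℕ.+ 2 ℕ.* i)) (𝕩^-same b)))))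
  P-other : ∀ k → a ≢ k → P k ≡ 0ℚ
  P-other k ne = trans (cong (ℚ._* V k) (𝕩^-other k ne)) (ℚₚ.*-zeroˡ (V k))
  P-same : P a ≡ V a
  P-same = trans (cong (ℚ._* V a) (𝕩^-same a)) (ℚₚ.*-identityˡ (V a))
  i≤N : ∀ i → i ≤ a → i ≤ N
  i≤N i le = ℕₚ.≤-trans le (coord≤ sᵃ a b c)
  *2≡ : ∀ i → 2 ℕ.* i ≡ i ℕ.* 2
  *2≡ i = ℕₚ.*-comm 2 i
  odd≢even : ∀ i j → i ℕ.* 2 ≢ suc (j ℕ.* 2)
  odd≢even i j e = contradiction (trans (sym (even-2* i)) (trans (cong even e) (even-1+2* j))) (λ ())
  pick : (∃ λ i → a ≡ i ℕ.* 2 ⊎ a ≡ suc (i ℕ.* 2)) → ∑≤ N (λ i → P (2 ℕ.* i)) ℚ.+ ∑≤ N (λ i → P (suc (2 ℕ.* i))) ≡ V a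
  pick (i₀ , inj₁ e) = trans (cong₂ ℚ._+_
      (trans (∑≤-single N i₀ (i≤N i₀ (ℕₚ.≤-trans (ℕₚ.m≤m*n i₀ 2) (ℕₚ.≤-reflexive (sym e))))
          (λ i ne → P-other (2 ℕ.* i) (λ q → ne (ℕₚ.*-cancelʳ-≡ i i₀ 2 (trans (sym (*2≡ i)) (trans (sym q) e))))))
        (trans (cong P (trans (*2≡ i₀) (sym e))) P-same))
      (∑≤-zero≤ N (λ i _ → P-other (suc (2 ℕ.* i)) (λ q → odd≢even i₀ i (trans (sym e) (trans q (cong suc (*2≡ i))))))))
    (ℚₚ.+-identityʳ (V a))
  pick (i₀ , inj₂ e) = trans (cong₂ ℚ._+_
      (∑≤-zero≤ N (λ i _ → P-other (2 ℕ.* i) (λ q → odd≢even i i₀ (trans (sym (*2≡ i)) (trans (sym q) e)))))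
      (trans (∑≤-single N i₀ (i≤N i₀ (ℕₚ.≤-trans (ℕₚ.m≤m*n i₀ 2) (ℕₚ.≤-trans (ℕₚ.n≤1+n _) (ℕₚ.≤-reflexive (sym e)))))
          (λ i ne → P-other (suc (2 ℕ.* i)) (λ q → ne (ℕₚ.*-cancelʳ-≡ i i₀ 2 (trans (sym (*2≡ i)) (ℕₚ.suc-injective (trans (sym q) e)))))))
        (trans (cong P (trans (cong suc (*2≡ i₀)) (sym e))) P-same)))
    (ℚₚ.+-identityˡ (V a))

-- Eulerian polynomials, type B series and composition with x²

-- From f/(1-x) = f + x f/(1-x): the composition G on the left satisfies G = `Sub v f` + v G.
Sub-𝕁 : ∀ {v i} → v ⟪ 0 ⟫ ≡ 0ℚ → (1ˢ ⊟ v) ✶ i ≗ 1ˢ → ∀ f → Sub v (𝕁 ✶ f) ≗ i ✶ Sub v f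
Sub-𝕁 {v} {i} v0 law f = cancel {1ˢ ⊟ v} {i} law (begin
  (1ˢ ⊟ v) ✶ G                ≈⟨ solve 2 (λ v G → (con 1ℚ :- v) :* G := G :- v :* G) ≗-refl v G ⟩
  G ⊟ v ✶ G                   ≈⟨ ℛ.+-congʳ G-rec ⟩
  (H ⊞ v ✶ G) ⊟ v ✶ G         ≈⟨ solve 2 (λ H p → (H :+ p) :- p := H) ≗-refl H (v ✶ G) ⟩
  H                           ≈⟨ ✶-identityˡ H ⟨
  1ˢ ✶ H                      ≈⟨ ℛ.*-congʳ law ⟨
  (1ˢ ⊟ v) ✶ i ✶ H            ≈⟨ ✶-assoc (1ˢ ⊟ v) i H ⟩
  (1ˢ ⊟ v) ✶ (i ✶ H) ∎)
  where
  open 𝒮 using (solve; con; _:=_; _:*_; _:-_; _:+_)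
  open SetoidR ℛ.setoid
  G = Sub v (𝕁 ✶ f)
  H = Sub v f
  unfold : 𝕁 ✶ f ≗ f ⊞ 𝕩 ✶ (𝕁 ✶ f)
  unfold = ≗-trans (solve 3 (λ x j f → j :* f := ((con 1ℚ :- x) :* j) :* f :+ x :* (j :* f)) ≗-refl 𝕩 𝕁 f)
    (ℛ.+-congʳ (≗-trans (ℛ.*-congʳ 𝕁-law) (✶-identityˡ f)))
  G-rec : G ≗ H ⊞ v ✶ G
  G-rec = ≗-trans (Sub-cong v unfold) (≗-trans (Sub-⊞ v f (𝕩 ✶ (𝕁 ✶ f))) (ℛ.+-congˡ (Sub-𝕩 {v} v0 (𝕁 ✶ f))))

Sub-𝕁^ : ∀ {v i} → v ⟪ 0 ⟫ ≡ 0ℚ → (1ˢ ⊟ v) ✶ i ≗ 1ˢ → ∀ k → Sub v (𝕁 ^ˢ k) ≗ i ^ˢ k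
Sub-𝕁^ {v} v0 law zero    = Sub-con v 1ℚ
Sub-𝕁^ {v} {i} v0 law (suc k) = ≗-trans (Sub-𝕁 {v} {i} v0 law (𝕁 ^ˢ k)) (ℛ.*-congˡ (Sub-𝕁^ {v} {i} v0 law k))

𝕩² : Ser
𝕩² = 𝕩 ✶ 𝕩

𝕩²✶-suc : ∀ f n → (𝕩² ✶ f) ⟪ suc (suc n) ⟫ ≡ f ⟪ n ⟫
𝕩²✶-suc f n = trans (coeff (✶-assoc 𝕩 𝕩 f) (suc (suc n))) (trans (𝕩✶-suc (𝕩 ✶ f) (suc n)) (𝕩✶-suc f n))

Sub-𝕩²-even : ∀ i f → Sub 𝕩² f ⟪ i ℕ.* 2 ⟫ ≡ f ⟪ i ⟫
Sub-𝕩²-even zero    f = ℚₚ.*-identityʳ (f ⟪ 0 ⟫)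
Sub-𝕩²-even (suc i) f = trans (coeff (Sub-step {𝕩²} refl f) (suc (suc (i ℕ.* 2)))) (trans (ℚₚ.+-identityˡ _)
  (trans (𝕩²✶-suc (Sub 𝕩² (tl f)) (i ℕ.* 2)) (Sub-𝕩²-even i (tl f))))

Sub-𝕩²-odd : ∀ i f → Sub 𝕩² f ⟪ suc (i ℕ.* 2) ⟫ ≡ 0ℚ
Sub-𝕩²-odd zero    f = trans (coeff (Sub-step {𝕩²} refl f) 1) (trans (ℚₚ.+-identityˡ _)
  (trans (coeff (✶-assoc 𝕩 𝕩 (Sub 𝕩² (tl f))) 1) (trans (𝕩✶-suc (𝕩 ✶ Sub 𝕩² (tl f)) 0) (𝕩✶-zero (Sub 𝕩² (tl f))))))
Sub-𝕩²-odd (suc i) f = trans (coeff (Sub-step {𝕩²} refl f) (suc (suc (suc (i ℕ.* 2))))) (trans (ℚₚ.+-identityˡ _)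
  (trans (𝕩²✶-suc (Sub 𝕩² (tl f)) (suc (i ℕ.* 2))) (Sub-𝕩²-odd i (tl f))))

Eulerian : ℕ → Ser → Ser
Eulerian zero    v = 1ˢ
Eulerian (suc k) v = ∑ˢ (Sym (suc k)) (λ w → v ^ˢ (des w ℕ.+ 1))

On-A : ∀ x {V v} → On x V v → ∀ k → On x (A k V) (Eulerian k v)
On-A x         o zero    = On-𝟙 x
On-A x {V} {v} o (suc k) = On-emb x (λ a b c → trans (sumSym-∑ (suc k) (λ w → pow V (des w ℕ.+ 1)) a b c)
  (emb-On x (On-∑ x (Sym (suc k)) {λ w → pow V (des w ℕ.+ 1)} {λ w → v ^ˢ (des w ℕ.+ 1)} (λ w → On-pow x {V} o (des w ℕ.+ 1))) a b c))

-- The classical expansion of A_k(t)/(1-t)^(k+1), obtained here from words over an alphabet of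
-- positive letters. For k = 0 it relies on 0^0 = 1.
Eulerian-𝕁 : ∀ k → Eulerian k 𝕩 ✶ 𝕁 ^ˢ suc k ≗ powers k
Eulerian-𝕁 zero    = ≗-trans (✶-identityˡ (𝕁 ^ˢ 1)) (≗-trans (ℛ.*-identityʳ 𝕁) (ptw 𝕁-coeff))
Eulerian-𝕁 (suc k) = ≗-trans (∑ˢ-✶ʳ (Sym (suc k)) (λ w → 𝕩 ^ˢ (des w ℕ.+ 1)) (𝕁 ^ˢ suc (suc k))) (∑-des k)

Eulerian-𝕂 : ∀ k → Eulerian k 𝕩² ✶ 𝕂 ^ˢ suc k ≗ Sub 𝕩² (powers k)
Eulerian-𝕂 zero    = ≗-trans (✶-identityˡ (𝕂 ^ˢ 1)) (≗-trans (≗-sym (Sub-𝕁^ {𝕩²} {𝕂} refl 𝕂-law 1)) (Sub-cong 𝕩² (≗-trans (≗-sym (✶-identityˡ (𝕁 ^ˢ 1))) (Eulerian-𝕁 0))))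
Eulerian-𝕂 (suc k) = begin
  ∑ˢ W (λ w → 𝕩² ^ˢ (des w ℕ.+ 1)) ✶ 𝕂 ^ˢ suc (suc k)       ≈⟨ ∑ˢ-✶ʳ W (λ w → 𝕩² ^ˢ (des w ℕ.+ 1)) (𝕂 ^ˢ suc (suc k)) ⟩
  ∑ˢ W (λ w → 𝕩² ^ˢ (des w ℕ.+ 1) ✶ 𝕂 ^ˢ suc (suc k))       ≈⟨ ∑ˢ-cong W (λ w → ≗-trans (ℛ.*-congˡ (≗-sym (Sub-𝕁^ {𝕩²} {𝕂} refl 𝕂-law (suc (suc k))))) (≗-sym (Sub-𝕩^ {𝕩²} refl (des w ℕ.+ 1) (𝕁 ^ˢ suc (suc k))))) ⟩
  ∑ˢ W (λ w → Sub 𝕩² (𝕩 ^ˢ (des w ℕ.+ 1) ✶ 𝕁 ^ˢ suc (suc k))) ≈⟨ Sub-∑ˢ 𝕩² W (λ w → 𝕩 ^ˢ (des w ℕ.+ 1) ✶ 𝕁 ^ˢ suc (suc k)) ⟨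
  Sub 𝕩² (∑ˢ W (λ w → 𝕩 ^ˢ (des w ℕ.+ 1) ✶ 𝕁 ^ˢ suc (suc k))) ≈⟨ Sub-cong 𝕩² (∑-des k) ⟩
  Sub 𝕩² (powers (suc k)) ∎
  where
  open SetoidR ℛ.setoid
  W = Sym (suc k)

oddPowers : ℕ → ℕ → ℚ
oddPowers k i = ℕtoℚ ((2 ℕ.* i ℕ.+ 1) ℕ.^ k)

On-B : ∀ k → On sᵃ (B k (S ⊗ S)) ((1ˢ ⊟ 𝕩²) ^ˢ suc k ✶ Sub 𝕩² (ser (oddPowers k)))
On-B k = On-⊗ sᵃ (On-pow sᵃ {𝟙 ⊖ S ⊗ S} (On-⊖ sᵃ {𝟙} {S ⊗ S} Is-𝟙 On-S²) (suc k)) (On-subst sᵃ {S ⊗ S} On-S² refl (oddPowers k))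

*-^ : ∀ m n k → (m ℕ.* n) ℕ.^ k ≡ m ℕ.^ k ℕ.* n ℕ.^ k
*-^ m n zero    = refl
*-^ m n (suc k) = trans (cong (m ℕ.* n ℕ.*_) (*-^ m n k)) (solve 4 (λ m n p q → m :* n :* (p :* q) := m :* p :* (n :* q)) refl m n (m ℕ.^ k) (n ℕ.^ k))
  where open ℕSolver.+-*-Solver

-- The powers a^k are split by the parity of a: (2i)^k = 2^k i^k accounts for 2^k A_k(s²) and
-- (2i+1)^k for s B_k(s²).
even+odd-powers : ∀ k → cˢ (ℕtoℚ (2 ℕ.^ k)) ✶ Sub 𝕩² (powers k) ⊞ 𝕩 ✶ Sub 𝕩² (ser (oddPowers k)) ≗ powers k
even+odd-powers k .coeff a = cases (halve a)
  where
  P = Sub 𝕩² (powers k)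
  Q = Sub 𝕩² (ser (oddPowers k))
  cases : (∃ λ i → a ≡ i ℕ.* 2 ⊎ a ≡ suc (i ℕ.* 2)) → (cˢ (ℕtoℚ (2 ℕ.^ k)) ✶ P) ⟪ a ⟫ ℚ.+ (𝕩 ✶ Q) ⟪ a ⟫ ≡ ℕtoℚ (a ℕ.^ k)
  cases (i , inj₁ refl) = trans (cong₂ ℚ._+_ (trans (coeff (cˢ-✶ (ℕtoℚ (2 ℕ.^ k)) P) (i ℕ.* 2)) (trans (cong (ℕtoℚ (2 ℕ.^ k) ℚ.*_) (Sub-𝕩²-even i (powers k)))
      (trans (sym (ℕtoℚ-* (2 ℕ.^ k) (i ℕ.^ k))) (cong ℕtoℚ (trans (sym (*-^ 2 i k)) (cong (ℕ._^ k) (ℕₚ.*-comm 2 i))))))) (shifted i))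
    (ℚₚ.+-identityʳ (ℕtoℚ ((i ℕ.* 2) ℕ.^ k)))
    where
    shifted : ∀ i → (𝕩 ✶ Q) ⟪ i ℕ.* 2 ⟫ ≡ 0ℚ
    shifted zero    = 𝕩✶-zero Q
    shifted (suc i) = trans (𝕩✶-suc Q (suc (i ℕ.* 2))) (Sub-𝕩²-odd i (ser (oddPowers k)))
  cases (i , inj₂ refl) = trans (cong₂ ℚ._+_ (trans (coeff (cˢ-✶ (ℕtoℚ (2 ℕ.^ k)) P) (suc (i ℕ.* 2))) (trans (cong (ℕtoℚ (2 ℕ.^ k) ℚ.*_) (Sub-𝕩²-odd i (powers k))) (ℚₚ.*-zeroʳ (ℕtoℚ (2 ℕ.^ k)))))
      (trans (𝕩✶-suc Q (i ℕ.* 2)) (trans (Sub-𝕩²-even i (ser (oddPowers k))) (cong (λ z → ℕtoℚ (z ℕ.^ k)) (trans (ℕₚ.+-comm (2 ℕ.* i) 1) (cong suc (ℕₚ.*-comm 2 i)))))))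
    (ℚₚ.+-identityˡ (ℕtoℚ (suc (i ℕ.* 2) ℕ.^ k)))

rhs-b-term : ℕ → PS
rhs-b-term k = (ℕtoℚ (2 ℕ.^ k) · A k (S ⊗ S) ⊕ S ⊗ B k (S ⊗ S)) ⊗ A k T ⊗ pow (inv (𝟙 ⊖ S ⊗ S)) (suc k) ⊗ pow (inv (𝟙 ⊖ T)) (suc k)

-- After division by the denominators only the sums of a^k s^a and of b^k t^b are left. With the
-- weight 2^k d(n,k) the coefficient is d(n,k) (2ab)^k, as in `𝕌^-d`.
Is-rhs-b : ∀ k → Is (rhs-b-term k) (powers k) (powers k) 1ˢ
Is-rhs-b k = Is-cong s-part t-part (solve 0 (con 1ℚ :* con 1ℚ :* con 1ℚ :* con 1ℚ := con 1ℚ) ≗-refl)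
  (Is-⊗ (Is-⊗ (Is-⊗ (On-⊕ sᵃ {ℕtoℚ (2 ℕ.^ k) · A k (S ⊗ S)} {S ⊗ B k (S ⊗ S)} (On-· sᵃ {A k (S ⊗ S)} (ℕtoℚ (2 ℕ.^ k)) (On-A sᵃ {S ⊗ S} On-S² k)) (On-⊗ sᵃ Is-S (On-B k)))
    (On-A tᵃ {T} Is-T k)) (On-pow sᵃ {inv (𝟙 ⊖ S ⊗ S)} On-𝕂 (suc k))) (On-pow tᵃ {inv (𝟙 ⊖ T)} On-𝕁ᵗ (suc k)))
  where
  open 𝒮 using (solve; con; _:=_; _:*_; _:+_)
  open SetoidR ℛ.setoid
  c2 = ℕtoℚ (2 ℕ.^ k)
  Q = Sub 𝕩² (ser (oddPowers k))
  inverse-pow : (1ˢ ⊟ 𝕩²) ^ˢ suc k ✶ 𝕂 ^ˢ suc k ≗ 1ˢ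
  inverse-pow = ≗-trans (≗-sym (^ˢ-✶ (1ˢ ⊟ 𝕩²) 𝕂 (suc k))) (≗-trans (^ˢ-cong 𝕂-law (suc k)) (1ˢ-^ˢ (suc k)))
  s-part : (c2 ·ˢ Eulerian k 𝕩² ⊞ 𝕩 ✶ ((1ˢ ⊟ 𝕩²) ^ˢ suc k ✶ Q)) ✶ 1ˢ ✶ 𝕂 ^ˢ suc k ✶ 1ˢ ≗ powers k
  s-part = begin
    (c2 ·ˢ Eulerian k 𝕩² ⊞ 𝕩 ✶ ((1ˢ ⊟ 𝕩²) ^ˢ suc k ✶ Q)) ✶ 1ˢ ✶ 𝕂 ^ˢ suc k ✶ 1ˢ
      ≈⟨ ℛ.*-congʳ (ℛ.*-congʳ (ℛ.*-congʳ (ℛ.+-congʳ (·ˢ-con c2 (Eulerian k 𝕩²))))) ⟩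
    (cˢ c2 ✶ Eulerian k 𝕩² ⊞ 𝕩 ✶ ((1ˢ ⊟ 𝕩²) ^ˢ suc k ✶ Q)) ✶ 1ˢ ✶ 𝕂 ^ˢ suc k ✶ 1ˢ
      ≈⟨ solve 6 (λ c e x m q K → (c :* e :+ x :* (m :* q)) :* con 1ℚ :* K :* con 1ℚ := c :* (e :* K) :+ (m :* K) :* (x :* q)) ≗-refl (cˢ c2) (Eulerian k 𝕩²) 𝕩 ((1ˢ ⊟ 𝕩²) ^ˢ suc k) Q (𝕂 ^ˢ suc k) ⟩
    cˢ c2 ✶ (Eulerian k 𝕩² ✶ 𝕂 ^ˢ suc k) ⊞ (1ˢ ⊟ 𝕩²) ^ˢ suc k ✶ 𝕂 ^ˢ suc k ✶ (𝕩 ✶ Q)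
      ≈⟨ ℛ.+-cong (ℛ.*-congˡ (Eulerian-𝕂 k)) (≗-trans (ℛ.*-congʳ inverse-pow) (✶-identityˡ (𝕩 ✶ Q))) ⟩
    cˢ c2 ✶ Sub 𝕩² (powers k) ⊞ 𝕩 ✶ Q
      ≈⟨ even+odd-powers k ⟩
    powers k ∎
  t-part : 1ˢ ✶ Eulerian k 𝕩 ✶ 1ˢ ✶ 𝕁 ^ˢ suc k ≗ powers k
  t-part = ≗-trans (solve 2 (λ e j → con 1ℚ :* e :* con 1ℚ :* j := e :* j) ≗-refl (Eulerian k 𝕩) (𝕁 ^ˢ suc k)) (Eulerian-𝕁 k)

part-b : ∀ n a b c → (prefactor ⊗ term (suc n)) a b c ≡ (recipFact (suc n) · sumPS (suc n) (λ k → ℕtoℚ (2 ℕ.^ k ℕ.* d (suc n) k) · rhs-b-term k)) a b c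
part-b n a b c = begin
  (prefactor ⊗ term N) a b c
    ≡⟨ prefactor-term n a b c ⟩
  (𝕌 ^ˢ (a ℕ.* b)) ⟪ N ⟫ ℚ.* 1ˢ ⟪ c ⟫
    ≡⟨ cong (ℚ._* 1ˢ ⟪ c ⟫) (𝕌^-recipFact N (a ℕ.* b)) ⟩
  recipFact N ℚ.* ∑≤ N D ℚ.* 1ˢ ⟪ c ⟫
    ≡⟨ ℚₚ.*-assoc (recipFact N) (∑≤ N D) (1ˢ ⟪ c ⟫) ⟩
  recipFact N ℚ.* (∑≤ N D ℚ.* 1ˢ ⟪ c ⟫)
    ≡⟨ cong (recipFact N ℚ.*_) (trans (sym (∑≤-*ʳ N (1ˢ ⟪ c ⟫) D)) (trans (∑≤-cong N each) (sym (sumℚ≡∑≤ N (λ k → ℕtoℚ (2 ℕ.^ k ℕ.* d N k) ℚ.* rhs-b-term k a b c))))) ⟩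
  (recipFact N · sumPS N (λ k → ℕtoℚ (2 ℕ.^ k ℕ.* d N k) · rhs-b-term k)) a b c ∎
  where
  open ≡-Reasoning
  N = suc n
  D : ℕ → ℚ
  D k = ℕtoℚ (d N k ℕ.* (2 ℕ.* (a ℕ.* b)) ℕ.^ k)
  arith : ∀ k → d N k ℕ.* (2 ℕ.* (a ℕ.* b)) ℕ.^ k ≡ 2 ℕ.^ k ℕ.* d N k ℕ.* (a ℕ.^ k ℕ.* b ℕ.^ k)
  arith k = trans (cong (d N k ℕ.*_) (trans (*-^ 2 (a ℕ.* b) k) (cong (2 ℕ.^ k ℕ.*_) (*-^ a b k))))
    (let open ℕSolver.+-*-Solver in solve 3 (λ d p q → d :* (p :* q) := p :* d :* q) refl (d N k) (2 ℕ.^ k) (a ℕ.^ k ℕ.* b ℕ.^ k))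
  each : ∀ k → D k ℚ.* 1ˢ ⟪ c ⟫ ≡ ℕtoℚ (2 ℕ.^ k ℕ.* d N k) ℚ.* rhs-b-term k a b c
  each k = trans (cong (ℚ._* 1ˢ ⟪ c ⟫) (trans (cong ℕtoℚ (arith k)) (trans (ℕtoℚ-* (2 ℕ.^ k ℕ.* d N k) (a ℕ.^ k ℕ.* b ℕ.^ k)) (cong (ℕtoℚ (2 ℕ.^ k ℕ.* d N k) ℚ.*_) (ℕtoℚ-* (a ℕ.^ k) (b ℕ.^ k))))))
    (trans (ℚₚ.*-assoc (ℕtoℚ (2 ℕ.^ k ℕ.* d N k)) _ (1ˢ ⟪ c ⟫)) (cong (ℕtoℚ (2 ℕ.^ k ℕ.* d N k) ℚ.*_) (sym (ext (Is-rhs-b k) a b c))))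

-- Part (c)

Unit : Ser → Set
Unit m = ∃ λ i → m ✶ i ≗ 1ˢ

Unit-✶ : ∀ {m m′} → Unit m → Unit m′ → Unit (m ✶ m′)
Unit-✶ {m} {m′} (i , e) (i′ , e′) = i ✶ i′ , ≗-trans
  (solve 4 (λ m m′ i i′ → (m :* m′) :* (i :* i′) := (m :* i) :* (m′ :* i′)) ≗-refl m m′ i i′) (≗-trans (ℛ.*-cong e e′) (✶-identityˡ 1ˢ))
  where open 𝒮 using (solve; _:=_; _:*_)

Unit-^ : ∀ {m} → Unit m → ∀ n → Unit (m ^ˢ n)
Unit-^ u zero    = 1ˢ , ✶-identityˡ 1ˢ
Unit-^ u (suc n) = Unit-✶ u (Unit-^ u n)

Unit-sym : ∀ {m i} → m ✶ i ≗ 1ˢ → Unit i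
Unit-sym {m} {i} e = m , ≗-trans (✶-comm i m) e

Unit-½ : Unit (cˢ ½)
Unit-½ = cˢ (ℕtoℚ 2) , let open 𝒮 in solve 0 (con ½ :* con (ℕtoℚ 2) := con 1ℚ) ≗-refl

Unit-1+𝕩² : Unit (1ˢ ⊞ 𝕩 ✶ 𝕩)
Unit-1+𝕩² = invˢ (1ˢ ⊞ 𝕩 ✶ 𝕩) , invˢ-law {1ˢ ⊞ 𝕩 ✶ 𝕩} refl

Unit-α : ∀ n → Unit (α n)
Unit-α n = Unit-✶ (Unit-✶ (Unit-✶ Unit-½ Unit-1+𝕩²) (Unit-✶ (Unit-sym 𝕁-law) (Unit-sym 𝕁-law))) (Unit-^ (Unit-✶ Unit-1+𝕩² (Unit-sym 𝕂-law)) n)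

Unit-β : ∀ n → Unit (β n)
Unit-β n = Unit-✶ Unit-½ (Unit-^ (Unit-✶ (invˢ (1ˢ ⊞ 𝕩) , invˢ-law {1ˢ ⊞ 𝕩} refl) (Unit-sym 𝕁-law)) (suc (suc n)))

record Substitution (m v : Ser) : Set where
  field
    injective : ∀ f → m ✶ Sub v f ≗ 0ˢ → ∀ n → f ⟪ n ⟫ ≡ 0ℚ

substitution : ∀ {m v} → Unit m → v ⟪ 0 ⟫ ≡ 0ℚ → ∀ {l q r} → l ✶ v ≗ cˢ q ✶ 𝕩 → r ℚ.* q ≡ 1ℚ → Substitution m v
substitution {m} {v} (i , mi) v0 {l} {q} {r} lv rq .Substitution.injective f z n =
  Sub-injective {v} v0 {l} {q} {r} lv rq n f (cancel {m} {i} mi (≗-trans z (≗-sym (ℛ.zeroʳ m))))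

module _ {I : Set} (L : List I) where

  private
    linear-image : ∀ m v (q : I → ℚ) (f : I → Ser) → m ✶ Sub v (∑ˢ L (λ x → q x ·ˢ f x)) ≗ ∑ˢ L (λ x → q x ·ˢ (m ✶ Sub v (f x)))
    linear-image m v q f = ≗-trans (ℛ.*-congˡ (Sub-∑ˢ v L (λ x → q x ·ˢ f x))) (≗-trans (∑ˢ-✶ˡ L m (λ x → Sub v (q x ·ˢ f x)))
      (∑ˢ-cong L (λ x → ≗-trans (ℛ.*-congˡ (Sub-·ˢ v (q x) (f x))) (≗-trans (✶-comm m (q x ·ˢ Sub v (f x)))
        (≗-trans (·ˢ-✶ (q x) (Sub v (f x)) m) (ptw λ n → cong (q x ℚ.*_) (coeff (✶-comm (Sub v (f x)) m) n)))))))

    kernel : ∀ {m v} → Substitution m v → (q : I → ℚ) (f : I → Ser) → (∀ a → ∑ℚ L (λ x → q x ℚ.* (m ✶ Sub v (f x)) ⟪ a ⟫) ≡ 0ℚ) → ∀ a → ∑ℚ L (λ x → q x ℚ.* f x ⟪ a ⟫) ≡ 0ℚ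
    kernel {m} {v} s q f z = Substitution.injective s (∑ˢ L (λ x → q x ·ˢ f x)) (≗-trans (linear-image m v q f) (ptw z))

  -- The substitutions in s and in t are inverted one after the other.
  bilinear-kernel : ∀ {m v m′ v′} → Substitution m v → Substitution m′ v′ → (q : I → ℚ) (f g : I → Ser) →
    (∀ a b → ∑ℚ L (λ x → q x ℚ.* ((m ✶ Sub v (f x)) ⟪ a ⟫ ℚ.* (m′ ✶ Sub v′ (g x)) ⟪ b ⟫)) ≡ 0ℚ) →
    ∀ a b → ∑ℚ L (λ x → q x ℚ.* (f x ⟪ a ⟫ ℚ.* g x ⟪ b ⟫)) ≡ 0ℚ
  bilinear-kernel {m} {v} {m′} {v′} s s′ q f g z a b = trans (ℚ∑.∑-cong L (λ x → sym (ℚₚ.*-assoc (q x) (f x ⟪ a ⟫) (g x ⟪ b ⟫))))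
    (kernel s′ (λ x → q x ℚ.* f x ⟪ a ⟫) g (λ b → trans (ℚ∑.∑-cong L (λ x → swap3 (q x) (f x ⟪ a ⟫) ((m′ ✶ Sub v′ (g x)) ⟪ b ⟫)))
      (kernel s (λ x → q x ℚ.* (m′ ✶ Sub v′ (g x)) ⟪ b ⟫) f (λ a → trans (ℚ∑.∑-cong L (λ x → swap3′ (q x) ((m ✶ Sub v (f x)) ⟪ a ⟫) ((m′ ✶ Sub v′ (g x)) ⟪ b ⟫))) (z a b)) a)) b)
    where
    open ℚSolver.+-*-Solver
    swap3 : ∀ q f g → q ℚ.* f ℚ.* g ≡ q ℚ.* g ℚ.* f
    swap3 = solve 3 (λ q f g → q :* f :* g := q :* g :* f) refl
    swap3′ : ∀ q f g → q ℚ.* g ℚ.* f ≡ q ℚ.* (f ℚ.* g)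
    swap3′ = solve 3 (λ q f g → q :* g :* f := q :* (f :* g)) refl

subst-𝕊 : ∀ n → Substitution (α n) 𝕊
subst-𝕊 n = substitution (Unit-α n) refl {1ˢ ⊞ 𝕩 ✶ 𝕩} {+ 2 ℚ./ 1} {½} 1+𝕩²-𝕊 refl

subst-𝕋 : ∀ n → Substitution (β n) 𝕋
subst-𝕋 n = substitution (Unit-β n) refl {(1ˢ ⊞ 𝕩) ✶ (1ˢ ⊞ 𝕩)} {+ 4 ℚ./ 1} {+ 1 ℚ./ 4} (begin
  (1ˢ ⊞ 𝕩) ✶ (1ˢ ⊞ 𝕩) ✶ 𝕋
    ≈⟨ solve 3 (λ p i f → p :* p :* (f :* (i :* (i :* con 1ℚ))) := (p :* i) :* (p :* i) :* f) ≗-refl (1ˢ ⊞ 𝕩) (invˢ (1ˢ ⊞ 𝕩)) ((+ 4 ℚ./ 1) ·ˢ 𝕩) ⟩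
  (1ˢ ⊞ 𝕩) ✶ invˢ (1ˢ ⊞ 𝕩) ✶ ((1ˢ ⊞ 𝕩) ✶ invˢ (1ˢ ⊞ 𝕩)) ✶ ((+ 4 ℚ./ 1) ·ˢ 𝕩)
    ≈⟨ ℛ.*-cong (≗-trans (ℛ.*-cong law law) (✶-identityˡ 1ˢ)) (·ˢ-con (+ 4 ℚ./ 1) 𝕩) ⟩
  1ˢ ✶ (cˢ (+ 4 ℚ./ 1) ✶ 𝕩)
    ≈⟨ ✶-identityˡ _ ⟩
  cˢ (+ 4 ℚ./ 1) ✶ 𝕩 ∎) refl
  where
  open 𝒮 using (solve; con; _:=_; _:*_)
  open SetoidR ℛ.setoid
  law : (1ˢ ⊞ 𝕩) ✶ invˢ (1ˢ ⊞ 𝕩) ≗ 1ˢ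
  law = invˢ-law {1ˢ ⊞ 𝕩} refl

-- The hypothesis on products with p is met for p = x and p = x² through `Sub-𝕩`.
Sub-1-^ : ∀ {v p} → v ⟪ 0 ⟫ ≡ 0ℚ → (∀ g → Sub v (p ✶ g) ≗ Sub v p ✶ Sub v g) → ∀ e g → Sub v ((1ˢ ⊟ p) ^ˢ e ✶ g) ≗ (1ˢ ⊟ Sub v p) ^ˢ e ✶ Sub v g
Sub-1-^ {v} {p} v0 mult zero    g = ≗-trans (Sub-cong v (✶-identityˡ g)) (≗-sym (✶-identityˡ (Sub v g)))
Sub-1-^ {v} {p} v0 mult (suc e) g = begin
  Sub v ((1ˢ ⊟ p) ✶ (1ˢ ⊟ p) ^ˢ e ✶ g)        ≈⟨ Sub-cong v (✶-assoc (1ˢ ⊟ p) ((1ˢ ⊟ p) ^ˢ e) g) ⟩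
  Sub v ((1ˢ ⊟ p) ✶ h)                        ≈⟨ one h ⟩
  (1ˢ ⊟ Sub v p) ✶ Sub v h                    ≈⟨ ℛ.*-congˡ (Sub-1-^ {v} {p} v0 mult e g) ⟩
  (1ˢ ⊟ Sub v p) ✶ ((1ˢ ⊟ Sub v p) ^ˢ e ✶ Sub v g) ≈⟨ ✶-assoc (1ˢ ⊟ Sub v p) ((1ˢ ⊟ Sub v p) ^ˢ e) (Sub v g) ⟨
  (1ˢ ⊟ Sub v p) ^ˢ suc e ✶ Sub v g ∎
  where
  open 𝒮 using (solve; con; _:=_; _:*_; _:-_; _:+_)
  open SetoidR ℛ.setoid
  h = (1ˢ ⊟ p) ^ˢ e ✶ g
  one : ∀ h → Sub v ((1ˢ ⊟ p) ✶ h) ≗ (1ˢ ⊟ Sub v p) ✶ Sub v h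
  one h = begin
    A₁                                        ≈⟨ solve 2 (λ a b → a := (a :+ b) :- b) ≗-refl A₁ (Sub v p ✶ Sub v h) ⟩
    (A₁ ⊞ Sub v p ✶ Sub v h) ⊟ Sub v p ✶ Sub v h ≈⟨ ℛ.+-congʳ (≗-trans (ℛ.+-congˡ (≗-sym (mult h))) (≗-trans (≗-sym (Sub-⊞ v ((1ˢ ⊟ p) ✶ h) (p ✶ h)))
                                                   (Sub-cong v (solve 2 (λ p h → (con 1ℚ :- p) :* h :+ p :* h := h) ≗-refl p h)))) ⟩
    Sub v h ⊟ Sub v p ✶ Sub v h               ≈⟨ solve 2 (λ p h → h :- p :* h := (con 1ℚ :- p) :* h) ≗-refl (Sub v p) (Sub v h) ⟩
    (1ˢ ⊟ Sub v p) ✶ Sub v h ∎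
    where A₁ = Sub v ((1ˢ ⊟ p) ✶ h)

Sub-𝕩^′ : ∀ {v} → v ⟪ 0 ⟫ ≡ 0ℚ → ∀ k → Sub v (𝕩 ^ˢ k) ≗ v ^ˢ k
Sub-𝕩^′ {v} v0 k = ≗-trans (Sub-cong v (≗-sym (ℛ.*-identityʳ (𝕩 ^ˢ k)))) (≗-trans (Sub-𝕩^ {v} v0 k 1ˢ)
  (≗-trans (ℛ.*-congˡ (Sub-con v 1ℚ)) (ℛ.*-identityʳ (v ^ˢ k))))

Sub-𝕩¹ : ∀ {v} → v ⟪ 0 ⟫ ≡ 0ℚ → Sub v 𝕩 ≗ v
Sub-𝕩¹ {v} v0 = ≗-trans (Sub-cong v (≗-sym (ℛ.*-identityʳ 𝕩))) (≗-trans (Sub-𝕩^′ {v} v0 1) (ℛ.*-identityʳ v))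

Sub-𝕩²′ : ∀ {v} → v ⟪ 0 ⟫ ≡ 0ℚ → Sub v 𝕩² ≗ v ✶ v
Sub-𝕩²′ {v} v0 = ≗-trans (Sub-𝕩 {v} v0 𝕩) (ℛ.*-congˡ (Sub-𝕩¹ {v} v0))

-- The origin of the exponent (n-k)/2 in (c). For c = `ℂ` and z = 1 - `𝕊`², or c = `𝕌` and z = 1 -
-- `𝕋`, each factor z lowers the exponent of c by two, from the one belonging to n to the one
-- belonging to k.
shrink : ∀ {c z} → z ✶ (c ✶ c) ≗ 1ˢ → ∀ k e → c ^ˢ (e ℕ.* 2 ℕ.+ k) ✶ z ^ˢ e ≗ c ^ˢ k
shrink {c} {z} law k zero    = ℛ.*-identityʳ (c ^ˢ k)
shrink {c} {z} law k (suc e) = ≗-trans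
  (solve 4 (λ c z p q → (c :* (c :* p)) :* (z :* q) := (z :* (c :* c)) :* (p :* q)) ≗-refl c z (c ^ˢ (e ℕ.* 2 ℕ.+ k)) (z ^ˢ e))
  (≗-trans (ℛ.*-cong law (shrink {c} {z} law k e)) (✶-identityˡ (c ^ˢ k)))
  where open 𝒮 using (solve; _:=_; _:*_)

-- (1+x²)² - (2x)² = (1-x²)². The analogue for `𝕋` is (1+x)² - 4x = (1-x)².
1-𝕊² : (1ˢ ⊟ 𝕊 ✶ 𝕊) ✶ (ℂ ✶ ℂ) ≗ 1ˢ
1-𝕊² = begin
  (1ˢ ⊟ 𝕊 ✶ 𝕊) ✶ (ℂ ✶ ℂ)
    ≈⟨ solve 2 (λ s c → (con 1ℚ :- s :* s) :* (c :* c) := c :* c :- (c :* s) :* (c :* s)) ≗-refl 𝕊 ℂ ⟩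
  ℂ ✶ ℂ ⊟ ℂ ✶ 𝕊 ✶ (ℂ ✶ 𝕊)
    ≈⟨ ℛ.+-congˡ (ℛ.-‿cong (ℛ.*-cong ℂ𝕊 ℂ𝕊)) ⟩
  ℂ ✶ ℂ ⊟ cˢ (+ 2 ℚ./ 1) ✶ 𝕩 ✶ 𝕂 ✶ (cˢ (+ 2 ℚ./ 1) ✶ 𝕩 ✶ 𝕂)
    ≈⟨ solve 2 (λ x k → ((con 1ℚ :+ x :* x) :* k) :* ((con 1ℚ :+ x :* x) :* k) :- (con (+ 2 ℚ./ 1) :* x :* k) :* (con (+ 2 ℚ./ 1) :* x :* k)
         := ((con 1ℚ :- x :* x) :* k) :* ((con 1ℚ :- x :* x) :* k)) ≗-refl 𝕩 𝕂 ⟩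
  (1ˢ ⊟ 𝕩 ✶ 𝕩) ✶ 𝕂 ✶ ((1ˢ ⊟ 𝕩 ✶ 𝕩) ✶ 𝕂)
    ≈⟨ ≗-trans (ℛ.*-cong 𝕂-law 𝕂-law) (✶-identityˡ 1ˢ) ⟩
  1ˢ ∎
  where
  open 𝒮 using (solve; con; _:=_; _:*_; _:-_; _:+_)
  open SetoidR ℛ.setoid

1-𝕋 : (1ˢ ⊟ 𝕋) ✶ (𝕌 ✶ 𝕌) ≗ 1ˢ
1-𝕋 = begin
  (1ˢ ⊟ 𝕋) ✶ (𝕌 ✶ 𝕌)
    ≈⟨ solve 2 (λ t u → (con 1ℚ :- t) :* (u :* u) := u :* u :- u :* u :* t) ≗-refl 𝕋 𝕌 ⟩
  𝕌 ✶ 𝕌 ⊟ 𝕌 ✶ 𝕌 ✶ 𝕋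
    ≈⟨ ℛ.+-congˡ (ℛ.-‿cong 𝕌𝕋) ⟩
  𝕌 ✶ 𝕌 ⊟ cˢ (+ 4 ℚ./ 1) ✶ 𝕩 ✶ (𝕁 ✶ 𝕁)
    ≈⟨ solve 2 (λ x j → ((con 1ℚ :+ x) :* j) :* ((con 1ℚ :+ x) :* j) :- con (+ 4 ℚ./ 1) :* x :* (j :* j) := ((con 1ℚ :- x) :* j) :* ((con 1ℚ :- x) :* j)) ≗-refl 𝕩 𝕁 ⟩
  (1ˢ ⊟ 𝕩) ✶ 𝕁 ✶ ((1ˢ ⊟ 𝕩) ✶ 𝕁)
    ≈⟨ ≗-trans (ℛ.*-cong 𝕁-law 𝕁-law) (✶-identityˡ 1ˢ) ⟩
  1ˢ ∎
  where
  open 𝒮 using (solve; con; _:=_; _:*_; _:-_; _:+_)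
  open SetoidR ℛ.setoid

udrSer pkSer : ℕ → Ser
udrSer zero    = 1ˢ
udrSer (suc k) = ∑ˢ (Sym (suc k)) (λ w → 𝕩 ^ˢ udr w)
pkSer zero    = 1ˢ
pkSer (suc k) = ∑ˢ (Sym (suc k)) (λ w → 𝕩 ^ˢ (pk w ℕ.+ 1))

On-Pudr : ∀ k → On sᵃ (Pudr k S) (udrSer k)
On-Pudr zero    = Is-𝟙
On-Pudr (suc k) = On-emb sᵃ (λ a b c → trans (sumSym-∑ (suc k) (λ w → pow S (udr w)) a b c)
  (emb-On sᵃ (On-∑ sᵃ (Sym (suc k)) {λ w → pow S (udr w)} {λ w → 𝕩 ^ˢ udr w} (λ w → On-pow sᵃ {S} Is-S (udr w))) a b c))

On-Ppk : ∀ k → On tᵃ (Ppk k T) (pkSer k)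
On-Ppk zero    = Is-𝟙
On-Ppk (suc k) = On-emb tᵃ (λ a b c → trans (sumSym-∑ (suc k) (λ w → pow T (pk w ℕ.+ 1)) a b c)
  (emb-On tᵃ (On-∑ tᵃ (Sym (suc k)) {λ w → pow T (pk w ℕ.+ 1)} {λ w → 𝕩 ^ˢ (pk w ℕ.+ 1)} (λ w → On-pow tᵃ {T} Is-T (pk w ℕ.+ 1))) a b c))

-- The e factors 1 - s² make up for the difference between `α (e * 2 + k)` and `α k`, so that a
-- polynomial of smaller size fits under the prefactor of the larger one; `∑-udr` then applies at
-- size k+1.
udr-image : ∀ e k → α (e ℕ.* 2 ℕ.+ k) ✶ Sub 𝕊 ((1ˢ ⊟ 𝕩²) ^ˢ e ✶ udrSer (suc k)) ≗ powers (suc k)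
udr-image e k = begin
  α (e ℕ.* 2 ℕ.+ k) ✶ Sub 𝕊 ((1ˢ ⊟ 𝕩²) ^ˢ e ✶ udrSer (suc k))
    ≈⟨ ℛ.*-congˡ (Sub-1-^ {𝕊} {𝕩²} refl mult e (udrSer (suc k))) ⟩
  α (e ℕ.* 2 ℕ.+ k) ✶ ((1ˢ ⊟ Sub 𝕊 𝕩²) ^ˢ e ✶ Sub 𝕊 (udrSer (suc k)))
    ≈⟨ ℛ.*-congˡ (ℛ.*-cong (^ˢ-cong (ℛ.+-congˡ (ℛ.-‿cong (Sub-𝕩²′ {𝕊} refl))) e) (≗-trans (Sub-∑ˢ 𝕊 (Sym (suc k)) (λ w → 𝕩 ^ˢ udr w)) (∑ˢ-cong (Sym (suc k)) (λ w → Sub-𝕩^′ {𝕊} refl (udr w))))) ⟩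
  α (e ℕ.* 2 ℕ.+ k) ✶ ((1ˢ ⊟ 𝕊 ✶ 𝕊) ^ˢ e ✶ Σ𝕊)
    ≈⟨ solve 4 (λ p c z s → (p :* c) :* (z :* s) := p :* (c :* z) :* s) ≗-refl (cˢ ½ ✶ (1ˢ ⊞ 𝕩 ✶ 𝕩) ✶ (𝕁 ✶ 𝕁)) (ℂ ^ˢ (e ℕ.* 2 ℕ.+ k)) ((1ˢ ⊟ 𝕊 ✶ 𝕊) ^ˢ e) Σ𝕊 ⟩
  cˢ ½ ✶ (1ˢ ⊞ 𝕩 ✶ 𝕩) ✶ (𝕁 ✶ 𝕁) ✶ (ℂ ^ˢ (e ℕ.* 2 ℕ.+ k) ✶ (1ˢ ⊟ 𝕊 ✶ 𝕊) ^ˢ e) ✶ Σ𝕊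
    ≈⟨ ℛ.*-congʳ (ℛ.*-congˡ (shrink {ℂ} {1ˢ ⊟ 𝕊 ✶ 𝕊} 1-𝕊² k e)) ⟩
  α k ✶ Σ𝕊
    ≈⟨ ∑-udr k ⟩
  powers (suc k) ∎
  where
  open 𝒮 using (solve; _:=_; _:*_)
  open SetoidR ℛ.setoid
  Σ𝕊 = ∑ˢ (Sym (suc k)) (λ w → 𝕊 ^ˢ udr w)
  mult : ∀ g → Sub 𝕊 (𝕩² ✶ g) ≗ Sub 𝕊 𝕩² ✶ Sub 𝕊 g
  mult g = ≗-trans (Sub-cong 𝕊 (✶-assoc 𝕩 𝕩 g)) (≗-trans (Sub-𝕩 {𝕊} refl (𝕩 ✶ g)) (≗-trans (ℛ.*-congˡ (Sub-𝕩 {𝕊} refl g))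
    (≗-trans (≗-sym (✶-assoc 𝕊 𝕊 (Sub 𝕊 g))) (ℛ.*-congʳ (≗-sym (Sub-𝕩²′ {𝕊} refl))))))

pk-image : ∀ e k → β (e ℕ.* 2 ℕ.+ k) ✶ Sub 𝕋 ((1ˢ ⊟ 𝕩) ^ˢ e ✶ pkSer (suc k)) ≗ evenPowers (suc k)
pk-image e k = begin
  β (e ℕ.* 2 ℕ.+ k) ✶ Sub 𝕋 ((1ˢ ⊟ 𝕩) ^ˢ e ✶ pkSer (suc k))
    ≈⟨ ℛ.*-congˡ (Sub-1-^ {𝕋} {𝕩} refl (λ g → ≗-trans (Sub-𝕩 {𝕋} refl g) (ℛ.*-congʳ (≗-sym (Sub-𝕩¹ {𝕋} refl)))) e (pkSer (suc k))) ⟩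
  β (e ℕ.* 2 ℕ.+ k) ✶ ((1ˢ ⊟ Sub 𝕋 𝕩) ^ˢ e ✶ Sub 𝕋 (pkSer (suc k)))
    ≈⟨ ℛ.*-congˡ (ℛ.*-cong (^ˢ-cong (ℛ.+-congˡ (ℛ.-‿cong (Sub-𝕩¹ {𝕋} refl))) e) (≗-trans (Sub-∑ˢ 𝕋 (Sym (suc k)) (λ w → 𝕩 ^ˢ (pk w ℕ.+ 1))) (∑ˢ-cong (Sym (suc k)) (λ w → Sub-𝕩^′ {𝕋} refl (pk w ℕ.+ 1))))) ⟩
  β (e ℕ.* 2 ℕ.+ k) ✶ ((1ˢ ⊟ 𝕋) ^ˢ e ✶ Σ𝕋)
    ≈⟨ solve 5 (λ p u c z s → (p :* (u :* (u :* c))) :* (z :* s) := p :* (u :* (u :* (c :* z))) :* s) ≗-refl (cˢ ½) 𝕌 (𝕌 ^ˢ (e ℕ.* 2 ℕ.+ k)) ((1ˢ ⊟ 𝕋) ^ˢ e) Σ𝕋 ⟩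
  cˢ ½ ✶ (𝕌 ✶ (𝕌 ✶ (𝕌 ^ˢ (e ℕ.* 2 ℕ.+ k) ✶ (1ˢ ⊟ 𝕋) ^ˢ e))) ✶ Σ𝕋
    ≈⟨ ℛ.*-congʳ (ℛ.*-congˡ (ℛ.*-congˡ (ℛ.*-congˡ (shrink {𝕌} {1ˢ ⊟ 𝕋} 1-𝕋 k e)))) ⟩
  β k ✶ Σ𝕋
    ≈⟨ ∑-pk k ⟩
  evenPowers (suc k) ∎
  where
  open 𝒮 using (solve; _:=_; _:*_)
  open SetoidR ℛ.setoid
  Σ𝕋 = ∑ˢ (Sym (suc k)) (λ w → 𝕋 ^ˢ (pk w ℕ.+ 1))

module PartC (n : ℕ) where

  N = suc n

  F G : ℕ → Ser
  F k = (1ˢ ⊟ 𝕩²) ^ˢ ((N ∸ k) ℕ./ 2) ✶ udrSer k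
  G k = (1ˢ ⊟ 𝕩) ^ˢ ((N ∸ k) ℕ./ 2) ✶ pkSer k

  rhs-c-term : ℕ → PS
  rhs-c-term k = pow ((𝟙 ⊖ S ⊗ S) ⊗ (𝟙 ⊖ T)) ((N ∸ k) ℕ./ 2) ⊗ Pudr k S ⊗ Ppk k T

  Is-rhs-c : ∀ k → Is (rhs-c-term k) (F k) (G k) 1ˢ
  Is-rhs-c k = Is-cong
    (≗-trans (ℛ.*-identityʳ _) (ℛ.*-congʳ (^ˢ-cong (ℛ.*-identityʳ (1ˢ ⊟ 𝕩²)) e)))
    (ℛ.*-congʳ (≗-trans (ℛ.*-identityʳ _) (^ˢ-cong (✶-identityˡ (1ˢ ⊟ 𝕩)) e)))
    (≗-trans (ℛ.*-identityʳ _) (≗-trans (ℛ.*-identityʳ _) (≗-trans (^ˢ-cong (✶-identityˡ 1ˢ) e) (1ˢ-^ˢ e))))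
    (Is-⊗ (Is-⊗ (Is-pow (Is-⊗ (On-⊖ sᵃ {𝟙} {S ⊗ S} Is-𝟙 On-S²) (On-⊖ tᵃ {𝟙} {T} Is-𝟙 Is-T)) e) (On-Pudr k)) (On-Ppk k))
    where e = (N ∸ k) ℕ./ 2

  private
    recip : ℚ
    recip = recipFact N

    weight : ℕ → ℚ
    weight k = ℚ.- (recip ℚ.* ℕtoℚ (d N k))

    D : ℕ → ℕ → ℕ → ℚ
    D a b k = ℕtoℚ (d N k ℕ.* (2 ℕ.* (a ℕ.* b)) ℕ.^ k)

    arith : ∀ a b → 2 ℕ.* (a ℕ.* b) ≡ a ℕ.* (b ℕ.* 2)
    arith a b = let open ℕSolver.+-*-Solver in solve 2 (λ a b → con 2 :* (a :* b) := a :* (b :* con 2)) refl a b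

    -- The weight vanishes for k = 0 and for odd N - k. In the remaining cases the images are the
    -- powers a^k and (2b)^k, whose product is (2ab)^k; the factor 2 comes from the doubled second
    -- alphabet.
    image : ∀ k → k ≤ N → ∀ a b → weight k ℚ.* ((α n ✶ Sub 𝕊 (F k)) ⟪ a ⟫ ℚ.* (β n ✶ Sub 𝕋 (G k)) ⟪ b ⟫) ≡ ℚ.- (recip ℚ.* D a b k)
    image k le a b = cases k le (halve (N ∸ k))
      where
      vanish : ∀ k → d N k ≡ 0 → ∀ x → weight k ℚ.* x ≡ ℚ.- (recip ℚ.* D a b k)
      vanish k e x rewrite e = trans (cong (λ z → (ℚ.- z) ℚ.* x) (ℚₚ.*-zeroʳ recip)) (trans (ℚₚ.*-zeroˡ x) (cong ℚ.-_ (sym (ℚₚ.*-zeroʳ recip))))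
      good : ∀ k e → n ≡ e ℕ.* 2 ℕ.+ k → (N ∸ suc k) ℕ./ 2 ≡ e → weight (suc k) ℚ.* ((α n ✶ Sub 𝕊 (F (suc k))) ⟪ a ⟫ ℚ.* (β n ✶ Sub 𝕋 (G (suc k))) ⟪ b ⟫) ≡ ℚ.- (recip ℚ.* D a b (suc k))
      good k e en ee = trans (cong (weight (suc k) ℚ.*_) (cong₂ ℚ._*_
          (trans (cong₂ (λ m h → (α m ✶ Sub 𝕊 ((1ˢ ⊟ 𝕩²) ^ˢ h ✶ udrSer (suc k))) ⟪ a ⟫) en ee) (coeff (udr-image e k) a))
          (trans (cong₂ (λ m h → (β m ✶ Sub 𝕋 ((1ˢ ⊟ 𝕩) ^ˢ h ✶ pkSer (suc k))) ⟪ b ⟫) en ee) (coeff (pk-image e k) b))))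
        (trans (neg recip (ℕtoℚ (d N (suc k))) _) (cong (λ z → ℚ.- (recip ℚ.* z))
          (trans (cong (ℕtoℚ (d N (suc k)) ℚ.*_) (sym (ℕtoℚ-* (a ℕ.^ suc k) ((b ℕ.* 2) ℕ.^ suc k))))
            (trans (sym (ℕtoℚ-* (d N (suc k)) _)) (cong (λ z → ℕtoℚ (d N (suc k) ℕ.* z)) (trans (sym (*-^ a (b ℕ.* 2) (suc k))) (cong (ℕ._^ suc k) (sym (arith a b)))))))))
        where
        neg : ∀ r q x → (ℚ.- (r ℚ.* q)) ℚ.* x ≡ ℚ.- (r ℚ.* (q ℚ.* x))
        neg = let open ℚSolver.+-*-Solver in solve 3 (λ r q x → (:- (r :* q)) :* x := :- (r :* (q :* x))) refl
      cases : ∀ k → k ≤ N → (∃ λ i → N ∸ k ≡ i ℕ.* 2 ⊎ N ∸ k ≡ suc (i ℕ.* 2)) → weight k ℚ.* ((α n ✶ Sub 𝕊 (F k)) ⟪ a ⟫ ℚ.* (β n ✶ Sub 𝕋 (G k)) ⟪ b ⟫) ≡ ℚ.- (recip ℚ.* D a b k)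
      -- `udr-image` and `pk-image` begin at size 1; size 0 is covered by d(N,0) = 0, as N ≥ 1.
      cases zero    _        _            = vanish 0 (d-suc-zero n) ((α n ✶ Sub 𝕊 (F 0)) ⟪ a ⟫ ℚ.* (β n ✶ Sub 𝕋 (G 0)) ⟪ b ⟫)
      cases (suc k) (s≤s le) (i , inj₁ e) = good k i (trans (sym (ℕₚ.m∸n+n≡m le)) (cong (ℕ._+ k) e)) (trans (cong (ℕ._/ 2) e) (m*n/n≡m i 2))
      cases (suc k) (s≤s le) (i , inj₂ e) = vanish (suc k) (d-parity N (suc k) parity) ((α n ✶ Sub 𝕊 (F (suc k))) ⟪ a ⟫ ℚ.* (β n ✶ Sub 𝕋 (G (suc k))) ⟪ b ⟫)
        where
        parity : even (N ℕ.+ suc k) ≡ false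
        parity = trans (cong even (trans (cong suc (ℕₚ.+-suc n k)) (cong (λ z → suc (suc (z ℕ.+ k))) (trans (sym (ℕₚ.m∸n+n≡m le)) (cong (ℕ._+ k) e)))))
          (trans (cong even (trans (cong (suc ∘ suc ∘ suc) (ℕₚ.+-assoc (i ℕ.* 2) k k)) (cong (suc ∘ suc ∘ suc) (trans (cong (i ℕ.* 2 ℕ.+_) (trans (cong (k ℕ.+_) (sym (ℕₚ.+-identityʳ k))) (ℕₚ.*-comm 2 k))) (sym (ℕₚ.*-distribʳ-+ 2 i k))))))
            (even-1+2* (i ℕ.+ k)))

    J = Sym N
    K = upTo (suc N)

    -- Both sides of (c) as one family, with weight 1 for a permutation and -d(N,k)/N! for a number
    -- k, so that (c) becomes the vanishing of a single sum, the form taken by `bilinear-kernel`.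
    index : List (List ℕ ⊎ ℕ)
    index = map inj₁ J ++ map inj₂ K

    q : List ℕ ⊎ ℕ → ℚ
    q (inj₁ w) = 1ℚ
    q (inj₂ k) = weight k
    f g : List ℕ ⊎ ℕ → Ser
    f (inj₁ w) = 𝕩 ^ˢ udr w
    f (inj₂ k) = F k
    g (inj₁ w) = 𝕩 ^ˢ (ipk w ℕ.+ 1)
    g (inj₂ k) = G k

    split : ∀ φ → ∑ℚ index φ ≡ ∑ℚ J (φ ∘ inj₁) ℚ.+ ∑≤ N (φ ∘ inj₂)
    split φ = trans (ℚ∑.∑-++ (map inj₁ J) (map inj₂ K) φ) (cong₂ ℚ._+_ (ℚ∑.∑-map inj₁ J φ) (trans (ℚ∑.∑-map inj₂ K φ) (∑≤-upTo N (φ ∘ inj₂))))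

    ∑≤-neg : ∀ m φ → ∑≤ m (λ k → ℚ.- (recip ℚ.* φ k)) ≡ ℚ.- (recip ℚ.* ∑≤ m φ)
    ∑≤-neg m φ = trans (∑≤-cong m (λ k → ℚₚ.neg-distribˡ-* recip (φ k))) (trans (∑≤-*ˡ m (ℚ.- recip) φ) (sym (ℚₚ.neg-distribˡ-* recip (∑≤ m φ))))

    -- After the substitutions the permutations contribute a coefficient of `𝕌 ^ˢ (a * b)` by
    -- `∑-udr-ipk`, and the numbers k contribute minus its expansion by numbers of cycles.
    vanishing : ∀ a b → ∑ℚ index (λ x → q x ℚ.* ((α n ✶ Sub 𝕊 (f x)) ⟪ a ⟫ ℚ.* (β n ✶ Sub 𝕋 (g x)) ⟪ b ⟫)) ≡ 0ℚ
    vanishing a b = trans (split _) (trans (cong₂ ℚ._+_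
        (trans (ℚ∑.∑-cong J (λ w → trans (ℚₚ.*-identityˡ _) (cong₂ ℚ._*_ (coeff (✶-cong {α n} ≗-refl (Sub-𝕩^′ {𝕊} refl (udr w))) a) (coeff (✶-cong {β n} ≗-refl (Sub-𝕩^′ {𝕋} refl (ipk w ℕ.+ 1))) b))))
          (trans (∑-udr-ipk n a b) (𝕌^-recipFact N (a ℕ.* b))))
        (trans (∑≤-cong≤ N (λ k le → image k le a b)) (∑≤-neg N (D a b))))
      (ℚₚ.+-inverseʳ (recip ℚ.* ∑≤ N (D a b))))

  part-c : ∀ a b c → Pudripk N S T a b c ≡ (recipFact N · sumPS N (λ k → ℕtoℚ (d N k) · rhs-c-term k)) a b c
  part-c a b c = begin
    Pudripk N S T a b c
      ≡⟨ value (Is∑-Pudripk N Is-S Is-T) a b c ⟩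
    ∑ℚ J (λ w → (𝕩 ^ˢ udr w) ⟪ a ⟫ ℚ.* (𝕩 ^ˢ (ipk w ℕ.+ 1)) ⟪ b ⟫ ℚ.* 1ˢ ⟪ c ⟫)
      ≡⟨ ℚ∑.∑-*ʳ J (1ˢ ⟪ c ⟫) (λ w → (𝕩 ^ˢ udr w) ⟪ a ⟫ ℚ.* (𝕩 ^ˢ (ipk w ℕ.+ 1)) ⟪ b ⟫) ⟩
    lhs ℚ.* 1ˢ ⟪ c ⟫
      ≡⟨ cong (ℚ._* 1ˢ ⟪ c ⟫) equal ⟩
    recip ℚ.* ∑≤ N φ ℚ.* 1ˢ ⟪ c ⟫
      ≡⟨ ℚₚ.*-assoc recip (∑≤ N φ) (1ˢ ⟪ c ⟫) ⟩
    recip ℚ.* (∑≤ N φ ℚ.* 1ˢ ⟪ c ⟫)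
      ≡⟨ cong (recip ℚ.*_) (trans (sym (∑≤-*ʳ N (1ˢ ⟪ c ⟫) φ)) (trans (∑≤-cong N (λ k → trans (ℚₚ.*-assoc (ℕtoℚ (d N k)) (F k ⟪ a ⟫ ℚ.* G k ⟪ b ⟫) (1ˢ ⟪ c ⟫)) (cong (ℕtoℚ (d N k) ℚ.*_) (sym (ext (Is-rhs-c k) a b c)))))
           (sym (sumℚ≡∑≤ N (λ k → ℕtoℚ (d N k) ℚ.* rhs-c-term k a b c))))) ⟩
    (recipFact N · sumPS N (λ k → ℕtoℚ (d N k) · rhs-c-term k)) a b c ∎
    where
    open ≡-Reasoning
    φ : ℕ → ℚ
    φ k = ℕtoℚ (d N k) ℚ.* (F k ⟪ a ⟫ ℚ.* G k ⟪ b ⟫)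
    lhs = ∑ℚ J (λ w → (𝕩 ^ˢ udr w) ⟪ a ⟫ ℚ.* (𝕩 ^ˢ (ipk w ℕ.+ 1)) ⟪ b ⟫)
    difference : lhs ℚ.+ (ℚ.- (recip ℚ.* ∑≤ N φ)) ≡ 0ℚ
    difference = trans (cong₂ ℚ._+_ (ℚ∑.∑-cong J (λ w → sym (ℚₚ.*-identityˡ _)))
        (sym (trans (∑≤-cong N (λ k → neg recip (ℕtoℚ (d N k)) (F k ⟪ a ⟫ ℚ.* G k ⟪ b ⟫))) (∑≤-neg N φ))))
      (trans (sym (split (λ x → q x ℚ.* (f x ⟪ a ⟫ ℚ.* g x ⟪ b ⟫)))) (bilinear-kernel index (subst-𝕊 n) (subst-𝕋 n) q f g vanishing a b))
      where
      neg : ∀ r q x → (ℚ.- (r ℚ.* q)) ℚ.* x ≡ ℚ.- (r ℚ.* (q ℚ.* x))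
      neg = let open ℚSolver.+-*-Solver in solve 3 (λ r q x → (:- (r :* q)) :* x := :- (r :* (q :* x))) refl
    equal : lhs ≡ recip ℚ.* ∑≤ N φ
    equal = trans (solve 2 (λ x y → x := (x :+ (:- y)) :+ y) refl lhs (recip ℚ.* ∑≤ N φ)) (trans (cong (ℚ._+ recip ℚ.* ∑≤ N φ) difference) (ℚₚ.+-identityˡ _))
      where open ℚSolver.+-*-Solver

theorem5p3 :
  let
    -- (1+s²)^n/(1-s²)^{n-1} ((1+t)/(1-t))^{n+1} P^(udr,ipk)_n(2s/(1+s²), 4t/(1+t)²)
    term : ℕ → PS
    term n = pow (𝟙 ⊕ S ⊗ S) n ⊗ pow (inv (𝟙 ⊖ S ⊗ S)) (n ∸ 1)
             ⊗ pow ((𝟙 ⊕ T) ⊗ inv (𝟙 ⊖ T)) (suc n)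
             ⊗ Pudripk n ((+ 2 /ℚ 1) · S ⊗ inv (𝟙 ⊕ S ⊗ S))
                         ((+ 4 /ℚ 1) · T ⊗ pow (inv (𝟙 ⊕ T)) 2)
    -- (1+x)/(1-x)
    u : PS
    u = (𝟙 ⊕ X) ⊗ inv (𝟙 ⊖ X)
  in
  -- (a)
  (inv (𝟙 ⊖ S) ⊗ inv (𝟙 ⊖ T)
     ⊕ (+ 1 /ℚ 4) · pow (inv (𝟙 ⊖ S)) 2 ⊗ Σ∞ (λ m → term (suc m) ⊗ pow X (suc m))
   ≈ₚ Σ∞ (λ i → Σ∞ (λ j →
        pow u (2 * i * j) ⊗ (𝟙 ⊕ S ⊗ pow u j) ⊗ pow S (2 * i) ⊗ pow T j)))
  ×
  -- (b)
  (∀ n → 1 ≤ n →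
     (+ 1 /ℚ 4) · pow (inv (𝟙 ⊖ S)) 2 ⊗ term n
     ≈ₚ recipFact n · sumPS n (λ k →
          ℕtoℚ (2 ^ k * d n k) ·
            ((ℕtoℚ (2 ^ k) · A k (S ⊗ S) ⊕ S ⊗ B k (S ⊗ S)) ⊗ A k T
             ⊗ pow (inv (𝟙 ⊖ S ⊗ S)) (suc k) ⊗ pow (inv (𝟙 ⊖ T)) (suc k))))
  ×
  -- (c)
  (∀ n → 1 ≤ n →
     Pudripk n S T
     ≈ₚ recipFact n · sumPS n (λ k →
          ℕtoℚ (d n k) ·
            (pow ((𝟙 ⊖ S ⊗ S) ⊗ (𝟙 ⊖ T)) ((n ∸ k) / 2) ⊗ Pudr k S ⊗ Ppk k T)))
theorem5p3 =
    (λ a b c → trans (lhs-a a b c) (sym (rhs-a a b c)))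
  , (λ { (suc n) _ → part-b n })
  , (λ { (suc n) _ → PartC.part-c n })
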